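{- Let $C_i$ be a sequence of self-dual codes over $\mathbb{Z}_4$ all of whose Euclidean weights are divisible by $8$ (Type II), with length $n(C_i)\to\infty$. Then \[ \limsup_{i\to\infty}\frac{d_E(C_i)}{n(C_i)}\le 2-2x\;(\approx .3332625492), \] where $x$ is the positive real root of \[ 11x^{16}+2112x^{14}-8525x^{12}+15048x^{10}-15218x^8+9552x^6-3718x^4+828x^2-81. \]
   Context: Self-duality over $\mathbb{Z}_4$ is with respect to the inner product $\sum x_iy_i\bmod 4$. The Euclidean weights of $0,1,2,3\in\mathbb{Z}_4$ are $0,1,4,1$, summed over coordinates; $d_E(C)$ is the minimum Euclidean weight of a nonzero codeword of $C$. -}

module Defs where

open import Data.Nat as ℕ using (ℕ; zero; suc; _≤_)
open import Data.Nat.Divisibility using (_∣_)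
open import Data.Fin using (Fin; zero; suc; toℕ)
open import Data.Vec using (Vec; []; _∷_; zipWith; foldr)
open import Data.List as List using (List; []; _∷_; concatMap; allFin)
open import Data.Maybe using (Maybe; just; nothing; fromMaybe)
open import Data.Bool using (Bool; true; false; if_then_else_)
open import Data.Product using (_×_; ∃-syntax)
open import Data.Sum using (_⊎_)
open import Data.Integer using (+_)
open import Relation.Binary.PropositionalEquality using (_≡_)
open import Relation.Nullary using (¬_)
import Data.Rational as ℚ
open ℚ using (ℚ)

Code : ℕ → Set
Code n = Vec (Fin 4) n → Bool

_∈C_ : ∀ {n} → Vec (Fin 4) n → Code n → Set
x ∈C C = C x ≡ true

-- Standard inner product ∑ xᵢ yᵢ, computed in ℕ (orthogonality = ≡ 0 mod 4).
inner : ∀ {n} → Vec (Fin 4) n → Vec (Fin 4) n → ℕ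
inner x y = foldr _ ℕ._+_ 0 (zipWith (λ a b → toℕ a ℕ.* toℕ b) x y)

SelfDual : ∀ {n} → Code n → Set
SelfDual {n} C = (x : Vec (Fin 4) n) →
  (x ∈C C → ((y : Vec (Fin 4) n) → y ∈C C → 4 ∣ inner x y))
  × (((y : Vec (Fin 4) n) → y ∈C C → 4 ∣ inner x y) → x ∈C C)

wtE₁ : Fin 4 → ℕ
wtE₁ zero = 0
wtE₁ (suc zero) = 1
wtE₁ (suc (suc zero)) = 4
wtE₁ (suc (suc (suc zero))) = 1

wtE : ∀ {n} → Vec (Fin 4) n → ℕ
wtE = foldr _ (λ a s → wtE₁ a ℕ.+ s) 0

TypeII : ∀ {n} → Code n → Set
TypeII {n} C = SelfDual C × ((x : Vec (Fin 4) n) → x ∈C C → 8 ∣ wtE x)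

isZero : ∀ {n} → Vec (Fin 4) n → Bool
isZero [] = true
isZero (zero ∷ x) = isZero x
isZero (suc _ ∷ x) = false

allVecs : (n : ℕ) → List (Vec (Fin 4) n)
allVecs zero = [] ∷ []
allVecs (suc n) = concatMap (λ a → List.map (a ∷_) (allVecs n)) (allFin 4)

minM : Maybe ℕ → ℕ → Maybe ℕ
minM nothing w = just w
minM (just m) w = just (m ℕ.⊓ w)

-- d_E(C): minimum Euclidean weight of a nonzero codeword
-- (convention: 0 if C has no nonzero codeword, i.e. only for length 0).
dE : ∀ {n} → Code n → ℕ
dE {n} C = fromMaybe 0 (List.foldl step nothing (allVecs n))
  where
  step : Maybe ℕ → Vec (Fin 4) n → Maybe ℕ
  step m x = if C x then (if isZero x then m else minM m (wtE x)) else m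

toℚ : ℕ → ℚ
toℚ k = (+ k) ℚ./ 1

pow : ℚ → ℕ → ℚ
pow q zero = ℚ.1ℚ
pow q (suc k) = q ℚ.* pow q k

poly : ℚ → ℚ
poly x =
  (((((((toℚ 11 ℚ.* pow x 16 ℚ.+ toℚ 2112 ℚ.* pow x 14)
    ℚ.- toℚ 8525 ℚ.* pow x 12) ℚ.+ toℚ 15048 ℚ.* pow x 10)
    ℚ.- toℚ 15218 ℚ.* pow x 8) ℚ.+ toℚ 9552 ℚ.* pow x 6)
    ℚ.- toℚ 3718 ℚ.* pow x 4) ℚ.+ toℚ 828 ℚ.* pow x 2)
    ℚ.- toℚ 81

-- "r < x" for the unique positive real root x of poly (Dedekind cut):
-- p(0) = −81 < 0 and p has exactly one positive root, so for r > 0,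
-- r < x ⇔ p(r) < 0.
BelowRoot : ℚ → Set
BelowRoot r = (r ℚ.≤ ℚ.0ℚ) ⊎ (poly r ℚ.< ℚ.0ℚ)

TendsToInfinity : (ℕ → ℕ) → Set
TendsToInfinity f = (M : ℕ) → ∃[ N ] ((i : ℕ) → N ≤ i → M ≤ f i)

-- limsup_{i} a i / b i ≤ 2 − 2x, stated via: for every rational q > 2 − 2x
-- (i.e. (2 − q)/2 < x), eventually a i ≤ q · b i.
LimsupRatioBound : (a b : ℕ → ℕ) → Set
LimsupRatioBound a b = (q : ℚ) → BelowRoot ((toℚ 2 ℚ.- q) ℚ.* ℚ.½) →
  ∃[ N ] ((i : ℕ) → N ≤ i → toℚ (a i) ℚ.≤ q ℚ.* toℚ (b i))

{-# OPTIONS --safe #-}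

-- Restrict the symmetrised weight enumerator, in variables a, b, c for the coordinates 0, ±1, 2, to the curve
-- 2b⁴ = ac(a² + c²). With T = (c/a)² a codeword c contributes a positive multiple of T^(wt/8) (1 + T)^(n₁/4), n₁ being
-- its number of odd coordinates. The MacWilliams transform and the divisibility of the weights act on
-- (a + c)⁴, (a − c)⁴, (2b)⁴ as permutations up to sign, and these satisfy one linear relation on the curve, so the
-- restriction is a polynomial in the symmetric functions E₄ and Δ (as for theta series of even unimodular lattices).
-- Hence its product with E₄^(3k−m−1) E₆ Δ^(−k) has no residue at T = 0 for n = 8m, 3k > m.
-- A combination of the identities for k and k + 1 is a linear relation between the codewords in which a codeword of
-- weight 8j and the zero codeword have coefficients governed by saddle points; the combining factor can be chosen so
-- that the coefficients of 0 and of all weights above (2 − 2r)n are positive exactly when r lies below the root x.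

module Submission where

open import Defs
open import Algebra.Bundles using (CommutativeRing)
open import Algebra.Solver.Ring.AlmostCommutativeRing using (fromCommutativeRing; _-Raw-AlmostCommutative⟶_; Induced-equivalence)
open import Algebra.Structures using (IsCommutativeRing)
open import Data.Bool using (true; false; if_then_else_)
open import Data.Empty using (⊥; ⊥-elim)
open import Data.Fin using (Fin; zero; suc; toℕ)
import Data.Fin.Properties as Finₚ
open import Data.Integer as ℤ using (ℤ; +_; -[1+_])
import Data.Integer.Properties as ℤₚ
open import Data.Integer.Tactic.RingSolver using (solve-∀)
open import Data.List as List using (List; []; _∷_)
open import Data.List.Membership.Propositional using (_∈_)
open import Data.List.Membership.Propositional.Properties using (∈-map⁺; ∈-concatMap⁺; ∈-allFin)
open import Data.List.Relation.Unary.Any as Any using (here; there)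
open import Data.Maybe using (Maybe; just; nothing; fromMaybe)
open import Data.Nat as ℕ using (ℕ; zero; suc)
open import Data.Nat.DivMod as ℕDivMod using (_mod_; _/_; m*n/n≡m; m/n*n≤m; m≡m%n+[m/n]*n; m%n<n; _divMod_; DivMod)
open import Data.Nat.Divisibility as Div using (_∣_; divides)
import Data.Nat.Properties as ℕₚ
open import Data.Nat.Tactic.RingSolver using () renaming (solve-∀ to ℕsolve-∀)
open import Data.Product using (Σ; ∃; ∃-syntax; _×_; _,_; proj₁; proj₂)
import Data.Rational as ℚ
import Data.Rational.Properties as ℚₚ
import Data.Rational.Unnormalised as ℚᵘ
import Data.Rational.Unnormalised.Properties as ℚᵘₚ
open import Data.Sum using (_⊎_; inj₁; inj₂)
open import Data.Vec as Vec using (Vec; []; _∷_)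
open import Level using (0ℓ)
open import Relation.Binary.Definitions using (WeaklyDecidable)
open import Relation.Binary.PropositionalEquality as ≡ using (_≡_)
open import Relation.Nullary using (¬_; Dec; yes; no)
open import Relation.Nullary.Decidable using (from-yes)

-- Put w = `𝐐`/`𝐏`, which increases with T on [0, 1). The factor contributed by E₆ has the sign of 1
-- - 2w: positive near T = 0, negative at the saddle point T₀ of the zero codeword, where w is about
-- 19.6. A single identity thus gives 0 and the heavy codewords opposite signs, which is no
-- contradiction. The combination adds a sign change at w = ω, and this restores the sign at 0 as
-- long as the remaining factor 1 - (ω² + 3ω)w - ωw² is still positive at T₀. The lighter a
-- codeword, the larger its saddle point, so ω should be as large as T₀ permits. That limit lies
-- slightly below 1/440, so the weights gained are few and the constant is only slightly below 1/3,
-- the value for r = 5/6. T₀ and the other saddle points are irrational in general, while the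
-- statement speaks of rationals. The analysis therefore stays in an Archimedean ordered field:
-- ratios of consecutive coefficients replace contour integrals, the crossing of a fine grid
-- replaces solving an equation, and error terms are beaten by large k.

-- Integer numerals in a commutative ring

module IntegerCoefficients (R : CommutativeRing 0ℓ 0ℓ) where

  open CommutativeRing R
  open import Algebra.Properties.Ring ring using (-0#≈0#; -‿distribˡ-*; -‿+-comm; -‿involutive)
  open import Algebra.Properties.Semiring.Mult semiring using (×-homo-+; ×1-homo-*) renaming (_×_ to _·_)
  open import Relation.Binary.Reasoning.Setoid setoid

  private
    cast : ℤ → Carrier
    cast (+ n)    = n · 1#
    cast -[1+ n ] = - (suc n · 1#)

    cast-neg : ∀ i → cast (ℤ.- i) ≈ - cast i
    cast-neg (+ zero)  = sym -0#≈0#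
    cast-neg (+ suc n) = refl
    cast-neg -[1+ n ]  = sym (-‿involutive _)

    cancel : ∀ x y z → y - z ≈ (x + y) - (x + z)
    cancel x y z = sym (begin
      (x + y) + - (x + z)     ≈⟨ +-congˡ (-‿+-comm x z) ⟨
      (x + y) + (- x + - z)   ≈⟨ +-congʳ (+-comm x y) ⟩
      (y + x) + (- x + - z)   ≈⟨ +-assoc y x _ ⟩
      y + (x + (- x + - z))   ≈⟨ +-congˡ (+-assoc x (- x) (- z)) ⟨
      y + ((x + - x) + - z)   ≈⟨ +-congˡ (+-congʳ (-‿inverseʳ x)) ⟩
      y + (0# + - z)          ≈⟨ +-congˡ (+-identityˡ _) ⟩
      y + - z                 ∎)

    cast-⊖ : ∀ m n → cast (m ℤ.⊖ n) ≈ m · 1# - n · 1#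
    cast-⊖ m zero = sym (trans (+-congˡ -0#≈0#) (+-identityʳ _))
    cast-⊖ zero (suc n) = sym (+-identityˡ _)
    cast-⊖ (suc m) (suc n) rewrite ℤₚ.[1+m]⊖[1+n]≡m⊖n m n =
      trans (cast-⊖ m n) (cancel 1# (m · 1#) (n · 1#))

    cast-+ : ∀ i j → cast (i ℤ.+ j) ≈ cast i + cast j
    cast-+ (+ m)    (+ n)    = ×-homo-+ 1# m n
    cast-+ (+ m)    -[1+ n ] = cast-⊖ m (suc n)
    cast-+ -[1+ m ] (+ n)    = trans (cast-⊖ n (suc m)) (+-comm _ _)
    cast-+ -[1+ m ] -[1+ n ] = begin
      - (suc (suc (m ℕ.+ n)) · 1#)        ≡⟨ ≡.cong (λ k → - (suc k · 1#)) (ℕₚ.+-suc m n) ⟨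
      - ((suc m ℕ.+ suc n) · 1#)          ≈⟨ -‿cong (×-homo-+ 1# (suc m) (suc n)) ⟩
      - (suc m · 1# + suc n · 1#)         ≈⟨ -‿+-comm _ _ ⟨
      - (suc m · 1#) + - (suc n · 1#)     ∎

    cast-*⁺ : ∀ m j → cast (+ m ℤ.* j) ≈ cast (+ m) * cast j
    cast-*⁺ m (+ n) rewrite ≡.sym (ℤₚ.pos-* m n) = ×1-homo-* m n
    cast-*⁺ m -[1+ n ] = begin
      cast (+ m ℤ.* ℤ.- (+ suc n))      ≡⟨ ≡.cong cast (ℤₚ.neg-distribʳ-* (+ m) (+ suc n)) ⟨
      cast (ℤ.- (+ m ℤ.* + suc n))      ≈⟨ cast-neg (+ m ℤ.* + suc n) ⟩
      - cast (+ m ℤ.* + suc n)          ≈⟨ -‿cong (cast-*⁺ m (+ suc n)) ⟩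
      - (m · 1# * (suc n · 1#))         ≈⟨ -‿cong (*-comm _ _) ⟩
      - ((suc n · 1#) * (m · 1#))       ≈⟨ -‿distribˡ-* _ _ ⟩
      - (suc n · 1#) * (m · 1#)         ≈⟨ *-comm _ _ ⟩
      m · 1# * - (suc n · 1#)           ∎

    cast-* : ∀ i j → cast (i ℤ.* j) ≈ cast i * cast j
    cast-* (+ m) j = cast-*⁺ m j
    cast-* -[1+ m ] j = begin
      cast (ℤ.- (+ suc m) ℤ.* j)    ≡⟨ ≡.cong cast (ℤₚ.neg-distribˡ-* (+ suc m) j) ⟨
      cast (ℤ.- (+ suc m ℤ.* j))    ≈⟨ cast-neg (+ suc m ℤ.* j) ⟩
      - cast (+ suc m ℤ.* j)        ≈⟨ -‿cong (cast-*⁺ (suc m) j) ⟩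
      - (suc m · 1# * cast j)       ≈⟨ -‿distribˡ-* _ _ ⟩
      - (suc m · 1#) * cast j       ∎

  opaque
    -- Opaque, so that a numeral such as `# 100000000` stays a symbol instead of unfolding into a
    -- sum of ones. Only 0 and 1 are kept transparent by `fromℤ`, since the solver's morphism must
    -- send them to `0#` and `1#`.
    large : ℕ → Carrier
    large n = suc (suc n) · 1#

    private
      large≈cast : ∀ n → large n ≈ cast (+ suc (suc n))
      large≈cast n = refl

  fromℤ : ℤ → Carrier
  fromℤ (+ 0)           = 0#
  fromℤ (+ 1)           = 1#
  fromℤ (+ suc (suc n)) = large n
  fromℤ -[1+ 0 ]        = - 1#
  fromℤ -[1+ suc n ]    = - large n

  private
    fromℤ≈cast : ∀ i → fromℤ i ≈ cast i
    fromℤ≈cast (+ 0)           = refl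
    fromℤ≈cast (+ 1)           = sym (+-identityʳ 1#)
    fromℤ≈cast (+ suc (suc n)) = large≈cast n
    fromℤ≈cast -[1+ 0 ]        = -‿cong (sym (+-identityʳ 1#))
    fromℤ≈cast -[1+ suc n ]    = -‿cong (large≈cast n)

  fromℤ-+ : ∀ i j → fromℤ (i ℤ.+ j) ≈ fromℤ i + fromℤ j
  fromℤ-+ i j = trans (fromℤ≈cast (i ℤ.+ j))
    (trans (cast-+ i j) (+-cong (sym (fromℤ≈cast i)) (sym (fromℤ≈cast j))))

  fromℤ-* : ∀ i j → fromℤ (i ℤ.* j) ≈ fromℤ i * fromℤ j
  fromℤ-* i j = trans (fromℤ≈cast (i ℤ.* j))
    (trans (cast-* i j) (*-cong (sym (fromℤ≈cast i)) (sym (fromℤ≈cast j))))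

  fromℤ-neg : ∀ i → fromℤ (ℤ.- i) ≈ - fromℤ i
  fromℤ-neg i = trans (fromℤ≈cast (ℤ.- i)) (trans (cast-neg i) (-‿cong (sym (fromℤ≈cast i))))

  infix 9 #_
  #_ : ℕ → Carrier
  # n = fromℤ (+ n)

  #-suc : ∀ n → # suc n ≈ 1# + # n
  #-suc n = fromℤ-+ (+ 1) (+ n)

  private
    morphism : ℤ.+-*-rawRing -Raw-AlmostCommutative⟶ fromCommutativeRing R
    morphism = record
      { ⟦_⟧ = fromℤ ; +-homo = fromℤ-+ ; *-homo = fromℤ-* ; -‿homo = fromℤ-neg
      ; 0-homo = refl ; 1-homo = refl }

    _≟-coeff_ : WeaklyDecidable (Induced-equivalence morphism)
    i ≟-coeff j with i ℤ.≟ j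
    ... | yes i≡j = just (reflexive (≡.cong fromℤ i≡j))
    ... | no _    = nothing

  open import Algebra.Solver.Ring ℤ.+-*-rawRing (fromCommutativeRing R) morphism _≟-coeff_ public
    using (Polynomial; solve; _:=_; _:+_; _:*_; _:-_; :-_; _:^_; con)

  infix 10 :#_
  :#_ : ∀ {n} → ℕ → Polynomial n
  :# k = con (+ k)

-- Archimedean ordered fields with decidable order

record OrderedField : Set₁ where
  field
    commutativeRing : CommutativeRing 0ℓ 0ℓ

  open CommutativeRing commutativeRing public
    renaming (zero to *-zero; zeroˡ to *-zeroˡ; zeroʳ to *-zeroʳ)
  open IntegerCoefficients commutativeRing public

  infix 4 _≤_ _<_
  field
    _≤_ : Carrier → Carrier → Set
    ≤-reflexive : ∀ {x y} → x ≈ y → x ≤ y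
    ≤-trans : ∀ {x y z} → x ≤ y → y ≤ z → x ≤ z
    ≤-antisym : ∀ {x y} → x ≤ y → y ≤ x → x ≈ y
    _≤?_ : ∀ x y → Dec (x ≤ y)
    ≤-total : ∀ x y → x ≤ y ⊎ y ≤ x
    +-monoʳ-≤ : ∀ z {x y} → x ≤ y → z + x ≤ z + y
    *-nonNeg : ∀ {x y} → 0# ≤ x → 0# ≤ y → 0# ≤ x * y
    1≰0 : ¬ 1# ≤ 0#
    inverse : ∀ x → ¬ x ≈ 0# → ∃[ y ] x * y ≈ 1#
    archimedean : ∀ x → ∃[ n ] x ≤ # n

  _<_ : Carrier → Carrier → Set
  x < y = ¬ y ≤ x

module OrderedFieldProperties (F : OrderedField) where
  open OrderedField F

  ≤-refl : ∀ {x} → x ≤ x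
  ≤-refl = ≤-reflexive refl

  <⇒≤ : ∀ {x y} → x < y → x ≤ y
  <⇒≤ {x} {y} x<y with ≤-total x y
  ... | inj₁ x≤y = x≤y
  ... | inj₂ y≤x = ⊥-elim (x<y y≤x)

  <-≤-trans : ∀ {x y z} → x < y → y ≤ z → x < z
  <-≤-trans x<y y≤z z≤x = x<y (≤-trans y≤z z≤x)

  ≤-<-trans : ∀ {x y z} → x ≤ y → y < z → x < z
  ≤-<-trans x≤y y<z z≤x = y<z (≤-trans z≤x x≤y)

  ≰⇒> : ∀ {x y} → ¬ x ≤ y → y < x
  ≰⇒> x≰y = x≰y

  0≤-resp : ∀ {x y} → x ≈ y → 0# ≤ x → 0# ≤ y
  0≤-resp x≈y 0≤x = ≤-trans 0≤x (≤-reflexive x≈y)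

  0<-resp : ∀ {x y} → x ≈ y → 0# < x → 0# < y
  0<-resp x≈y 0<x = <-≤-trans 0<x (≤-reflexive x≈y)

  private
    sub-add : ∀ x y → x + (y - x) ≈ y
    sub-add x y = (solve 2 (λ x y → x :+ (y :- x) := y) refl x y)

  ≤⇒0≤ : ∀ {x y} → x ≤ y → 0# ≤ y - x
  ≤⇒0≤ {x} {y} x≤y = ≤-trans (≤-reflexive (sym (-‿inverseˡ x)))
    (≤-trans (+-monoʳ-≤ (- x) x≤y) (≤-reflexive (+-comm (- x) y)))

  0≤⇒≤ : ∀ {x y} → 0# ≤ y - x → x ≤ y
  0≤⇒≤ {x} {y} 0≤d = ≤-trans (≤-reflexive (sym (+-identityʳ x)))
    (≤-trans (+-monoʳ-≤ x 0≤d) (≤-reflexive (sub-add x y)))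

  <⇒0< : ∀ {x y} → x < y → 0# < y - x
  <⇒0< {x} {y} x<y d≤0 = x<y (0≤⇒≤ (≤-trans (≤⇒0≤ d≤0)
    (≤-reflexive ((solve 2 (λ x y → :# 0 :- (y :- x) := x :- y) refl x y)))))

  0<⇒< : ∀ {x y} → 0# < y - x → x < y
  0<⇒< {x} {y} 0<d y≤x = 0<d (0≤⇒≤ (≤-trans (≤⇒0≤ y≤x)
    (≤-reflexive ((solve 2 (λ x y → x :- y := :# 0 :- (y :- x)) refl x y)))))

  -- The shape of most inequalities below: `z` is a sum of products of quantities already known to
  -- be nonnegative, and a ring identity equates it with the difference of the two sides.
  ≤-by : ∀ {x y} z → 0# ≤ z → z ≈ y - x → x ≤ y
  ≤-by z 0≤z eq = 0≤⇒≤ (0≤-resp eq 0≤z)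

  <-by : ∀ {x y} z → 0# < z → z ≈ y - x → x < y
  <-by z 0<z eq = 0<⇒< (0<-resp eq 0<z)

  +-nonNeg : ∀ {x y} → 0# ≤ x → 0# ≤ y → 0# ≤ x + y
  +-nonNeg {x} {y} 0≤x 0≤y = ≤-trans 0≤x
    (≤-trans (≤-reflexive (sym (+-identityʳ x))) (+-monoʳ-≤ x 0≤y))

  +-pos-nonNeg : ∀ {x y} → 0# < x → 0# ≤ y → 0# < x + y
  +-pos-nonNeg {x} {y} 0<x 0≤y = <-≤-trans 0<x
    (≤-trans (≤-reflexive (sym (+-identityʳ x))) (+-monoʳ-≤ x 0≤y))

  +-mono-≤ : ∀ {x y u v} → x ≤ y → u ≤ v → x + u ≤ y + v
  +-mono-≤ {x} {y} {u} {v} x≤y u≤v =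
    ≤-by ((y - x) + (v - u)) (+-nonNeg (≤⇒0≤ x≤y) (≤⇒0≤ u≤v))
      ((solve 4 (λ x y u v → (y :- x) :+ (v :- u) := (y :+ v) :- (x :+ u)) refl x y u v))

  -- The inverse of `x` is nonnegative, since otherwise 1 = x x⁻¹ would be at most 0; multiplying x
  -- y ≤ 0 by it would give y ≤ 0.
  *-pos : ∀ {x y} → 0# < x → 0# < y → 0# < x * y
  *-pos {x} {y} 0<x 0<y xy≤0 with inverse x (λ x≈0 → 0<x (≤-reflexive x≈0))
  ... | x⁻¹ , xx⁻¹≈1 with ≤-total x⁻¹ 0#
  ... | inj₁ x⁻¹≤0 = 1≰0 (≤-trans (≤-reflexive (sym xx⁻¹≈1))
          (0≤⇒≤ (0≤-resp ((solve 2 (λ x x⁻¹ → x :* (:# 0 :- x⁻¹) := :# 0 :- x :* x⁻¹) refl x x⁻¹))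
            (*-nonNeg (<⇒≤ 0<x) (≤⇒0≤ x⁻¹≤0)))))
  ... | inj₂ 0≤x⁻¹ = 0<y (0≤⇒≤ (0≤-resp (trans
          ((solve 3 (λ x x⁻¹ y → (:# 0 :- x :* y) :* x⁻¹ := :# 0 :- (x :* x⁻¹) :* y) refl x x⁻¹ y))
          (+-congˡ (-‿cong (trans (*-congʳ xx⁻¹≈1) (*-identityˡ y)))))
            (*-nonNeg (≤⇒0≤ xy≤0) 0≤x⁻¹)))

  0<1 : 0# < 1#
  0<1 = 1≰0

  #-nonNeg : ∀ n → 0# ≤ # n
  #-nonNeg zero = ≤-reflexive refl
  #-nonNeg (suc n) = 0≤-resp (sym (#-suc n)) (+-nonNeg (<⇒≤ 0<1) (#-nonNeg n))

  #-pos : ∀ n → 0# < # suc n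
  #-pos n = 0<-resp (sym (#-suc n)) (+-pos-nonNeg 0<1 (#-nonNeg n))

  #-+ : ∀ m n → # (m ℕ.+ n) ≈ # m + # n
  #-+ m n = fromℤ-+ (+ m) (+ n)

  #-* : ∀ m n → # (m ℕ.* n) ≈ # m * # n
  #-* m n = trans (reflexive (≡.cong fromℤ (ℤₚ.pos-* m n))) (fromℤ-* (+ m) (+ n))

  #-mono-≤ : ∀ {m n} → m ℕ.≤ n → # m ≤ # n
  #-mono-≤ {m} {n} m≤n = ≤-by (# (n ℕ.∸ m)) (#-nonNeg (n ℕ.∸ m)) (begin
    # (n ℕ.∸ m)                       ≈⟨ (solve 2 (λ a b → a := b :+ a :- b) refl (# (n ℕ.∸ m)) (# m)) ⟩
    # m + # (n ℕ.∸ m) - # m           ≈⟨ +-congʳ (#-+ m (n ℕ.∸ m)) ⟨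
    # (m ℕ.+ (n ℕ.∸ m)) - # m         ≡⟨ ≡.cong (λ k → # k - # m) (ℕₚ.m+[n∸m]≡n m≤n) ⟩
    # n - # m                         ∎)
    where open import Relation.Binary.Reasoning.Setoid setoid

  *-monoˡ-≤ : ∀ {z x y} → 0# ≤ z → x ≤ y → z * x ≤ z * y
  *-monoˡ-≤ {z} {x} {y} 0≤z x≤y = ≤-by (z * (y - x)) (*-nonNeg 0≤z (≤⇒0≤ x≤y))
    ((solve 3 (λ x y z → z :* (y :- x) := z :* y :- z :* x) refl x y z))

  *-mono-≤ : ∀ {x y u v} → 0# ≤ x → 0# ≤ v → x ≤ y → u ≤ v → x * u ≤ y * v
  *-mono-≤ {x} {y} {u} {v} 0≤x 0≤v x≤y u≤v =
    ≤-by (x * (v - u) + (y - x) * v)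
      (+-nonNeg (*-nonNeg 0≤x (≤⇒0≤ u≤v)) (*-nonNeg (≤⇒0≤ x≤y) 0≤v))
      ((solve 4 (λ x y u v → x :* (v :- u) :+ (y :- x) :* v := y :* v :- x :* u) refl x y u v))

  *-cancelˡ-≤ : ∀ {z x y} → 0# < z → z * x ≤ z * y → x ≤ y
  *-cancelˡ-≤ {z} {x} {y} 0<z zx≤zy with x ≤? y
  ... | yes x≤y = x≤y
  ... | no x≰y  = ⊥-elim (0<⇒< (0<-resp ((solve 3 (λ x y z → z :* (x :- y) := z :* x :- z :* y) refl x y z))
                    (*-pos 0<z (<⇒0< (≰⇒> x≰y)))) zx≤zy)

  pos-cancelˡ : ∀ {z x} → 0# ≤ z → 0# < z * x → 0# < x
  pos-cancelˡ {z} {x} 0≤z 0<zx x≤0 = 0<zx (0≤⇒≤ (0≤-resp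
    ((solve 2 (λ x z → z :* (:# 0 :- x) := :# 0 :- z :* x) refl x z)) (*-nonNeg 0≤z (≤⇒0≤ x≤0))))

  pos-inverse : ∀ {x} → 0# < x → ∃[ y ] (x * y ≈ 1#) × (0# < y)
  pos-inverse {x} 0<x with inverse x (λ x≈0 → 0<x (≤-reflexive x≈0))
  ... | y , xy≈1 = y , xy≈1 , pos-cancelˡ (<⇒≤ 0<x) (0<-resp (sym xy≈1) 0<1)

  multiple : ∀ x {d} → 0# < d → ∃[ n ] x ≤ # n * d
  multiple x {d} d>0 with pos-inverse d>0
  ... | d⁻¹ , dd⁻¹≈1 , d⁻¹>0 with archimedean (x * d⁻¹)
  ...   | n , le = n , ≤-trans (≤-reflexive (trans (sym (*-identityʳ x)) (trans (*-congˡ (sym dd⁻¹≈1))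
          ((solve 3 (λ x d e → x :* (d :* e) := d :* (x :* e)) refl x d d⁻¹))))) (≤-trans (*-monoˡ-≤ (<⇒≤ d>0) le)
              (≤-reflexive (*-comm d (# n))))

-- Formal power series and the Euler derivation

module PowerSeries (R : CommutativeRing 0ℓ 0ℓ) where

  private
    module R = CommutativeRing R
    module RI = IntegerCoefficients R
  open R using (Carrier)
  open RI using (solve; _:=_; _:+_; _:*_; _:-_; :#_)
  open import Relation.Binary.Reasoning.Setoid R.setoid

  record Series : Set where
    constructor series
    field coeff : ℕ → Carrier
  open Series public

  infix 4 _≋_
  record _≋_ (f g : Series) : Set where
    constructor coefficientwise
    field at : ∀ n → coeff f n R.≈ coeff g n
  open _≋_ public

  private
    -- The Cauchy product is defined by splitting off the leading coefficient of `f` instead of by a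
    -- sum over i + j = n, so that the ring laws follow by induction on `n` with `f` shifted.
    conv : (ℕ → Carrier) → (ℕ → Carrier) → ℕ → Carrier
    conv f g zero    = f 0 R.* g 0
    conv f g (suc n) = f 0 R.* g (suc n) R.+ conv (λ i → f (suc i)) g n

    conv-cong : ∀ {f f′ g g′} → (∀ i → f i R.≈ f′ i) → (∀ i → g i R.≈ g′ i) →
                ∀ n → conv f g n R.≈ conv f′ g′ n
    conv-cong p q zero    = R.*-cong (p 0) (q 0)
    conv-cong p q (suc n) = R.+-cong (R.*-cong (p 0) (q (suc n))) (conv-cong (λ i → p (suc i)) q n)

    conv-sucʳ : ∀ f g n → conv f g (suc n) R.≈ f (suc n) R.* g 0 R.+ conv f (λ i → g (suc i)) n
    conv-sucʳ f g zero = R.+-comm _ _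
    conv-sucʳ f g (suc n) = begin
      f 0 R.* g (2 ℕ.+ n) R.+ conv f′ g (suc n)
        ≈⟨ R.+-congˡ (conv-sucʳ f′ g n) ⟩
      f 0 R.* g (2 ℕ.+ n) R.+ (f (2 ℕ.+ n) R.* g 0 R.+ conv f′ g′ n)
        ≈⟨ x∙yz≈y∙xz _ _ _ ⟩
      f (2 ℕ.+ n) R.* g 0 R.+ (f 0 R.* g (2 ℕ.+ n) R.+ conv f′ g′ n) ∎
      where
      f′ = λ i → f (suc i)
      g′ = λ i → g (suc i)
      open import Algebra.Properties.CommutativeSemigroup
        (CommutativeRing.+-commutativeSemigroup R) using (x∙yz≈y∙xz)

    conv-comm : ∀ f g n → conv f g n R.≈ conv g f n
    conv-comm f g zero    = R.*-comm _ _
    conv-comm f g (suc n) = begin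
      f 0 R.* g (suc n) R.+ conv (λ i → f (suc i)) g n
        ≈⟨ R.+-cong (R.*-comm _ _) (conv-comm (λ i → f (suc i)) g n) ⟩
      g (suc n) R.* f 0 R.+ conv g (λ i → f (suc i)) n
        ≈⟨ conv-sucʳ g f n ⟨
      conv g f (suc n) ∎

    conv-distribʳ : ∀ h f g n → conv (λ i → f i R.+ g i) h n R.≈ conv f h n R.+ conv g h n
    conv-distribʳ h f g zero    = R.distribʳ _ _ _
    conv-distribʳ h f g (suc n) = begin
      (f 0 R.+ g 0) R.* h (suc n) R.+ conv (λ i → f (suc i) R.+ g (suc i)) h n
        ≈⟨ R.+-cong (R.distribʳ _ _ _) (conv-distribʳ h (λ i → f (suc i)) (λ i → g (suc i)) n) ⟩
      (f 0 R.* h (suc n) R.+ g 0 R.* h (suc n)) R.+ (conv (λ i → f (suc i)) h n R.+ conv (λ i → g (suc i)) h n)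
        ≈⟨ interchange _ _ _ _ ⟩
      conv f h (suc n) R.+ conv g h (suc n) ∎
      where open import Algebra.Properties.CommutativeSemigroup
              (CommutativeRing.+-commutativeSemigroup R) using (interchange)

    conv-scale : ∀ c f g n → conv (λ i → c R.* f i) g n R.≈ c R.* conv f g n
    conv-scale c f g zero    = R.*-assoc _ _ _
    conv-scale c f g (suc n) = R.trans
      (R.+-cong (R.*-assoc _ _ _) (conv-scale c (λ i → f (suc i)) g n)) (R.sym (R.distribˡ _ _ _))

    conv-assoc : ∀ f g h n → conv (conv f g) h n R.≈ conv f (conv g h) n
    conv-assoc f g h zero    = R.*-assoc _ _ _
    conv-assoc f g h (suc n) = begin
      (f 0 R.* g 0) R.* h (suc n) R.+ conv (λ i → f 0 R.* g (suc i) R.+ conv f′ g i) h n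
        ≈⟨ R.+-cong (R.*-assoc _ _ _) (conv-distribʳ h (λ i → f 0 R.* g (suc i)) (conv f′ g) n) ⟩
      f 0 R.* (g 0 R.* h (suc n)) R.+ (conv (λ i → f 0 R.* g (suc i)) h n R.+ conv (conv f′ g) h n)
        ≈⟨ R.+-congˡ (R.+-cong (conv-scale (f 0) (λ i → g (suc i)) h n) (conv-assoc f′ g h n)) ⟩
      f 0 R.* (g 0 R.* h (suc n)) R.+ (f 0 R.* conv (λ i → g (suc i)) h n R.+ conv f′ (conv g h) n)
        ≈⟨ R.+-assoc _ _ _ ⟨
      (f 0 R.* (g 0 R.* h (suc n)) R.+ f 0 R.* conv (λ i → g (suc i)) h n) R.+ conv f′ (conv g h) n
        ≈⟨ R.+-congʳ (R.distribˡ _ _ _) ⟨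
      conv f (conv g h) (suc n) ∎
      where f′ = λ i → f (suc i)

    zeroes : ℕ → Carrier
    zeroes _ = R.0#

    conv-zeroˡ : ∀ g n → conv zeroes g n R.≈ R.0#
    conv-zeroˡ g zero    = R.zeroˡ _
    conv-zeroˡ g (suc n) = R.trans (R.+-cong (R.zeroˡ _) (conv-zeroˡ g n)) (R.+-identityˡ _)

    konst : Carrier → ℕ → Carrier
    konst c zero    = c
    konst c (suc n) = R.0#

    conv-konst : ∀ c g n → conv (konst c) g n R.≈ c R.* g n
    conv-konst c g zero    = R.refl
    conv-konst c g (suc n) = R.trans (R.+-congˡ (conv-zeroˡ g n)) (R.+-identityʳ _)

    shift-θ : ∀ (f : ℕ → Carrier) i → RI.# suc i R.* f (suc i) R.≈ f (suc i) R.+ RI.# i R.* f (suc i)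
    shift-θ f i = R.trans (R.*-congʳ (RI.#-suc i))
      (R.trans (R.distribʳ _ _ _) (R.+-congʳ (R.*-identityˡ _)))

    leibniz : ∀ f g n → RI.# n R.* conv f g n R.≈
      conv (λ i → RI.# i R.* f i) g n R.+ conv f (λ i → RI.# i R.* g i) n
    leibniz f g zero = (solve 2 (λ a b → :# 0 :* (a :* b) := :# 0 :* a :* b :+ a :* (:# 0 :* b)) R.refl (f 0) (g 0))
    leibniz f g (suc n) = begin
      RI.# suc n R.* (f 0 R.* g (suc n) R.+ conv f′ g n)
        ≈⟨ R.*-congʳ (RI.#-suc n) ⟩
      (R.1# R.+ RI.# n) R.* (f 0 R.* g (suc n) R.+ conv f′ g n)
        ≈⟨ (solve 4 (λ k a b c → (:# 1 :+ k) :* (a :* b :+ c) := a :* ((:# 1 :+ k) :* b) :+ (c :+ k :* c)) R.refl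
            (RI.# n) (f 0) (g (suc n)) (conv f′ g n)) ⟩
      f 0 R.* ((R.1# R.+ RI.# n) R.* g (suc n)) R.+ (conv f′ g n R.+ RI.# n R.* conv f′ g n)
        ≈⟨ R.+-cong (R.*-congˡ (R.*-congʳ (R.sym (RI.#-suc n)))) (R.+-congˡ (leibniz f′ g n)) ⟩
      f 0 R.* θg (suc n) R.+ (conv f′ g n R.+ (conv (λ i → RI.# i R.* f′ i) g n R.+ conv f′ θg n))
        ≈⟨ (solve 5 (λ a b c d e → a :* b :+ (c :+ (d :+ e)) := (c :+ d) :+ (a :* b :+ e)) R.refl (f 0) (θg (suc n))
            (conv f′ g n) (conv (λ i → RI.# i R.* f′ i) g n) (conv f′ θg n)) ⟩
      (conv f′ g n R.+ conv (λ i → RI.# i R.* f′ i) g n) R.+ conv f θg (suc n)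
        ≈⟨ R.+-congʳ (R.trans (conv-cong (shift-θ f) (λ _ → R.refl) n)
             (conv-distribʳ g f′ (λ i → RI.# i R.* f′ i) n)) ⟨
      conv (λ i → RI.# suc i R.* f′ i) g n R.+ conv f θg (suc n)
        ≈⟨ R.+-congʳ (R.trans (R.+-congʳ (R.trans (R.*-congʳ (R.zeroˡ (f 0))) (R.zeroˡ (g (suc n)))))
             (R.+-identityˡ (conv (λ i → RI.# suc i R.* f′ i) g n))) ⟨
      conv (λ i → RI.# i R.* f i) g (suc n) R.+ conv f θg (suc n) ∎
      where
      f′ θg : ℕ → Carrier
      f′ i = f (suc i)
      θg i = RI.# i R.* g i

  opaque
    infixl 6 _+ₛ_
    infixl 7 _*ₛ_
    _+ₛ_ _*ₛ_ : Series → Series → Series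
    f +ₛ g = series (λ n → coeff f n R.+ coeff g n)
    f *ₛ g = series (conv (coeff f) (coeff g))

    negₛ : Series → Series
    negₛ f = series (λ n → R.- coeff f n)

    constant : Carrier → Series
    constant c = series (konst c)

    X : Series
    X = series λ { zero → R.0# ; (suc n) → konst R.1# n }

    coeff-+ : ∀ f g n → coeff (f +ₛ g) n R.≈ coeff f n R.+ coeff g n
    coeff-+ f g n = R.refl

    coeff-neg : ∀ f n → coeff (negₛ f) n R.≈ R.- coeff f n
    coeff-neg f n = R.refl

    coeff-constant-* : ∀ c f n → coeff (constant c *ₛ f) n R.≈ c R.* coeff f n
    coeff-constant-* c f n = conv-konst c (coeff f) n

    coeff-*-0 : ∀ f g → coeff (f *ₛ g) 0 R.≈ coeff f 0 R.* coeff g 0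
    coeff-*-0 f g = R.refl

    coeff-constant-0 : ∀ c → coeff (constant c) 0 R.≈ c
    coeff-constant-0 c = R.refl

    coeff-constant-suc : ∀ c n → coeff (constant c) (suc n) R.≈ R.0#
    coeff-constant-suc c n = R.refl

    coeff-X*-0 : ∀ f → coeff (X *ₛ f) 0 R.≈ R.0#
    coeff-X*-0 f = R.zeroˡ _

    coeff-X*-suc : ∀ f n → coeff (X *ₛ f) (suc n) R.≈ coeff f n
    coeff-X*-suc f n = R.trans (R.+-cong (R.zeroˡ _) (conv-konst R.1# (coeff f) n))
      (R.trans (R.+-identityˡ _) (R.*-identityˡ _))

    isCommutativeRing : IsCommutativeRing _≋_ _+ₛ_ _*ₛ_ negₛ (constant R.0#) (constant R.1#)
    isCommutativeRing = record
      { isRing = record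
        { +-isAbelianGroup = record
          { isGroup = record
            { isMonoid = record
              { isSemigroup = record
                { isMagma = record
                  { isEquivalence = record
                    { refl  = coefficientwise (λ _ → R.refl)
                    ; sym   = λ p → coefficientwise (λ n → R.sym (at p n))
                    ; trans = λ p q → coefficientwise (λ n → R.trans (at p n) (at q n)) }
                  ; ∙-cong = λ p q → coefficientwise (λ n → R.+-cong (at p n) (at q n)) }
                ; assoc = λ f g h → coefficientwise (λ n → R.+-assoc _ _ _) }
              ; identity = (λ f → coefficientwise λ n → R.trans (R.+-congʳ (konst-0 n)) (R.+-identityˡ _))
                         , (λ f → coefficientwise λ n → R.trans (R.+-congˡ (konst-0 n)) (R.+-identityʳ _)) }
            ; inverse = (λ f → coefficientwise λ n → R.trans (R.-‿inverseˡ _) (R.sym (konst-0 n)))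
                      , (λ f → coefficientwise λ n → R.trans (R.-‿inverseʳ _) (R.sym (konst-0 n)))
            ; ⁻¹-cong = λ p → coefficientwise (λ n → R.-‿cong (at p n)) }
          ; comm = λ f g → coefficientwise (λ n → R.+-comm _ _) }
        ; *-cong = λ p q → coefficientwise (conv-cong (at p) (at q))
        ; *-assoc = λ f g h → coefficientwise (conv-assoc (coeff f) (coeff g) (coeff h))
        ; *-identity = (λ f → coefficientwise λ n → *-idˡ f n)
                     , (λ f → coefficientwise λ n → R.trans (conv-comm (coeff f) (konst R.1#) n) (*-idˡ f n))
        ; distrib = (λ f g h → coefficientwise λ n →
                      R.trans (conv-comm (coeff f) _ n)
                        (R.trans (conv-distribʳ (coeff f) (coeff g) (coeff h) n)
                          (R.+-cong (conv-comm (coeff g) (coeff f) n) (conv-comm (coeff h) (coeff f) n))))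
                  , (λ f g h → coefficientwise (conv-distribʳ (coeff f) (coeff g) (coeff h))) }
      ; *-comm = λ f g → coefficientwise (conv-comm (coeff f) (coeff g)) }
      where
      konst-0 : ∀ n → konst R.0# n R.≈ R.0#
      konst-0 zero    = R.refl
      konst-0 (suc n) = R.refl
      *-idˡ : ∀ f n → conv (konst R.1#) (coeff f) n R.≈ coeff f n
      *-idˡ f n = R.trans (conv-konst R.1# (coeff f) n) (R.*-identityˡ _)

    constant-cong : ∀ {c d} → c R.≈ d → constant c ≋ constant d
    constant-cong c≈d = coefficientwise λ { zero → c≈d ; (suc n) → R.refl }

    constant-+ : ∀ c d → constant (c R.+ d) ≋ constant c +ₛ constant d
    constant-+ c d = coefficientwise λ { zero → R.refl ; (suc n) → R.sym (R.+-identityˡ _) }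

    constant-* : ∀ c d → constant (c R.* d) ≋ constant c *ₛ constant d
    constant-* c d = coefficientwise λ n → R.sym (R.trans (conv-konst c (konst d) n) (lemma n))
      where
      lemma : ∀ n → c R.* konst d n R.≈ konst (c R.* d) n
      lemma zero    = R.refl
      lemma (suc n) = R.zeroʳ _

  seriesRing : CommutativeRing 0ℓ 0ℓ
  seriesRing = record { isCommutativeRing = isCommutativeRing }

  private module S = CommutativeRing seriesRing

  constant-neg : ∀ c → constant (R.- c) ≋ negₛ (constant c)
  constant-neg c = S.trans (S.sym (S.+-identityʳ _))
    (S.trans (S.+-congˡ (S.sym (S.-‿inverseʳ (constant c))))
    (S.trans (S.sym (S.+-assoc _ _ _))
    (S.trans (S.+-congʳ (S.trans (S.sym (constant-+ _ _)) (constant-cong (R.-‿inverseˡ c))))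
      (S.+-identityˡ _))))

  opaque
    unfolding _+ₛ_
    -- The derivation X d/dX. Unlike d/dX it does not shift indices: the coefficient of index N
    -- vanishes in N g - `θ` g, and this is the form in which residues of exact differentials are
    -- shown to vanish.
    θ : Series → Series
    θ f = series (λ n → RI.# n R.* coeff f n)

    coeff-θ : ∀ f n → coeff (θ f) n R.≈ RI.# n R.* coeff f n
    coeff-θ f n = R.refl

    θ-cong : ∀ {f g} → f ≋ g → θ f ≋ θ g
    θ-cong p = coefficientwise (λ n → R.*-congˡ (at p n))

    θ-+ : ∀ f g → θ (f +ₛ g) ≋ θ f +ₛ θ g
    θ-+ f g = coefficientwise (λ n → R.distribˡ _ _ _)

    θ-constant : ∀ c → θ (constant c) ≋ constant R.0#
    θ-constant c = coefficientwise λ { zero → R.zeroˡ _ ; (suc n) → R.zeroʳ _ }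

    θ-X : θ X ≋ X
    θ-X = coefficientwise λ
      { zero → R.zeroˡ _ ; 1 → R.*-identityˡ _ ; (suc (suc n)) → R.zeroʳ _ }

    θ-* : ∀ f g → θ (f *ₛ g) ≋ θ f *ₛ g +ₛ f *ₛ θ g
    θ-* f g = coefficientwise (leibniz (coeff f) (coeff g))

-- Finite sums over lists and over vectors

vecs : ∀ k n → List (Vec (Fin k) n)
vecs k zero    = [] ∷ []
vecs k (suc n) = List.concatMap (λ a → List.map (a ∷_) (vecs k n)) (List.allFin k)

module Sums (R : CommutativeRing 0ℓ 0ℓ) where
  open CommutativeRing R
  open IntegerCoefficients R using (solve; _:=_; _:+_)
  open import Relation.Binary.Reasoning.Setoid setoid

  private variable
    A B : Set

  ∑ : List A → (A → Carrier) → Carrier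
  ∑ []       f = 0#
  ∑ (x ∷ xs) f = f x + ∑ xs f

  syntax ∑ xs (λ x → e) = ∑[ x ← xs ] e

  ∑-cong : ∀ (xs : List A) {f g} → (∀ x → f x ≈ g x) → ∑ xs f ≈ ∑ xs g
  ∑-cong []       p = refl
  ∑-cong (x ∷ xs) p = +-cong (p x) (∑-cong xs p)

  ∑-zero : ∀ (xs : List A) → ∑[ x ← xs ] 0# ≈ 0#
  ∑-zero []       = refl
  ∑-zero (x ∷ xs) = trans (+-identityˡ _) (∑-zero xs)

  ∑-+ : ∀ (xs : List A) f g → ∑[ x ← xs ] (f x + g x) ≈ ∑ xs f + ∑ xs g
  ∑-+ [] f g = sym (+-identityˡ _)
  ∑-+ (x ∷ xs) f g = trans (+-congˡ (∑-+ xs f g))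
    ((solve 4 (λ a b c d → (a :+ b) :+ (c :+ d) := (a :+ c) :+ (b :+ d)) refl (f x) (g x) (∑ xs f) (∑ xs g)))

  ∑-*ˡ : ∀ (xs : List A) c f → c * ∑ xs f ≈ ∑[ x ← xs ] (c * f x)
  ∑-*ˡ [] c f = zeroʳ c
  ∑-*ˡ (x ∷ xs) c f = trans (distribˡ _ _ _) (+-congˡ (∑-*ˡ xs c f))

  ∑-*ʳ : ∀ (xs : List A) c f → ∑ xs f * c ≈ ∑[ x ← xs ] (f x * c)
  ∑-*ʳ [] c f = zeroˡ c
  ∑-*ʳ (x ∷ xs) c f = trans (distribʳ _ _ _) (+-congˡ (∑-*ʳ xs c f))

  ∑-swap : ∀ (xs : List A) (ys : List B) (f : A → B → Carrier) →
           ∑[ x ← xs ] ∑ ys (f x) ≈ ∑[ y ← ys ] ∑[ x ← xs ] f x y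
  ∑-swap [] ys f = sym (∑-zero ys)
  ∑-swap (x ∷ xs) ys f = trans (+-congˡ (∑-swap xs ys f))
    (sym (∑-+ ys (f x) (λ y → ∑[ x ← xs ] f x y)))

  ∑-++ : ∀ (xs ys : List A) f → ∑ (xs List.++ ys) f ≈ ∑ xs f + ∑ ys f
  ∑-++ [] ys f = sym (+-identityˡ _)
  ∑-++ (x ∷ xs) ys f = trans (+-congˡ (∑-++ xs ys f)) (sym (+-assoc _ _ _))

  ∑-map : ∀ (xs : List A) (h : A → B) f → ∑ (List.map h xs) f ≈ ∑[ x ← xs ] f (h x)
  ∑-map [] h f = refl
  ∑-map (x ∷ xs) h f = +-congˡ (∑-map xs h f)

  ∑-concatMap : ∀ (xs : List A) (h : A → List B) f →
                ∑ (List.concatMap h xs) f ≈ ∑[ x ← xs ] ∑ (h x) f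
  ∑-concatMap [] h f = refl
  ∑-concatMap (x ∷ xs) h f = trans (∑-++ (h x) _ f) (+-congˡ (∑-concatMap xs h f))

  ∑-vecs : ∀ k n (f : Vec (Fin k) (suc n) → Carrier) →
           ∑ (vecs k (suc n)) f ≈ ∑[ a ← List.allFin k ] ∑[ v ← vecs k n ] f (a ∷ v)
  ∑-vecs k n f = trans (∑-concatMap (List.allFin k) _ f)
    (∑-cong (List.allFin k) (λ a → ∑-map (vecs k n) (a ∷_) f))

  -- That `h` permutes the alphabet is expressed by its effect on sums, which for `σ` and `τ` is a
  -- single ring identity.
  ∑-vecs-map : ∀ {k} (h : Fin k → Fin k) →
    (∀ f → ∑[ a ← List.allFin k ] f (h a) ≈ ∑ (List.allFin k) f) →
    ∀ n (f : Vec (Fin k) n → Carrier) → ∑[ v ← vecs k n ] f (Vec.map h v) ≈ ∑ (vecs k n) f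
  ∑-vecs-map h p zero f = refl
  ∑-vecs-map {k} h p (suc n) f = begin
    ∑[ v ← vecs k (suc n) ] f (Vec.map h v)
      ≈⟨ ∑-vecs k n (λ v → f (Vec.map h v)) ⟩
    ∑[ a ← List.allFin k ] ∑[ v ← vecs k n ] f (h a ∷ Vec.map h v)
      ≈⟨ ∑-cong (List.allFin k) (λ a → ∑-vecs-map h p n (λ v → f (h a ∷ v))) ⟩
    ∑[ a ← List.allFin k ] ∑[ v ← vecs k n ] f (h a ∷ v)
      ≈⟨ p (λ a → ∑[ v ← vecs k n ] f (a ∷ v)) ⟩
    ∑[ a ← List.allFin k ] ∑[ v ← vecs k n ] f (a ∷ v)
      ≈⟨ ∑-vecs k n f ⟨
    ∑ (vecs k (suc n)) f ∎

module ℤSums = Sums ℤₚ.+-*-commutativeRing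

∑-nonNeg : ∀ {A : Set} (xs : List A) f → (∀ x → + 0 ℤ.≤ f x) → + 0 ℤ.≤ ℤSums.∑ xs f
∑-nonNeg [] f p = ℤₚ.≤-refl
∑-nonNeg (x ∷ xs) f p = ℤₚ.+-mono-≤ (p x) (∑-nonNeg xs f p)

∑≢0 : ∀ {A : Set} (xs : List A) f → ¬ ℤSums.∑ xs f ≡ + 0 → ∃[ x ] ¬ f x ≡ + 0
∑≢0 [] f ne = ⊥-elim (ne ≡.refl)
∑≢0 (x ∷ xs) f ne with f x ℤ.≟ + 0
... | no fx≢0  = x , fx≢0
... | yes fx≡0 = ∑≢0 xs f (λ eq → ne (≡.cong₂ ℤ._+_ fx≡0 eq))

term≤∑ : ∀ {A : Set} (xs : List A) f → (∀ x → + 0 ℤ.≤ f x) → ∀ {x} → x ∈ xs → f x ℤ.≤ ℤSums.∑ xs f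
term≤∑ (x ∷ xs) f p (here ≡.refl) =
  ≡.subst (ℤ._≤ f x ℤ.+ ℤSums.∑ xs f) (ℤₚ.+-identityʳ (f x)) (ℤₚ.+-monoʳ-≤ (f x) (∑-nonNeg xs f p))
term≤∑ (y ∷ xs) f p (there x∈xs) =
  ≡.subst (ℤ._≤ f y ℤ.+ ℤSums.∑ xs f) (ℤₚ.+-identityˡ _) (ℤₚ.+-mono-≤ (p y) (term≤∑ xs f p x∈xs))

∈-vecs : ∀ {k n} (v : Vec (Fin k) n) → v ∈ vecs k n
∈-vecs [] = here ≡.refl
∈-vecs {k} (a ∷ v) = ∈-concatMap⁺ (λ a → List.map (a ∷_) (vecs k _))
  (Any.map (λ { ≡.refl → ∈-map⁺ (a ∷_) (∈-vecs v) }) (∈-allFin a))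

-- The MacWilliams identity for self-dual codes over ℤ/4

-- Expanding a code's symmetrised weight enumerator in U = a + c, V = a − c, Z = 2b
-- (a, b, c recording the coordinates 0, ±1, 2) gives each word in U, V, Z a coefficient ∑ χs.
pattern U = zero
pattern V = suc zero
pattern Z = suc (suc zero)

Word : ℕ → Set
Word = Vec (Fin 3)

χ : Fin 3 → Fin 4 → ℤ
χ U zero                   = + 1
χ U (suc zero)             = + 0
χ U (suc (suc zero))       = + 1
χ U (suc (suc (suc zero))) = + 0
χ V zero                   = + 1
χ V (suc zero)             = + 0
χ V (suc (suc zero))       = -[1+ 0 ]
χ V (suc (suc (suc zero))) = + 0
χ Z zero                   = + 0
χ Z (suc zero)             = + 1
χ Z (suc (suc zero))       = + 0
χ Z (suc (suc (suc zero))) = + 1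

χs : ∀ {n} → Word n → Vec (Fin 4) n → ℤ
χs []      []      = + 1
χs (l ∷ ω) (a ∷ x) = χ l a ℤ.* χs ω x

-- `σ` is the effect of the Fourier transform of ℤ/4 on the three letters, up to a factor 2; `τ` is
-- the effect of c ↦ -c, a sign for every coordinate equal to 2.
σ τ : Fin 3 → Fin 3
σ U = U
σ V = Z
σ Z = V
τ U = V
τ V = U
τ Z = Z

-- The real part of iᵏ.
κ : ℕ → ℤ
κ 0 = + 1
κ 1 = + 0
κ 2 = -[1+ 0 ]
κ 3 = + 0
κ (suc (suc (suc (suc k)))) = κ k

κ-+2 : ∀ k → κ (2 ℕ.+ k) ≡ ℤ.- κ k
κ-+2 0 = ≡.refl
κ-+2 1 = ≡.refl
κ-+2 2 = ≡.refl
κ-+2 3 = ≡.refl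
κ-+2 (suc (suc (suc (suc k)))) = κ-+2 k

κ-*4 : ∀ q k → κ (q ℕ.* 4 ℕ.+ k) ≡ κ k
κ-*4 zero    k = ≡.refl
κ-*4 (suc q) k = κ-*4 q k

κ≡1⇒4∣ : ∀ k → κ k ≡ + 1 → 4 ∣ k
κ≡1⇒4∣ 0 eq = divides 0 ≡.refl
κ≡1⇒4∣ (suc (suc (suc (suc k)))) eq with κ≡1⇒4∣ k eq
... | divides q ≡.refl = divides (suc q) ≡.refl

4∣⇒κ-+ : ∀ {j} k → 4 ∣ j → κ (j ℕ.+ k) ≡ κ k
4∣⇒κ-+ k (divides q ≡.refl) = κ-*4 q k

mod4-ind : ∀ {P : ℕ → Set} → (∀ (k : Fin 4) → P (toℕ k)) → (∀ k → P k → P (4 ℕ.+ k)) → ∀ k → P k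
mod4-ind base step 0 = base zero
mod4-ind base step 1 = base (suc zero)
mod4-ind base step 2 = base (suc (suc zero))
mod4-ind base step 3 = base (suc (suc (suc zero)))
mod4-ind base step (suc (suc (suc (suc k)))) = step k (mod4-ind base step k)

∑ℤ : ∀ {A : Set} → List A → (A → ℤ) → ℤ
∑ℤ = ℤSums.∑

syntax ∑ℤ xs (λ x → e) = ∑ℤ[ x ← xs ] e

private
  +-4+ : ∀ m k → m ℕ.+ (4 ℕ.+ k) ≡ 4 ℕ.+ (m ℕ.+ k)
  +-4+ m k = ≡.trans (≡.sym (ℕₚ.+-assoc m 4 k))
    (≡.trans (≡.cong (ℕ._+ k) (ℕₚ.+-comm m 4)) (ℕₚ.+-assoc 4 m k))

  κ-+4+ : ∀ m k → κ (m ℕ.+ (4 ℕ.+ k)) ≡ κ (m ℕ.+ k)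
  κ-+4+ m k = ≡.cong κ (+-4+ m k)

  -- Each `χ l` is an even function on ℤ/4, so its Fourier coefficients are real and the integers
  -- can replace the Gaussian integers. The phase `k` is carried along because it collects the
  -- contributions of the other coordinates in `χs-transform`.
  χ-transform : ∀ k (l : Fin 3) (y : Fin 4) → ∑ℤ[ x ← List.allFin 4 ] (χ l x ℤ.* κ (toℕ x ℕ.* toℕ y ℕ.+ k))
                          ≡ + 2 ℤ.* χ (σ l) y ℤ.* κ k
  χ-transform = mod4-ind
    (from-yes (Finₚ.all? {n = 4} λ k → Finₚ.all? {n = 3} λ l → Finₚ.all? {n = 4} λ y →
      ∑ℤ[ x ← List.allFin 4 ] (χ l x ℤ.* κ (toℕ x ℕ.* toℕ y ℕ.+ toℕ k)) ℤ.≟ + 2 ℤ.* χ (σ l) y ℤ.* κ (toℕ k)))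
    (λ k ih l y → ≡.trans (ℤSums.∑-cong (List.allFin 4) {λ x → χ l x ℤ.* κ (toℕ x ℕ.* toℕ y ℕ.+ (4 ℕ.+ k))} {λ x
        → χ l x ℤ.* κ (toℕ x ℕ.* toℕ y ℕ.+ k)} λ x →
      ≡.cong (χ l x ℤ.*_) (κ-+4+ (toℕ x ℕ.* toℕ y) k)) (ih l y))

χs-transform : ∀ {n} (ω : Word n) y k →
  ∑ℤ[ x ← vecs 4 n ] (χs ω x ℤ.* κ (inner x y ℕ.+ k)) ≡ (+ 2) ℤ.^ n ℤ.* χs (Vec.map σ ω) y ℤ.* κ k
χs-transform [] [] k = ℤₚ.+-identityʳ (+ 1 ℤ.* κ k)
χs-transform {suc n} (l ∷ ω) (b ∷ y) k = begin
  ∑ℤ[ x ← vecs 4 (suc n) ] (χs (l ∷ ω) x ℤ.* κ (inner x (b ∷ y) ℕ.+ k))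
    ≡⟨ ℤSums.∑-vecs 4 n (λ x → χs (l ∷ ω) x ℤ.* κ (inner x (b ∷ y) ℕ.+ k)) ⟩
  ∑ℤ[ a ← List.allFin 4 ] ∑ℤ[ x ← vecs 4 n ] (χ l a ℤ.* χs ω x ℤ.* κ (toℕ a ℕ.* toℕ b ℕ.+ inner x y ℕ.+ k))
    ≡⟨ ℤSums.∑-cong (List.allFin 4) {λ a → ∑ℤ[ x ← vecs 4 n ] (χ l a ℤ.* χs ω x ℤ.* κ
        (toℕ a ℕ.* toℕ b ℕ.+ inner x y ℕ.+ k))} {λ a → w ℤ.* (χ l a ℤ.* κ (toℕ a ℕ.* toℕ b ℕ.+ k))} step ⟩
  ∑ℤ[ a ← List.allFin 4 ] (w ℤ.* (χ l a ℤ.* κ (toℕ a ℕ.* toℕ b ℕ.+ k)))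
    ≡⟨ ℤSums.∑-*ˡ (List.allFin 4) w (λ a → χ l a ℤ.* κ (toℕ a ℕ.* toℕ b ℕ.+ k)) ⟨
  w ℤ.* ∑ℤ[ a ← List.allFin 4 ] (χ l a ℤ.* κ (toℕ a ℕ.* toℕ b ℕ.+ k))
    ≡⟨ ≡.cong (w ℤ.*_) (χ-transform k l b) ⟩
  w ℤ.* (+ 2 ℤ.* χ (σ l) b ℤ.* κ k)
    ≡⟨ regroup ((+ 2) ℤ.^ n) (χs (Vec.map σ ω) y) (χ (σ l) b) (κ k) ⟩
  (+ 2) ℤ.^ suc n ℤ.* (χ (σ l) b ℤ.* χs (Vec.map σ ω) y) ℤ.* κ k ∎
  where
  open ≡.≡-Reasoning
  w : ℤ
  w = (+ 2) ℤ.^ n ℤ.* χs (Vec.map σ ω) y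
  regroup : ∀ p c d e → p ℤ.* c ℤ.* (+ 2 ℤ.* d ℤ.* e) ≡ + 2 ℤ.* p ℤ.* (d ℤ.* c) ℤ.* e
  regroup = solve-∀
  rearrange : ∀ i j k → i ℕ.+ j ℕ.+ k ≡ j ℕ.+ (i ℕ.+ k)
  rearrange i j k = ≡.trans (≡.cong (ℕ._+ k) (ℕₚ.+-comm i j)) (ℕₚ.+-assoc j i k)
  move : ∀ c d e → c ℤ.* (d ℤ.* e) ≡ d ℤ.* (c ℤ.* e)
  move = solve-∀
  step : ∀ a → ∑ℤ[ x ← vecs 4 n ] (χ l a ℤ.* χs ω x ℤ.* κ (toℕ a ℕ.* toℕ b ℕ.+ inner x y ℕ.+ k))
               ≡ w ℤ.* (χ l a ℤ.* κ (toℕ a ℕ.* toℕ b ℕ.+ k))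
  step a = begin
    ∑ℤ[ x ← vecs 4 n ] (χ l a ℤ.* χs ω x ℤ.* κ (toℕ a ℕ.* toℕ b ℕ.+ inner x y ℕ.+ k))
      ≡⟨ ℤSums.∑-cong (vecs 4 n) (λ x → ≡.trans (ℤₚ.*-assoc (χ l a) (χs ω x) _)
           (≡.cong (λ j → χ l a ℤ.* (χs ω x ℤ.* κ j)) (rearrange (toℕ a ℕ.* toℕ b) (inner x y) k))) ⟩
    ∑ℤ[ x ← vecs 4 n ] (χ l a ℤ.* (χs ω x ℤ.* κ (inner x y ℕ.+ (toℕ a ℕ.* toℕ b ℕ.+ k))))
      ≡⟨ ℤSums.∑-*ˡ (vecs 4 n) (χ l a) _ ⟨
    χ l a ℤ.* ∑ℤ[ x ← vecs 4 n ] (χs ω x ℤ.* κ (inner x y ℕ.+ (toℕ a ℕ.* toℕ b ℕ.+ k)))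
      ≡⟨ ≡.cong (χ l a ℤ.*_) (χs-transform ω y (toℕ a ℕ.* toℕ b ℕ.+ k)) ⟩
    χ l a ℤ.* (w ℤ.* κ (toℕ a ℕ.* toℕ b ℕ.+ k))
      ≡⟨ move (χ l a) w (κ (toℕ a ℕ.* toℕ b ℕ.+ k)) ⟩
    w ℤ.* (χ l a ℤ.* κ (toℕ a ℕ.* toℕ b ℕ.+ k)) ∎

add₄ : Fin 4 → Fin 4 → Fin 4
add₄ a b = (toℕ a ℕ.+ toℕ b) mod 4

_⊕_ : ∀ {n} → Vec (Fin 4) n → Vec (Fin 4) n → Vec (Fin 4) n
_⊕_ = Vec.zipWith add₄

private
  κ-add₄ : ∀ k (a b c : Fin 4) → κ (toℕ a ℕ.* toℕ (add₄ b c) ℕ.+ k) ≡ κ (toℕ a ℕ.* toℕ b ℕ.+ (toℕ a ℕ.* toℕ c ℕ.+ k))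
  κ-add₄ = mod4-ind
    (from-yes (Finₚ.all? {n = 4} λ k → Finₚ.all? {n = 4} λ a → Finₚ.all? {n = 4} λ b → Finₚ.all? {n = 4} λ c →
      κ (toℕ a ℕ.* toℕ (add₄ b c) ℕ.+ toℕ k) ℤ.≟ κ (toℕ a ℕ.* toℕ b ℕ.+ (toℕ a ℕ.* toℕ c ℕ.+ toℕ k))))
    (λ k ih a b c → ≡.trans (κ-+4+ (toℕ a ℕ.* toℕ (add₄ b c)) k) (≡.trans (ih a b c)
      (≡.sym (≡.trans (≡.cong (λ j → κ (toℕ a ℕ.* toℕ b ℕ.+ j)) (+-4+ (toℕ a ℕ.* toℕ c) k))
        (κ-+4+ (toℕ a ℕ.* toℕ b) _)))))

-- Bilinearity holds only modulo 4, as `⊕` reduces each coordinate; applying `κ` at an arbitrary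
-- shift makes it an equation.
κ-inner-⊕ : ∀ {n} (x y z : Vec (Fin 4) n) k →
            κ (inner x (y ⊕ z) ℕ.+ k) ≡ κ (inner x y ℕ.+ (inner x z ℕ.+ k))
κ-inner-⊕ [] [] [] k = ≡.refl
κ-inner-⊕ (a ∷ x) (b ∷ y) (c ∷ z) k = begin
  κ (a*bc ℕ.+ inner x (y ⊕ z) ℕ.+ k)                ≡⟨ ≡.cong κ (rearrange a*bc (inner x (y ⊕ z)) k) ⟩
  κ (inner x (y ⊕ z) ℕ.+ (a*bc ℕ.+ k))              ≡⟨ κ-inner-⊕ x y z (a*bc ℕ.+ k) ⟩
  κ (inner x y ℕ.+ (inner x z ℕ.+ (a*bc ℕ.+ k)))    ≡⟨ ≡.cong κ (rotate (inner x y) (inner x z) a*bc k) ⟩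
  κ (a*bc ℕ.+ (inner x y ℕ.+ (inner x z ℕ.+ k)))    ≡⟨ κ-add₄ (inner x y ℕ.+ (inner x z ℕ.+ k)) a b c ⟩
  κ (a*b ℕ.+ (a*c ℕ.+ (inner x y ℕ.+ (inner x z ℕ.+ k))))
    ≡⟨ ≡.cong κ (shuffle a*b a*c (inner x y) (inner x z) k) ⟩
  κ (a*b ℕ.+ inner x y ℕ.+ (a*c ℕ.+ inner x z ℕ.+ k)) ∎
  where
  open ≡.≡-Reasoning
  a*bc a*b a*c : ℕ
  a*bc = toℕ a ℕ.* toℕ (add₄ b c)
  a*b = toℕ a ℕ.* toℕ b
  a*c = toℕ a ℕ.* toℕ c
  rearrange : ∀ i j k → i ℕ.+ j ℕ.+ k ≡ j ℕ.+ (i ℕ.+ k)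
  rearrange = ℕsolve-∀
  rotate : ∀ i j l k → i ℕ.+ (j ℕ.+ (l ℕ.+ k)) ≡ l ℕ.+ (i ℕ.+ (j ℕ.+ k))
  rotate = ℕsolve-∀
  shuffle : ∀ b c i j k → b ℕ.+ (c ℕ.+ (i ℕ.+ (j ℕ.+ k))) ≡ b ℕ.+ i ℕ.+ (c ℕ.+ j ℕ.+ k)
  shuffle = ℕsolve-∀

inner-comm : ∀ {n} (x y : Vec (Fin 4) n) → inner x y ≡ inner y x
inner-comm [] [] = ≡.refl
inner-comm (a ∷ x) (b ∷ y) = ≡.cong₂ ℕ._+_ (ℕₚ.*-comm (toℕ a) (toℕ b)) (inner-comm x y)

∑-translate : ∀ {n} (z : Vec (Fin 4) n) f → ∑ℤ[ y ← vecs 4 n ] f (y ⊕ z) ≡ ∑ℤ (vecs 4 n) f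
∑-translate [] f = ≡.refl
∑-translate {suc n} (c ∷ z) f = begin
  ∑ℤ[ y ← vecs 4 (suc n) ] f (y ⊕ (c ∷ z))
    ≡⟨ ℤSums.∑-vecs 4 n (λ y → f (y ⊕ (c ∷ z))) ⟩
  ∑ℤ[ b ← List.allFin 4 ] ∑ℤ[ y ← vecs 4 n ] f (add₄ b c ∷ (y ⊕ z))
    ≡⟨ ℤSums.∑-cong (List.allFin 4) {λ b → ∑ℤ[ y ← vecs 4 n ] f (add₄ b c ∷ (y ⊕ z))} {λ b → g (add₄ b c)} (λ b
        → ∑-translate z (λ y → f (add₄ b c ∷ y))) ⟩
  ∑ℤ[ b ← List.allFin 4 ] g (add₄ b c)
    ≡⟨ rotate c ⟩
  ∑ℤ (List.allFin 4) g
    ≡⟨ ℤSums.∑-vecs 4 n f ⟨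
  ∑ℤ (vecs 4 (suc n)) f ∎
  where
  open ≡.≡-Reasoning
  g : Fin 4 → ℤ
  g b = ∑ℤ[ y ← vecs 4 n ] f (b ∷ y)
  rotate₁ : ∀ p q r s → q ℤ.+ (r ℤ.+ (s ℤ.+ (p ℤ.+ + 0))) ≡ p ℤ.+ (q ℤ.+ (r ℤ.+ (s ℤ.+ + 0)))
  rotate₁ = solve-∀
  rotate₂ : ∀ p q r s → r ℤ.+ (s ℤ.+ (p ℤ.+ (q ℤ.+ + 0))) ≡ p ℤ.+ (q ℤ.+ (r ℤ.+ (s ℤ.+ + 0)))
  rotate₂ = solve-∀
  rotate₃ : ∀ p q r s → s ℤ.+ (p ℤ.+ (q ℤ.+ (r ℤ.+ + 0))) ≡ p ℤ.+ (q ℤ.+ (r ℤ.+ (s ℤ.+ + 0)))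
  rotate₃ = solve-∀
  rotate : ∀ c → ∑ℤ[ b ← List.allFin 4 ] g (add₄ b c) ≡ ∑ℤ (List.allFin 4) g
  rotate zero                   = ≡.refl
  rotate (suc zero)             = rotate₁ (g zero) (g (suc zero)) (g (suc (suc zero))) (g (suc (suc (suc zero))))
  rotate (suc (suc zero))       = rotate₂ (g zero) (g (suc zero)) (g (suc (suc zero))) (g (suc (suc (suc zero))))
  rotate (suc (suc (suc zero))) = rotate₃ (g zero) (g (suc zero)) (g (suc (suc zero))) (g (suc (suc (suc zero))))

module Duality {n : ℕ} (C : Code n) (selfDual : SelfDual C) where

  open ≡.≡-Reasoning

  ind : Vec (Fin 4) n → ℤ
  ind x = if C x then + 1 else + 0

  coefficient : Word n → ℤ
  coefficient ω = ∑ℤ[ c ← vecs 4 n ] (ind c ℤ.* χs ω c)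

  private
    ∈⇒4∣ : ∀ {x y} → x ∈C C → y ∈C C → 4 ∣ inner x y
    ∈⇒4∣ {x} {y} x∈C y∈C = proj₁ (selfDual x) x∈C y y∈C

    4∣⇒∈ : ∀ {x} → (∀ y → y ∈C C → 4 ∣ inner y x) → x ∈C C
    4∣⇒∈ {x} p = proj₂ (selfDual x) (λ y y∈C → ≡.subst (4 ∣_) (inner-comm y x) (p y y∈C))

    κ-inner-⊕-∈ : ∀ {z} → z ∈C C → ∀ y {w} → w ∈C C → κ (inner w (y ⊕ z)) ≡ κ (inner w y)
    κ-inner-⊕-∈ {z} z∈C y {w} w∈C = begin
      κ (inner w (y ⊕ z))                      ≡⟨ ≡.cong κ (ℕₚ.+-identityʳ (inner w (y ⊕ z))) ⟨
      κ (inner w (y ⊕ z) ℕ.+ 0)                ≡⟨ κ-inner-⊕ w y z 0 ⟩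
      κ (inner w y ℕ.+ (inner w z ℕ.+ 0))      ≡⟨ ≡.cong κ (swap (inner w y) (inner w z)) ⟩
      κ (inner w z ℕ.+ inner w y)              ≡⟨ 4∣⇒κ-+ (inner w y) (∈⇒4∣ w∈C z∈C) ⟩
      κ (inner w y)                            ∎
      where
      swap : ∀ i j → i ℕ.+ (j ℕ.+ 0) ≡ j ℕ.+ i
      swap = ℕsolve-∀

    4∣⇒κ : ∀ {j} → 4 ∣ j → κ j ≡ + 1
    4∣⇒κ {j} 4∣j = ≡.trans (≡.cong κ (≡.sym (ℕₚ.+-identityʳ j))) (4∣⇒κ-+ 0 4∣j)

    -- `Code` is just a set of vectors; its closure under addition comes from self-duality, since
    -- adding a codeword does not change the inner products with codewords modulo 4.
    ind-⊕ : ∀ {z} → z ∈C C → ∀ y → ind (y ⊕ z) ≡ ind y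
    ind-⊕ {z} z∈C y with C y in y∈ | C (y ⊕ z) in y⊕z∈
    ... | true  | true  = ≡.refl
    ... | false | false = ≡.refl
    ... | true  | false with () ← ≡.trans (≡.sym y⊕z∈) (4∣⇒∈ λ w w∈C → κ≡1⇒4∣ _
                          (≡.trans (κ-inner-⊕-∈ z∈C y w∈C) (4∣⇒κ (∈⇒4∣ w∈C y∈))))
    ... | false | true  with () ← ≡.trans (≡.sym y∈) (4∣⇒∈ λ w w∈C → κ≡1⇒4∣ _
                          (≡.trans (≡.sym (κ-inner-⊕-∈ z∈C y w∈C)) (4∣⇒κ (∈⇒4∣ w∈C y⊕z∈))))

    -- The character sum over the code: the real part of i^(x·y + k) summed over the codewords y.
    G : Vec (Fin 4) n → ℕ → ℤ
    G x k = ∑ℤ[ y ← vecs 4 n ] (ind y ℤ.* κ (inner x y ℕ.+ k))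

    G-period : ∀ x {z} → z ∈C C → ∀ k → G x (inner x z ℕ.+ k) ≡ G x k
    G-period x {z} z∈C k = begin
      ∑ℤ[ y ← vecs 4 n ] (ind y ℤ.* κ (inner x y ℕ.+ (inner x z ℕ.+ k)))
        ≡⟨ ℤSums.∑-cong (vecs 4 n) (λ y → ≡.cong₂ ℤ._*_ (ind-⊕ z∈C y) (κ-inner-⊕ x y z k)) ⟨
      ∑ℤ[ y ← vecs 4 n ] (ind (y ⊕ z) ℤ.* κ (inner x (y ⊕ z) ℕ.+ k))
        ≡⟨ ∑-translate z (λ y → ind y ℤ.* κ (inner x y ℕ.+ k)) ⟩
      G x k ∎

    G-+2 : ∀ x k → G x (2 ℕ.+ k) ≡ ℤ.- G x k
    G-+2 x k = begin
      ∑ℤ[ y ← vecs 4 n ] (ind y ℤ.* κ (inner x y ℕ.+ (2 ℕ.+ k)))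
        ≡⟨ ℤSums.∑-cong (vecs 4 n) (λ y → begin
             ind y ℤ.* κ (inner x y ℕ.+ (2 ℕ.+ k))       ≡⟨ ≡.cong (λ j → ind y ℤ.* κ j) (+-2+ (inner x y) k) ⟩
             ind y ℤ.* κ (2 ℕ.+ (inner x y ℕ.+ k))       ≡⟨ ≡.cong (ind y ℤ.*_) (κ-+2 (inner x y ℕ.+ k)) ⟩
             ind y ℤ.* (ℤ.- κ (inner x y ℕ.+ k))         ≡⟨ neg (ind y) (κ (inner x y ℕ.+ k)) ⟩
             -[1+ 0 ] ℤ.* (ind y ℤ.* κ (inner x y ℕ.+ k)) ∎) ⟩
      ∑ℤ[ y ← vecs 4 n ] (-[1+ 0 ] ℤ.* (ind y ℤ.* κ (inner x y ℕ.+ k)))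
        ≡⟨ ℤSums.∑-*ˡ (vecs 4 n) -[1+ 0 ] (λ y → ind y ℤ.* κ (inner x y ℕ.+ k)) ⟨
      -[1+ 0 ] ℤ.* G x k
        ≡⟨ ℤₚ.-1*i≡-i (G x k) ⟩
      ℤ.- G x k ∎
      where
      +-2+ : ∀ i k → i ℕ.+ (2 ℕ.+ k) ≡ 2 ℕ.+ (i ℕ.+ k)
      +-2+ = ℕsolve-∀
      neg : ∀ i j → i ℤ.* (ℤ.- j) ≡ -[1+ 0 ] ℤ.* (i ℤ.* j)
      neg = solve-∀

    i≡-i⇒i≡0 : ∀ i → i ≡ ℤ.- i → i ≡ + 0
    i≡-i⇒i≡0 (+ 0) eq = ≡.refl

    -- A period congruent to 2 would give g 0 = -g 0, and an odd period doubles to such a one.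
    period⇒4∣ : ∀ (g : ℕ → ℤ) → (∀ k → g (2 ℕ.+ k) ≡ ℤ.- g k) → ¬ g 0 ≡ + 0 →
                ∀ j → (∀ k → g (j ℕ.+ k) ≡ g k) → 4 ∣ j
    period⇒4∣ g anti g0≢0 0 per = divides 0 ≡.refl
    period⇒4∣ g anti g0≢0 1 per =
      ⊥-elim (g0≢0 (i≡-i⇒i≡0 (g 0) (≡.trans (≡.sym (≡.trans (per 1) (per 0))) (anti 0))))
    period⇒4∣ g anti g0≢0 2 per =
      ⊥-elim (g0≢0 (i≡-i⇒i≡0 (g 0) (≡.trans (≡.sym (per 0)) (anti 0))))
    period⇒4∣ g anti g0≢0 3 per = ⊥-elim (g0≢0 (i≡-i⇒i≡0 (g 0) (begin
      g 0           ≡⟨ ≡.trans (per 3) (per 0) ⟨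
      g 6           ≡⟨ anti 4 ⟩
      ℤ.- g 4       ≡⟨ ≡.cong ℤ.-_ (anti 2) ⟩
      ℤ.- (ℤ.- g 2) ≡⟨ ℤₚ.neg-involutive (g 2) ⟩
      g 2           ≡⟨ anti 0 ⟩
      ℤ.- g 0       ∎)))
    period⇒4∣ g anti g0≢0 (suc (suc (suc (suc j)))) per
      with period⇒4∣ g anti g0≢0 j (λ k → ≡.trans (≡.sym (≡.trans (anti (2 ℕ.+ (j ℕ.+ k)))
             (≡.trans (≡.cong ℤ.-_ (anti (j ℕ.+ k))) (ℤₚ.neg-involutive _)))) (per k))
    ... | divides q ≡.refl = divides (suc q) ≡.refl

    N : ℤ
    N = ∑ℤ (vecs 4 n) ind

    -- By translation, x·z is a period of `G x` for every codeword z. If `G x 0` is not zero, all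
    -- these periods are divisible by 4, and then self-duality puts `x` into the code.
    orthogonality : ∀ x → G x 0 ≡ N ℤ.* ind x
    orthogonality x with C x in x∈
    ... | true = ≡.trans (ℤSums.∑-cong (vecs 4 n) constant) (≡.sym (ℤₚ.*-identityʳ N))
      where
      constant : ∀ y → ind y ℤ.* κ (inner x y ℕ.+ 0) ≡ ind y
      constant y with C y in y∈
      ... | true  = ≡.trans (ℤₚ.*-identityˡ _) (4∣⇒κ-+ 0 (∈⇒4∣ x∈ y∈))
      ... | false = ≡.refl
    ... | false with G x 0 ℤ.≟ + 0
    ...   | yes G≡0 = ≡.trans G≡0 (≡.sym (ℤₚ.*-zeroʳ N))
    ...   | no G≢0 with () ← ≡.trans (≡.sym x∈) (proj₂ (selfDual x) λ z z∈C →
              period⇒4∣ (G x) (G-+2 x) G≢0 (inner x z) (G-period x z∈C))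

    -- Poisson summation over the code. The size `N` of the code is not known at this point and
    -- stays as a factor on the left.
    poisson : ∀ ω → N ℤ.* coefficient ω ≡ (+ 2) ℤ.^ n ℤ.* coefficient (Vec.map σ ω)
    poisson ω = begin
      N ℤ.* coefficient ω
        ≡⟨ ℤSums.∑-*ˡ (vecs 4 n) N _ ⟩
      ∑ℤ[ x ← vecs 4 n ] (N ℤ.* (ind x ℤ.* χs ω x))
        ≡⟨ ℤSums.∑-cong (vecs 4 n) (λ x → begin
             N ℤ.* (ind x ℤ.* χs ω x)     ≡⟨ ℤₚ.*-assoc N (ind x) (χs ω x) ⟨
             N ℤ.* ind x ℤ.* χs ω x       ≡⟨ ≡.cong (ℤ._* χs ω x) (orthogonality x) ⟨
             G x 0 ℤ.* χs ω x             ≡⟨ ℤSums.∑-*ʳ (vecs 4 n) (χs ω x) _ ⟩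
             ∑ℤ[ y ← vecs 4 n ] (ind y ℤ.* κ (inner x y ℕ.+ 0) ℤ.* χs ω x) ∎) ⟩
      ∑ℤ[ x ← vecs 4 n ] ∑ℤ[ y ← vecs 4 n ] (ind y ℤ.* κ (inner x y ℕ.+ 0) ℤ.* χs ω x)
        ≡⟨ ℤSums.∑-swap (vecs 4 n) (vecs 4 n) (λ x y → ind y ℤ.* κ (inner x y ℕ.+ 0) ℤ.* χs ω x) ⟩
      ∑ℤ[ y ← vecs 4 n ] ∑ℤ[ x ← vecs 4 n ] (ind y ℤ.* κ (inner x y ℕ.+ 0) ℤ.* χs ω x)
        ≡⟨ ℤSums.∑-cong (vecs 4 n) (λ y → begin
             ∑ℤ[ x ← vecs 4 n ] (ind y ℤ.* κ (inner x y ℕ.+ 0) ℤ.* χs ω x)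
               ≡⟨ ℤSums.∑-cong (vecs 4 n) (λ x → regroup (ind y) (κ (inner x y ℕ.+ 0)) (χs ω x)) ⟩
             ∑ℤ[ x ← vecs 4 n ] (ind y ℤ.* (χs ω x ℤ.* κ (inner x y ℕ.+ 0)))
               ≡⟨ ℤSums.∑-*ˡ (vecs 4 n) (ind y) _ ⟨
             ind y ℤ.* ∑ℤ[ x ← vecs 4 n ] (χs ω x ℤ.* κ (inner x y ℕ.+ 0))
               ≡⟨ ≡.cong (ind y ℤ.*_) (χs-transform ω y 0) ⟩
             ind y ℤ.* ((+ 2) ℤ.^ n ℤ.* χs (Vec.map σ ω) y ℤ.* + 1)
               ≡⟨ move (ind y) ((+ 2) ℤ.^ n) (χs (Vec.map σ ω) y) ⟩
             (+ 2) ℤ.^ n ℤ.* (ind y ℤ.* χs (Vec.map σ ω) y) ∎) ⟩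
      ∑ℤ[ y ← vecs 4 n ] ((+ 2) ℤ.^ n ℤ.* (ind y ℤ.* χs (Vec.map σ ω) y))
        ≡⟨ ℤSums.∑-*ˡ (vecs 4 n) ((+ 2) ℤ.^ n) _ ⟨
      (+ 2) ℤ.^ n ℤ.* coefficient (Vec.map σ ω) ∎
      where
      regroup : ∀ i j k → i ℤ.* j ℤ.* k ≡ i ℤ.* (k ℤ.* j)
      regroup = solve-∀
      move : ∀ i j k → i ℤ.* (j ℤ.* k ℤ.* + 1) ≡ j ℤ.* (i ℤ.* k)
      move = solve-∀

  0ⁿ : Vec (Fin 4) n
  0ⁿ = Vec.replicate n zero

  0∈C : 0ⁿ ∈C C
  0∈C = proj₂ (selfDual 0ⁿ) (λ y _ → ≡.subst (4 ∣_) (≡.sym (inner-0 y)) (divides 0 ≡.refl))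
    where
    inner-0 : ∀ {n} (y : Vec (Fin 4) n) → inner (Vec.replicate n zero) y ≡ 0
    inner-0 []      = ≡.refl
    inner-0 (a ∷ y) = inner-0 y

  -- `χ U` has no negative values, so the contribution 1 of the zero codeword cannot be cancelled.
  -- This single nonzero coefficient yields both the size of the code and, moved to the word Zⁿ, the
  -- divisibility of the length by 8.
  coefficient-Uⁿ≢0 : ¬ coefficient (Vec.replicate n U) ≡ + 0
  coefficient-Uⁿ≢0 eq = 1≰0 (≡.subst (+ 1 ℤ.≤_) eq
    (≡.subst (ℤ._≤ coefficient Uⁿ) zero-term
      (term≤∑ (vecs 4 n) (λ x → ind x ℤ.* χs Uⁿ x) nonNeg (∈-vecs 0ⁿ))))
    where
    1≰0 : ¬ + 1 ℤ.≤ + 0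
    1≰0 (ℤ.+≤+ ())
    Uⁿ : Word n
    Uⁿ = Vec.replicate n U
    χs-0 : ∀ n → χs (Vec.replicate n U) (Vec.replicate n zero) ≡ + 1
    χs-0 zero    = ≡.refl
    χs-0 (suc n) = ≡.trans (ℤₚ.*-identityˡ _) (χs-0 n)
    zero-term : ind 0ⁿ ℤ.* χs Uⁿ 0ⁿ ≡ + 1
    zero-term rewrite 0∈C = ≡.trans (ℤₚ.*-identityˡ _) (χs-0 n)
    χ-U : ∀ a → + 0 ℤ.≤ χ U a
    χ-U = from-yes (Finₚ.all? {n = 4} λ a → + 0 ℤ.≤? χ U a)
    *-nonNegℤ : ∀ {i j} → + 0 ℤ.≤ i → + 0 ℤ.≤ j → + 0 ℤ.≤ i ℤ.* j
    *-nonNegℤ {+ i} {+ j} _ _ = ≡.subst (+ 0 ℤ.≤_) (ℤₚ.pos-* i j) (ℤ.+≤+ ℕ.z≤n)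
    χs-U : ∀ {n} (x : Vec (Fin 4) n) → + 0 ℤ.≤ χs (Vec.replicate n U) x
    χs-U []      = ℤ.+≤+ ℕ.z≤n
    χs-U (a ∷ x) = *-nonNegℤ (χ-U a) (χs-U x)
    nonNeg : ∀ x → + 0 ℤ.≤ ind x ℤ.* χs Uⁿ x
    nonNeg x with C x
    ... | true  = *-nonNegℤ {+ 1} (ℤ.+≤+ ℕ.z≤n) (χs-U x)
    ... | false = ℤₚ.≤-refl

  private
    map-replicate : ∀ (h : Fin 3 → Fin 3) l m → Vec.map h (Vec.replicate m l) ≡ Vec.replicate m (h l)
    map-replicate h l zero    = ≡.refl
    map-replicate h l (suc m) = ≡.cong (h l ∷_) (map-replicate h l m)

    -- The word Uⁿ is fixed by σ, so its nonzero coefficient determines the size of the code.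
    N≡2ⁿ : N ≡ (+ 2) ℤ.^ n
    N≡2ⁿ = ℤₚ.*-cancelʳ-≡ N ((+ 2) ℤ.^ n) (coefficient (Vec.replicate n U))
      {{ℤ.≢-nonZero coefficient-Uⁿ≢0}}
      (≡.trans (poisson (Vec.replicate n U))
        (≡.cong (λ ω → (+ 2) ℤ.^ n ℤ.* coefficient ω) (map-replicate σ U n)))

  coefficient-σ : ∀ ω → coefficient (Vec.map σ ω) ≡ coefficient ω
  coefficient-σ ω = ≡.sym (ℤₚ.*-cancelˡ-≡ ((+ 2) ℤ.^ n) _ _ {{ℤ.≢-nonZero 2ⁿ≢0}}
    (≡.trans (≡.cong (ℤ._* coefficient ω) (≡.sym N≡2ⁿ)) (poisson ω)))
    where
    2ⁿ≢0 : ¬ (+ 2) ℤ.^ n ≡ + 0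
    2ⁿ≢0 eq with ℤₚ.i^n≡0⇒i≡0 (+ 2) n eq
    ... | ()

  coefficient≢0 : ∀ ω → ¬ coefficient ω ≡ + 0 → ∃[ c ] (c ∈C C) × (¬ χs ω c ≡ + 0)
  coefficient≢0 ω ne with ∑≢0 (vecs 4 n) _ ne
  ... | c , term≢0 with C c in c∈
  ...   | true  = c , c∈ , λ χ≡0 → term≢0 (≡.trans (ℤₚ.*-identityˡ _) χ≡0)
  ...   | false = ⊥-elim (term≢0 ≡.refl)

-- Consequences of the divisibility of the weights by 8

tally : ∀ {k n} → (Fin k → ℕ) → Vec (Fin k) n → ℕ
tally w = Vec.foldr _ (λ a s → w a ℕ.+ s) 0

δ : ∀ {k} → Fin k → Fin k → ℕ
δ zero    zero    = 1
δ zero    (suc _) = 0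
δ (suc _) zero    = 0
δ (suc i) (suc j) = δ i j

n₀ n₁ n₂ : ∀ {n} → Vec (Fin 4) n → ℕ
n₀ = tally (δ zero)
n₁ = tally (λ a → δ (suc zero) a ℕ.+ δ (suc (suc (suc zero))) a)
n₂ = tally (δ (suc (suc zero)))

#U #V #Z : ∀ {n} → Word n → ℕ
#U = tally (δ U)
#V = tally (δ V)
#Z = tally (δ Z)

wtE≡ : ∀ {n} (c : Vec (Fin 4) n) → wtE c ≡ n₁ c ℕ.+ n₂ c ℕ.* 4
wtE≡ [] = ≡.refl
wtE≡ (zero ∷ c) = wtE≡ c
wtE≡ (suc zero ∷ c) = ≡.cong suc (wtE≡ c)
wtE≡ (suc (suc zero) ∷ c) = ≡.trans (≡.cong (4 ℕ.+_) (wtE≡ c)) (swap (n₁ c) (n₂ c))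
  where
  swap : ∀ i j → 4 ℕ.+ (i ℕ.+ j ℕ.* 4) ≡ i ℕ.+ (4 ℕ.+ j ℕ.* 4)
  swap = ℕsolve-∀
wtE≡ (suc (suc (suc zero)) ∷ c) = ≡.cong suc (wtE≡ c)

n₀+n₂+n₁≡n : ∀ {n} (c : Vec (Fin 4) n) → n₀ c ℕ.+ n₂ c ℕ.+ n₁ c ≡ n
n₀+n₂+n₁≡n [] = ≡.refl
n₀+n₂+n₁≡n (zero ∷ c) = ≡.cong suc (n₀+n₂+n₁≡n c)
n₀+n₂+n₁≡n (suc zero ∷ c) = ≡.trans (ℕₚ.+-suc _ _) (≡.cong suc (n₀+n₂+n₁≡n c))
n₀+n₂+n₁≡n (suc (suc zero) ∷ c) =
  ≡.trans (≡.cong (ℕ._+ n₁ c) (ℕₚ.+-suc (n₀ c) (n₂ c))) (≡.cong suc (n₀+n₂+n₁≡n c))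
n₀+n₂+n₁≡n (suc (suc (suc zero)) ∷ c) = ≡.trans (ℕₚ.+-suc _ _) (≡.cong suc (n₀+n₂+n₁≡n c))

#U+#V+#Z≡n : ∀ {n} (ω : Word n) → #U ω ℕ.+ #V ω ℕ.+ #Z ω ≡ n
#U+#V+#Z≡n [] = ≡.refl
#U+#V+#Z≡n (U ∷ ω) = ≡.cong suc (#U+#V+#Z≡n ω)
#U+#V+#Z≡n (V ∷ ω) = ≡.trans (≡.cong (ℕ._+ #Z ω) (ℕₚ.+-suc (#U ω) (#V ω))) (≡.cong suc (#U+#V+#Z≡n ω))
#U+#V+#Z≡n (Z ∷ ω) = ≡.trans (ℕₚ.+-suc _ _) (≡.cong suc (#U+#V+#Z≡n ω))

tally-map : ∀ {k n} (w w′ : Fin k → ℕ) h → (∀ a → w (h a) ≡ w′ a) →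
            ∀ (v : Vec (Fin k) n) → tally w (Vec.map h v) ≡ tally w′ v
tally-map w w′ h p []      = ≡.refl
tally-map w w′ h p (a ∷ v) = ≡.cong₂ ℕ._+_ (p a) (tally-map w w′ h p v)

private
  i≢0×j≢0 : ∀ i j → ¬ i ℤ.* j ≡ + 0 → ¬ i ≡ + 0 × ¬ j ≡ + 0
  i≢0×j≢0 i j ne = (λ { ≡.refl → ne ≡.refl }) , (λ { ≡.refl → ne (ℤₚ.*-zeroʳ i) })

-- `Z` is the letter that sees exactly the odd coordinates.
χs≢0⇒#Z≡n₁ : ∀ {n} (ω : Word n) c → ¬ χs ω c ≡ + 0 → #Z ω ≡ n₁ c
χs≢0⇒#Z≡n₁ [] [] ne = ≡.refl
χs≢0⇒#Z≡n₁ (l ∷ ω) (a ∷ c) ne with i≢0×j≢0 (χ l a) (χs ω c) ne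
... | χ≢0 , χs≢0 = ≡.cong₂ ℕ._+_ (letter l a χ≢0) (χs≢0⇒#Z≡n₁ ω c χs≢0)
  where
  letter : ∀ l a → ¬ χ l a ≡ + 0 → δ Z l ≡ δ (suc zero) a ℕ.+ δ (suc (suc (suc zero))) a
  letter U zero                   ne = ≡.refl
  letter U (suc zero)             ne = ⊥-elim (ne ≡.refl)
  letter U (suc (suc zero))       ne = ≡.refl
  letter U (suc (suc (suc zero))) ne = ⊥-elim (ne ≡.refl)
  letter V zero                   ne = ≡.refl
  letter V (suc zero)             ne = ⊥-elim (ne ≡.refl)
  letter V (suc (suc zero))       ne = ≡.refl
  letter V (suc (suc (suc zero))) ne = ⊥-elim (ne ≡.refl)
  letter Z zero                   ne = ⊥-elim (ne ≡.refl)
  letter Z (suc zero)             ne = ≡.refl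
  letter Z (suc (suc zero))       ne = ⊥-elim (ne ≡.refl)
  letter Z (suc (suc (suc zero))) ne = ≡.refl

ε : ℕ → ℤ
ε zero    = + 1
ε (suc k) = ℤ.- ε k

ε-+ : ∀ i j → ε (i ℕ.+ j) ≡ ε i ℤ.* ε j
ε-+ zero    j = ≡.sym (ℤₚ.*-identityˡ _)
ε-+ (suc i) j = ≡.trans (≡.cong ℤ.-_ (ε-+ i j)) (ℤₚ.neg-distribˡ-* (ε i) (ε j))

ε² : ∀ i → ε i ℤ.* ε i ≡ + 1
ε² zero    = ≡.refl
ε² (suc i) = ≡.trans (square (ε i)) (ε² i)
  where
  square : ∀ x → (ℤ.- x) ℤ.* (ℤ.- x) ≡ x ℤ.* x
  square = solve-∀

2∣+⇒ε≡ : ∀ i j → 2 ∣ i ℕ.+ j → ε i ≡ ε j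
2∣+⇒ε≡ i j (divides q eq) = begin
  ε i                          ≡⟨ ℤₚ.*-identityʳ (ε i) ⟨
  ε i ℤ.* + 1                  ≡⟨ ≡.cong (ε i ℤ.*_) ε-sum ⟨
  ε i ℤ.* (ε i ℤ.* ε j)        ≡⟨ ℤₚ.*-assoc (ε i) (ε i) (ε j) ⟨
  ε i ℤ.* ε i ℤ.* ε j          ≡⟨ ≡.cong (ℤ._* ε j) (ε² i) ⟩
  + 1 ℤ.* ε j                  ≡⟨ ℤₚ.*-identityˡ (ε j) ⟩
  ε j                          ∎
  where
  open ≡.≡-Reasoning
  ε-even : ∀ q → ε (q ℕ.* 2) ≡ + 1
  ε-even zero    = ≡.refl
  ε-even (suc q) = ≡.trans (ℤₚ.neg-involutive _) (ε-even q)
  ε-sum : ε i ℤ.* ε j ≡ + 1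
  ε-sum = ≡.trans (≡.sym (ε-+ i j)) (≡.trans (≡.cong ε eq) (ε-even q))

χs-τ : ∀ {n} (ω : Word n) c → χs (Vec.map τ ω) c ≡ ε (n₂ c) ℤ.* χs ω c
χs-τ [] [] = ≡.refl
χs-τ (l ∷ ω) (a ∷ c) = begin
  χ (τ l) a ℤ.* χs (Vec.map τ ω) c                ≡⟨ ≡.cong₂ ℤ._*_ (letter l a) (χs-τ ω c) ⟩
  ε (δ (suc (suc zero)) a) ℤ.* χ l a ℤ.* (ε (n₂ c) ℤ.* χs ω c)
    ≡⟨ regroup (ε (δ (suc (suc zero)) a)) (χ l a) (ε (n₂ c)) (χs ω c) ⟩
  ε (δ (suc (suc zero)) a) ℤ.* ε (n₂ c) ℤ.* (χ l a ℤ.* χs ω c)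
    ≡⟨ ≡.cong (ℤ._* (χ l a ℤ.* χs ω c)) (ε-+ (δ (suc (suc zero)) a) (n₂ c)) ⟨
  ε (n₂ (a ∷ c)) ℤ.* χs (l ∷ ω) (a ∷ c)           ∎
  where
  open ≡.≡-Reasoning
  letter : ∀ l a → χ (τ l) a ≡ ε (δ (suc (suc zero)) a) ℤ.* χ l a
  letter = from-yes (Finₚ.all? {n = 3} λ l → Finₚ.all? {n = 4} λ a →
    χ (τ l) a ℤ.≟ ε (δ (suc (suc zero)) a) ℤ.* χ l a)
  regroup : ∀ i j k l → i ℤ.* j ℤ.* (k ℤ.* l) ≡ i ℤ.* k ℤ.* (j ℤ.* l)
  regroup = solve-∀

module TypeIICode {n : ℕ} (C : Code n) (typeII : TypeII C) where

  open Duality C (proj₁ typeII) public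

  4∣n₁ : ∀ {c} → c ∈C C → 4 ∣ n₁ c
  4∣n₁ {c} c∈C = Div.∣m+n∣m⇒∣n (≡.subst (4 ∣_) (ℕₚ.+-comm (n₁ c) (n₂ c ℕ.* 4)) 4∣wtE)
    (divides (n₂ c) ≡.refl)
    where
    4∣wtE : 4 ∣ n₁ c ℕ.+ n₂ c ℕ.* 4
    4∣wtE = ≡.subst (4 ∣_) (wtE≡ c) (Div.∣-trans (divides 2 ≡.refl) (proj₂ typeII c c∈C))

  -- The sum is a quarter of the weight; it is also the exponent of X which `c` contributes on the
  -- curve.
  2∣n₁/4+n₂ : ∀ {c} → c ∈C C → 2 ∣ n₁ c / 4 ℕ.+ n₂ c
  2∣n₁/4+n₂ {c} c∈C with 4∣n₁ c∈C
  ... | divides h eq = Div.*-cancelʳ-∣ 4 (≡.subst (8 ∣_) (begin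
      wtE c                              ≡⟨ wtE≡ c ⟩
      n₁ c ℕ.+ n₂ c ℕ.* 4                ≡⟨ ≡.cong (ℕ._+ n₂ c ℕ.* 4) eq ⟩
      h ℕ.* 4 ℕ.+ n₂ c ℕ.* 4             ≡⟨ ℕₚ.*-distribʳ-+ 4 h (n₂ c) ⟨
      (h ℕ.+ n₂ c) ℕ.* 4                 ≡⟨ ≡.cong (λ k → (k ℕ.+ n₂ c) ℕ.* 4) h≡ ⟩
      (n₁ c / 4 ℕ.+ n₂ c) ℕ.* 4          ∎) (proj₂ typeII c c∈C))
    where
    open ≡.≡-Reasoning
    h≡ : h ≡ n₁ c / 4
    h≡ = ≡.sym (≡.trans (≡.cong (_/ 4) eq) (m*n/n≡m h 4))

  wtE≡8j : ∀ {c} → c ∈C C → ∀ j → n₁ c / 4 ℕ.+ n₂ c ≡ j ℕ.* 2 → wtE c ≡ j ℕ.* 8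
  wtE≡8j {c} c∈C j 2j with 4∣n₁ c∈C
  ... | divides h eq = begin
    wtE c                            ≡⟨ wtE≡ c ⟩
    n₁ c ℕ.+ n₂ c ℕ.* 4              ≡⟨ ≡.cong (ℕ._+ n₂ c ℕ.* 4) (≡.trans eq (≡.cong (ℕ._* 4) h≡)) ⟩
    n₁ c / 4 ℕ.* 4 ℕ.+ n₂ c ℕ.* 4    ≡⟨ ℕₚ.*-distribʳ-+ 4 (n₁ c / 4) (n₂ c) ⟨
    (n₁ c / 4 ℕ.+ n₂ c) ℕ.* 4        ≡⟨ ≡.cong (ℕ._* 4) 2j ⟩
    j ℕ.* 2 ℕ.* 4                    ≡⟨ ℕₚ.*-assoc j 2 4 ⟩
    j ℕ.* 8                          ∎
    where
    open ≡.≡-Reasoning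
    h≡ : h ≡ n₁ c / 4
    h≡ = ≡.sym (≡.trans (≡.cong (_/ 4) eq) (m*n/n≡m h 4))

  coefficient≢0⇒4∣#Z : ∀ ω → ¬ coefficient ω ≡ + 0 → 4 ∣ #Z ω
  coefficient≢0⇒4∣#Z ω ne with coefficient≢0 ω ne
  ... | c , c∈C , χs≢0 = ≡.subst (4 ∣_) (≡.sym (χs≢0⇒#Z≡n₁ ω c χs≢0)) (4∣n₁ c∈C)

  -- Codewords control `#Z` directly; `σ` carries the divisibility over to `#V`.
  coefficient≢0⇒4∣#V : ∀ ω → ¬ coefficient ω ≡ + 0 → 4 ∣ #V ω
  coefficient≢0⇒4∣#V ω ne = ≡.subst (4 ∣_)
    (tally-map (δ Z) (δ V) σ (λ { U → ≡.refl ; V → ≡.refl ; Z → ≡.refl }) ω)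
    (coefficient≢0⇒4∣#Z (Vec.map σ ω) (λ eq → ne (≡.trans (≡.sym (coefficient-σ ω)) eq)))

  -- For a codeword the sign of (-1)^n₂ equals that of (-1)^(n₁/4), because a quarter of its weight
  -- is even; and n₁ is the number of letters `Z` wherever `χs` does not vanish. So the sign depends
  -- on the word alone and leaves the sum over the code.
  coefficient-τ : ∀ ω → coefficient (Vec.map τ ω) ≡ ε (#Z ω / 4) ℤ.* coefficient ω
  coefficient-τ ω = ≡.trans (ℤSums.∑-cong (vecs 4 n) term) (≡.sym (ℤSums.∑-*ˡ (vecs 4 n) (ε (#Z ω / 4)) _))
    where
    open ≡.≡-Reasoning
    sign : ∀ c → c ∈C C → χs (Vec.map τ ω) c ≡ ε (#Z ω / 4) ℤ.* χs ω c
    sign c c∈C with χs ω c ℤ.≟ + 0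
    ... | yes χs≡0 = ≡.trans (χs-τ ω c) (≡.trans (≡.trans (≡.cong (ε (n₂ c) ℤ.*_) χs≡0) (ℤₚ.*-zeroʳ (ε (n₂ c))))
                       (≡.sym (≡.trans (≡.cong (ε (#Z ω / 4) ℤ.*_) χs≡0) (ℤₚ.*-zeroʳ (ε (#Z ω / 4))))))
    ... | no χs≢0 = ≡.trans (χs-τ ω c) (≡.cong (ℤ._* χs ω c) (≡.trans
                      (≡.sym (2∣+⇒ε≡ (n₁ c / 4) (n₂ c) (2∣n₁/4+n₂ c∈C)))
                      (≡.cong (λ k → ε (k / 4)) (≡.sym (χs≢0⇒#Z≡n₁ ω c χs≢0)))))
    term : ∀ c → ind c ℤ.* χs (Vec.map τ ω) c ≡ ε (#Z ω / 4) ℤ.* (ind c ℤ.* χs ω c)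
    term c with C c in c∈
    ... | true  = ≡.trans (ℤₚ.*-identityˡ _) (≡.trans (sign c c∈)
                    (≡.cong (ε (#Z ω / 4) ℤ.*_) (≡.sym (ℤₚ.*-identityˡ (χs ω c)))))
    ... | false = ≡.sym (ℤₚ.*-zeroʳ (ε (#Z ω / 4)))

  -- σ and τ carry Uⁿ to Zⁿ, so some codeword has all coordinates odd; its weight is n.
  opaque
    8∣n : 8 ∣ n
    8∣n = conclude (coefficient≢0 Zⁿ nonzero)
      where
      Uⁿ Vⁿ Zⁿ : Word n
      Uⁿ = Vec.replicate n U
      Vⁿ = Vec.map τ Uⁿ
      Zⁿ = Vec.map σ Vⁿ
      #Z-U : ∀ n → #Z (Vec.replicate n U) ≡ 0
      #Z-U zero    = ≡.refl
      #Z-U (suc n) = #Z-U n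
      #Z-Z : ∀ n → #Z (Vec.map σ (Vec.map τ (Vec.replicate n U))) ≡ n
      #Z-Z zero    = ≡.refl
      #Z-Z (suc n) = ≡.cong suc (#Z-Z n)
      nonzero : ¬ coefficient Zⁿ ≡ + 0
      nonzero eq = coefficient-Uⁿ≢0 (begin
        coefficient Uⁿ                            ≡⟨ ℤₚ.*-identityˡ (coefficient Uⁿ) ⟨
        ε 0 ℤ.* coefficient Uⁿ                    ≡⟨ ≡.cong (λ k → ε k ℤ.* coefficient Uⁿ) #Z/4≡0 ⟨
        ε (#Z Uⁿ / 4) ℤ.* coefficient Uⁿ          ≡⟨ coefficient-τ Uⁿ ⟨
        coefficient Vⁿ                            ≡⟨ coefficient-σ Vⁿ ⟨
        coefficient Zⁿ                            ≡⟨ eq ⟩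
        + 0                                       ∎)
        where
        open ≡.≡-Reasoning
        #Z/4≡0 : #Z Uⁿ / 4 ≡ 0
        #Z/4≡0 = ≡.cong (_/ 4) (#Z-U n)
      conclude : ∃[ c ] (c ∈C C) × (¬ χs Zⁿ c ≡ + 0) → 8 ∣ n
      conclude (c , c∈C , χs≢0) = ≡.subst (8 ∣_) wtE≡n (proj₂ typeII c c∈C)
        where
        n₁≡n : n₁ c ≡ n
        n₁≡n = ≡.trans (≡.sym (χs≢0⇒#Z≡n₁ Zⁿ c χs≢0)) (#Z-Z n)
        n₂≡0 : n₂ c ≡ 0
        n₂≡0 = ℕₚ.m+n≡0⇒n≡0 (n₀ c) (ℕₚ.+-cancelʳ-≡ n (n₀ c ℕ.+ n₂ c) 0
          (≡.trans (≡.cong (λ k → n₀ c ℕ.+ n₂ c ℕ.+ k) (≡.sym n₁≡n)) (n₀+n₂+n₁≡n c)))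
        wtE≡n : wtE c ≡ n
        wtE≡n = ≡.trans (wtE≡ c) (≡.trans (≡.cong₂ (λ i j → i ℕ.+ j ℕ.* 4) n₁≡n n₂≡0) (ℕₚ.+-identityʳ n))

-- Symmetric functions of three elements with sum zero

module SymmetricSpan (R : CommutativeRing 0ℓ 0ℓ) (x₁ x₂ x₃ : CommutativeRing.Carrier R)
  (e₁≈0 : CommutativeRing._≈_ R (CommutativeRing._+_ R (CommutativeRing._+_ R x₁ x₂) x₃) (CommutativeRing.0# R)) where

  open CommutativeRing R
  open IntegerCoefficients R
  open import Algebra.Properties.Semiring.Exp semiring using (_^_; ^-homo-*)

  e₂ e₃ : Carrier
  e₂ = x₁ * x₂ + x₁ * x₃ + x₂ * x₃
  e₃ = x₁ * x₂ * x₃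

  -- Integer combinations of monomials of weighted degree `d`, with `e₂` of degree 2 and `e₃` of
  -- degree 3. The degree is part of the type because the residue of a monomial vanishes only when
  -- its degree matches the exponents of the kernel.
  data Span (d : ℕ) : Carrier → Set where
    span-monomial : ∀ i j → 2 ℕ.* i ℕ.+ 3 ℕ.* j ≡ d → Span d (e₂ ^ i * e₃ ^ j)
    span-0        : Span d 0#
    span-+        : ∀ {x y} → Span d x → Span d y → Span d (x + y)
    span-neg      : ∀ {x} → Span d x → Span d (- x)
    span-resp     : ∀ {x y} → x ≈ y → Span d x → Span d y

  private
    span-ℕ : ∀ {d x} n → Span d x → Span d (# n * x)
    span-ℕ zero s = span-resp (sym (zeroˡ _)) span-0
    span-ℕ {x = x} (suc n) s = span-resp
      (trans ((solve 2 (λ x k → x :+ k :* x := (:# 1 :+ k) :* x) refl x (# n))) (*-congʳ (sym (#-suc n))))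
      (span-+ s (span-ℕ n s))

  span-ℤ : ∀ {d x} i → Span d x → Span d (fromℤ i * x)
  span-ℤ (+ n) s = span-ℕ n s
  span-ℤ {x = x} -[1+ n ] s = span-resp
    (trans ((solve 2 (λ x k → :- (k :* x) := (:- k) :* x) refl x (# suc n))) (*-congʳ (sym (fromℤ-neg (+ suc n)))))
    (span-neg (span-ℕ (suc n) s))

  private
    span-*-monomial : ∀ {d x} i j → Span d x → Span (d ℕ.+ (2 ℕ.* i ℕ.+ 3 ℕ.* j)) (x * (e₂ ^ i * e₃ ^ j))
    span-*-monomial i j (span-monomial i′ j′ ≡.refl) = span-resp
      (trans (*-cong (^-homo-* e₂ i′ i) (^-homo-* e₃ j′ j))
        ((solve 4 (λ a b c d → (a :* b) :* (c :* d) := (a :* c) :* (b :* d)) refl (e₂ ^ i′) (e₂ ^ i) (e₃ ^ j′)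
            (e₃ ^ j))))
      (span-monomial (i′ ℕ.+ i) (j′ ℕ.+ j) (degree i′ i j′ j))
      where
      degree : ∀ i′ i j′ j → 2 ℕ.* (i′ ℕ.+ i) ℕ.+ 3 ℕ.* (j′ ℕ.+ j) ≡ 2 ℕ.* i′ ℕ.+ 3 ℕ.* j′ ℕ.+ (2 ℕ.* i ℕ.+ 3 ℕ.* j)
      degree = ℕsolve-∀
    span-*-monomial i j span-0 = span-resp (sym (zeroˡ _)) span-0
    span-*-monomial i j (span-+ s t) = span-resp (sym (distribʳ _ _ _))
      (span-+ (span-*-monomial i j s) (span-*-monomial i j t))
    span-*-monomial i j (span-neg {x} s) = span-resp ((solve 2 (λ x y → :- (x :* y) := (:- x) :* y) refl x
        (e₂ ^ i * e₃ ^ j)))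
      (span-neg (span-*-monomial i j s))
    span-*-monomial i j (span-resp eq s) = span-resp (*-congʳ eq) (span-*-monomial i j s)

  span-* : ∀ {d e x y} → Span d x → Span e y → Span (d ℕ.+ e) (x * y)
  span-* s (span-monomial i j ≡.refl) = span-*-monomial i j s
  span-* s span-0 = span-resp (sym (zeroʳ _)) span-0
  span-* s (span-+ t u) = span-resp (sym (distribˡ _ _ _)) (span-+ (span-* s t) (span-* s u))
  span-* {x = x} s (span-neg {y} t) = span-resp ((solve 2 (λ x y → :- (x :* y) := x :* (:- y)) refl x y)) (span-neg
      (span-* s t))
  span-* s (span-resp eq t) = span-resp (*-congˡ eq) (span-* s t)

  span-degree : ∀ {d e x} → d ≡ e → Span d x → Span e x
  span-degree ≡.refl s = s

  powerSum : ℕ → Carrier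
  powerSum a = x₁ ^ a + x₂ ^ a + x₃ ^ a

  private
    e₂-span : Span 2 e₂
    e₂-span = span-resp ((solve 1 (λ e → (e :* :# 1) :* :# 1 := e) refl e₂)) (span-monomial 1 0 ≡.refl)

    e₃-span : Span 3 e₃
    e₃-span = span-resp ((solve 1 (λ e → :# 1 :* (e :* :# 1) := e) refl e₃)) (span-monomial 0 1 ≡.refl)

    -- Each of the three elements is a root of x³ + e₂x - e₃, as the first symmetric function
    -- vanishes; the zero term added at the start is that function times a power sum.
    newton : ∀ a → (- (e₂ * powerSum (1 ℕ.+ a)) + e₃ * powerSum a) ≈ powerSum (3 ℕ.+ a)
    newton a = trans (sym (+-identityˡ _)) (trans (+-congʳ (sym (trans (*-congʳ e₁≈0) (zeroˡ (powerSum (2 ℕ.+ a))))))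
      ((solve 6 (λ x y z p q r → (x :+ y :+ z) :* (x :* (x :* p) :+ y :* (y :* q) :+ z :* (z :* r)) :+ (:- ((x :* y
          :+ x :* z :+ y :* z) :* (x :* p :+ y :* q :+ z :* r)) :+ (x :* y :* z) :* (p :+ q :+ r)) := x :* (x :*
          (x :* p)) :+ y :* (y :* (y :* q)) :+ z :* (z :* (z :* r))) refl x₁ x₂ x₃ (x₁ ^ a) (x₂ ^ a) (x₃ ^ a))))

  powerSum-span : ∀ a → Span a (powerSum a)
  powerSum-span 0 = span-resp ((solve 0 (:# 3 :* (:# 1 :* :# 1) := :# 1 :+ :# 1 :+ :# 1) refl)) (span-ℤ (+ 3)
      (span-monomial 0 0 ≡.refl))
  powerSum-span 1 = span-resp (sym (trans ((solve 3 (λ x y z → x :* :# 1 :+ y :* :# 1 :+ z :* :# 1 := x :+ y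
      :+ z) refl x₁ x₂ x₃)) e₁≈0)) span-0
  powerSum-span 2 = span-resp
    (trans (sym (+-identityˡ _)) (trans (+-congʳ (sym (trans (*-congʳ e₁≈0) (zeroˡ (x₁ + x₂ + x₃)))))
      ((solve 3 (λ x y z → (x :+ y :+ z) :* (x :+ y :+ z) :+ (:- (:# 2 :* (x :* y :+ x :* z :+ y :* z))) := x :*
          (x :* :# 1) :+ y :* (y :* :# 1) :+ z :* (z :* :# 1)) refl x₁ x₂ x₃))))
    (span-neg (span-ℤ (+ 2) e₂-span))
  powerSum-span (suc (suc (suc a))) = span-resp (newton a)
    (span-+ (span-neg (span-* e₂-span (powerSum-span (suc a)))) (span-* e₃-span (powerSum-span a)))

  symmetricMonomial : ℕ → ℕ → ℕ → Carrier
  symmetricMonomial a b c =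
    x₁ ^ a * x₂ ^ b * x₃ ^ c + x₁ ^ a * x₃ ^ b * x₂ ^ c + x₂ ^ a * x₁ ^ b * x₃ ^ c +
    x₂ ^ a * x₃ ^ b * x₁ ^ c + x₃ ^ a * x₁ ^ b * x₂ ^ c + x₃ ^ a * x₂ ^ b * x₁ ^ c

  private
    powerSum-+ : ∀ a b → powerSum (a ℕ.+ b) ≈ x₁ ^ a * x₁ ^ b + x₂ ^ a * x₂ ^ b + x₃ ^ a * x₃ ^ b
    powerSum-+ a b = +-cong (+-cong (^-homo-* x₁ a b) (^-homo-* x₂ a b)) (^-homo-* x₃ a b)

    powerSum-++ : ∀ a b c → powerSum (a ℕ.+ b ℕ.+ c) ≈
      x₁ ^ a * x₁ ^ b * x₁ ^ c + x₂ ^ a * x₂ ^ b * x₂ ^ c + x₃ ^ a * x₃ ^ b * x₃ ^ c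
    powerSum-++ a b c = trans (powerSum-+ (a ℕ.+ b) c)
      (+-cong (+-cong (*-congʳ (^-homo-* x₁ a b)) (*-congʳ (^-homo-* x₂ a b))) (*-congʳ (^-homo-* x₃ a b)))

  -- Inclusion and exclusion over coinciding indices: with power sums p, the six arrangements add up
  -- to p_a p_b p_c minus the three products of the form p_(a+b) p_c plus 2p_(a+b+c). Keeping all
  -- six even when exponents coincide avoids case distinctions.
  symmetricMonomial-span : ∀ a b c → Span (a ℕ.+ b ℕ.+ c) (symmetricMonomial a b c)
  symmetricMonomial-span a b c = span-resp
    (trans (+-cong (+-cong (+-cong (+-cong refl
        (-‿cong (*-congʳ (powerSum-+ a b)))) (-‿cong (*-congʳ (powerSum-+ a c)))) (-‿cong (*-congʳ (powerSum-+ b c))))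
        (*-congˡ (powerSum-++ a b c)))
      ((solve 9 (λ p q r p′ q′ r′ p″ q″ r″ → (p :+ q :+ r) :* (p′ :+ q′ :+ r′) :* (p″ :+ q″ :+ r″) :+ (:- ((p :* p′
          :+ q :* q′ :+ r :* r′) :* (p″ :+ q″ :+ r″))) :+ (:- ((p :* p″ :+ q :* q″ :+ r :* r″) :* (p′ :+ q′
          :+ r′))) :+ (:- ((p′ :* p″ :+ q′ :* q″ :+ r′ :* r″) :* (p :+ q :+ r))) :+ :# 2 :* (p :* p′ :* p″
          :+ q :* q′ :* q″ :+ r :* r′ :* r″) := p :* q′ :* r″ :+ p :* r′ :* q″ :+ q :* p′ :* r″ :+ q :* r′ :* p″
          :+ r :* p′ :* q″ :+ r :* q′ :* p″) refl (x₁ ^ a) (x₂ ^ a) (x₃ ^ a) (x₁ ^ b) (x₂ ^ b) (x₃ ^ b) (x₁ ^ c)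
          (x₂ ^ c) (x₃ ^ c))))
    (span-+ (span-+ (span-+ (span-+
      (span-* (span-* (powerSum-span a) (powerSum-span b)) (powerSum-span c))
      (span-neg (span-* (powerSum-span (a ℕ.+ b)) (powerSum-span c))))
      (span-neg (span-degree (deg₁ a b c) (span-* (powerSum-span (a ℕ.+ c)) (powerSum-span b)))))
      (span-neg (span-degree (deg₂ a b c) (span-* (powerSum-span (b ℕ.+ c)) (powerSum-span a)))))
      (span-ℤ (+ 2) (powerSum-span (a ℕ.+ b ℕ.+ c))))
    where
    deg₁ : ∀ a b c → a ℕ.+ c ℕ.+ b ≡ a ℕ.+ b ℕ.+ c
    deg₁ = ℕsolve-∀
    deg₂ : ∀ a b c → b ℕ.+ c ℕ.+ a ≡ a ℕ.+ b ℕ.+ c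
    deg₂ = ℕsolve-∀

  span-∑ : ∀ {A : Set} {d} (xs : List A) f → (∀ x → Span d (f x)) → Span d (Sums.∑ R xs f)
  span-∑ []       f p = span-0
  span-∑ (x ∷ xs) f p = span-+ (p x) (span-∑ xs f p)

-- The weight enumerator as a polynomial in fourth powers

module WeightEnumerator {n : ℕ} (C : Code n) (typeII : TypeII C) (R : CommutativeRing 0ℓ 0ℓ) where

  open TypeIICode C typeII
  open CommutativeRing R
  open IntegerCoefficients R
  open Sums R
  open import Algebra.Properties.Semiring.Exp semiring using (_^_; ^-assocʳ; ^-congʳ; ^-congˡ)
  open import Relation.Binary.Reasoning.Setoid setoid

  private
    fromℤ-∑ : ∀ {A : Set} (xs : List A) f → fromℤ (∑ℤ xs f) ≈ ∑[ x ← xs ] fromℤ (f x)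
    fromℤ-∑ []       f = refl
    fromℤ-∑ (x ∷ xs) f = trans (fromℤ-+ (f x) (∑ℤ xs f)) (+-congˡ (fromℤ-∑ xs f))

    neg-^ : ∀ x k → (- x) ^ k ≈ fromℤ (ε k) * x ^ k
    neg-^ x zero    = sym (*-identityˡ 1#)
    neg-^ x (suc k) = begin
      (- x) * (- x) ^ k                     ≈⟨ *-congˡ (neg-^ x k) ⟩
      (- x) * (fromℤ (ε k) * x ^ k)         ≈⟨ (solve 3 (λ x e p → (:- x) :* (e :* p) := (:- e) :* (x :* p)) refl x
          (fromℤ (ε k)) (x ^ k)) ⟩
      (- fromℤ (ε k)) * (x * x ^ k)         ≈⟨ *-congʳ (fromℤ-neg (ε k)) ⟨
      fromℤ (ε (suc k)) * x ^ suc k         ∎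

  -- The arguments stand for U⁴, V⁴, Z⁴, so exponents are divided by 4. Rounding does no harm: words
  -- whose letter counts are not all divisible by 4 have coefficient 0, as `quarters` shows.
  monomial : Carrier → Carrier → Carrier → Word n → Carrier
  monomial u v z ω = u ^ (#U ω / 4) * v ^ (#V ω / 4) * z ^ (#Z ω / 4)

  P : Carrier → Carrier → Carrier → Carrier
  P u v z = ∑[ ω ← vecs 3 n ] (fromℤ (coefficient ω) * monomial u v z ω)

  private
    ∑-σ : ∀ f → ∑[ l ← List.allFin 3 ] f (σ l) ≈ ∑ (List.allFin 3) f
    ∑-σ f = (solve 3 (λ a b c → a :+ (c :+ (b :+ :# 0)) := a :+ (b :+ (c :+ :# 0))) refl (f U) (f V) (f Z))

    ∑-τ : ∀ f → ∑[ l ← List.allFin 3 ] f (τ l) ≈ ∑ (List.allFin 3) f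
    ∑-τ f = (solve 3 (λ a b c → b :+ (a :+ (c :+ :# 0)) := a :+ (b :+ (c :+ :# 0))) refl (f U) (f V) (f Z))

    /4-tally : ∀ {w w′ : Fin 3 → ℕ} h → (∀ l → w (h l) ≡ w′ l) → ∀ x (ω : Word n) →
               x ^ (tally w (Vec.map h ω) / 4) ≈ x ^ (tally w′ ω / 4)
    /4-tally {w} {w′} h p x ω = ^-congʳ x (≡.cong (_/ 4) (tally-map w w′ h p ω))

  P-σ : ∀ u v z → P u v z ≈ P u z v
  P-σ u v z = trans (sym (∑-vecs-map σ ∑-σ n (λ ω → fromℤ (coefficient ω) * monomial u v z ω)))
    (∑-cong (vecs 3 n) λ ω → *-cong (reflexive (≡.cong fromℤ (coefficient-σ ω)))
      (trans (*-cong (*-cong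
          (/4-tally {δ U} {δ U} σ (λ { U → ≡.refl ; V → ≡.refl ; Z → ≡.refl }) u ω)
          (/4-tally {δ V} {δ Z} σ (λ { U → ≡.refl ; V → ≡.refl ; Z → ≡.refl }) v ω))
          (/4-tally {δ Z} {δ V} σ (λ { U → ≡.refl ; V → ≡.refl ; Z → ≡.refl }) z ω))
        ((solve 3 (λ a b c → a :* b :* c := a :* c :* b) refl (u ^ (#U ω / 4)) (v ^ (#Z ω / 4)) (z ^ (#V ω / 4))))))

  P-τ : ∀ u v z → P u v z ≈ P v u (- z)
  P-τ u v z = trans (sym (∑-vecs-map τ ∑-τ n (λ ω → fromℤ (coefficient ω) * monomial u v z ω)))
    (∑-cong (vecs 3 n) λ ω → begin
      fromℤ (coefficient (Vec.map τ ω)) * monomial u v z (Vec.map τ ω)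
        ≈⟨ *-cong (trans (reflexive (≡.cong fromℤ (coefficient-τ ω))) (fromℤ-* (ε (#Z ω / 4)) (coefficient ω)))
             (*-cong (*-cong
               (/4-tally {δ U} {δ V} τ (λ { U → ≡.refl ; V → ≡.refl ; Z → ≡.refl }) u ω)
               (/4-tally {δ V} {δ U} τ (λ { U → ≡.refl ; V → ≡.refl ; Z → ≡.refl }) v ω))
               (/4-tally {δ Z} {δ Z} τ (λ { U → ≡.refl ; V → ≡.refl ; Z → ≡.refl }) z ω)) ⟩
      fromℤ (ε (#Z ω / 4)) * fromℤ (coefficient ω) * (u ^ (#V ω / 4) * v ^ (#U ω / 4) * z ^ (#Z ω / 4))
        ≈⟨ (solve 5 (λ e k a b c → e :* k :* (a :* b :* c) := k :* (b :* a :* (e :* c))) refl (fromℤ (ε (#Z ω / 4)))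
            (fromℤ (coefficient ω)) (u ^ (#V ω / 4)) (v ^ (#U ω / 4)) (z ^ (#Z ω / 4))) ⟩
      fromℤ (coefficient ω) * (v ^ (#U ω / 4) * u ^ (#V ω / 4) * (fromℤ (ε (#Z ω / 4)) * z ^ (#Z ω / 4)))
        ≈⟨ *-congˡ (*-congˡ (neg-^ z (#Z ω / 4))) ⟨
      fromℤ (coefficient ω) * monomial v u (- z) ω ∎)

  m : ℕ
  m = Div.quotient 8∣n

  private
    n≡ : n ≡ m ℕ.* 8
    n≡ = _∣_.equality 8∣n

    quarters : ∀ ω → ¬ coefficient ω ≡ + 0 →
      ∃[ i ] ∃[ j ] ∃[ l ] (#U ω ≡ i ℕ.* 4) × (#V ω ≡ j ℕ.* 4) × (#Z ω ≡ l ℕ.* 4) × (i ℕ.+ j ℕ.+ l ≡ m ℕ.* 2)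
    quarters ω ne = combine (coefficient≢0⇒4∣#V ω ne) (coefficient≢0⇒4∣#Z ω ne)
      where
      rearrange : ∀ a b c → a ℕ.+ b ℕ.+ c ≡ c ℕ.+ a ℕ.+ b
      rearrange = ℕsolve-∀
      expand : ∀ i j l → (i ℕ.+ j ℕ.+ l) ℕ.* 4 ≡ i ℕ.* 4 ℕ.+ j ℕ.* 4 ℕ.+ l ℕ.* 4
      expand = ℕsolve-∀
      sum≡ : #U ω ℕ.+ #V ω ℕ.+ #Z ω ≡ m ℕ.* 2 ℕ.* 4
      sum≡ = ≡.trans (#U+#V+#Z≡n ω) (≡.trans n≡ (≡.sym (ℕₚ.*-assoc m 2 4)))
      4∣#U : 4 ∣ #V ω → 4 ∣ #Z ω → 4 ∣ #U ω
      4∣#U 4∣V 4∣Z = Div.∣m+n∣m⇒∣n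
        (divides (m ℕ.* 2) (≡.trans (rearrange (#V ω) (#Z ω) (#U ω)) sum≡)) (Div.∣m∣n⇒∣m+n 4∣V 4∣Z)
      combine : 4 ∣ #V ω → 4 ∣ #Z ω →
        ∃[ i ] ∃[ j ] ∃[ l ] (#U ω ≡ i ℕ.* 4) × (#V ω ≡ j ℕ.* 4) × (#Z ω ≡ l ℕ.* 4) × (i ℕ.+ j ℕ.+ l ≡ m ℕ.* 2)
      combine 4∣V@(divides j #V≡) 4∣Z@(divides l #Z≡) with 4∣#U 4∣V 4∣Z
      ... | divides i #U≡ = i , j , l , #U≡ , #V≡ , #Z≡ , ℕₚ.*-cancelʳ-≡ (i ℕ.+ j ℕ.+ l) (m ℕ.* 2) 4
              (≡.trans (expand i j l)
                (≡.trans (≡.sym (≡.cong₂ ℕ._+_ (≡.cong₂ ℕ._+_ #U≡ #V≡) #Z≡)) sum≡))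

    by-quarters : ∀ ω (A B : Carrier) →
      (∀ i j l → #U ω ≡ i ℕ.* 4 → #V ω ≡ j ℕ.* 4 → #Z ω ≡ l ℕ.* 4 → i ℕ.+ j ℕ.+ l ≡ m ℕ.* 2 → A ≈ B) →
      fromℤ (coefficient ω) * A ≈ fromℤ (coefficient ω) * B
    by-quarters ω A B p = cases (coefficient ω ℤ.≟ + 0)
      where
      zero-coefficient : coefficient ω ≡ + 0 → ∀ X → fromℤ (coefficient ω) * X ≈ 0#
      zero-coefficient eq X = trans (*-congʳ (reflexive (≡.cong fromℤ eq))) (zeroˡ X)
      cases : Dec (coefficient ω ≡ + 0) → fromℤ (coefficient ω) * A ≈ fromℤ (coefficient ω) * B
      cases (yes eq) = trans (zero-coefficient eq A) (sym (zero-coefficient eq B))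
      cases (no ne) = let (i , j , l , #U≡ , #V≡ , #Z≡ , sum) = quarters ω ne in
        *-congˡ (p i j l #U≡ #V≡ #Z≡ sum)

    /4 : ∀ {a} i → a ≡ i ℕ.* 4 → a / 4 ≡ i
    /4 i eq = ≡.trans (≡.cong (_/ 4) eq) (m*n/n≡m i 4)

    monomial-quarters : ∀ u v z ω i j l → #U ω ≡ i ℕ.* 4 → #V ω ≡ j ℕ.* 4 → #Z ω ≡ l ℕ.* 4 →
                        monomial u v z ω ≈ u ^ i * v ^ j * z ^ l
    monomial-quarters u v z ω i j l p q r =
      *-cong (*-cong (^-congʳ u (/4 i p)) (^-congʳ v (/4 j q))) (^-congʳ z (/4 l r))

  P-cong : ∀ {u u′ v v′ z z′} → u ≈ u′ → v ≈ v′ → z ≈ z′ → P u v z ≈ P u′ v′ z′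
  P-cong p q r = ∑-cong (vecs 3 n) λ ω → *-congˡ
    (*-cong (*-cong (^-congˡ (#U ω / 4) p) (^-congˡ (#V ω / 4) q)) (^-congˡ (#Z ω / 4) r))

  -- `P` is homogeneous of the even degree 2m.
  P-neg : ∀ u v z → P (- u) (- v) (- z) ≈ P u v z
  P-neg u v z = ∑-cong (vecs 3 n) λ ω → by-quarters ω (monomial (- u) (- v) (- z) ω) (monomial u v z ω)
    λ i j l p q r sum → begin
      monomial (- u) (- v) (- z) ω            ≈⟨ monomial-quarters (- u) (- v) (- z) ω i j l p q r ⟩
      (- u) ^ i * (- v) ^ j * (- z) ^ l       ≈⟨ *-cong (*-cong (neg-^ u i) (neg-^ v j)) (neg-^ z l) ⟩
      fromℤ (ε i) * u ^ i * (fromℤ (ε j) * v ^ j) * (fromℤ (ε l) * z ^ l)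
        ≈⟨ (solve 6 (λ a b c p q r → a :* p :* (b :* q) :* (c :* r) := a :* b :* c :* (p :* q :* r)) refl (fromℤ
            (ε i)) (fromℤ (ε j)) (fromℤ (ε l)) (u ^ i) (v ^ j) (z ^ l)) ⟩
      fromℤ (ε i) * fromℤ (ε j) * fromℤ (ε l) * (u ^ i * v ^ j * z ^ l)
        ≈⟨ *-congʳ (signs i j l sum) ⟩
      1# * (u ^ i * v ^ j * z ^ l)            ≈⟨ *-identityˡ _ ⟩
      u ^ i * v ^ j * z ^ l                   ≈⟨ monomial-quarters u v z ω i j l p q r ⟨
      monomial u v z ω ∎
    where
    signs : ∀ i j l → i ℕ.+ j ℕ.+ l ≡ m ℕ.* 2 → fromℤ (ε i) * fromℤ (ε j) * fromℤ (ε l) ≈ 1#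
    signs i j l sum = begin
      fromℤ (ε i) * fromℤ (ε j) * fromℤ (ε l)   ≈⟨ *-congʳ (fromℤ-* (ε i) (ε j)) ⟨
      fromℤ (ε i ℤ.* ε j) * fromℤ (ε l)         ≈⟨ fromℤ-* (ε i ℤ.* ε j) (ε l) ⟨
      fromℤ (ε i ℤ.* ε j ℤ.* ε l)               ≡⟨ ≡.cong (λ e → fromℤ (e ℤ.* ε l)) (≡.sym (ε-+ i j)) ⟩
      fromℤ (ε (i ℕ.+ j) ℤ.* ε l)               ≡⟨ ≡.cong fromℤ (≡.sym (ε-+ (i ℕ.+ j) l)) ⟩
      fromℤ (ε (i ℕ.+ j ℕ.+ l))                 ≡⟨ ≡.cong fromℤ (2∣+⇒ε≡ (i ℕ.+ j ℕ.+ l) 0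
                                                     (divides m (≡.trans (ℕₚ.+-identityʳ _) sum))) ⟩
      1#                                        ∎

  codewordTerm : (p q z : Carrier) → Vec (Fin 4) n → Carrier
  codewordTerm p q z c = p ^ n₀ c * q ^ n₂ c * z ^ (n₁ c / 4)

  private
    module Expansion (p q : Carrier) where
      word : ∀ {k} → (ℕ → Carrier) → Word k → Carrier
      word g ω = p ^ #U ω * q ^ #V ω * g (#Z ω)

      factor : ∀ {k} i x (f g : Word k → Carrier) c → (∀ ω → f ω ≈ x * g ω) →
        ∑[ ω ← vecs 3 k ] (fromℤ (i ℤ.* χs ω c) * f ω) ≈ fromℤ i * (x * ∑[ ω ← vecs 3 k ] (fromℤ (χs ω c) * g ω))
      factor {k} i x f g c eq = begin
        ∑[ ω ← vecs 3 k ] (fromℤ (i ℤ.* χs ω c) * f ω)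
          ≈⟨ ∑-cong (vecs 3 k) (λ ω → trans (*-cong (fromℤ-* i (χs ω c)) (eq ω))
               ((solve 4 (λ a b x d → a :* b :* (x :* d) := (a :* x) :* (b :* d)) refl (fromℤ i) (fromℤ (χs ω c)) x
                   (g ω)))) ⟩
        ∑[ ω ← vecs 3 k ] (fromℤ i * x * (fromℤ (χs ω c) * g ω))
          ≈⟨ ∑-*ˡ (vecs 3 k) (fromℤ i * x) (λ ω → fromℤ (χs ω c) * g ω) ⟨
        fromℤ i * x * ∑[ ω ← vecs 3 k ] (fromℤ (χs ω c) * g ω)
          ≈⟨ *-assoc _ _ _ ⟩
        fromℤ i * (x * ∑[ ω ← vecs 3 k ] (fromℤ (χs ω c) * g ω)) ∎

      -- Odd coordinates are recorded by an arbitrary function `g` of their number rather than by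
      -- powers of a third variable, because the value substituted for Z⁴ on the curve has no fourth
      -- root among the series.
      expansion : ∀ {k} (c : Vec (Fin 4) k) g → ∑[ ω ← vecs 3 k ] (fromℤ (χs ω c) * word g ω) ≈
                  (p + q) ^ n₀ c * (p - q) ^ n₂ c * g (n₁ c)
      expansion [] g = (solve 1 (λ a → :# 1 :* (:# 1 :* :# 1 :* a) :+ :# 0 := :# 1 :* :# 1 :* a) refl (g 0))
      expansion {suc k} (a ∷ c) g = begin
        ∑[ ω ← vecs 3 (suc k) ] (fromℤ (χs ω (a ∷ c)) * word g ω)
          ≈⟨ ∑-vecs 3 k (λ ω → fromℤ (χs ω (a ∷ c)) * word g ω) ⟩
        ∑[ ω ← vecs 3 k ] (fromℤ (χ U a ℤ.* χs ω c) * word g (U ∷ ω)) +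
          (∑[ ω ← vecs 3 k ] (fromℤ (χ V a ℤ.* χs ω c) * word g (V ∷ ω)) +
          (∑[ ω ← vecs 3 k ] (fromℤ (χ Z a ℤ.* χs ω c) * word g (Z ∷ ω)) + 0#))
          ≈⟨ +-cong (factor (χ U a) p (λ ω → word g (U ∷ ω)) (word g) c (λ ω →
                 (solve 4 (λ p a b c → p :* a :* b :* c := p :* (a :* b :* c)) refl p (p ^ #U ω) (q ^ #V ω) (g
                     (#Z ω)))))
             (+-cong (factor (χ V a) q (λ ω → word g (V ∷ ω)) (word g) c (λ ω →
                 (solve 4 (λ q a b c → a :* (q :* b) :* c := q :* (a :* b :* c)) refl q (p ^ #U ω) (q ^ #V ω) (g
                     (#Z ω)))))
             (+-congʳ (factor (χ Z a) 1# (λ ω → word g (Z ∷ ω)) (word (λ i → g (suc i))) c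
                 (λ ω → sym (*-identityˡ _))))) ⟩
        fromℤ (χ U a) * (p * S) + (fromℤ (χ V a) * (q * S) + (fromℤ (χ Z a) * (1# * S′) + 0#))
          ≈⟨ +-cong (*-congˡ (*-congˡ (expansion c g)))
             (+-cong (*-congˡ (*-congˡ (expansion c g)))
             (+-congʳ (*-congˡ (*-congˡ (expansion c (λ i → g (suc i))))))) ⟩
        fromℤ (χ U a) * (p * E g) + (fromℤ (χ V a) * (q * E g) + (fromℤ (χ Z a) * (1# * E (λ i → g (suc i))) + 0#))
          ≈⟨ letter a ⟩
        (p + q) ^ n₀ (a ∷ c) * (p - q) ^ n₂ (a ∷ c) * g (n₁ (a ∷ c)) ∎
        where
        S S′ : Carrier
        S  = ∑[ ω ← vecs 3 k ] (fromℤ (χs ω c) * word g ω)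
        S′ = ∑[ ω ← vecs 3 k ] (fromℤ (χs ω c) * word (λ i → g (suc i)) ω)
        E : (ℕ → Carrier) → Carrier
        E h = (p + q) ^ n₀ c * (p - q) ^ n₂ c * h (n₁ c)
        letter : ∀ a → fromℤ (χ U a) * (p * E g) + (fromℤ (χ V a) * (q * E g) +
                   (fromℤ (χ Z a) * (1# * E (λ i → g (suc i))) + 0#)) ≈
                   (p + q) ^ n₀ (a ∷ c) * (p - q) ^ n₂ (a ∷ c) * g (n₁ (a ∷ c))
        letter zero = (solve 6 (λ p q a b x y → :# 1 :* (p :* (a :* b :* x)) :+ (:# 1 :* (q :* (a :* b :* x)) :+
            (:# 0 :* (:# 1 :* (a :* b :* y)) :+ :# 0)) := (p :+ q) :* a :* b :* x) refl p q ((p + q) ^ n₀ c)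
            ((p - q) ^ n₂ c) (g (n₁ c)) (g (suc (n₁ c))))
        letter (suc zero) = (solve 6 (λ p q a b x y → :# 0 :* (p :* (a :* b :* x)) :+ (:# 0 :* (q :* (a :* b :* x))
            :+ (:# 1 :* (:# 1 :* (a :* b :* y)) :+ :# 0)) := a :* b :* y) refl p q ((p + q) ^ n₀ c) ((p - q) ^ n₂ c)
            (g (n₁ c)) (g (suc (n₁ c))))
        letter (suc (suc zero)) = (solve 6 (λ p q a b x y → :# 1 :* (p :* (a :* b :* x)) :+ ((:- :# 1) :* (q :*
            (a :* b :* x)) :+ (:# 0 :* (:# 1 :* (a :* b :* y)) :+ :# 0)) := a :* ((p :- q) :* b) :* x) refl p q
            ((p + q) ^ n₀ c) ((p - q) ^ n₂ c) (g (n₁ c)) (g (suc (n₁ c))))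
        letter (suc (suc (suc zero))) = (solve 6 (λ p q a b x y → :# 0 :* (p :* (a :* b :* x)) :+ (:# 0 :* (q :*
            (a :* b :* x)) :+ (:# 1 :* (:# 1 :* (a :* b :* y)) :+ :# 0)) := a :* b :* y) refl p q ((p + q) ^ n₀ c)
            ((p - q) ^ n₂ c) (g (n₁ c)) (g (suc (n₁ c))))

  P-codewords : ∀ p q z → P (p ^ 4) (q ^ 4) z ≈ ∑[ c ← vecs 4 n ] (fromℤ (ind c) * codewordTerm (p + q) (p - q) z c)
  P-codewords p q z = begin
    P (p ^ 4) (q ^ 4) z
      ≈⟨ ∑-cong (vecs 3 n) (λ ω → by-quarters ω (monomial (p ^ 4) (q ^ 4) z ω) (word g ω) (unquarter ω)) ⟩
    ∑[ ω ← vecs 3 n ] (fromℤ (coefficient ω) * word g ω)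
      ≈⟨ ∑-cong (vecs 3 n) (λ ω → begin
           fromℤ (coefficient ω) * word g ω
             ≈⟨ *-congʳ (fromℤ-∑ (vecs 4 n) (λ c → ind c ℤ.* χs ω c)) ⟩
           (∑[ c ← vecs 4 n ] fromℤ (ind c ℤ.* χs ω c)) * word g ω
             ≈⟨ ∑-*ʳ (vecs 4 n) (word g ω) (λ c → fromℤ (ind c ℤ.* χs ω c)) ⟩
           ∑[ c ← vecs 4 n ] (fromℤ (ind c ℤ.* χs ω c) * word g ω) ∎) ⟩
    ∑[ ω ← vecs 3 n ] ∑[ c ← vecs 4 n ] (fromℤ (ind c ℤ.* χs ω c) * word g ω)
      ≈⟨ ∑-swap (vecs 3 n) (vecs 4 n) (λ ω c → fromℤ (ind c ℤ.* χs ω c) * word g ω) ⟩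
    ∑[ c ← vecs 4 n ] ∑[ ω ← vecs 3 n ] (fromℤ (ind c ℤ.* χs ω c) * word g ω)
      ≈⟨ ∑-cong (vecs 4 n) (λ c → begin
           ∑[ ω ← vecs 3 n ] (fromℤ (ind c ℤ.* χs ω c) * word g ω)
             ≈⟨ factor (ind c) 1# (word g) (word g) c (λ ω → sym (*-identityˡ _)) ⟩
           fromℤ (ind c) * (1# * ∑[ ω ← vecs 3 n ] (fromℤ (χs ω c) * word g ω))
             ≈⟨ *-congˡ (trans (*-identityˡ _) (expansion c g)) ⟩
           fromℤ (ind c) * codewordTerm (p + q) (p - q) z c ∎) ⟩
    ∑[ c ← vecs 4 n ] (fromℤ (ind c) * codewordTerm (p + q) (p - q) z c) ∎
    where
    open Expansion p q
    g : ℕ → Carrier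
    g k = z ^ (k / 4)
    pow4 : ∀ x {a} i → a ≡ i ℕ.* 4 → (x ^ 4) ^ (a / 4) ≈ x ^ a
    pow4 x i ≡.refl = trans (^-congʳ (x ^ 4) (m*n/n≡m i 4))
      (trans (^-assocʳ x 4 i) (^-congʳ x (ℕₚ.*-comm 4 i)))
    unquarter : ∀ ω i j l → #U ω ≡ i ℕ.* 4 → #V ω ≡ j ℕ.* 4 → #Z ω ≡ l ℕ.* 4 → i ℕ.+ j ℕ.+ l ≡ m ℕ.* 2 →
                monomial (p ^ 4) (q ^ 4) z ω ≈ word g ω
    unquarter ω i j l a b c _ = *-cong (*-cong (pow4 p i a) (pow4 q j b)) refl

  module _ (x₁ x₂ x₃ : Carrier) (e₁≈0 : x₁ + x₂ + x₃ ≈ 0#) where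
    open SymmetricSpan R x₁ x₂ x₃ e₁≈0

    private
      -- With these signs the two symmetries generate all permutations of the arguments: `σ`
      -- exchanges the last two, and `τ` followed by an overall change of sign exchanges the first
      -- two. The relation u = v + z of the curve becomes vanishing of the sum.
      Q : Carrier → Carrier → Carrier → Carrier
      Q a b c = P a (- b) (- c)

      Q-swap₂₃ : ∀ a b c → Q a c b ≈ Q a b c
      Q-swap₂₃ a b c = P-σ a (- c) (- b)

      Q-swap₁₂ : ∀ a b c → Q b a c ≈ Q a b c
      Q-swap₁₂ a b c = begin
        P b (- a) (- c)              ≈⟨ P-τ b (- a) (- c) ⟩
        P (- a) b (- (- c))          ≈⟨ P-cong refl ((solve 1 (λ b → b := :- (:- b)) refl b)) refl ⟩
        P (- a) (- (- b)) (- (- c))  ≈⟨ P-neg a (- b) (- c) ⟩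
        P a (- b) (- c)              ∎

      orbit : Q x₁ x₂ x₃ + Q x₁ x₃ x₂ + Q x₂ x₁ x₃ + Q x₂ x₃ x₁ + Q x₃ x₁ x₂ + Q x₃ x₂ x₁ ≈ # 6 * Q x₁ x₂ x₃
      orbit = trans (+-cong (+-cong (+-cong (+-cong (+-cong refl q₁₃₂) q₂₁₃)
          (trans (Q-swap₂₃ x₂ x₁ x₃) q₂₁₃)) q₃₁₂)
          (trans (Q-swap₂₃ x₃ x₁ x₂) q₃₁₂))
        ((solve 1 (λ a → a :+ a :+ a :+ a :+ a :+ a := :# 6 :* a) refl (Q x₁ x₂ x₃)))
        where
        q₁₃₂ = Q-swap₂₃ x₁ x₂ x₃
        q₂₁₃ = Q-swap₁₂ x₁ x₂ x₃
        q₃₁₂ = trans (Q-swap₁₂ x₁ x₃ x₂) q₁₃₂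

      signed : Word n → ℤ
      signed ω = coefficient ω ℤ.* (ε (#V ω / 4) ℤ.* ε (#Z ω / 4))

      Q-signed : ∀ a b c → Q a b c ≈ ∑[ ω ← vecs 3 n ] (fromℤ (signed ω) * monomial a b c ω)
      Q-signed a b c = ∑-cong (vecs 3 n) λ ω → begin
        fromℤ (coefficient ω) * (a ^ (#U ω / 4) * (- b) ^ (#V ω / 4) * (- c) ^ (#Z ω / 4))
          ≈⟨ *-congˡ (*-cong (*-congˡ (neg-^ b (#V ω / 4))) (neg-^ c (#Z ω / 4))) ⟩
        fromℤ (coefficient ω) * (a ^ (#U ω / 4) * (fromℤ (ε (#V ω / 4)) * b ^ (#V ω / 4)) * (fromℤ (ε
            (#Z ω / 4)) * c ^ (#Z ω / 4)))
          ≈⟨ (solve 6 (λ k p q x y z → k :* (x :* (p :* y) :* (q :* z)) := k :* (p :* q) :* (x :* y :* z)) refl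
              (fromℤ (coefficient ω)) (fromℤ (ε (#V ω / 4))) (fromℤ (ε (#Z ω / 4))) (a ^ (#U ω / 4)) (b ^
              (#V ω / 4)) (c ^ (#Z ω / 4))) ⟩
        fromℤ (coefficient ω) * (fromℤ (ε (#V ω / 4)) * fromℤ (ε (#Z ω / 4))) * monomial a b c ω
          ≈⟨ *-congʳ (trans (fromℤ-* (coefficient ω) _) (*-congˡ (fromℤ-* (ε (#V ω / 4)) (ε (#Z ω / 4))))) ⟨
        fromℤ (signed ω) * monomial a b c ω ∎

      term-span : ∀ ω → Span (m ℕ.* 2) (fromℤ (signed ω) * symmetricMonomial (#U ω / 4) (#V ω / 4) (#Z ω / 4))
      term-span ω = cases (coefficient ω ℤ.≟ + 0)
        where
        cases : Dec (coefficient ω ≡ + 0) →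
          Span (m ℕ.* 2) (fromℤ (signed ω) * symmetricMonomial (#U ω / 4) (#V ω / 4) (#Z ω / 4))
        cases (yes eq) = span-resp (sym (trans (*-congʳ (reflexive (≡.cong
          (λ k → fromℤ (k ℤ.* (ε (#V ω / 4) ℤ.* ε (#Z ω / 4)))) eq))) (zeroˡ _))) span-0
        cases (no ne) = let (i , j , l , #U≡ , #V≡ , #Z≡ , sum) = quarters ω ne in
          span-ℤ (signed ω) (span-degree
            (≡.trans (≡.cong₂ ℕ._+_ (≡.cong₂ ℕ._+_ (/4 i #U≡) (/4 j #V≡)) (/4 l #Z≡)) sum)
            (symmetricMonomial-span (#U ω / 4) (#V ω / 4) (#Z ω / 4)))

    -- Averaging over the six permutations turns each monomial into a symmetric one. The factor 6
    -- stays so that only integer coefficients are needed.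
    6P-span : Span (m ℕ.* 2) (# 6 * P x₁ (- x₂) (- x₃))
    6P-span = span-resp (begin
      ∑[ ω ← W ] (fromℤ (signed ω) * symmetricMonomial (#U ω / 4) (#V ω / 4) (#Z ω / 4))
        ≈⟨ ∑-cong W (λ ω → (solve 7 (λ s a b c d e f → s :* (a :+ b :+ c :+ d :+ e :+ f) := s :* a :+ s :* b
            :+ s :* c :+ s :* d :+ s :* e :+ s :* f) refl (fromℤ (signed ω)) (monomial x₁ x₂ x₃ ω)
            (monomial x₁ x₃ x₂ ω) (monomial x₂ x₁ x₃ ω) (monomial x₂ x₃ x₁ ω) (monomial x₃ x₁ x₂ ω)
            (monomial x₃ x₂ x₁ ω))) ⟩
      ∑[ ω ← W ] (T x₁ x₂ x₃ ω + T x₁ x₃ x₂ ω + T x₂ x₁ x₃ ω + T x₂ x₃ x₁ ω + T x₃ x₁ x₂ ω + T x₃ x₂ x₁ ω)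
        ≈⟨ trans (∑-+ W _ _) (+-congʳ (trans (∑-+ W _ _) (+-congʳ (trans (∑-+ W _ _) (+-congʳ
             (trans (∑-+ W _ _) (+-congʳ (∑-+ W _ _)))))))) ⟩
      ∑ W (T x₁ x₂ x₃) + ∑ W (T x₁ x₃ x₂) + ∑ W (T x₂ x₁ x₃) + ∑ W (T x₂ x₃ x₁) + ∑ W (T x₃ x₁ x₂) + ∑ W (T x₃ x₂ x₁)
        ≈⟨ +-cong (+-cong (+-cong (+-cong (+-cong (Q-signed x₁ x₂ x₃) (Q-signed x₁ x₃ x₂)) (Q-signed x₂ x₁ x₃))
             (Q-signed x₂ x₃ x₁)) (Q-signed x₃ x₁ x₂)) (Q-signed x₃ x₂ x₁) ⟨
      Q x₁ x₂ x₃ + Q x₁ x₃ x₂ + Q x₂ x₁ x₃ + Q x₂ x₃ x₁ + Q x₃ x₁ x₂ + Q x₃ x₂ x₁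
        ≈⟨ orbit ⟩
      # 6 * Q x₁ x₂ x₃ ∎)
      (span-∑ W _ term-span)
      where
      W : List (Word n)
      W = vecs 3 n
      T : Carrier → Carrier → Carrier → Word n → Carrier
      T a b c ω = fromℤ (signed ω) * monomial a b c ω

-- Vanishing residues on the curve

module Residues (F : OrderedField) where

  private
    module F = OrderedField F
    module Fₚ = OrderedFieldProperties F
  open PowerSeries F.commutativeRing public
  open CommutativeRing seriesRing
  open IntegerCoefficients seriesRing
  open import Algebra.Properties.Semiring.Exp semiring using (_^_)
  open import Relation.Binary.Reasoning.Setoid setoid

  T : Series
  T = X * X

  coeff-T*-0 : ∀ f → coeff (T * f) 0 F.≈ F.0#
  coeff-T*-0 f = F.trans (at (*-assoc X X f) 0) (coeff-X*-0 (X * f))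

  coeff-T*-1 : ∀ f → coeff (T * f) 1 F.≈ F.0#
  coeff-T*-1 f = F.trans (at (*-assoc X X f) 1) (F.trans (coeff-X*-suc (X * f) 0) (coeff-X*-0 f))

  coeff-T*-+2 : ∀ f n → coeff (T * f) (2 ℕ.+ n) F.≈ coeff f n
  coeff-T*-+2 f n = F.trans (at (*-assoc X X f) (2 ℕ.+ n))
    (F.trans (coeff-X*-suc (X * f) (suc n)) (coeff-X*-suc f n))

  coeff-T^* : ∀ j f n → coeff (T ^ j * f) (j ℕ.* 2 ℕ.+ n) F.≈ coeff f n
  coeff-T^* zero f n = at (*-identityˡ f) n
  coeff-T^* (suc j) f n = F.trans (at (*-assoc T (T ^ j) f) (2 ℕ.+ (j ℕ.* 2 ℕ.+ n)))
    (F.trans (coeff-T*-+2 (T ^ j * f) (j ℕ.* 2 ℕ.+ n)) (coeff-T^* j f n))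

  coeff-#* : ∀ k f n → coeff (# k * f) n F.≈ F.# k F.* coeff f n
  coeff-#* zero f n = F.trans (coeff-constant-* F.0# f n) F.refl
  coeff-#* (suc k) f n = F.trans (at (trans (*-congʳ (#-suc k)) (trans (distribʳ f 1# (# k)) (+-congʳ
      (*-identityˡ f)))) n)
    (F.trans (coeff-+ f (# k * f) n) (F.trans (F.+-congˡ (coeff-#* k f n))
    (F.trans (F.+-congʳ (F.sym (F.*-identityˡ _))) (F.trans (F.sym (F.distribʳ _ _ _)) (F.*-congʳ (F.sym
        (F.#-suc k)))))))

  coeff-0 : ∀ n → coeff 0# n F.≈ F.0#
  coeff-0 n = F.trans (F.sym (at (zeroˡ 0#) n)) (F.trans (coeff-constant-* F.0# 0# n) (F.*-zeroˡ _))

  private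
    geometric : F.Carrier → ℕ → F.Carrier
    geometric c 0 = F.1#
    geometric c 1 = F.0#
    geometric c (suc (suc n)) = c F.* geometric c n

    geometric-inverse : ∀ c → (1# - constant c * T) * series (geometric c) ≈ 1#
    geometric-inverse c = trans ((solve 3 (λ k t g → (:# 1 :- k :* t) :* g := g :- k :* (t :* g)) refl
        (constant c) T (series (geometric c))))
      (trans (+-congʳ fixed) ((solve 1 (λ x → :# 1 :+ x :- x := :# 1) refl (constant c * (T * series
          (geometric c))))))
      where
      g : Series
      g = series (geometric c)
      at-n : ∀ n → geometric c n F.≈ coeff 1# n F.+ coeff (constant c * (T * g)) n
      at-n 0 = F.sym (F.trans (F.+-cong (coeff-constant-0 F.1#) (F.trans (coeff-constant-* c (T * g) 0)
        (F.trans (F.*-congˡ (coeff-T*-0 g)) (F.*-zeroʳ c)))) (F.+-identityʳ _))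
      at-n 1 = F.sym (F.trans (F.+-cong (coeff-constant-suc F.1# 0) (F.trans (coeff-constant-* c (T * g) 1)
        (F.trans (F.*-congˡ (coeff-T*-1 g)) (F.*-zeroʳ c)))) (F.+-identityʳ _))
      at-n (suc (suc n)) = F.sym (F.trans (F.+-cong (coeff-constant-suc F.1# (suc n))
        (F.trans (coeff-constant-* c (T * g) (2 ℕ.+ n)) (F.*-congˡ (coeff-T*-+2 g n)))) (F.+-identityˡ _))
      fixed : g ≈ 1# + constant c * (T * g)
      fixed = coefficientwise λ n → F.trans (at-n n) (F.sym (coeff-+ 1# (constant c * (T * g)) n))

  p q : Series
  p = 1# + T
  q = 1# - T

  opaque
    p⁻¹ q⁻¹ : Series
    p⁻¹ = series (geometric (F.- F.1#))
    q⁻¹ = series (geometric F.1#)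

    p*p⁻¹≈1 : p * p⁻¹ ≈ 1#
    p*p⁻¹≈1 = trans (*-congʳ (trans ((solve 1 (λ t → :# 1 :+ t := :# 1 :- (:- :# 1) :* t) refl T))
      (+-congˡ (-‿cong (*-congʳ (sym (constant-neg F.1#))))))) (geometric-inverse (F.- F.1#))

    q*q⁻¹≈1 : q * q⁻¹ ≈ 1#
    q*q⁻¹≈1 = trans (*-congʳ ((solve 1 (λ t → :# 1 :- t := :# 1 :- :# 1 :* t) refl T))) (geometric-inverse F.1#)

  θ-T : θ T ≈ # 2 * T
  θ-T = trans (θ-* X X) (trans (+-cong (*-congʳ θ-X) (*-congˡ θ-X)) ((solve 1 (λ x → x :* x :+ x :* x := :# 2 :*
      (x :* x)) refl X)))

  θ-1 : θ 1# ≈ 0#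
  θ-1 = θ-constant F.1#

  θ-# : ∀ k → θ (# k) ≈ 0#
  θ-# zero    = θ-constant F.0#
  θ-# (suc k) = trans (θ-cong (#-suc k)) (trans (θ-+ 1# (# k)) (trans (+-cong θ-1 (θ-# k)) (+-identityˡ 0#)))

  θ-#+T* : ∀ k f → θ (# k + T * f) ≈ T * (# 2 * f + θ f)
  θ-#+T* k f = trans (θ-+ (# k) (T * f)) (trans (+-cong (θ-# k) (trans (θ-* T f) (+-congʳ (*-congʳ θ-T))))
    ((solve 3 (λ t f g → :# 0 :+ (:# 2 :* t :* f :+ t :* g) := t :* (:# 2 :* f :+ g)) refl T f (θ f))))

  θ-^ : ∀ f k → θ (f ^ suc k) ≈ # suc k * (f ^ k * θ f)
  θ-^ f zero = trans (θ-* f 1#) (trans (+-congˡ (*-congˡ θ-1)) ((solve 2 (λ f g → g :* :# 1 :+ f :* :# 0 := :# 1 :*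
      (:# 1 :* g)) refl f (θ f))))
  θ-^ f (suc k) = trans (θ-* f (f ^ suc k)) (trans (+-congˡ (*-congˡ (θ-^ f k)))
    (trans ((solve 4 (λ f g k x → g :* (f :* x) :+ f :* (k :* (x :* g)) := (:# 1 :+ k) :* (f :* x :* g)) refl f
        (θ f) (# suc k) (f ^ k)))
      (*-congʳ (sym (#-suc (suc k))))))

  private
    unit-log-derivative : ∀ f f⁻¹ → f * f⁻¹ ≈ 1# → ∀ a → θ (f⁻¹ ^ a) ≈ - (# a * (θ f * f⁻¹ ^ suc a))
    unit-log-derivative f f⁻¹ ff⁻¹≈1 zero = trans θ-1 ((solve 2 (λ g h → :# 0 := :- (:# 0 :* (g :*
        (h :* :# 1)))) refl (θ f) f⁻¹))
    unit-log-derivative f f⁻¹ ff⁻¹≈1 (suc a) = trans (θ-^ f⁻¹ a) (trans (*-congˡ (*-congˡ θf⁻¹))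
      ((solve 4 (λ k x g h → k :* (x :* (:- (g :* (h :* h)))) := :- (k :* (g :* (h :* (h :* x))))) refl (# suc a)
          (f⁻¹ ^ a) (θ f) f⁻¹)))
      where
      θf⁻¹ : θ f⁻¹ ≈ - (θ f * (f⁻¹ * f⁻¹))
      θf⁻¹ = begin
        θ f⁻¹                                         ≈⟨ *-identityˡ (θ f⁻¹) ⟨
        1# * θ f⁻¹                                    ≈⟨ *-congʳ ff⁻¹≈1 ⟨
        f * f⁻¹ * θ f⁻¹                               ≈⟨ (solve 4 (λ f h g k → f :* h :* k := h :* (g :* h
            :+ f :* k) :- g :* (h :* h)) refl f f⁻¹ (θ f) (θ f⁻¹)) ⟩
        f⁻¹ * (θ f * f⁻¹ + f * θ f⁻¹) - θ f * (f⁻¹ * f⁻¹)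
          ≈⟨ +-congʳ (*-congˡ (trans (sym (θ-* f f⁻¹)) (trans (θ-cong ff⁻¹≈1) θ-1))) ⟩
        f⁻¹ * 0# - θ f * (f⁻¹ * f⁻¹)                  ≈⟨ (solve 2 (λ h g → h :* :# 0 :- g :* (h :* h) := :- (g :*
            (h :* h))) refl f⁻¹ (θ f)) ⟩
        - (θ f * (f⁻¹ * f⁻¹))                         ∎

  θ-p⁻¹^ : ∀ a → θ (p⁻¹ ^ a) ≈ - (# a * (# 2 * T * p⁻¹ ^ suc a))
  θ-p⁻¹^ a = trans (unit-log-derivative p p⁻¹ p*p⁻¹≈1 a) (-‿cong (*-congˡ (*-congʳ
    (trans (θ-+ 1# T) (trans (+-cong θ-1 θ-T) (+-identityˡ _))))))

  θ-q⁻¹^ : ∀ a → θ (q⁻¹ ^ a) ≈ # a * (# 2 * T * q⁻¹ ^ suc a)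
  θ-q⁻¹^ a = trans (unit-log-derivative q q⁻¹ q*q⁻¹≈1 a) (trans (-‿cong (*-congˡ (*-congʳ θq)))
    ((solve 3 (λ k t x → :- (k :* ((:- (:# 2 :* t)) :* x)) := k :* (:# 2 :* t :* x)) refl (# a) T (q⁻¹ ^ suc a))))
    where
    θq : θ q ≈ - (# 2 * T)
    θq = trans (sym (+-identityʳ _)) (trans (+-congˡ (sym (-‿inverseʳ (# 2 * T))))
      (trans (sym (+-assoc _ _ _)) (trans (+-congʳ (trans (+-congˡ (sym θ-T)) (trans (sym (θ-+ q T))
        (trans (θ-cong ((solve 1 (λ t → :# 1 :- t :+ t := :# 1) refl T))) θ-1)))) (+-identityˡ _))))

  -- With T = (θ₂/θ₃)² for the theta constants at 2τ, the polynomials E, 𝐏²𝐐 and D are E₄, Δ and E₆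
  -- up to constants and powers of θ₃.
  𝐏 𝐐 E D : Series
  𝐏 = q * q * (q * q)
  𝐐 = # 64 * (T * (p * p))
  E = 𝐏 + 𝐐
  D = (1# + # 6 * T + T * T) * (𝐏 - # 2 * 𝐐)

  private
    E′ : Series
    E′ = T * (# 60 + # 268 * T + # 180 * (T * T) + # 4 * (T * T * T))

    θ-E : θ E ≈ # 2 * E′
    θ-E = trans (θ-cong horner) (trans (θ-#+T* 1 _) (trans (*-congˡ (+-congˡ (trans (θ-#+T* 60 _)
      (*-congˡ (+-congˡ (trans (θ-#+T* 134 _) (*-congˡ (+-congˡ (trans (θ-#+T* 60 _) (*-congˡ (+-congˡ θ-1)))))))))))
      ((solve 1 (λ t → t :* (:# 2 :* (:# 60 :+ t :* (:# 134 :+ t :* (:# 60 :+ t :* :# 1))) :+ t :* (:# 2 :* (:# 134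
          :+ t :* (:# 60 :+ t :* :# 1)) :+ t :* (:# 2 :* (:# 60 :+ t :* :# 1) :+ t :* (:# 2 :* :# 1 :+ :# 0))))
          := :# 2 :* (t :* (:# 60 :+ :# 268 :* t :+ :# 180 :* (t :* t) :+ :# 4 :* (t :* t :* t)))) refl T))))
      where
      horner : E ≈ # 1 + T * (# 60 + T * (# 134 + T * (# 60 + T * 1#)))
      horner = (solve 1 (λ t → (:# 1 :- t) :* (:# 1 :- t) :* ((:# 1 :- t) :* (:# 1 :- t)) :+ :# 64 :* (t :* ((:# 1
          :+ t) :* (:# 1 :+ t))) := :# 1 :+ t :* (:# 60 :+ t :* (:# 134 :+ t :* (:# 60 :+ t :* :# 1)))) refl T)

    -- The coefficient extracted is that of a derivative: E³ʳp⁻²ʳq⁻⁸ʳ − (θ of it)/2r at X²ʳ.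
    exact : ∀ r k → suc k ≡ 3 ℕ.* r →
      # (r ℕ.* 2) * (E ^ k * D * (p⁻¹ ^ (1 ℕ.+ 2 ℕ.* r) * q⁻¹ ^ (1 ℕ.+ 8 ℕ.* r))) ≈
      # (r ℕ.* 2) * (E ^ suc k * (p⁻¹ ^ (2 ℕ.* r) * q⁻¹ ^ (8 ℕ.* r))) - θ (E ^ suc k * (p⁻¹ ^ (2 ℕ.* r) * q⁻¹ ^
          (8 ℕ.* r)))
    exact r k 1+k≡3r = sym (begin
      #2r * (E * e * (a * b)) - θ (E ^ suc k * (a * b))
        ≈⟨ +-congˡ (-‿cong (trans (θ-* (E ^ suc k) (a * b)) (+-cong
             (*-congʳ (trans (θ-^ E k) (*-cong #3r (*-congˡ θ-E))))
             (*-congˡ (trans (θ-* a b) (+-cong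
               (*-congʳ (trans (θ-p⁻¹^ (2 ℕ.* r)) (-‿cong (*-congʳ (#-k* 2)))))
               (*-congˡ (trans (θ-q⁻¹^ (8 ℕ.* r)) (*-congʳ (#-k* 8)))))))))) ⟩
      #2r * (E * e * (a * b)) - (# 3 * # r * (e * (# 2 * E′)) * (a * b) +
        E * e * (- (# 2 * # r * (# 2 * T * (p⁻¹ * a))) * b + a * (# 8 * # r * (# 2 * T * (q⁻¹ * b)))))
        ≈⟨ +-cong (*-congʳ #r2) (-‿cong (+-congʳ refl)) ⟩
      # r * # 2 * (E * e * (a * b)) - (# 3 * # r * (e * (# 2 * E′)) * (a * b) +
        E * e * (- (# 2 * # r * (# 2 * T * (p⁻¹ * a))) * b + a * (# 8 * # r * (# 2 * T * (q⁻¹ * b)))))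
        ≈⟨ (solve 9 (λ E e a b t d r h k → r :* :# 2 :* (E :* e :* (a :* b)) :- (:# 3 :* r :* (e :* (:# 2 :* d)) :*
            (a :* b) :+ E :* e :* ((:- (:# 2 :* r :* (:# 2 :* t :* (h :* a)))) :* b :+ a :* (:# 8 :* r :*
            (:# 2 :* t :* (k :* b))))) := r :* :# 2 :* (e :* (E :* (a :* b) :- :# 3 :* (d :* (a :* b)) :+ :# 2 :*
            (E :* (t :* ((h :* a) :* b))) :- :# 8 :* (E :* (t :* (a :* (k :* b))))))) refl E e a b T E′
            (# r) p⁻¹ q⁻¹) ⟩
      # r * # 2 * (e * (E * (a * b) - # 3 * (E′ * (a * b)) + # 2 * (E * (T * ((p⁻¹ * a) * b))) - # 8 * (E * (T *
          (a * (q⁻¹ * b))))))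
        ≈⟨ *-cong (sym #r2) (*-congˡ (+-cong (+-cong (+-cong
             (*-congˡ (*-cong unp unq)) (-‿cong (*-congˡ (*-congˡ (*-cong unp unq)))))
             (*-congˡ (*-congˡ (*-congˡ (*-congˡ unq)))))
             (-‿cong (*-congˡ (*-congˡ (*-congˡ (*-congʳ unp))))))) ⟩
      #2r * (e * (E * ((p * a′) * (q * b′)) - # 3 * (E′ * ((p * a′) * (q * b′)))
        + # 2 * (E * (T * (a′ * (q * b′)))) - # 8 * (E * (T * ((p * a′) * b′)))))
        -- This is where `D` arises: p q E - 3 p q E′ + 2 T q E - 8 T p E = `D`, with `E′` = T
        -- dE/dT. It is the counterpart of Ramanujan's formula by which the derivative of E₄³/Δ is,
        -- up to a constant, E₄²E₆/Δ.
        ≈⟨ (solve 5 (λ n e t a b → n :* (e :* (((:# 1 :- t) :* (:# 1 :- t) :* ((:# 1 :- t) :* (:# 1 :- t))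
            :+ :# 64 :* (t :* ((:# 1 :+ t) :* (:# 1 :+ t)))) :* (((:# 1 :+ t) :* a) :* ((:# 1 :- t) :* b))
            :- :# 3 :* (t :* (:# 60 :+ :# 268 :* t :+ :# 180 :* (t :* t) :+ :# 4 :* (t :* t :* t)) :* (((:# 1
            :+ t) :* a) :* ((:# 1 :- t) :* b))) :+ :# 2 :* (((:# 1 :- t) :* (:# 1 :- t) :* ((:# 1 :- t) :* (:# 1
            :- t)) :+ :# 64 :* (t :* ((:# 1 :+ t) :* (:# 1 :+ t)))) :* (t :* (a :* ((:# 1 :- t) :* b)))) :- :# 8 :*
            (((:# 1 :- t) :* (:# 1 :- t) :* ((:# 1 :- t) :* (:# 1 :- t)) :+ :# 64 :* (t :* ((:# 1 :+ t) :* (:# 1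
            :+ t)))) :* (t :* (((:# 1 :+ t) :* a) :* b))))) := n :* (e :* ((:# 1 :+ :# 6 :* t :+ t :* t) :* ((:# 1
            :- t) :* (:# 1 :- t) :* ((:# 1 :- t) :* (:# 1 :- t)) :- :# 2 :* (:# 64 :* (t :* ((:# 1 :+ t) :* (:# 1
            :+ t)))))) :* (a :* b))) refl #2r e T a′ b′) ⟩
      #2r * (e * D * (a′ * b′)) ∎)
      where
      #2r e a b a′ b′ : Series
      #2r = # (r ℕ.* 2)
      e = E ^ k
      a = p⁻¹ ^ (2 ℕ.* r)
      b = q⁻¹ ^ (8 ℕ.* r)
      a′ = p⁻¹ ^ (1 ℕ.+ 2 ℕ.* r)
      b′ = q⁻¹ ^ (1 ℕ.+ 8 ℕ.* r)
      #-mul : ∀ i j → # (i ℕ.* j) ≈ # i * # j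
      #-mul i j = trans (reflexive (≡.cong fromℤ (ℤₚ.pos-* i j))) (fromℤ-* (+ i) (+ j))
      #-k* : ∀ i → # (i ℕ.* r) ≈ # i * # r
      #-k* i = #-mul i r
      #r2 : #2r ≈ # r * # 2
      #r2 = #-mul r 2
      #3r : # suc k ≈ # 3 * # r
      #3r = trans (reflexive (≡.cong #_ 1+k≡3r)) (#-mul 3 r)
      unp : a ≈ p * a′
      unp = trans (sym (*-identityˡ a)) (trans (*-congʳ (sym p*p⁻¹≈1)) (*-assoc p p⁻¹ a))
      unq : b ≈ q * b′
      unq = trans (sym (*-identityˡ b)) (trans (*-congʳ (sym q*q⁻¹≈1)) (*-assoc q q⁻¹ b))

  residue-vanishes : ∀ r k → suc k ≡ 3 ℕ.* suc r →
    coeff (E ^ k * D * (p⁻¹ ^ (1 ℕ.+ 2 ℕ.* suc r) * q⁻¹ ^ (1 ℕ.+ 8 ℕ.* suc r))) (suc r ℕ.* 2) F.≈ F.0#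
  residue-vanishes r k eq = cancel _ (F.trans (F.sym (coeff-#* N _ N)) (F.trans (at (exact (suc r) k eq) N)
    (F.trans (coeff-+ (# N * g) (- θ g) N) (F.trans (F.+-cong (coeff-#* N g N)
      (F.trans (coeff-neg (θ g) N) (F.-‿cong (coeff-θ g N)))) (F.-‿inverseʳ _)))))
    where
    N : ℕ
    N = suc r ℕ.* 2
    g : Series
    g = E ^ suc k * (p⁻¹ ^ (2 ℕ.* suc r) * q⁻¹ ^ (8 ℕ.* suc r))
    cancel : ∀ x → F.# N F.* x F.≈ F.0# → x F.≈ F.0#
    cancel x Nx≈0 = F.≤-antisym
      (Fₚ.*-cancelˡ-≤ (Fₚ.#-pos (suc (r ℕ.* 2))) (F.≤-reflexive (F.trans Nx≈0 (F.sym (F.*-zeroʳ _)))))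
      (Fₚ.*-cancelˡ-≤ (Fₚ.#-pos (suc (r ℕ.* 2))) (F.≤-reflexive (F.trans (F.*-zeroʳ _) (F.sym Nx≈0))))

-- The linear functional annihilating the restricted enumerator

module Functional (F : OrderedField) where

  private module F = OrderedField F
  open Residues F public
  open CommutativeRing seriesRing
  open IntegerCoefficients seriesRing
  open import Algebra.Properties.Semiring.Exp semiring using (_^_; ^-homo-*; ^-assocʳ; ^-congʳ; ^-congˡ)
  open import Algebra.Properties.CommutativeSemiring.Exp commutativeSemiring using (^-distrib-*)
  open import Relation.Binary.Reasoning.Setoid setoid

  Vanishes : ℕ → Series → Set
  Vanishes N f = coeff f N F.≈ F.0#

  module _ {N : ℕ} where
    vanishes-resp : ∀ {f g} → f ≈ g → Vanishes N f → Vanishes N g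
    vanishes-resp f≈g v = F.trans (F.sym (at f≈g N)) v

    vanishes-+ : ∀ {f g} → Vanishes N f → Vanishes N g → Vanishes N (f + g)
    vanishes-+ {f} {g} v w = F.trans (coeff-+ f g N) (F.trans (F.+-cong v w) (F.+-identityˡ _))

    vanishes-neg : ∀ {f} → Vanishes N f → Vanishes N (- f)
    vanishes-neg {f} v = F.trans (at ((solve 1 (λ f → :- f := :# 0 :- f) refl f)) N) (F.trans (coeff-+ 0# (- f) N)
      (F.trans (F.+-cong (coeff-0 N) (F.trans (coeff-neg f N) (F.trans (F.-‿cong v) (F.trans (F.sym
          (F.+-identityˡ _)) (F.-‿inverseʳ _))))) (F.+-identityˡ _)))

    vanishes-constant : ∀ c {f} → Vanishes N f → Vanishes N (constant c * f)
    vanishes-constant c {f} v = F.trans (coeff-constant-* c f N) (F.trans (F.*-congˡ v) (F.*-zeroʳ c))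

    vanishes-# : ∀ k {f} → Vanishes N f → Vanishes N (# k * f)
    vanishes-# k {f} v = F.trans (coeff-#* k f N) (F.trans (F.*-congˡ v) (F.*-zeroʳ _))

    vanishes-^ : ∀ {a} → (∀ {f} → Vanishes N f → Vanishes N (a * f)) → ∀ i {f} → Vanishes N f → Vanishes N (a ^ i * f)
    vanishes-^ closed zero {f} v = vanishes-resp (sym (*-identityˡ f)) v
    vanishes-^ {a} closed (suc i) {f} v = vanishes-resp (sym (*-assoc a (a ^ i) f)) (closed (vanishes-^ closed i v))

  denominators : ℕ → Series
  denominators k = p⁻¹ ^ (1 ℕ.+ 2 ℕ.* k) * q⁻¹ ^ (1 ℕ.+ 8 ℕ.* k)

  -- Together with the extraction of X^(2k) this is the differential with coefficient E₄^e E₆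
  -- Δ^(-k). The additional 1/(pq) = 1/(1 - T²) comes from writing dτ in terms of dT/T.
  kernel : ℕ → ℕ → Series
  kernel k e = E ^ e * D * denominators k

  -- Δ without its zero at T = 0: `𝐏` `𝐏` `𝐐` is 64 T `Π`.
  Π : Series
  Π = p * p * q ^ 8

  private
    Π⁻¹ : Series
    Π⁻¹ = p⁻¹ * p⁻¹ * q⁻¹ ^ 8

    ΠΠ⁻¹≈1 : Π * Π⁻¹ ≈ 1#
    ΠΠ⁻¹≈1 = begin
      p * p * q ^ 8 * (p⁻¹ * p⁻¹ * q⁻¹ ^ 8)
        ≈⟨ (solve 4 (λ p h x y → p :* p :* x :* (h :* h :* y) := (p :* h) :* (p :* h) :* (x :* y)) refl p p⁻¹
            (q ^ 8) (q⁻¹ ^ 8)) ⟩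
      (p * p⁻¹) * (p * p⁻¹) * (q ^ 8 * q⁻¹ ^ 8)
        ≈⟨ *-cong (*-cong p*p⁻¹≈1 p*p⁻¹≈1) (trans (sym (^-distrib-* q q⁻¹ 8)) (^-congˡ 8 q*q⁻¹≈1)) ⟩
      1# * 1# * 1# ^ 8
        ≈⟨ (solve 0 (:# 1 :* :# 1 :* :# 1 :^ 8 := :# 1) refl) ⟩
      1# ∎

    denominators-suc : ∀ k → denominators (suc k) ≈ Π⁻¹ * denominators k
    denominators-suc k = begin
      p⁻¹ ^ (1 ℕ.+ 2 ℕ.* suc k) * q⁻¹ ^ (1 ℕ.+ 8 ℕ.* suc k)
        ≈⟨ *-cong (^-congʳ p⁻¹ (shift 2)) (^-congʳ q⁻¹ (shift 8)) ⟩
      p⁻¹ ^ (2 ℕ.+ (1 ℕ.+ 2 ℕ.* k)) * q⁻¹ ^ (8 ℕ.+ (1 ℕ.+ 8 ℕ.* k))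
        ≈⟨ *-cong (^-homo-* p⁻¹ 2 (1 ℕ.+ 2 ℕ.* k)) (^-homo-* q⁻¹ 8 (1 ℕ.+ 8 ℕ.* k)) ⟩
      p⁻¹ ^ 2 * p⁻¹ ^ (1 ℕ.+ 2 ℕ.* k) * (q⁻¹ ^ 8 * q⁻¹ ^ (1 ℕ.+ 8 ℕ.* k))
        ≈⟨ (solve 4 (λ h a y b → h :^ 2 :* a :* (y :* b) := h :* h :* y :* (a :* b)) refl p⁻¹ (p⁻¹ ^
            (1 ℕ.+ 2 ℕ.* k)) (q⁻¹ ^ 8) (q⁻¹ ^ (1 ℕ.+ 8 ℕ.* k))) ⟩
      Π⁻¹ * denominators k ∎
      where
      shift : ∀ c → 1 ℕ.+ c ℕ.* suc k ≡ c ℕ.+ (1 ℕ.+ c ℕ.* k)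
      shift c = ≡.trans (≡.cong suc (ℕₚ.*-suc c k)) (≡.sym (ℕₚ.+-suc c (c ℕ.* k)))

  denominators-Π : ∀ k → denominators k ≈ Π * denominators (suc k)
  denominators-Π k = sym (trans (*-congˡ (denominators-suc k))
    (trans (sym (*-assoc Π Π⁻¹ _)) (trans (*-congʳ ΠΠ⁻¹≈1) (*-identityˡ _))))

  Π^-denominators : ∀ j r → Π ^ j * denominators (j ℕ.+ r) ≈ denominators r
  Π^-denominators zero r = *-identityˡ _
  Π^-denominators (suc j) r = trans ((solve 3 (λ P x y → P :* x :* y := x :* (P :* y)) refl Π (Π ^ j) (denominators
      (suc (j ℕ.+ r)))))
    (trans (*-congˡ (sym (denominators-Π (j ℕ.+ r)))) (Π^-denominators j r))

  -- The curve is parametrised by a = 1, c = X. Then z = 8X(1 + X²) is the value of (2b)⁴, whose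
  -- equality with u - v is the linear relation.
  u v z x₁ x₂ x₃ : Series
  u = (1# + X) ^ 4
  v = (1# - X) ^ 4
  z = u - v
  x₁ = u
  x₂ = - v
  x₃ = - z

  e₁≈0 : x₁ + x₂ + x₃ ≈ 0#
  e₁≈0 = (solve 2 (λ u v → u :+ (:- v) :+ (:- (u :- v)) := :# 0) refl u v)

  open SymmetricSpan seriesRing x₁ x₂ x₃ e₁≈0

  private
    e₂≈-E : e₂ ≈ (- 1#) * E
    e₂≈-E = (solve 1 (λ x → (:# 1 :+ x) :^ 4 :* (:- ((:# 1 :- x) :^ 4)) :+ (:# 1 :+ x) :^ 4 :* (:- ((:# 1
        :+ x) :^ 4 :- (:# 1 :- x) :^ 4)) :+ (:- ((:# 1 :- x) :^ 4)) :* (:- ((:# 1 :+ x) :^ 4 :- (:# 1 :- x) :^ 4))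
        := (:- :# 1) :* ((:# 1 :- x :* x) :* (:# 1 :- x :* x) :* ((:# 1 :- x :* x) :* (:# 1 :- x :* x)) :+ :# 64 :*
        (x :* x :* ((:# 1 :+ x :* x) :* (:# 1 :+ x :* x))))) refl X)

    e₃²≈ : e₃ ^ 2 ≈ # 64 * (T * Π)
    e₃²≈ = trans (*-cong root (*-congʳ root)) (trans ((solve 3 (λ x y p → :# 8 :* (x :* (p :* y)) :* (:# 8 :* (x :*
        (p :* y)) :* :# 1) := :# 64 :* (x :* x :* (p :* p :* (y :* y)))) refl X (q ^ 4) p))
        (*-congˡ (*-congˡ (*-congˡ (sym (^-homo-* q 4 4))))))
      where
      root : e₃ ≈ # 8 * (X * (p * q ^ 4))
      root = (solve 1 (λ x → (:# 1 :+ x) :^ 4 :* (:- ((:# 1 :- x) :^ 4)) :* (:- ((:# 1 :+ x) :^ 4 :- (:# 1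
          :- x) :^ 4)) := :# 8 :* (x :* ((:# 1 :+ x :* x) :* (:# 1 :- x :* x) :^ 4))) refl X)

    -- `e₃` is odd in X and only its square is a series in T; homogeneity of even degree excludes
    -- the odd powers.
    2∣j : ∀ i j M → 2 ℕ.* i ℕ.+ 3 ℕ.* j ≡ M ℕ.* 2 → 2 ∣ j
    2∣j i j M eq = Div.∣m+n∣m⇒∣n (divides M (≡.trans (rearrange i j) eq)) (divides (i ℕ.+ j) (ℕₚ.*-comm 2 (i ℕ.+ j)))
      where
      rearrange : ∀ i j → 2 ℕ.* (i ℕ.+ j) ℕ.+ j ≡ 2 ℕ.* i ℕ.+ 3 ℕ.* j
      rearrange = ℕsolve-∀

    monomial-kernel : ∀ i j r e →
      e₂ ^ i * e₃ ^ (2 ℕ.* j) * kernel (j ℕ.+ r) e ≈ (- 1#) ^ i * ((# 64) ^ j * (T ^ j * (E ^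
          (i ℕ.+ e) * D * denominators r)))
    monomial-kernel i j r e = begin
      e₂ ^ i * e₃ ^ (2 ℕ.* j) * (E ^ e * D * denominators (j ℕ.+ r))
        ≈⟨ *-congʳ (*-cong (trans (^-congˡ i e₂≈-E) (^-distrib-* (- 1#) E i))
             (trans (sym (^-assocʳ e₃ 2 j)) (trans (^-congˡ j e₃²≈)
               (trans (^-distrib-* (# 64) (T * Π) j) (*-congˡ (^-distrib-* T Π j)))))) ⟩
      (- 1#) ^ i * E ^ i * ((# 64) ^ j * (T ^ j * Π ^ j)) * (E ^ e * D * denominators (j ℕ.+ r))
        ≈⟨ (solve 8 (λ s a c t P b d y → s :* a :* (c :* (t :* P)) :* (b :* d :* y) := s :* (c :* (t :*
            (a :* b :* d :* (P :* y))))) refl ((- 1#) ^ i) (E ^ i) ((# 64) ^ j) (T ^ j) (Π ^ j) (E ^ e) D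
            (denominators (j ℕ.+ r))) ⟩
      (- 1#) ^ i * ((# 64) ^ j * (T ^ j * (E ^ i * E ^ e * D * (Π ^ j * denominators (j ℕ.+ r)))))
        ≈⟨ *-congˡ (*-congˡ (*-congˡ (*-cong (*-congʳ (sym (^-homo-* E i e))) (Π^-denominators j r)))) ⟩
      (- 1#) ^ i * ((# 64) ^ j * (T ^ j * (E ^ (i ℕ.+ e) * D * denominators r))) ∎

  -- A monomial e₂^i e₃^(2j) cancels Δ^j and raises the power of E₄ by i. The degree condition i +
  -- 3j = M turns the hypothesis into i + e + 1 = 3(k - j), which is the case where the differential
  -- is exact; in particular j < k.
  span-kernel : ∀ {M y} k e → suc e ℕ.+ M ≡ 3 ℕ.* k → Span (M ℕ.* 2) y → Vanishes (k ℕ.* 2) (y * kernel k e)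
  span-kernel {M} k e eq (span-monomial i j deg) with 2∣j i j M deg
  ... | divides j′ ≡.refl = vanishes-resp (sym rewritten)
        (vanishes-^ (λ {f} v → vanishes-resp ((solve 1 (λ f → :- f := (:- :# 1) :* f) refl f)) (vanishes-neg v)) i
          (vanishes-^ (vanishes-# 64) j′ shifted))
    where
    i+3j′≡M : i ℕ.+ 3 ℕ.* j′ ≡ M
    i+3j′≡M = ℕₚ.*-cancelʳ-≡ _ _ 2 (≡.trans (rearrange i j′) deg)
      where
      rearrange : ∀ i j → (i ℕ.+ 3 ℕ.* j) ℕ.* 2 ≡ 2 ℕ.* i ℕ.+ 3 ℕ.* (j ℕ.* 2)
      rearrange = ℕsolve-∀
    j′<k : j′ ℕ.< k
    j′<k = ℕₚ.*-cancelˡ-< 3 j′ k (≡.subst (3 ℕ.* j′ ℕ.<_) eq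
      (ℕ.s≤s (ℕₚ.≤-trans (≡.subst (3 ℕ.* j′ ℕ.≤_) i+3j′≡M (ℕₚ.m≤n+m (3 ℕ.* j′) i)) (ℕₚ.m≤n+m M e))))
    r : ℕ
    r = k ℕ.∸ suc j′
    k≡ : k ≡ j′ ℕ.+ suc r
    k≡ = ≡.sym (≡.trans (ℕₚ.+-suc j′ r) (ℕₚ.m+[n∸m]≡n j′<k))
    degree : suc (i ℕ.+ e) ≡ 3 ℕ.* suc r
    degree = ℕₚ.+-cancelʳ-≡ (3 ℕ.* j′) _ _ (≡.trans (shuffle i e j′)
      (≡.trans (≡.cong (suc e ℕ.+_) i+3j′≡M) (≡.trans eq (≡.trans (≡.cong (3 ℕ.*_) k≡) (shuffle′ j′ (suc r))))))
      where
      shuffle : ∀ i e j → suc (i ℕ.+ e) ℕ.+ 3 ℕ.* j ≡ suc e ℕ.+ (i ℕ.+ 3 ℕ.* j)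
      shuffle = ℕsolve-∀
      shuffle′ : ∀ j r → 3 ℕ.* (j ℕ.+ r) ≡ 3 ℕ.* r ℕ.+ 3 ℕ.* j
      shuffle′ = ℕsolve-∀
    rewritten : e₂ ^ i * e₃ ^ (j′ ℕ.* 2) * kernel k e ≈
      (- 1#) ^ i * ((# 64) ^ j′ * (T ^ j′ * (E ^ (i ℕ.+ e) * D * denominators (suc r))))
    rewritten = trans (*-cong (*-congˡ (^-congʳ e₃ (ℕₚ.*-comm j′ 2))) (reflexive (≡.cong (λ l → kernel l e) k≡)))
      (monomial-kernel i j′ (suc r) e)
    index : k ℕ.* 2 ≡ j′ ℕ.* 2 ℕ.+ suc r ℕ.* 2
    index = ≡.trans (≡.cong (ℕ._* 2) k≡) (ℕₚ.*-distribʳ-+ 2 j′ (suc r))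
    shifted : Vanishes (k ℕ.* 2) (T ^ j′ * (E ^ (i ℕ.+ e) * D * denominators (suc r)))
    shifted = ≡.subst (λ l → Vanishes l (T ^ j′ * (E ^ (i ℕ.+ e) * D * denominators (suc r)))) (≡.sym index)
      (F.trans (coeff-T^* j′ _ (suc r ℕ.* 2)) (residue-vanishes r (i ℕ.+ e) degree))
  span-kernel k e eq span-0 = vanishes-resp (sym (zeroˡ _)) (coeff-0 (k ℕ.* 2))
  span-kernel k e eq (span-+ s t) = vanishes-resp (sym (distribʳ _ _ _)) (vanishes-+ (span-kernel k e eq s)
      (span-kernel k e eq t))
  span-kernel k e eq (span-neg {y} s) = vanishes-resp ((solve 2 (λ y K → :- (y :* K) := (:- y) :* K) refl y
      (kernel k e))) (vanishes-neg (span-kernel k e eq s))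
  span-kernel k e eq (span-resp y≈y′ s) = vanishes-resp (*-congʳ y≈y′) (span-kernel k e eq s)

  -- `𝐏`⁴ times (1 - 2w)(ω - w)(1 - (ω² + 3ω)w - ωw²) at w = `𝐐`/`𝐏`. The first factor is the part
  -- of `D` that changes sign; the positive `sextic` is kept apart.
  numerator : F.Carrier → Series
  numerator ω = (𝐏 - # 2 * 𝐐) * ((constant ω * 𝐏 - 𝐐) *
    (𝐏 * 𝐏 - (constant ω * constant ω + # 3 * constant ω) * (𝐏 * 𝐐) - constant ω * (𝐐 * 𝐐)))

  sextic : Series
  sextic = 1# + # 6 * T + T * T

  combinedKernel : F.Carrier → ℕ → ℕ → Series
  combinedKernel ω k e = E ^ e * (sextic * (numerator ω * denominators (suc k)))

  -- ω(1 + w)³ − w(1 + ω)³ = (ω − w)(1 − (ω² + 3ω)w − ωw²): the two residue identities are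
  -- combined so that the kernel vanishes at w = 𝐐/𝐏 = ω.
  span-combinedKernel : ∀ {M y} ω k e → suc e ℕ.+ M ≡ 3 ℕ.* k → Span (M ℕ.* 2) y →
                        Vanishes (suc k ℕ.* 2) (y * combinedKernel ω k e)
  span-combinedKernel {M} {y} ω k e eq s = vanishes-resp identity
    (vanishes-+ (vanishes-constant ω (span-kernel (suc k) (3 ℕ.+ e) eq′ s))
      (vanishes-neg (cube (vanishes-# 64 (F.trans (coeff-T*-+2 (y * kernel k e) (k ℕ.* 2)) (span-kernel k e eq s))))))
    where
    w d f : Series
    w = constant ω
    d = denominators (suc k)
    -- The factor T moves the identity for `k` to the index of the one for k + 1, and 64 T `Π` =
    -- `𝐏`²`𝐐` brings both over the same denominators.
    f = # 64 * (T * (y * kernel k e))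
    eq′ : suc (3 ℕ.+ e) ℕ.+ M ≡ 3 ℕ.* suc k
    eq′ = ≡.trans (≡.cong (3 ℕ.+_) eq) (≡.sym (ℕₚ.*-suc 3 k))
    plus-one : ∀ {f} → Vanishes (suc k ℕ.* 2) f → Vanishes (suc k ℕ.* 2) ((1# + w) * f)
    plus-one {f} v = vanishes-resp ((solve 2 (λ w f → f :+ w :* f := (:# 1 :+ w) :* f) refl w f)) (vanishes-+ v
        (vanishes-constant ω v))
    cube : ∀ {f} → Vanishes (suc k ℕ.* 2) f → Vanishes (suc k ℕ.* 2) ((1# + w) * ((1# + w) * ((1# + w) * f)))
    cube v = plus-one (plus-one (plus-one v))
    64TΠ : # 64 * (T * Π) ≈ 𝐏 * 𝐏 * 𝐐
    64TΠ = (solve 3 (λ t p q → :# 64 :* (t :* (p :* p :* q :^ 8)) := q :* q :* (q :* q) :* (q :* q :* (q :* q)) :*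
        (:# 64 :* (t :* (p :* p)))) refl T p q)
    f≈ : f ≈ 𝐏 * 𝐏 * 𝐐 * (y * (E ^ e * D) * d)
    f≈ = trans (*-congˡ (*-congˡ (*-congˡ (*-congˡ (denominators-Π k)))))
      (trans ((solve 5 (λ t y a P d → :# 64 :* (t :* (y :* (a :* (P :* d)))) := :# 64 :* (t :* P) :*
          (y :* a :* d)) refl T y (E ^ e * D) Π d)) (*-congʳ 64TΠ))
    identity : w * (y * kernel (suc k) (3 ℕ.+ e)) - (1# + w) * ((1# + w) * ((1# + w) * f)) ≈ y * combinedKernel ω k e
    identity = trans (+-congˡ (-‿cong (*-congˡ (*-congˡ (*-congˡ f≈)))))
      ((solve 7 (λ w y a s P Q d → w :* (y :* ((P :+ Q) :* ((P :+ Q) :* ((P :+ Q) :* a)) :* (s :* (P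
          :- :# 2 :* Q)) :* d)) :- (:# 1 :+ w) :* ((:# 1 :+ w) :* ((:# 1 :+ w) :* (P :* P :* Q :* (y :* (a :* (s :*
          (P :- :# 2 :* Q))) :* d)))) := y :* (a :* (s :* ((P :- :# 2 :* Q) :* ((w :* P :- Q) :* (P :* P :- (w :* w
          :+ :# 3 :* w) :* (P :* Q) :- w :* (Q :* Q))) :* d)))) refl w y (E ^ e) sextic 𝐏 𝐐 d))

  -- The logarithmic derivative of p^(-1-2κ) q^(-1-8κ) with κ = k + 1, multiplied by pq = 1 - T².
  -- Coefficientwise it is the three-term recursion behind `CoefficientRatios`.
  denominators-equation : ∀ k → let f = denominators (suc k) in
    θ f - T * (T * θ f) ≈ # 2 * (T * (# 6 * (# suc k * f) + T * (# 10 * (# suc k * f) + # 2 * f)))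
  denominators-equation k = trans (+-cong θf (-‿cong (*-congˡ (*-congˡ θf))))
    (trans ((solve 7 (λ t x y a d a₁ d₁ → ((:- (x :* (:# 2 :* t :* a₁))) :* d :+ a :* (y :* (:# 2 :* t :* d₁)))
        :- t :* (t :* ((:- (x :* (:# 2 :* t :* a₁))) :* d :+ a :* (y :* (:# 2 :* t :* d₁)))) := :# 2 :* (t :* (y :*
        ((:# 1 :+ t) :* (a :* ((:# 1 :- t) :* d₁))) :- x :* ((:# 1 :- t) :* (((:# 1 :+ t) :* a₁) :* d))))) refl T
        (# xₑ) (# yₑ) a d a₁ d₁))
    (trans (*-congˡ (*-congˡ (+-cong
        (*-cong (#-affine 8) (*-congˡ (*-congˡ q*d₁)))
        (-‿cong (*-cong (#-affine 2) (*-congˡ (*-congʳ p*a₁)))))))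
      ((solve 4 (λ t k a d → :# 2 :* (t :* ((:# 1 :+ :# 8 :* k) :* ((:# 1 :+ t) :* (a :* d)) :- (:# 1
          :+ :# 2 :* k) :* ((:# 1 :- t) :* (a :* d)))) := :# 2 :* (t :* (:# 6 :* (k :* (a :* d)) :+ t :* (:# 10 :*
          (k :* (a :* d)) :+ :# 2 :* (a :* d))))) refl T (# suc k) a d))))
    where
    xₑ yₑ : ℕ
    xₑ = 1 ℕ.+ 2 ℕ.* suc k
    yₑ = 1 ℕ.+ 8 ℕ.* suc k
    a a₁ d d₁ : Series
    a  = p⁻¹ ^ xₑ
    a₁ = p⁻¹ ^ suc xₑ
    d  = q⁻¹ ^ yₑ
    d₁ = q⁻¹ ^ suc yₑ
    p*a₁ : p * a₁ ≈ a
    p*a₁ = trans (sym (*-assoc p p⁻¹ a)) (trans (*-congʳ p*p⁻¹≈1) (*-identityˡ a))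
    q*d₁ : q * d₁ ≈ d
    q*d₁ = trans (sym (*-assoc q q⁻¹ d)) (trans (*-congʳ q*q⁻¹≈1) (*-identityˡ d))
    #-affine : ∀ c → # (1 ℕ.+ c ℕ.* suc k) ≈ 1# + # c * # suc k
    #-affine c = trans (#-suc (c ℕ.* suc k))
      (+-congˡ (trans (reflexive (≡.cong fromℤ (ℤₚ.pos-* c (suc k)))) (fromℤ-* (+ c) (+ suc k))))
    θf : θ (a * d) ≈ (- (# xₑ * (# 2 * T * a₁))) * d + a * (# yₑ * (# 2 * T * d₁))
    θf = trans (θ-* a d) (+-cong (*-congʳ (θ-p⁻¹^ xₑ)) (*-congˡ (θ-q⁻¹^ yₑ)))

-- From signs of coefficients to the absence of a gap in the weights

-- Q is one of 0 ≤_ and 0 <_, and I d is the set of indices s at which the coefficient of X²ˢ is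
-- controlled after multiplication by a polynomial of degree d in T.
module Positivity (F : OrderedField) (Q : OrderedField.Carrier F → Set)
  (Q-resp : ∀ {x y} → OrderedField._≈_ F x y → Q x → Q y) (Q-+ : ∀ {x y} → Q x → Q y → Q (OrderedField._+_ F x y))
  (Q-# : ∀ k {x} → Q x → Q (OrderedField._*_ F (OrderedField.#_ F (suc k)) x))
  (I : ℕ → ℕ → Set) (I-mono : ∀ {d s} → I (suc d) s → I d s) (I-shift : ∀ {d s} → I (suc d) (suc s) → I d s)
  (I-zero : ∀ {d} → I (suc d) 0 → Q (OrderedField.0# F)) where

  private module F = OrderedField F
  open Functional F
  open CommutativeRing seriesRing hiding (zero)
  open IntegerCoefficients seriesRing
  open import Algebra.Properties.Semiring.Exp semiring using (_^_)

  record QQ (d : ℕ) (f : Series) : Set where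
    constructor qq
    field holds : ∀ s → I d s → Q (coeff f (s ℕ.* 2))
  open QQ public

  qq-resp : ∀ {d f g} → f ≈ g → QQ d f → QQ d g
  qq-resp f≈g Qf = qq λ s i → Q-resp (at f≈g (s ℕ.* 2)) (holds Qf s i)

  qq-mono : ∀ {d f} → QQ d f → QQ (suc d) f
  qq-mono Qf = qq λ s i → holds Qf s (I-mono i)

  qq-+ : ∀ {d f g} → QQ d f → QQ d g → QQ d (f + g)
  qq-+ {f = f} {g} Qf Qg = qq λ s i → Q-resp (F.sym (coeff-+ f g (s ℕ.* 2))) (Q-+ (holds Qf s i) (holds Qg s i))

  qq-# : ∀ {d} k {f} → QQ d f → QQ d (# suc k * f)
  qq-# k {f} Qf = qq λ s i → Q-resp (F.sym (coeff-#* (suc k) f (s ℕ.* 2))) (Q-# k (holds Qf s i))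

  qq-T : ∀ {d f} → QQ d f → QQ (suc d) (T * f)
  qq-T {f = f} Qf = qq λ
    { zero    i → Q-resp (F.sym (coeff-T*-0 f)) (I-zero i)
    ; (suc s) i → Q-resp (F.sym (coeff-T*-+2 f (s ℕ.* 2))) (holds Qf s (I-shift i)) }

  private
    horner : ∀ {d} k {f g} → QQ d f → QQ d g → QQ (suc d) (# suc k * f + T * g)
    horner k Qf Qg = qq-+ (qq-mono (qq-# k Qf)) (qq-T Qg)

  qq-p : ∀ {d f} → QQ d f → QQ (suc d) (p * f)
  qq-p {f = f} Qf = qq-resp ((solve 2 (λ t f → :# 1 :* f :+ t :* f := (:# 1 :+ t) :* f) refl T f)) (horner 0 Qf Qf)

  qq-p^ : ∀ {d f} h → QQ d f → QQ (h ℕ.+ d) (p ^ h * f)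
  qq-p^ {f = f} zero Qf = qq-resp (sym (*-identityˡ f)) Qf
  qq-p^ {f = f} (suc h) Qf = qq-resp (sym (*-assoc p (p ^ h) f)) (qq-p (qq-p^ h Qf))

  qq-sextic : ∀ {d f} → QQ d f → QQ (2 ℕ.+ d) (sextic * f)
  qq-sextic {f = f} Qf = qq-resp ((solve 2 (λ t f → :# 1 :* f :+ t :* (:# 6 :* f :+ t :* f) := (:# 1 :+ :# 6 :* t
      :+ t :* t) :* f) refl T f))
    (horner 0 (qq-mono Qf) (horner 5 Qf Qf))

  qq-E : ∀ {d f} → QQ d f → QQ (4 ℕ.+ d) (E * f)
  qq-E {f = f} Qf = qq-resp ((solve 2 (λ t f → :# 1 :* f :+ t :* (:# 60 :* f :+ t :* (:# 134 :* f :+ t :*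
      (:# 60 :* f :+ t :* f))) := ((:# 1 :- t) :* (:# 1 :- t) :* ((:# 1 :- t) :* (:# 1 :- t)) :+ :# 64 :* (t :*
      ((:# 1 :+ t) :* (:# 1 :+ t)))) :* f) refl T f))
    (horner 0 (qq-mono (qq-mono (qq-mono Qf))) (horner 59 (qq-mono (qq-mono Qf))
      (horner 133 (qq-mono Qf) (horner 59 Qf Qf))))

  qq-E^ : ∀ {d f} e → QQ d f → QQ (e ℕ.* 4 ℕ.+ d) (E ^ e * f)
  qq-E^ {f = f} zero Qf = qq-resp (sym (*-identityˡ f)) Qf
  qq-E^ {f = f} (suc e) Qf = qq-resp (sym (*-assoc E (E ^ e) f)) (qq-E (qq-E^ e Qf))

module CodeKernel (F : OrderedField) {n : ℕ} (C : Code n) (typeII : TypeII C) where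

  private
    module F = OrderedField F
    module Fₚ = OrderedFieldProperties F
    module FSums = Sums F.commutativeRing
  open Functional F
  open TypeIICode C typeII
  open WeightEnumerator C typeII seriesRing
  open CommutativeRing seriesRing hiding (zero)
  open IntegerCoefficients seriesRing
  open Sums seriesRing
  open import Algebra.Properties.Semiring.Exp semiring using (_^_; ^-homo-*; ^-assocʳ; ^-congʳ; ^-congˡ)
  open import Algebra.Properties.CommutativeSemiring.Exp commutativeSemiring using (^-distrib-*)
  open import Relation.Binary.Reasoning.Setoid setoid

  private
    coeff-∑ : ∀ {A : Set} (xs : List A) f N → coeff (∑ xs f) N F.≈ FSums.∑ xs (λ x → coeff (f x) N)
    coeff-∑ []       f N = coeff-0 N
    coeff-∑ (x ∷ xs) f N = F.trans (coeff-+ (f x) (∑ xs f) N) (F.+-congˡ (coeff-∑ xs f N))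

    ∑-nonNegative : ∀ {A : Set} (xs : List A) f → (∀ x → F.0# F.≤ f x) → F.0# F.≤ FSums.∑ xs f
    ∑-nonNegative []       f f≥0 = Fₚ.≤-refl
    ∑-nonNegative (x ∷ xs) f f≥0 = Fₚ.+-nonNeg (f≥0 x) (∑-nonNegative xs f f≥0)

    ∑-positive : ∀ {A : Set} {xs : List A} {x} f → (∀ x → F.0# F.≤ f x) → x ∈ xs → F.0# F.< f x
        → F.0# F.< FSums.∑ xs f
    ∑-positive {xs = x ∷ xs} f f≥0 (here ≡.refl) fx>0 = Fₚ.+-pos-nonNeg fx>0 (∑-nonNegative xs f f≥0)
    ∑-positive {xs = y ∷ xs} f f≥0 (there x∈xs) fx>0 = Fₚ.0<-resp (F.+-comm _ _)
      (Fₚ.+-pos-nonNeg (∑-positive f f≥0 x∈xs fx>0) (f≥0 y))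

  word : Vec (Fin 4) n → Series
  word = codewordTerm ((1# + X) + (1# - X)) ((1# + X) - (1# - X)) z

  private
    word-form : ∀ c j K → n₁ c / 4 ℕ.+ n₂ c ≡ j ℕ.* 2 → let h = n₁ c / 4 in
      word c * K ≈ (# 2) ^ n₀ c * ((# 2) ^ n₂ c * ((# 8) ^ h * (T ^ j * (p ^ h * K))))
    word-form c j K 2j = begin
      ((1# + X) + (1# - X)) ^ n₀ c * ((1# + X) - (1# - X)) ^ n₂ c * z ^ h * K
        ≈⟨ *-congʳ (*-cong (*-cong (^-congˡ (n₀ c) ((solve 1 (λ x → (:# 1 :+ x) :+ (:# 1 :- x) := :# 2) refl X)))
             (trans (^-congˡ (n₂ c) ((solve 1 (λ x → (:# 1 :+ x) :- (:# 1 :- x) := :# 2 :* x) refl X))) (^-distrib-*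
                 (# 2) X (n₂ c))))
             (trans (^-congˡ h ((solve 1 (λ x → (:# 1 :+ x) :^ 4 :- (:# 1 :- x) :^ 4 := :# 8 :* (x :* (:# 1
                 :+ x :* x))) refl X)))
               (trans (^-distrib-* (# 8) (X * p) h) (*-congˡ (^-distrib-* X p h))))) ⟩
      (# 2) ^ n₀ c * ((# 2) ^ n₂ c * X ^ n₂ c) * ((# 8) ^ h * (X ^ h * p ^ h)) * K
        ≈⟨ (solve 7 (λ a b x d y P K → a :* (b :* x) :* (d :* (y :* P)) :* K := a :* (b :* (d :* ((y :* x) :*
            (P :* K))))) refl ((# 2) ^ n₀ c) ((# 2) ^ n₂ c) (X ^ n₂ c) ((# 8) ^ h) (X ^ h) (p ^ h) K) ⟩
      (# 2) ^ n₀ c * ((# 2) ^ n₂ c * ((# 8) ^ h * ((X ^ h * X ^ n₂ c) * (p ^ h * K))))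
        ≈⟨ *-congˡ (*-congˡ (*-congˡ (*-congʳ Xʲ))) ⟩
      (# 2) ^ n₀ c * ((# 2) ^ n₂ c * ((# 8) ^ h * (T ^ j * (p ^ h * K)))) ∎
      where
      h = n₁ c / 4
      Xʲ : X ^ h * X ^ n₂ c ≈ T ^ j
      Xʲ = trans (sym (^-homo-* X h (n₂ c))) (trans (^-congʳ X (≡.trans 2j (ℕₚ.*-comm j 2)))
        (trans (sym (^-assocʳ X 2 j)) (^-congˡ j ((solve 1 (λ x → x :* (x :* :# 1) := x :* x) refl X)))))

    coeff-T^*-below : ∀ j f i → i ℕ.< j → coeff (T ^ j * f) (i ℕ.* 2) F.≈ F.0#
    coeff-T^*-below (suc j) f zero _ = F.trans (at (*-assoc T (T ^ j) f) 0) (coeff-T*-0 _)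
    coeff-T^*-below (suc j) f (suc i) (ℕ.s≤s i<j) = F.trans (at (*-assoc T (T ^ j) f) (2 ℕ.+ i ℕ.* 2))
      (F.trans (coeff-T*-+2 _ (i ℕ.* 2)) (coeff-T^*-below j f i i<j))

    coeff-T^*-above : ∀ j f i → j ℕ.≤ i → coeff (T ^ j * f) (i ℕ.* 2) F.≈ coeff f ((i ℕ.∸ j) ℕ.* 2)
    coeff-T^*-above j f i j≤i = F.trans (F.reflexive (≡.cong (coeff (T ^ j * f)) index)) (coeff-T^* j f
        ((i ℕ.∸ j) ℕ.* 2))
      where
      index : i ℕ.* 2 ≡ j ℕ.* 2 ℕ.+ (i ℕ.∸ j) ℕ.* 2
      index = ≡.trans (≡.cong (ℕ._* 2) (≡.sym (ℕₚ.m+[n∸m]≡n j≤i))) (ℕₚ.*-distribʳ-+ 2 j (i ℕ.∸ j))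

    scale-≥ : ∀ k N i {f} → F.0# F.≤ coeff f N → F.0# F.≤ coeff ((# suc k) ^ i * f) N
    scale-≥ k N zero {f} f≥0 = Fₚ.0≤-resp (F.sym (at (*-identityˡ f) N)) f≥0
    scale-≥ k N (suc i) {f} f≥0 = Fₚ.0≤-resp (F.sym (F.trans (at (*-assoc (# suc k) _ f) N) (coeff-#* (suc k) _ N)))
      (F.*-nonNeg (Fₚ.#-nonNeg (suc k)) (scale-≥ k N i f≥0))

    scale-> : ∀ k N i {f} → F.0# F.< coeff f N → F.0# F.< coeff ((# suc k) ^ i * f) N
    scale-> k N zero {f} f>0 = Fₚ.0<-resp (F.sym (at (*-identityˡ f) N)) f>0
    scale-> k N (suc i) {f} f>0 = Fₚ.0<-resp (F.sym (F.trans (at (*-assoc (# suc k) _ f) N) (coeff-#* (suc k) _ N)))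
      (Fₚ.*-pos (Fₚ.#-pos k) (scale-> k N i f>0))

  code-sum-vanishes : ∀ ω k e → suc e ℕ.+ m ≡ 3 ℕ.* k →
    FSums.∑ (vecs 4 n) (λ c → coeff (fromℤ (ind c) * (word c * combinedKernel ω k e)) (suc k ℕ.* 2)) F.≈ F.0#
  code-sum-vanishes ω k e eq = cancel (F.trans (F.*-congˡ (F.sym (coeff-∑ (vecs 4 n) _ N)))
    (F.trans (F.sym (coeff-#* 6 _ N)) (vanishes-resp rewritten
      (span-combinedKernel ω k e eq (6P-span x₁ x₂ x₃ e₁≈0)))))
    where
    N : ℕ
    N = suc k ℕ.* 2
    K : Series
    K = combinedKernel ω k e
    cancel : ∀ {x} → F.# 6 F.* x F.≈ F.0# → x F.≈ F.0#
    cancel {x} 6x≈0 = F.≤-antisym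
      (Fₚ.*-cancelˡ-≤ (Fₚ.#-pos 5) (F.≤-reflexive (F.trans 6x≈0 (F.sym (F.*-zeroʳ _)))))
      (Fₚ.*-cancelˡ-≤ (Fₚ.#-pos 5) (F.≤-reflexive (F.trans (F.*-zeroʳ _) (F.sym 6x≈0))))
    rewritten : # 6 * P x₁ (- x₂) (- x₃) * K ≈ # 6 * ∑[ c ← vecs 4 n ] (fromℤ (ind c) * (word c * K))
    rewritten = begin
      # 6 * P x₁ (- x₂) (- x₃) * K
        ≈⟨ *-congʳ (*-congˡ (P-cong refl ((solve 1 (λ v → :- (:- v) := v) refl v)) ((solve 1 (λ z → :- (:- z)
            := z) refl z)))) ⟩
      # 6 * P u v z * K
        ≈⟨ *-congʳ (*-congˡ (P-codewords (1# + X) (1# - X) z)) ⟩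
      # 6 * (∑[ c ← vecs 4 n ] (fromℤ (ind c) * word c)) * K
        ≈⟨ *-assoc _ _ _ ⟩
      # 6 * ((∑[ c ← vecs 4 n ] (fromℤ (ind c) * word c)) * K)
        ≈⟨ *-congˡ (trans (∑-*ʳ (vecs 4 n) K _) (∑-cong (vecs 4 n) (λ c → *-assoc _ _ _))) ⟩
      # 6 * ∑[ c ← vecs 4 n ] (fromℤ (ind c) * (word c * K)) ∎

  -- A gap in the weights would make every term of the vanishing sum nonnegative and the term of 0 positive.
  no-gap : ∀ ω k e S → suc e ℕ.+ m ≡ 3 ℕ.* k → e ℕ.≤ 2 →
    (∀ s → s ℕ.≤ S → F.0# F.≤ coeff (numerator ω * denominators (suc k)) (s ℕ.* 2)) →
    (∀ s → k ℕ.≤ s ℕ.+ 9 → s ℕ.≤ suc k → F.0# F.< coeff (numerator ω * denominators (suc k)) (s ℕ.* 2)) →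
    (∀ c → c ∈C C → isZero c ≡ false → suc k ℕ.* 8 ℕ.≤ wtE c ℕ.+ S ℕ.* 8) → 9 ℕ.≤ k → ⊥
  no-gap ω k e S eq e≤2 low high gap 9≤k = ∑-positive value value≥0 (∈-vecs 0ⁿ) value-0>0
    (F.≤-reflexive (code-sum-vanishes ω k e eq))
    where
    N : ℕ
    N = suc k ℕ.* 2
    K : Series
    K = combinedKernel ω k e
    value : Vec (Fin 4) n → F.Carrier
    value c = coeff (fromℤ (ind c) * (word c * K)) N

    Up-to-S Window : ℕ → ℕ → Set
    Up-to-S _ s = s ℕ.≤ S
    -- The product of E^e and `sextic` has degree at most 10 in T since e ≤ 2, so its effect on
    -- index k + 1 involves only the indices from k - 9 on. Strict positivity is needed there alone,
    -- for the zero codeword.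
    Window d s = (k ℕ.∸ 9 ℕ.+ d ℕ.≤ s) × (s ℕ.≤ suc k)

    scale-nonNeg : ∀ i {x} → F.0# F.≤ x → F.0# F.≤ F.# suc i F.* x
    scale-nonNeg i = F.*-nonNeg (Fₚ.#-nonNeg (suc i))
    scale-pos : ∀ i {x} → F.0# F.< x → F.0# F.< F.# suc i F.* x
    scale-pos i = Fₚ.*-pos (Fₚ.#-pos i)
    +-pos : ∀ {x y} → F.0# F.< x → F.0# F.< y → F.0# F.< x F.+ y
    +-pos x>0 y>0 = Fₚ.+-pos-nonNeg x>0 (Fₚ.<⇒≤ y>0)

    up-to-shift : ∀ {s} → suc s ℕ.≤ S → s ℕ.≤ S
    up-to-shift = ℕₚ.≤-trans (ℕₚ.n≤1+n _)
    up-to-zero : 0 ℕ.≤ S → F.0# F.≤ F.0#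
    up-to-zero _ = Fₚ.≤-refl
    window-mono : ∀ {d s} → Window (suc d) s → Window d s
    window-mono {d} (lo , hi) = ℕₚ.≤-trans (ℕₚ.+-monoʳ-≤ (k ℕ.∸ 9) (ℕₚ.n≤1+n d)) lo , hi
    window-shift : ∀ {d s} → Window (suc d) (suc s) → Window d s
    window-shift {d} {s} (lo , hi) =
      ℕₚ.≤-pred (≡.subst (ℕ._≤ suc s) (ℕₚ.+-suc (k ℕ.∸ 9) d) lo) , ℕₚ.≤-trans (ℕₚ.n≤1+n s) hi
    window-zero : ∀ {d} → Window (suc d) 0 → F.0# F.< F.0#
    window-zero {d} (lo , _) = ⊥-elim (ℕₚ.<⇒≱ (ℕ.s≤s ℕ.z≤n) (ℕₚ.≤-trans (ℕₚ.m≤n+m (suc d) (k ℕ.∸ 9)) lo))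

    module Low = Positivity F (F.0# F.≤_) Fₚ.0≤-resp Fₚ.+-nonNeg scale-nonNeg Up-to-S (λ i → i) up-to-shift up-to-zero
    module High = Positivity F (F.0# F.<_) Fₚ.0<-resp +-pos scale-pos Window window-mono window-shift window-zero

    kernel-low : ∀ h s → s ℕ.≤ S → F.0# F.≤ coeff (p ^ h * K) (s ℕ.* 2)
    kernel-low h = Low.holds (Low.qq-p^ {d = e ℕ.* 4 ℕ.+ 2} h (Low.qq-E^ {d = 2} e (Low.qq-sextic {d = 0}
        (Low.qq low))))

    low-in-range : ∀ c → suc k ℕ.* 8 ℕ.≤ wtE c ℕ.+ S ℕ.* 8 → ∀ j → n₁ c / 4 ℕ.+ n₂ c ≡ j ℕ.* 2 → c ∈C C
        → suc k ℕ.∸ j ℕ.≤ S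
    low-in-range c big j 2j c∈C = ℕₚ.m≤n+o⇒m∸n≤o (suc k) j
      (ℕₚ.*-cancelʳ-≤ (suc k) (j ℕ.+ S) 8 (≡.subst (suc k ℕ.* 8 ℕ.≤_) total big))
      where
      total : wtE c ℕ.+ S ℕ.* 8 ≡ (j ℕ.+ S) ℕ.* 8
      total = ≡.trans (≡.cong (ℕ._+ S ℕ.* 8) (wtE≡8j c∈C j 2j)) (≡.sym (ℕₚ.*-distribʳ-+ 8 j S))

    word-value≥0 : ∀ c → c ∈C C → isZero c ≡ false → F.0# F.≤ coeff (word c * K) N
    word-value≥0 c c∈C c≢0 with 2∣n₁/4+n₂ c∈C
    ... | divides j 2j = Fₚ.0≤-resp (F.sym (at (word-form c j K 2j) N))
          (scale-≥ 1 N (n₀ c) (scale-≥ 1 N (n₂ c) (scale-≥ 7 N (n₁ c / 4) shifted)))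
      where
      shifted : F.0# F.≤ coeff (T ^ j * (p ^ (n₁ c / 4) * K)) N
      shifted with j ℕ.≤? suc k
      ... | yes j≤ = Fₚ.0≤-resp (F.sym (coeff-T^*-above j _ (suc k) j≤))
              (kernel-low (n₁ c / 4) (suc k ℕ.∸ j) (low-in-range c (gap c c∈C c≢0) j 2j c∈C))
      ... | no j≰ = F.≤-reflexive (F.sym (coeff-T^*-below j _ (suc k) (ℕₚ.≰⇒> j≰)))

    zero-counts : ∀ {k} (c : Vec (Fin 4) k) → isZero c ≡ true → (n₁ c ≡ 0) × (n₂ c ≡ 0)
    zero-counts [] _ = ≡.refl , ≡.refl
    zero-counts (zero ∷ c) eq = zero-counts c eq

    word-value>0 : ∀ c → isZero c ≡ true → F.0# F.< coeff (word c * K) N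
    word-value>0 c c≡0 = Fₚ.0<-resp (F.sym (at (word-form c 0 K counts) N))
      (scale-> 1 N (n₀ c) (scale-> 1 N (n₂ c) (scale-> 7 N (n₁ c / 4)
        (Fₚ.0<-resp (F.sym (at (trans (*-identityˡ _) (trans (*-congʳ (^-congʳ p h≡0))
            (*-identityˡ K))) N)) kernel-high))))
      where
      h≡0 : n₁ c / 4 ≡ 0
      h≡0 = ≡.cong (_/ 4) (proj₁ (zero-counts c c≡0))
      counts : n₁ c / 4 ℕ.+ n₂ c ≡ 0
      counts = ≡.cong₂ ℕ._+_ h≡0 (proj₂ (zero-counts c c≡0))
      window : k ℕ.∸ 9 ℕ.+ (e ℕ.* 4 ℕ.+ (2 ℕ.+ 0)) ℕ.≤ suc k
      window = ℕₚ.≤-trans (ℕₚ.+-monoʳ-≤ (k ℕ.∸ 9) (ℕₚ.+-monoˡ-≤ 2 (ℕₚ.*-monoˡ-≤ 4 e≤2)))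
        (ℕₚ.≤-reflexive (≡.trans (ℕₚ.+-suc (k ℕ.∸ 9) 9) (≡.cong suc (ℕₚ.m∸n+n≡m 9≤k))))
      ∸-swap : ∀ s → k ℕ.∸ 9 ℕ.≤ s → k ℕ.≤ s ℕ.+ 9
      ∸-swap s le = ≡.subst (ℕ._≤ s ℕ.+ 9) (ℕₚ.m∸n+n≡m 9≤k) (ℕₚ.+-monoˡ-≤ 9 le)
      kernel-high : F.0# F.< coeff K N
      kernel-high = High.holds (High.qq-E^ {d = 2} e (High.qq-sextic {d = 0}
        (High.qq λ s (lo , hi) → high s (∸-swap s (≡.subst (ℕ._≤ s) (ℕₚ.+-identityʳ (k ℕ.∸ 9)) lo)) hi))) (suc k)
            (window , ℕₚ.≤-refl)

    term≥0 : ∀ c → F.0# F.≤ coeff (word c * K) N → F.0# F.≤ coeff (1# * (word c * K)) N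
    term≥0 c = Fₚ.0≤-resp (F.sym (at (*-identityˡ _) N))

    value≥0 : ∀ c → F.0# F.≤ value c
    value≥0 c with C c in c∈
    ... | false = F.≤-reflexive (F.sym (F.trans (at (zeroˡ _) N) (coeff-0 N)))
    ... | true with isZero c in c-zero
    ...   | false = term≥0 c (word-value≥0 c c∈ c-zero)
    ...   | true  = term≥0 c (Fₚ.<⇒≤ (word-value>0 c c-zero))

    isZero-0ⁿ : ∀ k → isZero (Vec.replicate k zero) ≡ true
    isZero-0ⁿ zero    = ≡.refl
    isZero-0ⁿ (suc k) = isZero-0ⁿ k

    value-0>0 : F.0# F.< value 0ⁿ
    value-0>0 = Fₚ.0<-resp (F.sym (at (trans (*-congʳ (reflexive (≡.cong fromℤ ind-0))) (*-identityˡ _)) N))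
      (word-value>0 0ⁿ (isZero-0ⁿ n))
      where
      ind-0 : ind 0ⁿ ≡ + 1
      ind-0 rewrite 0∈C = ≡.refl

-- Polynomials, their evaluation and bounds on the unit interval

-- One piece of syntax serves two evaluations: at the series T, where it yields `numerator`, and at
-- numbers, where it yields the function whose sign is studied.
data PolyExpr (A : Set) : Set where
  coef : A → PolyExpr A
  num : ℕ → PolyExpr A
  arg : PolyExpr A
  _⊞_ _⊠_ : PolyExpr A → PolyExpr A → PolyExpr A
  ⊟_ : PolyExpr A → PolyExpr A

module Polynomials (K : CommutativeRing 0ℓ 0ℓ) where

  private
    module K = CommutativeRing K
    module KI = IntegerCoefficients K

  Poly : Set
  Poly = List K.Carrier

  _+ₚ_ : Poly → Poly → Poly
  []      +ₚ g       = g
  (c ∷ f) +ₚ []      = c ∷ f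
  (c ∷ f) +ₚ (d ∷ g) = (c K.+ d) ∷ (f +ₚ g)

  scale : K.Carrier → Poly → Poly
  scale c []      = []
  scale c (d ∷ f) = (c K.* d) ∷ scale c f

  _*ₚ_ : Poly → Poly → Poly
  []      *ₚ g = []
  (c ∷ f) *ₚ g = scale c g +ₚ (K.0# ∷ (f *ₚ g))

  expand : PolyExpr K.Carrier → Poly
  expand (coef c) = c ∷ []
  expand (num k) = KI.# k ∷ []
  expand arg     = K.0# ∷ K.1# ∷ []
  expand (e ⊞ f) = expand e +ₚ expand f
  expand (e ⊠ f) = expand e *ₚ expand f
  expand (⊟ e)   = scale (K.- K.1#) (expand e)

  module Evaluation (R : CommutativeRing 0ℓ 0ℓ) (φ : K.Carrier → CommutativeRing.Carrier R)
    (φ-+ : ∀ c d → CommutativeRing._≈_ R (φ (c K.+ d)) (CommutativeRing._+_ R (φ c) (φ d)))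
    (φ-* : ∀ c d → CommutativeRing._≈_ R (φ (c K.* d)) (CommutativeRing._*_ R (φ c) (φ d)))
    (φ-0 : CommutativeRing._≈_ R (φ K.0#) (CommutativeRing.0# R))
    (φ-1 : CommutativeRing._≈_ R (φ K.1#) (CommutativeRing.1# R))
    (φ-neg : ∀ c → CommutativeRing._≈_ R (φ (K.- c)) (CommutativeRing.-_ R (φ c)))
    (φ-cong : ∀ {c d} → c K.≈ d → CommutativeRing._≈_ R (φ c) (φ d)) (x : CommutativeRing.Carrier R) where

    open CommutativeRing R
    open IntegerCoefficients R
    open import Relation.Binary.Reasoning.Setoid setoid

    ev : Poly → Carrier
    ev []      = 0#
    ev (c ∷ f) = φ c + x * ev f

    meaning : PolyExpr K.Carrier → Carrier
    meaning (coef c) = φ c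
    meaning (num k) = # k
    meaning arg     = x
    meaning (e ⊞ f) = meaning e + meaning f
    meaning (e ⊠ f) = meaning e * meaning f
    meaning (⊟ e)   = - meaning e

    private
      ev-+ : ∀ f g → ev (f +ₚ g) ≈ ev f + ev g
      ev-+ [] g = sym (+-identityˡ _)
      ev-+ (c ∷ f) [] = sym (+-identityʳ _)
      ev-+ (c ∷ f) (d ∷ g) = trans (+-cong (φ-+ c d) (*-congˡ (ev-+ f g)))
        (solve 5 (λ c d x f g → (c :+ d) :+ x :* (f :+ g) := (c :+ x :* f) :+ (d :+ x :* g)) refl (φ c) (φ d) x
            (ev f) (ev g))

      ev-scale : ∀ c f → ev (scale c f) ≈ φ c * ev f
      ev-scale c [] = sym (zeroʳ _)
      ev-scale c (d ∷ f) = trans (+-cong (φ-* c d) (*-congˡ (ev-scale c f)))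
        (solve 4 (λ c d x f → c :* d :+ x :* (c :* f) := c :* (d :+ x :* f)) refl (φ c) (φ d) x (ev f))

      ev-* : ∀ f g → ev (f *ₚ g) ≈ ev f * ev g
      ev-* [] g = sym (zeroˡ _)
      ev-* (c ∷ f) g = trans (ev-+ (scale c g) (K.0# ∷ (f *ₚ g)))
        (trans (+-cong (ev-scale c g) (trans (+-cong φ-0 (*-congˡ (ev-* f g))) (+-identityˡ _)))
        (solve 4 (λ c x f g → c :* g :+ x :* (f :* g) := (c :+ x :* f) :* g) refl (φ c) x (ev f) (ev g)))

      φ-# : ∀ k → φ (KI.# k) ≈ # k
      φ-# zero    = φ-0
      φ-# (suc k) = trans (φ-cong (KI.#-suc k)) (trans (φ-+ K.1# (KI.# k)) (trans (+-cong φ-1 (φ-# k)) (sym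
          (#-suc k))))

      ev-constant : ∀ c → ev (c ∷ []) ≈ φ c
      ev-constant c = trans (+-congˡ (zeroʳ x)) (+-identityʳ _)

    ev-expand : ∀ e → ev (expand e) ≈ meaning e
    ev-expand (coef c) = ev-constant c
    ev-expand (num k) = trans (ev-constant (KI.# k)) (φ-# k)
    ev-expand arg = trans (+-cong φ-0 (*-congˡ (trans (ev-constant K.1#) φ-1)))
      (solve 1 (λ x → :# 0 :+ x :* :# 1 := x) refl x)
    ev-expand (e ⊞ f) = trans (ev-+ (expand e) (expand f)) (+-cong (ev-expand e) (ev-expand f))
    ev-expand (e ⊠ f) = trans (ev-* (expand e) (expand f)) (*-cong (ev-expand e) (ev-expand f))
    ev-expand (⊟ e) = trans (ev-scale (K.- K.1#) (expand e)) (trans (*-cong (trans (φ-neg K.1#) (-‿cong φ-1))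
        (ev-expand e))
      (solve 1 (λ x → (:- :# 1) :* x := :- x) refl (meaning e)))

module PolynomialBounds (F : OrderedField) where

  open OrderedField F
  open OrderedFieldProperties F
  open Polynomials commutativeRing public

  module At (x : Carrier) = Evaluation commutativeRing (λ c → c) (λ _ _ → refl) (λ _ _ → refl) refl refl (λ _ → refl) (λ p → p) x

  evalAt : Carrier → Poly → Carrier
  evalAt x = At.ev x

  private
    positivePart : ∀ c → ∃[ d ] (0# ≤ d) × (c ≤ d)
    positivePart c with ≤-total 0# c
    ... | inj₁ 0≤c = c , 0≤c , ≤-refl
    ... | inj₂ c≤0 = 0# , ≤-refl , c≤0

  upper-bound : ∀ f → ∃[ S ] (0# ≤ S) × (∀ x → 0# ≤ x → x ≤ 1# → evalAt x f ≤ S)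
  upper-bound [] = 0# , ≤-refl , λ _ _ _ → ≤-refl
  upper-bound (c ∷ f) with upper-bound f | positivePart c
  ... | S , S≥0 , bound | d , d≥0 , c≤d = d + S , +-nonNeg d≥0 S≥0 , λ x x≥0 x≤1 →
    ≤-by ((d - c) + (x * (S - evalAt x f) + (1# - x) * S))
      (+-nonNeg (≤⇒0≤ c≤d) (+-nonNeg (*-nonNeg x≥0 (≤⇒0≤ (bound x x≥0 x≤1))) (*-nonNeg (≤⇒0≤ x≤1) S≥0)))
      ((solve 5 (λ x S d c f → (d :- c) :+ (x :* (S :- f) :+ (:# 1 :- x) :* S) := (d :+ S) :- (c
          :+ x :* f)) refl x S d c (evalAt x f)))

  -- A one-sided bound at scale 1/b, multiplied by `b` to avoid division; `L` does not depend on
  -- `b`. This matches ratios of coefficients, which move by at most 1/b from one index to the next.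
  Lipschitz : Poly → Carrier → Set
  Lipschitz f L = ∀ b x y → 0# ≤ b → 0# ≤ x → x ≤ y → y ≤ 1# → b * (y - x) ≤ 1# → b * evalAt y f ≤ b * evalAt x f + L

  lipschitz : ∀ f → ∃[ L ] (0# ≤ L) × Lipschitz f L
  lipschitz [] = 0# , ≤-refl , λ b _ _ _ _ _ _ _ → ≤-reflexive (sym (+-identityʳ _))
  lipschitz (c ∷ f) with lipschitz f | upper-bound f
  ... | L , L≥0 , lip | S , S≥0 , bound = L + S , +-nonNeg L≥0 S≥0 , λ b x y b≥0 x≥0 x≤y y≤1 bd →
    ≤-by (y * ((b * evalAt x f + L) - b * evalAt y f) + (1# - y) * L + b * (y - x) * (S - evalAt x f) + (1# - b *
        (y - x)) * S)
      (+-nonNeg (+-nonNeg (+-nonNeg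
        (*-nonNeg (≤-trans x≥0 x≤y) (≤⇒0≤ (lip b x y b≥0 x≥0 x≤y y≤1 bd)))
        (*-nonNeg (≤⇒0≤ y≤1) L≥0))
        (*-nonNeg (*-nonNeg b≥0 (≤⇒0≤ x≤y)) (≤⇒0≤ (bound x x≥0 (≤-trans x≤y y≤1)))))
        (*-nonNeg (≤⇒0≤ bd) S≥0))
      ((solve 8 (λ b x y L S c f g → y :* ((b :* f :+ L) :- b :* g) :+ (:# 1 :- y) :* L :+ b :* (y :- x) :* (S
          :- f) :+ (:# 1 :- b :* (y :- x)) :* S := (b :* (c :+ x :* f) :+ (L :+ S)) :- b :* (c
          :+ y :* g)) refl b x y L S c (evalAt x f) (evalAt y f)))

-- Ratios of consecutive coefficients of the denominators

module CoefficientRatios (F : OrderedField) (k : ℕ) where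

  open OrderedField F
  open OrderedFieldProperties F
  private
    module Fun = Functional F
    module S = CommutativeRing Fun.seriesRing
    module SI = IntegerCoefficients Fun.seriesRing
  open Fun using (coeff; at; Series; T; denominators)
  open import Relation.Binary.Reasoning.Setoid setoid

  C : ℕ → Carrier
  C s = coeff (denominators (suc k)) (s ℕ.* 2)

  b : Carrier
  b = # 6 * # suc k

  -- N + s is the coefficient of ρ s in the recursion, with N = 10k + 11.
  N : Carrier
  N = # 10 * # suc k + 1#

  private
    f f′ : Series
    f  = denominators (suc k)
    f′ = Fun.θ f

    module _ where
      open S using () renaming (_+_ to _⊹_; _*_ to _∙_; _-_ to _⊖_)
      open SI using () renaming (#_ to ##_)

      two-terms : ∀ c n → coeff (## c ∙ (## suc k ∙ f)) n ≈ # c * (# suc k * coeff f n)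
      two-terms c n = trans (Fun.coeff-#* c (## suc k ∙ f) n) (*-congˡ (Fun.coeff-#* (suc k) f n))

      right-side : ∀ n → coeff (## 2 ∙ (T ∙ (## 6 ∙ (## suc k ∙ f) ⊹ T ∙ (## 10 ∙ (## suc k ∙ f) ⊹ ## 2 ∙ f))))
          (2 ℕ.+ n) ≈
        # 2 * (# 6 * (# suc k * coeff f n) + coeff (T ∙ (## 10 ∙ (## suc k ∙ f) ⊹ ## 2 ∙ f)) n)
      right-side n = trans (Fun.coeff-#* 2 _ (2 ℕ.+ n)) (*-congˡ (trans (Fun.coeff-T*-+2 _ n)
        (trans (Fun.coeff-+ _ _ n) (+-congʳ (two-terms 6 n)))))

      left-side : ∀ n → coeff (f′ ⊖ T ∙ (T ∙ f′)) (2 ℕ.+ n) ≈ # (2 ℕ.+ n) * coeff f (2 ℕ.+ n) - coeff (T ∙ f′) n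
      left-side n = trans (Fun.coeff-+ _ _ (2 ℕ.+ n)) (+-cong (Fun.coeff-θ f (2 ℕ.+ n))
        (trans (Fun.coeff-neg _ (2 ℕ.+ n)) (-‿cong (Fun.coeff-T*-+2 (T ∙ f′) n))))

      equation : ∀ n → # (2 ℕ.+ n) * coeff f (2 ℕ.+ n) - coeff (T ∙ f′) n ≈
        # 2 * (# 6 * (# suc k * coeff f n) + coeff (T ∙ (## 10 ∙ (## suc k ∙ f) ⊹ ## 2 ∙ f)) n)
      equation n = trans (sym (left-side n)) (trans (at (Fun.denominators-equation k) (2 ℕ.+ n)) (right-side n))

      inner-term : ∀ n → coeff (T ∙ (## 10 ∙ (## suc k ∙ f) ⊹ ## 2 ∙ f)) (2 ℕ.+ n) ≈ # 10 *
          (# suc k * coeff f n) + # 2 * coeff f n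
      inner-term n = trans (Fun.coeff-T*-+2 _ n) (trans (Fun.coeff-+ _ _ n) (+-cong (two-terms 10 n)
          (Fun.coeff-#* 2 f n)))

    halve : ∀ {x y} → # 2 * x ≈ # 2 * y → x ≈ y
    halve eq = ≤-antisym (*-cancelˡ-≤ (#-pos 1) (≤-reflexive eq)) (*-cancelˡ-≤ (#-pos 1) (≤-reflexive (sym eq)))

    C₁ : # 1 * C 1 ≈ b * C 0
    C₁ = halve (begin
      # 2 * (# 1 * C 1)                    ≈⟨ (solve 1 (λ x → :# 2 :* (:# 1 :* x) := :# 2 :* x :- :# 0) refl (C 1)) ⟩
      # 2 * C 1 - 0#                       ≈⟨ +-congˡ (-‿cong (Fun.coeff-T*-0 f′)) ⟨
      # 2 * C 1 - coeff (T S.* f′) 0       ≈⟨ equation 0 ⟩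
      # 2 * (# 6 * (# suc k * C 0) + coeff (T S.* _) 0)
                                           ≈⟨ *-congˡ (+-congˡ (Fun.coeff-T*-0 _)) ⟩
      # 2 * (# 6 * (# suc k * C 0) + 0#)   ≈⟨ (solve 2 (λ k x → :# 2 :* (:# 6 :* (k :* x) :+ :# 0) := :# 2 :*
          (:# 6 :* k :* x)) refl (# suc k) (C 0)) ⟩
      # 2 * (b * C 0)                      ∎)

    C₂₊ : ∀ s → # (2 ℕ.+ s) * C (2 ℕ.+ s) ≈ b * C (suc s) + (N + # suc s) * C s
    C₂₊ s = halve (begin
      # 2 * (# (2 ℕ.+ s) * C (2 ℕ.+ s))
        ≈⟨ (solve 4 (λ i x j y → :# 2 :* (i :* x) := (i :* :# 2 :* x :- j :* y) :+ j :* y) refl (# (2 ℕ.+ s)) (C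
            (2 ℕ.+ s)) (# (s ℕ.* 2)) (C s)) ⟩
      (# (2 ℕ.+ s) * # 2 * C (2 ℕ.+ s) - # (s ℕ.* 2) * C s) + # (s ℕ.* 2) * C s
        ≈⟨ +-congʳ (+-cong (*-congʳ (sym (#-* (2 ℕ.+ s) 2)))
             (-‿cong (trans (sym (Fun.coeff-θ f (s ℕ.* 2))) (sym (Fun.coeff-T*-+2 f′ (s ℕ.* 2)))))) ⟩
      (# ((2 ℕ.+ s) ℕ.* 2) * C (2 ℕ.+ s) - coeff (T S.* f′) (suc s ℕ.* 2)) + # (s ℕ.* 2) * C s
        ≈⟨ +-cong (equation (suc s ℕ.* 2)) (*-congʳ (#-* s 2)) ⟩
      # 2 * (# 6 * (# suc k * C (suc s)) + coeff (T S.* _) (2 ℕ.+ s ℕ.* 2)) + # s * # 2 * C s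
        ≈⟨ +-congʳ (*-congˡ (+-congˡ (inner-term (s ℕ.* 2)))) ⟩
      # 2 * (# 6 * (# suc k * C (suc s)) + (# 10 * (# suc k * C s) + # 2 * C s)) + # s * # 2 * C s
        ≈⟨ (solve 4 (λ k s x y → :# 2 :* (:# 6 :* (k :* x) :+ (:# 10 :* (k :* y) :+ :# 2 :* y)) :+ s :* :# 2 :* y
            := :# 2 :* (:# 6 :* k :* x :+ (:# 10 :* k :+ :# 1 :+ (:# 1 :+ s)) :* y)) refl (# suc k) (# s) (C
            (suc s)) (C s)) ⟩
      # 2 * (b * C (suc s) + (N + (1# + # s)) * C s)
        ≈⟨ *-congˡ (+-congˡ (*-congʳ (+-congˡ (#-suc s)))) ⟨
      # 2 * (b * C (suc s) + (N + # suc s) * C s) ∎)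

  -- Total, with value `0#` at nonpositive arguments, so that `ρ` and `Δ` can be defined by
  -- recursion before `Δ` is known to be positive.
  recip : Carrier → Carrier
  recip x with x ≤? 0#
  ... | yes _  = 0#
  ... | no x≰0 = proj₁ (pos-inverse x≰0)

  recip-inverse : ∀ x → 0# < x → x * recip x ≈ 1#
  recip-inverse x 0<x with x ≤? 0#
  ... | yes x≤0 = ⊥-elim (0<x x≤0)
  ... | no x≰0  = proj₁ (proj₂ (pos-inverse x≰0))

  recip-nonNeg : ∀ x → 0# ≤ recip x
  recip-nonNeg x with x ≤? 0#
  ... | yes _  = ≤-refl
  ... | no x≰0 = <⇒≤ (proj₂ (proj₂ (pos-inverse x≰0)))

  -- `ρ s` is C(s - 1)/C(s), as `C-ratio` confirms, and 0 at the start. Dividing the recursion (s +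
  -- 1)C(s + 1) = b C(s) + (N + s)C(s - 1) by C(s) gives this continued fraction.
  ρ Δ : ℕ → Carrier
  ρ zero    = 0#
  ρ (suc s) = # suc s * recip (Δ s)
  Δ s = b + (N + # s) * ρ s

  ρ-nonNeg : ∀ s → 0# ≤ ρ s
  ρ-nonNeg zero    = ≤-refl
  ρ-nonNeg (suc s) = *-nonNeg (#-nonNeg (suc s)) (recip-nonNeg (Δ s))

  b-pos : 0# < b
  b-pos = *-pos (#-pos 5) (#-pos k)

  N+-nonNeg : ∀ s → 0# ≤ N + # s
  N+-nonNeg s = +-nonNeg (+-nonNeg (*-nonNeg (#-nonNeg 10) (#-nonNeg (suc k))) (<⇒≤ 0<1)) (#-nonNeg s)

  b≤Δ : ∀ s → b ≤ Δ s
  b≤Δ s = ≤-by ((N + # s) * ρ s) (*-nonNeg (N+-nonNeg s) (ρ-nonNeg s))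
    ((solve 2 (λ b x → x := (b :+ x) :- b) refl b ((N + # s) * ρ s)))

  Δ-pos : ∀ s → 0# < Δ s
  Δ-pos s = <-≤-trans b-pos (b≤Δ s)

  ρΔ : ∀ s → ρ (suc s) * Δ s ≈ # suc s
  ρΔ s = trans ((solve 3 (λ n r d → n :* r :* d := n :* (d :* r)) refl (# suc s) (recip (Δ s)) (Δ s)))
    (trans (*-congˡ (recip-inverse (Δ s) (Δ-pos s))) (*-identityʳ _))

  private
    cancel-Δ : ∀ s {x y} → Δ s * x ≈ Δ s * y → x ≈ y
    cancel-Δ s eq = ≤-antisym (*-cancelˡ-≤ (Δ-pos s) (≤-reflexive eq)) (*-cancelˡ-≤ (Δ-pos s) (≤-reflexive (sym eq)))

  mutual
    C-recursion : ∀ s → # suc s * C (suc s) ≈ Δ s * C s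
    C-recursion zero = trans C₁ (*-congʳ ((solve 2 (λ b n → b := b :+ n :* :# 0) refl b (N + # 0))))
    C-recursion (suc s) = trans (C₂₊ s) (trans (+-congˡ (*-congˡ (C-ratio s)))
      ((solve 4 (λ b n x r → b :* x :+ n :* (r :* x) := (b :+ n :* r) :* x) refl b (N + # suc s) (C (suc s)) (ρ
          (suc s)))))

    C-ratio : ∀ s → C s ≈ ρ (suc s) * C (suc s)
    C-ratio s = sym (cancel-Δ s (trans ((solve 3 (λ d r x → d :* (r :* x) := r :* d :* x) refl (Δ s) (ρ (suc s)) (C
        (suc s))))
      (trans (*-congʳ (ρΔ s)) (C-recursion s))))

  C-pos : ∀ s → 0# < C s
  C-pos zero = 0<-resp (sym C₀) 0<1
    where
    constant-term : ∀ {g g⁻¹} → coeff g 0 ≈ 1# → g S.* g⁻¹ S.≈ S.1# → coeff g⁻¹ 0 ≈ 1#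
    constant-term {g} {g⁻¹} g₀ gg⁻¹ = trans (sym (*-identityˡ _)) (trans (*-congʳ (sym g₀))
      (trans (sym (Fun.coeff-*-0 g g⁻¹)) (trans (at gg⁻¹ 0) (Fun.coeff-constant-0 1#))))
    p₀ : coeff Fun.p 0 ≈ 1#
    p₀ = trans (Fun.coeff-+ S.1# T 0) (trans (+-cong (Fun.coeff-constant-0 1#)
      (trans (sym (at (S.*-identityʳ T) 0)) (Fun.coeff-T*-0 S.1#))) (+-identityʳ _))
    q₀ : coeff Fun.q 0 ≈ 1#
    q₀ = trans (Fun.coeff-+ S.1# (S.- T) 0) (trans (+-cong (Fun.coeff-constant-0 1#)
      (trans (Fun.coeff-neg T 0) (-‿cong (trans (sym (at (S.*-identityʳ T) 0)) (Fun.coeff-T*-0 S.1#)))))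
      ((solve 0 (:# 1 :- :# 0 := :# 1) refl)))
    open import Algebra.Properties.Semiring.Exp (CommutativeRing.semiring Fun.seriesRing) using (_^_)
    power₀ : ∀ {g} → coeff g 0 ≈ 1# → ∀ i → coeff (g ^ i) 0 ≈ 1#
    power₀ g₀ zero = Fun.coeff-constant-0 1#
    power₀ {g} g₀ (suc i) = trans (Fun.coeff-*-0 g (g ^ i)) (trans (*-cong g₀ (power₀ g₀ i)) (*-identityˡ _))
    C₀ : C 0 ≈ 1#
    C₀ = trans (Fun.coeff-*-0 _ _) (trans (*-cong (power₀ (constant-term p₀ Fun.p*p⁻¹≈1) (1 ℕ.+ 2 ℕ.* suc k))
      (power₀ (constant-term q₀ Fun.q*q⁻¹≈1) (1 ℕ.+ 8 ℕ.* suc k))) (*-identityˡ _))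
  C-pos (suc s) = pos-cancelˡ (#-nonNeg (suc s)) (0<-resp (sym (C-recursion s)) (*-pos (Δ-pos s) (C-pos s)))

  record Slow (s : ℕ) : Set where
    field
      increasing : ρ s ≤ ρ (suc s)
      increment  : b * (ρ (suc s) - ρ s) ≤ 1#
      linear     : b * ρ s ≤ # s
  open Slow public

  private
    ≤1/6 : ∀ {s} x → b * x ≤ # s → s ℕ.≤ suc k → # 6 * x ≤ 1#
    ≤1/6 {s} x bx≤s s≤k = *-cancelˡ-≤ (#-pos k) (≤-trans (≤-reflexive ((solve 2 (λ k x → k :* (:# 6 :* x)
        := :# 6 :* k :* x) refl (# suc k) x)))
      (≤-trans bx≤s (≤-trans (#-mono-≤ s≤k) (≤-reflexive (sym (*-identityʳ _))))))

  -- Subtracting consecutive relations `ρΔ` gives Δ(s + 1)(ρ(s + 2) - ρ(s + 1)) = `J`. It lies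
  -- between 0 and 1 because ρ is at most 1/6 and N + s at most 2b in this range, and Δ is at least
  -- b. Adding up the increments gives the linear bound, hence the 1/6 for the next index.
  slow : ∀ s → s ℕ.≤ suc k → Slow s
  slow zero _ = record
    { increasing = ρ-nonNeg 1
    ; increment  = ≤-reflexive (trans ((solve 3 (λ b r n → b :* (r :- :# 0) := r :* (b :+ n :* :# 0)) refl b (ρ 1)
        (N + # 0))) (ρΔ 0))
    ; linear     = ≤-reflexive (*-zeroʳ b) }
  slow (suc s) (ℕ.s≤s s≤k) = record
    { increasing = r′≤r″
    ; increment  = ≤-trans (≤-by ((Δ (suc s) - b) * (r″ - r′)) (*-nonNeg (≤⇒0≤ (b≤Δ (suc s))) (≤⇒0≤ r′≤r″))
        ((solve 3 (λ d b x → (d :- b) :* x := d :* x :- b :* x) refl (Δ (suc s)) b (r″ - r′)))) (≤-trans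
            (≤-reflexive difference) J≤1)
    ; linear     = r′-linear }
    where
    ih : Slow s
    ih = slow s (ℕₚ.≤-trans s≤k (ℕₚ.n≤1+n k))
    r r′ r″ n J : Carrier
    r = ρ s
    r′ = ρ (suc s)
    r″ = ρ (suc (suc s))
    n = N + # s
    J = 1# - r′ * r′ - r′ * (n * (r′ - r))
    difference : Δ (suc s) * (r″ - r′) ≈ J
    difference = begin
      Δ (suc s) * (r″ - r′)
        ≈⟨ (solve 3 (λ d x y → d :* (x :- y) := x :* d :- y :* d) refl (Δ (suc s)) r″ r′) ⟩
      r″ * Δ (suc s) - r′ * Δ (suc s)
        ≈⟨ +-cong (ρΔ (suc s)) (-‿cong (*-congˡ (+-congˡ (*-congʳ (+-congˡ (#-suc s)))))) ⟩
      # suc (suc s) - r′ * (b + (N + (1# + # s)) * r′)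
        ≈⟨ +-cong (#-suc (suc s)) ((solve 5 (λ b N s x y → :- (x :* (b :+ (N :+ (:# 1 :+ s)) :* x)) := :- (x :* (b
            :+ (N :+ s) :* y)) :- x :* x :- x :* ((N :+ s) :* (x :- y))) refl b N (# s) r′ r)) ⟩
      1# + # suc s + (- (r′ * Δ s) - r′ * r′ - r′ * (n * (r′ - r)))
        ≈⟨ +-congˡ (+-congʳ (+-congʳ (-‿cong (ρΔ s)))) ⟩
      1# + # suc s + (- # suc s - r′ * r′ - r′ * (n * (r′ - r)))
        ≈⟨ (solve 3 (λ i x y → :# 1 :+ i :+ (:- i :- x :* x :- x :* y) := :# 1 :- x :* x :- x :* y) refl
            (# suc s) r′ (n * (r′ - r))) ⟩
      J ∎
    δ≥0 : 0# ≤ r′ - r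
    δ≥0 = ≤⇒0≤ (increasing ih)
    r′≥0 : 0# ≤ r′
    r′≥0 = ρ-nonNeg (suc s)
    r′-linear : b * r′ ≤ # suc s
    r′-linear = ≤-trans (≤-reflexive ((solve 3 (λ b x y → b :* x := b :* (x :- y) :+ b :* y) refl b r′ r)))
      (≤-trans (+-mono-≤ (increment ih) (linear ih)) (≤-reflexive (sym (#-suc s))))
    6r′≤1 : # 6 * r′ ≤ 1#
    6r′≤1 = ≤1/6 r′ r′-linear (ℕ.s≤s s≤k)
    n≤2b : n ≤ # 2 * b
    n≤2b = ≤-by ((# suc k - # suc s) + # suc k) (+-nonNeg (≤⇒0≤ (#-mono-≤ (ℕ.s≤s s≤k))) (#-nonNeg (suc k)))
      (trans (+-congʳ (+-congˡ (-‿cong (#-suc s)))) ((solve 2 (λ k s → (k :- (:# 1 :+ s)) :+ k := :# 2 :*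
          (:# 6 :* k) :- (:# 10 :* k :+ :# 1 :+ s)) refl (# suc k) (# s))))
    nδ≤2 : n * (r′ - r) ≤ # 2
    nδ≤2 = ≤-by ((# 2 * b - n) * (r′ - r) + # 2 * (1# - b * (r′ - r)))
      (+-nonNeg (*-nonNeg (≤⇒0≤ n≤2b) δ≥0) (*-nonNeg (#-nonNeg 2) (≤⇒0≤ (increment ih))))
      ((solve 3 (λ b n x → (:# 2 :* b :- n) :* x :+ :# 2 :* (:# 1 :- b :* x) := :# 2 :- n :* x) refl b n (r′ - r)))
    J≤1 : J ≤ 1#
    J≤1 = ≤-by (r′ * r′ + r′ * (n * (r′ - r))) (+-nonNeg (*-nonNeg r′≥0 r′≥0) (*-nonNeg r′≥0 (*-nonNeg
        (N+-nonNeg s) δ≥0)))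
      ((solve 2 (λ x y → x :* x :+ x :* y := :# 1 :- (:# 1 :- x :* x :- x :* y)) refl r′ (n * (r′ - r))))
    1-r′≥0 : 0# ≤ 1# - r′
    1-r′≥0 = 0≤-resp ((solve 1 (λ x → (:# 1 :- :# 6 :* x) :+ :# 5 :* x := :# 1 :- x) refl r′)) (+-nonNeg
        (≤⇒0≤ 6r′≤1) (*-nonNeg (#-nonNeg 5) r′≥0))
    J≥0 : 0# ≤ J
    J≥0 = 0≤-resp ((solve 2 (λ x y → (:# 1 :- :# 6 :* x) :+ :# 3 :* x :+ x :* (:# 1 :- x) :+ x :* (:# 2 :- y)
        := :# 1 :- x :* x :- x :* y) refl r′ (n * (r′ - r))))
      (+-nonNeg (+-nonNeg (+-nonNeg (≤⇒0≤ 6r′≤1) (*-nonNeg (#-nonNeg 3) r′≥0)) (*-nonNeg r′≥0 1-r′≥0))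
          (*-nonNeg r′≥0 (≤⇒0≤ nδ≤2)))
    r′≤r″ : r′ ≤ r″
    r′≤r″ = *-cancelˡ-≤ (Δ-pos (suc s)) (≤-by J J≥0 (trans (sym difference) ((solve 3 (λ d x y → d :* (x :- y)
        := d :* x :- d :* y) refl (Δ (suc s)) r″ r′))))

  6ρ≤1 : ∀ s → s ℕ.≤ suc k → # 6 * ρ s ≤ 1#
  6ρ≤1 s s≤k = ≤1/6 (ρ s) (linear (slow s s≤k)) s≤k

  ρ≤1 : ∀ s → s ℕ.≤ suc k → ρ s ≤ 1#
  ρ≤1 s s≤k = ≤-by ((1# - # 6 * ρ s) + # 5 * ρ s) (+-nonNeg (≤⇒0≤ (6ρ≤1 s s≤k)) (*-nonNeg (#-nonNeg 5) (ρ-nonNeg s)))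
    ((solve 1 (λ x → (:# 1 :- :# 6 :* x) :+ :# 5 :* x := :# 1 :- x) refl (ρ s)))

  -- Monotonicity gives ρ(s)Δ(s) ≤ ρ(s + 1)Δ(s) = s + 1, so ρ(s) is at most the positive solution of
  -- t(b + (N + s)t) = s + 1. For large k this is the saddle point equation of index s.
  ρ-upper : ∀ s t → s ℕ.≤ suc k → 0# ≤ t → # suc s ≤ t * (b + (N + # s) * t) → ρ s ≤ t
  ρ-upper s t s≤k t≥0 big with ρ s ≤? t
  ... | yes ρ≤t = ρ≤t
  ... | no ρ≰t = ⊥-elim (<-≤-trans strict ρΔ≤ big)
    where
    r : Carrier
    r = ρ s
    strict : t * (b + (N + # s) * t) < r * Δ s
    strict = <-by ((r - t) * (b + (N + # s) * (r + t)))
      (*-pos (<⇒0< (≰⇒> ρ≰t)) (+-pos-nonNeg b-pos (*-nonNeg (N+-nonNeg s) (+-nonNeg (ρ-nonNeg s) t≥0))))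
      ((solve 4 (λ r t b n → (r :- t) :* (b :+ n :* (r :+ t)) := r :* (b :+ n :* r) :- t :* (b
          :+ n :* t)) refl r t b (N + # s)))
    ρΔ≤ : r * Δ s ≤ # suc s
    ρΔ≤ = ≤-trans (≤-by ((ρ (suc s) - r) * Δ s) (*-nonNeg (≤⇒0≤ (increasing (slow s s≤k))) (<⇒≤ (Δ-pos s)))
      ((solve 3 (λ x r d → (x :- r) :* d := x :* d :- r :* d) refl (ρ (suc s)) r (Δ s)))) (≤-reflexive (ρΔ s))

  -- From ρ ≤ 1/6 follows Δ ≤ 6κ + 12κ/6 = 8κ with κ = k + 1, so ρ is at least the index divided by
  -- 8κ. The assumption on `k` ensures 8(k + 1) ≤ 10(k - 9).
  ρ-lower : ∀ s → k ℕ.≤ s ℕ.+ 9 → s ℕ.≤ suc k → 50 ℕ.≤ k → 1# ≤ # 10 * ρ s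
  ρ-lower zero k≤ _ 50≤k = ⊥-elim (ℕₚ.<⇒≱ {9} {50} (ℕₚ.≤ᵇ⇒≤ 10 50 _) (ℕₚ.≤-trans 50≤k k≤))
  ρ-lower (suc s) k≤ (ℕ.s≤s s≤k) 50≤k with 1# ≤? (# 10 * ρ (suc s))
  ... | yes p = p
  ... | no ¬p = ⊥-elim (<-≤-trans strict Δ≤ 8k≤)
    where
    strict : # 10 * # suc s < Δ s
    strict = <-by ((1# - # 10 * ρ (suc s)) * Δ s) (*-pos (<⇒0< (≰⇒> ¬p)) (Δ-pos s))
      (trans ((solve 2 (λ r d → (:# 1 :- :# 10 :* r) :* d := d :- :# 10 :* (r :* d)) refl (ρ (suc s)) (Δ s)))
          (+-congˡ (-‿cong (*-congˡ (ρΔ s)))))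
    Δ≤ : Δ s ≤ # 8 * # suc k
    Δ≤ = ≤-by (# 2 * # suc k * (1# - # 6 * ρ s) + (# 12 * # suc k - (N + # s)) * ρ s)
      (+-nonNeg (*-nonNeg (*-nonNeg (#-nonNeg 2) (#-nonNeg (suc k))) (≤⇒0≤ (6ρ≤1 s (ℕₚ.≤-trans s≤k (ℕₚ.n≤1+n k)))))
        (*-nonNeg (0≤-resp (trans (+-congʳ (+-congˡ (-‿cong (#-suc s)))) ((solve 2 (λ k s → (k :- (:# 1 :+ s)) :+ k
            := :# 12 :* k :- (:# 10 :* k :+ :# 1 :+ s)) refl (# suc k) (# s))))
          (+-nonNeg (≤⇒0≤ (#-mono-≤ (ℕ.s≤s s≤k))) (#-nonNeg (suc k)))) (ρ-nonNeg s)))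
      ((solve 3 (λ k r n → :# 2 :* k :* (:# 1 :- :# 6 :* r) :+ (:# 12 :* k :- n) :* r := :# 8 :* k :- (:# 6 :* k
          :+ n :* r)) refl (# suc k) (ρ s) (N + # s)))
    8k≤ : # 8 * # suc k ≤ # 10 * # suc s
    8k≤ = ≤-trans (≤-reflexive (sym (#-* 8 (suc k)))) (≤-trans (#-mono-≤ nat) (≤-reflexive (#-* 10 (suc s))))
      where
      split : ∀ k → 8 ℕ.* suc k ℕ.+ 2 ℕ.* k ≡ 10 ℕ.* k ℕ.+ 8
      split = ℕsolve-∀
      split′ : ∀ s → 10 ℕ.* (suc s ℕ.+ 9) ℕ.+ 8 ≡ 10 ℕ.* suc s ℕ.+ 98
      split′ = ℕsolve-∀
      nat : 8 ℕ.* suc k ℕ.≤ 10 ℕ.* suc s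
      nat = ℕₚ.+-cancelʳ-≤ 98 (8 ℕ.* suc k) (10 ℕ.* suc s) (ℕₚ.≤-trans
        (ℕₚ.+-monoʳ-≤ (8 ℕ.* suc k) (ℕₚ.≤-trans (ℕₚ.≤ᵇ⇒≤ 98 100 _) (ℕₚ.*-monoʳ-≤ 2 50≤k)))
        (ℕₚ.≤-trans (ℕₚ.≤-reflexive (split k)) (ℕₚ.≤-trans (ℕₚ.+-monoˡ-≤ 8 (ℕₚ.*-monoʳ-≤ 10 k≤)) (ℕₚ.≤-reflexive
            (split′ s)))))

-- Positivity of the combined kernel for large k

module KernelPositivity (F : OrderedField) where

  open OrderedField F
  open OrderedFieldProperties F
  open PolynomialBounds F
  private
    module Fun = Functional F
    module S = CommutativeRing Fun.seriesRing
  open Fun using (coeff; at; T; denominators; constant)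
  open CoefficientRatios F

  module InSeries = Evaluation Fun.seriesRing constant Fun.constant-+ Fun.constant-*
    S.refl S.refl Fun.constant-neg Fun.constant-cong T

  private
    A : ℕ → Poly → ℕ → Carrier
    A k f s = coeff (InSeries.ev f S.* denominators (suc k)) (s ℕ.* 2)

    A-[] : ∀ k s → A k [] s ≈ 0#
    A-[] k s = trans (at (S.zeroˡ _) (s ℕ.* 2)) (Fun.coeff-0 (s ℕ.* 2))

    split : ∀ k c f s → A k (c ∷ f) s ≈ c * C k s + coeff (T S.* (InSeries.ev f S.* denominators (suc k))) (s ℕ.* 2)
    split k c f s = trans (at (S.trans (S.distribʳ _ _ _) (S.+-congˡ (S.*-assoc _ _ _))) (s ℕ.* 2))
      (trans (Fun.coeff-+ _ _ (s ℕ.* 2)) (+-congʳ (Fun.coeff-constant-* c _ (s ℕ.* 2))))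

    A-zero : ∀ k c f → A k (c ∷ f) 0 ≈ c * C k 0
    A-zero k c f = trans (split k c f 0) (trans (+-congˡ (Fun.coeff-T*-0 _)) (+-identityʳ _))

    A-suc : ∀ k c f s → A k (c ∷ f) (suc s) ≈ c * C k (suc s) + A k f s
    A-suc k c f s = trans (split k c f (suc s)) (+-congˡ (Fun.coeff-T*-+2 _ (s ℕ.* 2)))

  -- Successive coefficients of the denominators form nearly a geometric progression of ratio 1/ρ, so multiplying by a
  -- polynomial f amounts to multiplying by f(ρ), up to a relative error O(1/k).
  approximation : ∀ f → ∃[ K ] (0# ≤ K) × (∀ k s → s ℕ.≤ suc k →
    b k * evalAt (ρ k s) f * C k s ≤ b k * A k f s + K * C k s)
  approximation [] = 0# , ≤-refl , λ k s _ → ≤-reflexive (trans ((solve 2 (λ b c → b :* :# 0 :* c := b :* :# 0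
      :+ :# 0 :* c) refl (b k) (C k s)))
    (+-congʳ (*-congˡ (sym (A-[] k s)))))
  approximation (c ∷ f) with approximation f | lipschitz f
  ... | K , K≥0 , approx | L , L≥0 , lip = K + L , +-nonNeg K≥0 L≥0 , bound
    where
    bound : ∀ k s → s ℕ.≤ suc k → b k * evalAt (ρ k s) (c ∷ f) * C k s ≤ b k * A k (c ∷ f) s + (K + L) * C k s
    bound k zero s≤k = ≤-trans (≤-by ((K + L) * C k 0) (*-nonNeg (+-nonNeg K≥0 L≥0) (<⇒≤ (C-pos k 0)))
      ((solve 6 (λ b c f C K L → (K :+ L) :* C := (b :* (c :* C) :+ (K :+ L) :* C) :- b :* (c
          :+ :# 0 :* f) :* C) refl (b k) c (evalAt 0# f) (C k 0) K L)))
      (≤-reflexive (+-congʳ (*-congˡ (sym (A-zero k c f)))))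
    bound k (suc s) s<k = ≤-trans (≤-by total total≥0 identity)
      (≤-reflexive (+-congʳ (*-congˡ (sym (A-suc k c f s)))))
      where
      s≤k : s ℕ.≤ suc k
      s≤k = ℕₚ.≤-trans (ℕₚ.n≤1+n s) s<k
      r r′ x x′ : Carrier
      r  = ρ k s
      r′ = ρ k (suc s)
      x  = C k s
      x′ = C k (suc s)
      total : Carrier
      total = ((b k * A k f s + K * x) - b k * evalAt r f * x) +
        (((b k * evalAt r f + L) - b k * evalAt r′ f) * x + (K + L) * ((1# - r′) * x′))
      total≥0 : 0# ≤ total
      total≥0 = +-nonNeg (≤⇒0≤ (approx k s s≤k)) (+-nonNeg
        (*-nonNeg (≤⇒0≤ (lip (b k) r r′ (<⇒≤ (b-pos k)) (ρ-nonNeg k s) (increasing (slow k s s≤k)) (ρ≤1 k (suc s) s<k)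
          (increment (slow k s s≤k)))) (<⇒≤ (C-pos k s)))
        (*-nonNeg (+-nonNeg K≥0 L≥0) (*-nonNeg (≤⇒0≤ (ρ≤1 k (suc s) s<k)) (<⇒≤ (C-pos k (suc s))))))
      identity : total ≈ (b k * (c * x′ + A k f s) + (K + L) * x′) - b k * (c + r′ * evalAt r′ f) * x′
      identity = trans
        ((solve 9 (λ b A K L x x′ f g r′ → ((b :* A :+ K :* x) :- b :* f :* x) :+ (((b :* f :+ L) :- b :* g) :* x :+
            (K :+ L) :* ((:# 1 :- r′) :* x′)) := (b :* A :+ (K :+ L) :* x′) :+ (((K :+ L) :- b :* g) :* x :- (K
            :+ L) :* (r′ :* x′))) refl (b k) (A k f s) K L x x′ (evalAt r f) (evalAt r′ f) r′))
        (trans (+-congˡ (+-congʳ (*-congˡ (C-ratio k s))))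
        ((solve 8 (λ b A K L x′ c g r′ → (b :* A :+ (K :+ L) :* x′) :+ (((K :+ L) :- b :* g) :* (r′ :* x′) :- (K
            :+ L) :* (r′ :* x′)) := (b :* (c :* x′ :+ A) :+ (K :+ L) :* x′) :- b :* (c :+ r′ :* g) :* x′) refl (b k)
            (A k f s) K L x′ c (evalAt r′ f) r′)))

  private
    positive-coefficient : ∀ {δ K} k s f → b k * evalAt (ρ k s) f * C k s ≤ b k * A k f s + K * C k s →
      δ ≤ evalAt (ρ k s) f → K < b k * δ → 0# < A k f s
    positive-coefficient {δ} {K} k s f approx δ≤ K<bδ = pos-cancelˡ (<⇒≤ (b-pos k)) (0<-resp
      ((solve 1 (λ x → x :- :# 0 := x) refl (b k * A k f s))) (<⇒0< (<-≤-trans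
        (*-pos (<⇒0< K<bδ) (C-pos k s))
        (≤-by (((b k * A k f s + K * C k s) - b k * evalAt (ρ k s) f * C k s) + b k * ((evalAt
            (ρ k s) f - δ) * C k s))
          (+-nonNeg (≤⇒0≤ approx) (*-nonNeg (<⇒≤ (b-pos k)) (*-nonNeg (≤⇒0≤ δ≤) (<⇒≤ (C-pos k s)))))
          ((solve 6 (λ b A K C f d → ((b :* A :+ K :* C) :- b :* f :* C) :+ b :* ((f :- d) :* C) := b :* A :-
              (b :* d :- K) :* C) refl (b k) (A k f s) K (C k s) (evalAt (ρ k s) f) δ))))))

  𝐏ₑ 𝐐ₑ : PolyExpr Carrier
  𝐏ₑ = ((num 1 ⊞ (⊟ arg)) ⊠ (num 1 ⊞ (⊟ arg))) ⊠ ((num 1 ⊞ (⊟ arg)) ⊠ (num 1 ⊞ (⊟ arg)))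
  𝐐ₑ = num 64 ⊠ (arg ⊠ ((num 1 ⊞ arg) ⊠ (num 1 ⊞ arg)))

  numeratorₑ : Carrier → PolyExpr Carrier
  numeratorₑ ω = (𝐏ₑ ⊞ (⊟ (num 2 ⊠ 𝐐ₑ))) ⊠ (((coef ω ⊠ 𝐏ₑ) ⊞ (⊟ 𝐐ₑ)) ⊠
    (((𝐏ₑ ⊠ 𝐏ₑ) ⊞ (⊟ (((coef ω ⊠ coef ω) ⊞ (num 3 ⊠ coef ω)) ⊠ (𝐏ₑ ⊠ 𝐐ₑ)))) ⊞ (⊟ (coef ω ⊠ (𝐐ₑ ⊠ 𝐐ₑ)))))

  numerator≈ : ∀ ω → InSeries.ev (expand (numeratorₑ ω)) S.≈ Fun.numerator ω
  numerator≈ ω = InSeries.ev-expand (numeratorₑ ω)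

  P Q : Carrier → Carrier
  P x = (1# - x) * (1# - x) * ((1# - x) * (1# - x))
  Q x = # 64 * (x * ((1# + x) * (1# + x)))

  𝐕 : Carrier → Carrier → Carrier → Carrier
  𝐕 ω p q = p * p - (ω * ω + # 3 * ω) * (p * q) - ω * (q * q)

  R : Carrier → Carrier → Carrier
  R ω x = (P x - # 2 * Q x) * ((ω * P x - Q x) * 𝐕 ω (P x) (Q x))

  -- `t₁` bounds the ratios at the indices that belong to heavy codewords, and `below-ω` keeps the
  -- factor ω - w positive up to there. `t₃` lies just beyond T₀, the positive root of 6t + 11t² =
  -- 1, and `V-pos` keeps the last factor positive up to `t₃`.
  record Parameters : Set where
    field
      ω t₁ t₃ : Carrier
      ω-pos   : 0# < ω
      ω-small : # 400 * ω ≤ 1#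
      t₁-nonNeg : 0# ≤ t₁
      t₁-small  : # 1000 * t₁ ≤ 1#
      t₃-nonNeg : 0# ≤ t₃
      t₃-small  : # 5 * t₃ ≤ 1#
      below-ω : Q t₁ < ω * P t₁
      t₃-large  : 1# < # 6 * t₃ + # 11 * (t₃ * t₃)
      V-pos : 0# < 𝐕 ω (P t₃) (Q t₃)

  module WithParameters (params : Parameters) where
    open Parameters params

    private
      ω≥0 : 0# ≤ ω
      ω≥0 = <⇒≤ ω-pos

      1-x≥0 : ∀ {c x} → 0# ≤ x → # suc c * x ≤ 1# → 0# ≤ 1# - x
      1-x≥0 {c} {x} x≥0 small = 0≤-resp (trans (+-congʳ (+-congˡ (-‿cong (*-congʳ (#-suc c)))))
        ((solve 2 (λ x c → (:# 1 :- (:# 1 :+ c) :* x) :+ c :* x := :# 1 :- x) refl x (# c)))) (+-nonNeg (≤⇒0≤ small)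
            (*-nonNeg (#-nonNeg c) x≥0))

      P-anti : ∀ {x y} → 0# ≤ 1# - y → x ≤ y → P y ≤ P x
      P-anti {x} {y} 1-y≥0 x≤y = *-mono-≤ (*-nonNeg 1-y≥0 1-y≥0) (*-nonNeg 1-x′ 1-x′) square square
        where
        le : 1# - y ≤ 1# - x
        le = ≤-by (y - x) (≤⇒0≤ x≤y) ((solve 2 (λ x y → y :- x := (:# 1 :- x) :- (:# 1 :- y)) refl x y))
        1-x′ : 0# ≤ 1# - x
        1-x′ = ≤-trans 1-y≥0 le
        square : (1# - y) * (1# - y) ≤ (1# - x) * (1# - x)
        square = *-mono-≤ 1-y≥0 1-x′ le le

      Q-mono : ∀ {x y} → 0# ≤ x → x ≤ y → Q x ≤ Q y
      Q-mono {x} {y} x≥0 x≤y = *-monoˡ-≤ (#-nonNeg 64) (*-mono-≤ x≥0 (*-nonNeg 1+y 1+y) x≤y (*-mono-≤ 1+x 1+y le le))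
        where
        le : 1# + x ≤ 1# + y
        le = +-monoʳ-≤ 1# x≤y
        1+x : 0# ≤ 1# + x
        1+x = +-nonNeg (<⇒≤ 0<1) x≥0
        1+y : 0# ≤ 1# + y
        1+y = ≤-trans 1+x le

      P≥0 : ∀ {x} → 0# ≤ 1# - x → 0# ≤ P x
      P≥0 h = *-nonNeg (*-nonNeg h h) (*-nonNeg h h)

      P≤1 : ∀ {x} → 0# ≤ x → 0# ≤ 1# - x → P x ≤ 1#
      P≤1 x≥0 h = ≤-trans (P-anti h x≥0) (≤-reflexive ((solve 0 ((:# 1 :- :# 0) :* (:# 1 :- :# 0) :* ((:# 1
          :- :# 0) :* (:# 1 :- :# 0)) := :# 1) refl)))

      Q≥0 : ∀ {x} → 0# ≤ x → 0# ≤ Q x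
      Q≥0 x≥0 = *-nonNeg (#-nonNeg 64) (*-nonNeg x≥0 (*-nonNeg (+-nonNeg (<⇒≤ 0<1) x≥0) (+-nonNeg (<⇒≤ 0<1) x≥0)))

      ω′ : Carrier
      ω′ = ω * ω + # 3 * ω

      ω′≥0 : 0# ≤ ω′
      ω′≥0 = +-nonNeg (*-nonNeg ω≥0 ω≥0) (*-nonNeg (#-nonNeg 3) ω≥0)

      1-ω≥0 : 0# ≤ 1# - ω
      1-ω≥0 = 1-x≥0 {399} ω≥0 ω-small

      100ω′≤1 : # 100 * ω′ ≤ 1#
      100ω′≤1 = ≤-by ((1# - # 400 * ω) + # 100 * (ω * (1# - ω))) (+-nonNeg (≤⇒0≤ ω-small) (*-nonNeg (#-nonNeg 100)
          (*-nonNeg ω≥0 1-ω≥0)))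
        ((solve 1 (λ w → (:# 1 :- :# 400 :* w) :+ :# 100 :* (w :* (:# 1 :- w)) := :# 1 :- :# 100 :* (w :* w
            :+ :# 3 :* w)) refl ω))

      δ₁ δ₃ : Carrier
      δ₁ = ω * P t₁ - Q t₁
      δ₃ = 𝐕 ω (P t₃) (Q t₃) * (P t₃ * P t₃)

      δ₁-pos : 0# < δ₁
      δ₁-pos = <⇒0< below-ω

      P₃-pos : 0# < P t₃
      P₃-pos = *-pos (*-pos h h) (*-pos h h)
        where
        h : 0# < 1# - t₃
        h = pos-cancelˡ (#-nonNeg 5) (0<-resp ((solve 1 (λ t → :# 4 :+ (:# 1 :- :# 5 :* t) := :# 5 :* (:# 1
            :- t)) refl t₃))
          (+-pos-nonNeg (#-pos 3) (≤⇒0≤ t₃-small)))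

      δ₃-pos : 0# < δ₃
      δ₃-pos = *-pos V-pos (*-pos P₃-pos P₃-pos)

      δ₁≤ : ∀ x → 0# ≤ x → x ≤ t₁ → δ₁ ≤ ω * P x - Q x
      δ₁≤ x x≥0 x≤t₁ = ≤-by (ω * (P x - P t₁) + (Q t₁ - Q x))
        (+-nonNeg (*-nonNeg ω≥0 (≤⇒0≤ (P-anti (1-x≥0 {999} t₁-nonNeg t₁-small) x≤t₁))) (≤⇒0≤ (Q-mono x≥0 x≤t₁)))
        ((solve 5 (λ w p q a b → w :* (p :- a) :+ (b :- q) := (w :* p :- q) :- (w :* a :- b)) refl ω (P x) (Q x)
            (P t₁) (Q t₁)))

      -- Near 0 the first and third factors of R are at least 1/2.
      low-R : ∀ x → 0# ≤ x → x ≤ t₁ → δ₁ ≤ # 4 * R ω x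
      low-R x x≥0 x≤t₁ = ≤-by ((g - δ₁) + g * (# 2 * l - 1#) + # 2 * (l * (g * (# 2 * v - 1#))))
        (+-nonNeg (+-nonNeg (≤⇒0≤ (δ₁≤ x x≥0 x≤t₁)) (*-nonNeg g≥0 2l-1≥0)) (*-nonNeg (#-nonNeg 2) (*-nonNeg l≥0
            (*-nonNeg g≥0 2v-1≥0))))
        ((solve 4 (λ l g v d → (g :- d) :+ g :* (:# 2 :* l :- :# 1) :+ :# 2 :* (l :* (g :* (:# 2 :* v :- :# 1)))
            := :# 4 :* (l :* (g :* v)) :- d) refl l g v δ₁))
        where
        p q l g v : Carrier
        p = P x
        q = Q x
        l = p - # 2 * q
        g = ω * p - q
        v = 𝐕 ω p q
        small : 0# ≤ 1# - # 1000 * x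
        small = ≤⇒0≤ (≤-trans (*-monoˡ-≤ (#-nonNeg 1000) x≤t₁) t₁-small)
        1-x : 0# ≤ 1# - x
        1-x = 1-x≥0 {999} x≥0 (0≤⇒≤ small)
        g≥0 : 0# ≤ g
        g≥0 = ≤-trans (<⇒≤ δ₁-pos) (δ₁≤ x x≥0 x≤t₁)
        p≥0 : 0# ≤ p
        p≥0 = P≥0 1-x
        q≥0 : 0# ≤ q
        q≥0 = Q≥0 x≥0
        10q≤1 : 0# ≤ 1# - # 10 * q
        10q≤1 = 0≤-resp ((solve 1 (λ x → (:# 1 :- :# 1000 :* x) :+ x :* (:# 358 :+ :# 2 :* (:# 1 :- :# 1000 :* x)
            :+ :# 80 :* x :+ :# 640 :* (x :* (:# 1 :- x))) := :# 1 :- :# 10 :* (:# 64 :* (x :* ((:# 1 :+ x) :*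
            (:# 1 :+ x))))) refl x))
          (+-nonNeg small (*-nonNeg x≥0 (+-nonNeg (+-nonNeg (+-nonNeg (#-nonNeg 358) (*-nonNeg (#-nonNeg 2) small))
            (*-nonNeg (#-nonNeg 80) x≥0)) (*-nonNeg (#-nonNeg 640) (*-nonNeg x≥0 1-x)))))
        10p≥9 : 0# ≤ # 10 * p - # 9
        10p≥9 = 0≤-resp ((solve 1 (λ x → (:# 1 :- :# 1000 :* x) :+ :# 960 :* x :+ :# 10 :* (x :* x :* (:# 2
            :+ :# 4 :* (:# 1 :- x) :+ x :* x)) := :# 10 :* ((:# 1 :- x) :* (:# 1 :- x) :* ((:# 1 :- x) :* (:# 1
            :- x))) :- :# 9) refl x))
          (+-nonNeg (+-nonNeg small (*-nonNeg (#-nonNeg 960) x≥0)) (*-nonNeg (#-nonNeg 10) (*-nonNeg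
              (*-nonNeg x≥0 x≥0)
            (+-nonNeg (+-nonNeg (#-nonNeg 2) (*-nonNeg (#-nonNeg 4) 1-x)) (*-nonNeg x≥0 x≥0)))))
        2l-1≥0 : 0# ≤ # 2 * l - 1#
        2l-1≥0 = *-cancelˡ-≤ (#-pos 9) (≤-by (# 2 * (# 10 * p - # 9) + # 4 * (1# - # 10 * q) + # 4)
          (+-nonNeg (+-nonNeg (*-nonNeg (#-nonNeg 2) 10p≥9) (*-nonNeg (#-nonNeg 4) 10q≤1)) (#-nonNeg 4))
          ((solve 2 (λ p q → :# 2 :* (:# 10 :* p :- :# 9) :+ :# 4 :* (:# 1 :- :# 10 :* q) :+ :# 4 := :# 10 :*
              (:# 2 :* (p :- :# 2 :* q) :- :# 1) :- :# 10 :* :# 0) refl p q)))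
        l≥0 : 0# ≤ l
        l≥0 = *-cancelˡ-≤ (#-pos 1) (≤-by ((# 2 * l - 1#) + 1#) (+-nonNeg 2l-1≥0 (<⇒≤ 0<1)) ((solve 1 (λ l →
            (:# 2 :* l :- :# 1) :+ :# 1 := :# 2 :* l :- :# 2 :* :# 0) refl l)))
        q≤1 : q ≤ 1#
        q≤1 = ≤-by ((1# - # 10 * q) + # 9 * q) (+-nonNeg 10q≤1 (*-nonNeg (#-nonNeg 9) q≥0)) ((solve 1 (λ q → (:# 1
            :- :# 10 :* q) :+ :# 9 :* q := :# 1 :- q) refl q))
        product≤1 : ∀ {y} → 0# ≤ y → y ≤ 1# → y * q ≤ 1#
        product≤1 y≥0 y≤1 = ≤-trans (*-mono-≤ y≥0 (<⇒≤ 0<1) y≤1 q≤1) (≤-reflexive (*-identityˡ 1#))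
        2v-1≥0 : 0# ≤ # 2 * v - 1#
        2v-1≥0 = *-cancelˡ-≤ (#-pos 399) (≤-by
          (# 8 * ((# 10 * p - # 9) * (# 10 * p + # 9)) + # 8 * (p * q * (1# - # 100 * ω′) + (1# - p * q))
            + # 2 * (q * q * (1# - # 400 * ω) + (1# - q * q)) + # 238)
          (+-nonNeg (+-nonNeg (+-nonNeg
            (*-nonNeg (#-nonNeg 8) (*-nonNeg 10p≥9 (+-nonNeg (*-nonNeg (#-nonNeg 10) p≥0) (#-nonNeg 9))))
            (*-nonNeg (#-nonNeg 8) (+-nonNeg (*-nonNeg (*-nonNeg p≥0 q≥0) (≤⇒0≤ 100ω′≤1)) (≤⇒0≤ (product≤1 p≥0
                (P≤1 x≥0 1-x))))))
            (*-nonNeg (#-nonNeg 2) (+-nonNeg (*-nonNeg (*-nonNeg q≥0 q≥0) (≤⇒0≤ ω-small)) (≤⇒0≤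
                (product≤1 q≥0 q≤1)))))
            (#-nonNeg 238))
          ((solve 3 (λ p q w → :# 8 :* ((:# 10 :* p :- :# 9) :* (:# 10 :* p :+ :# 9)) :+ :# 8 :* (p :* q :* (:# 1
              :- :# 100 :* (w :* w :+ :# 3 :* w)) :+ (:# 1 :- p :* q)) :+ :# 2 :* (q :* q :* (:# 1 :- :# 400 :* w)
              :+ (:# 1 :- q :* q)) :+ :# 238 := :# 400 :* (:# 2 :* (p :* p :- (w :* w :+ :# 3 :* w) :* (p :* q)
              :- w :* (q :* q)) :- :# 1) :- :# 400 :* :# 0) refl p q ω)))

      -- From 1/10 on, Q is at least 6 while P is at most 1, so the first two factors are both at
      -- most -1 and their signs cancel. The last factor divided by P² decreases with Q/P, hence is
      -- smallest at `t₃`.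
      high-R : ∀ x → 1# ≤ # 10 * x → x ≤ t₃ → δ₃ ≤ R ω x
      high-R x 1≤10x x≤t₃ = ≤-trans δ₃≤v (≤-by ((l′ - 1#) * (g′ * v) + (g′ - 1#) * v)
        (+-nonNeg (*-nonNeg l′-1≥0 (*-nonNeg g′≥0 v≥0)) (*-nonNeg g′-1≥0 v≥0))
        ((solve 4 (λ p q w v → ((:# 2 :* q :- p) :- :# 1) :* ((q :- w :* p) :* v) :+ ((q :- w :* p) :- :# 1) :* v :=
            (p :- :# 2 :* q) :* ((w :* p :- q) :* v) :- v) refl p q ω v)))
        where
        p q p₃ q₃ v V₃ l′ g′ : Carrier
        p = P x
        q = Q x
        p₃ = P t₃
        q₃ = Q t₃
        v = 𝐕 ω p q
        V₃ = 𝐕 ω p₃ q₃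
        l′ = # 2 * q - p
        g′ = q - ω * p
        x≥0 : 0# ≤ x
        x≥0 = *-cancelˡ-≤ (#-pos 9) (≤-trans (≤-reflexive (*-zeroʳ _)) (≤-trans (<⇒≤ 0<1) 1≤10x))
        1-t₃ : 0# ≤ 1# - t₃
        1-t₃ = 1-x≥0 {4} t₃-nonNeg t₃-small
        1-x : 0# ≤ 1# - x
        1-x = ≤-trans 1-t₃ (≤-by (t₃ - x) (≤⇒0≤ x≤t₃) ((solve 2 (λ x t → t :- x := (:# 1 :- x) :- (:# 1
            :- t)) refl x t₃)))
        p≥0 : 0# ≤ p
        p≥0 = P≥0 1-x
        1-p : 0# ≤ 1# - p
        1-p = ≤⇒0≤ (P≤1 x≥0 1-x)
        q-6≥0 : 0# ≤ q - # 6
        q-6≥0 = *-cancelˡ-≤ (#-pos 9) (≤-by (# 64 * ((# 10 * x - 1#) * ((1# + x) * (1# + x))) + # 64 *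
            (# 2 * x + x * x) + # 4)
          (+-nonNeg (+-nonNeg
            (*-nonNeg (#-nonNeg 64) (*-nonNeg (≤⇒0≤ 1≤10x) (*-nonNeg (+-nonNeg (<⇒≤ 0<1) x≥0) (+-nonNeg
                (<⇒≤ 0<1) x≥0))))
            (*-nonNeg (#-nonNeg 64) (+-nonNeg (*-nonNeg (#-nonNeg 2) x≥0) (*-nonNeg x≥0 x≥0)))) (#-nonNeg 4))
          ((solve 1 (λ x → :# 64 :* ((:# 10 :* x :- :# 1) :* ((:# 1 :+ x) :* (:# 1 :+ x))) :+ :# 64 :* (:# 2 :* x
              :+ x :* x) :+ :# 4 := :# 10 :* (:# 64 :* (x :* ((:# 1 :+ x) :* (:# 1 :+ x))) :- :# 6)
              :- :# 10 :* :# 0) refl x)))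
        l′-1≥0 : 0# ≤ l′ - 1#
        l′-1≥0 = 0≤-resp ((solve 2 (λ p q → :# 2 :* (q :- :# 6) :+ (:# 1 :- p) :+ :# 10 := :# 2 :* q :- p
            :- :# 1) refl p q))
          (+-nonNeg (+-nonNeg (*-nonNeg (#-nonNeg 2) q-6≥0) 1-p) (#-nonNeg 10))
        g′-1≥0 : 0# ≤ g′ - 1#
        g′-1≥0 = 0≤-resp ((solve 3 (λ p q w → (q :- :# 6) :+ w :* (:# 1 :- p) :+ (:# 1 :- w) :+ :# 4 := q :- w :* p
            :- :# 1) refl p q ω))
          (+-nonNeg (+-nonNeg (+-nonNeg q-6≥0 (*-nonNeg ω≥0 1-p)) 1-ω≥0) (#-nonNeg 4))
        g′≥0 : 0# ≤ g′
        g′≥0 = 0≤-resp ((solve 1 (λ g → (g :- :# 1) :+ :# 1 := g) refl g′)) (+-nonNeg g′-1≥0 (<⇒≤ 0<1))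
        p₃≤p : p₃ ≤ p
        p₃≤p = P-anti 1-t₃ x≤t₃
        p₃≥0 : 0# ≤ p₃
        p₃≥0 = <⇒≤ P₃-pos
        q≥0 : 0# ≤ q
        q≥0 = Q≥0 x≥0
        q₃≥0 : 0# ≤ q₃
        q₃≥0 = Q≥0 t₃-nonNeg
        cross : 0# ≤ p * q₃ - q * p₃
        cross = 0≤-resp ((solve 4 (λ p q a b → (p :- a) :* b :+ a :* (b :- q) := p :* b :- q :* a) refl p q p₃ q₃))
          (+-nonNeg (*-nonNeg (≤⇒0≤ p₃≤p) q₃≥0) (*-nonNeg p₃≥0 (≤⇒0≤ (Q-mono x≥0 x≤t₃))))
        δ₃≤vp₃² : δ₃ ≤ v * (p₃ * p₃)
        δ₃≤vp₃² = ≤-by (V₃ * ((p - p₃) * (p + p₃)) + (ω′ * (p * p₃ * (p * q₃ - q * p₃)) + ω * ((p * q₃ - q * p₃) *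
            (p * q₃ + q * p₃))))
          (+-nonNeg (*-nonNeg (<⇒≤ V-pos) (*-nonNeg (≤⇒0≤ p₃≤p) (+-nonNeg p≥0 p₃≥0)))
            (+-nonNeg (*-nonNeg ω′≥0 (*-nonNeg (*-nonNeg p≥0 p₃≥0) cross))
              (*-nonNeg ω≥0 (*-nonNeg cross (+-nonNeg (*-nonNeg p≥0 q₃≥0) (*-nonNeg q≥0 p₃≥0))))))
          ((solve 5 (λ p q a b w → (a :* a :- (w :* w :+ :# 3 :* w) :* (a :* b) :- w :* (b :* b)) :* ((p :- a) :*
              (p :+ a)) :+ ((w :* w :+ :# 3 :* w) :* (p :* a :* (p :* b :- q :* a)) :+ w :* ((p :* b :- q :* a) :*
              (p :* b :+ q :* a))) := (p :* p :- (w :* w :+ :# 3 :* w) :* (p :* q) :- w :* (q :* q)) :* (a :* a) :-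
              (a :* a :- (w :* w :+ :# 3 :* w) :* (a :* b) :- w :* (b :* b)) :* (a :* a)) refl p q p₃ q₃ ω))
        v≥0 : 0# ≤ v
        v≥0 = *-cancelˡ-≤ (*-pos P₃-pos P₃-pos) (≤-trans (≤-reflexive (*-zeroʳ _))
          (≤-trans (<⇒≤ δ₃-pos) (≤-trans δ₃≤vp₃² (≤-reflexive (*-comm _ _)))))
        δ₃≤v : δ₃ ≤ v
        δ₃≤v = ≤-trans δ₃≤vp₃² (≤-by (v * ((1# - p₃) * (1# + p₃)))
          (*-nonNeg v≥0 (*-nonNeg (≤⇒0≤ (P≤1 t₃-nonNeg 1-t₃)) (+-nonNeg (<⇒≤ 0<1) p₃≥0)))
          ((solve 2 (λ v a → v :* ((:# 1 :- a) :* (:# 1 :+ a)) := v :- v :* (a :* a)) refl v p₃)))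

      exceeds : ∀ {K d} n k → 0# < d → K ≤ # n * d → n ℕ.≤ k → K < b k * d
      exceeds {K} {d} n k d>0 K≤nd n≤k = ≤-<-trans K≤nd (<-by ((# suc k - # n) * d + # 5 * (# suc k * d))
        (0<-resp (+-comm _ _) (+-pos-nonNeg (*-pos (#-pos 4) (*-pos (#-pos k) d>0))
          (*-nonNeg (≤⇒0≤ (#-mono-≤ (ℕₚ.≤-trans n≤k (ℕₚ.n≤1+n k)))) (<⇒≤ d>0))))
        ((solve 3 (λ k n d → (k :- n) :* d :+ :# 5 :* (k :* d) := :# 6 :* k :* d :- n :* d) refl (# suc k) (# n) d)))

      opaque
        f : Poly
        f = expand (numeratorₑ ω)

        eval-f : ∀ x → evalAt x f ≈ R ω x
        eval-f x = At.ev-expand x (numeratorₑ ω)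

        A≈ : ∀ k s → A k f s ≈ coeff (Fun.numerator ω S.* denominators (suc k)) (s ℕ.* 2)
        A≈ k s = at (S.*-congʳ (numerator≈ ω)) (s ℕ.* 2)

      η : Carrier
      η = (# 6 * t₃ + # 11 * (t₃ * t₃)) - 1#

      -- The worst case is s = k + 1, where the difference of the two sides is (k + 1)η + t₃² - 1;
      -- so `η`, the excess of `t₃` over the equation of T₀, has to exceed about 1/k.
      below-t₃ : ∀ n k → 1# ≤ # n * η → n ℕ.≤ k → ∀ s → s ℕ.≤ suc k → # suc s ≤ t₃ * (b k + (N k + # s) * t₃)
      below-t₃ n k 1≤nη n≤k s s≤k = ≤-trans (≤-reflexive (#-suc s)) (≤-by
        ((# n * η - 1#) + (# suc k - # n) * η + (# suc k - # s) * (1# - t₃ * t₃) + t₃ * t₃)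
        (+-nonNeg (+-nonNeg (+-nonNeg (≤⇒0≤ 1≤nη) (*-nonNeg (≤⇒0≤ (#-mono-≤ (ℕₚ.≤-trans n≤k (ℕₚ.n≤1+n k)))) (<⇒≤
            (<⇒0< t₃-large))))
          (*-nonNeg (≤⇒0≤ (#-mono-≤ s≤k)) (0≤-resp ((solve 1 (λ t → (:# 1 :- t) :* (:# 1 :+ t) := :# 1
              :- t :* t) refl t₃))
            (*-nonNeg (1-x≥0 {4} t₃-nonNeg t₃-small) (+-nonNeg (<⇒≤ 0<1) t₃-nonNeg)))))
                (*-nonNeg t₃-nonNeg t₃-nonNeg))
        ((solve 4 (λ n k s t → (n :* ((:# 6 :* t :+ :# 11 :* (t :* t)) :- :# 1) :- :# 1) :+ (k :- n) :* ((:# 6 :* t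
            :+ :# 11 :* (t :* t)) :- :# 1) :+ (k :- s) :* (:# 1 :- t :* t) :+ t :* t := t :* (:# 6 :* k :+
            (:# 10 :* k :+ :# 1 :+ s) :* t) :- (:# 1 :+ s)) refl (# n) (# suc k) (# s) t₃)))

      below-t₁ : ∀ k s S → s ℕ.≤ S → # suc S ≤ t₁ * (b k + (N k + # S) * t₁) → # suc s ≤ t₁ * (b k + (N k + # s) * t₁)
      below-t₁ k s S s≤S le = ≤-trans (≤-reflexive (#-suc s)) (≤-by
        ((t₁ * (b k + (N k + # S) * t₁) - (1# + # S)) + (# S - # s) * (1# - t₁ * t₁))
        (+-nonNeg (≤⇒0≤ (≤-trans (≤-reflexive (sym (#-suc S))) le)) (*-nonNeg (≤⇒0≤ (#-mono-≤ s≤S))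
          (0≤-resp ((solve 1 (λ t → (:# 1 :- t) :* (:# 1 :+ t) := :# 1 :- t :* t) refl t₁))
            (*-nonNeg (1-x≥0 {999} t₁-nonNeg t₁-small) (+-nonNeg (<⇒≤ 0<1) t₁-nonNeg)))))
        ((solve 5 (λ b N S s t → (t :* (b :+ (N :+ S) :* t) :- (:# 1 :+ S)) :+ (S :- s) :* (:# 1 :- t :* t) := t :*
            (b :+ (N :+ s) :* t) :- (:# 1 :+ s)) refl (b k) (N k) (# S) (# s) t₁)))

    private
      Approximates : Carrier → Set
      Approximates K = ∀ k s → s ℕ.≤ suc k → b k * evalAt (ρ k s) f * C k s ≤ b k * A k f s + K * C k s

      low : ∀ {K ¼} n → Approximates K → # 4 * ¼ ≈ 1# → 0# < ¼ → K ≤ # n * (δ₁ * ¼) → ∀ k → n ℕ.≤ k →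
        ∀ S → S ℕ.≤ suc k → # suc S ≤ t₁ * (b k + (N k + # S) * t₁) →
        ∀ s → s ℕ.≤ S → 0# ≤ coeff (Fun.numerator ω S.* denominators (suc k)) (s ℕ.* 2)
      low {K} {¼} n approx 4¼≈1 ¼>0 large k n≤k S S≤k le s s≤S = <⇒≤ (0<-resp (A≈ k s)
        (positive-coefficient {δ₁ * ¼} {K} k s f (approx k s s≤k) δ≤ (exceeds n k (*-pos δ₁-pos ¼>0) large n≤k)))
        where
        s≤k : s ℕ.≤ suc k
        s≤k = ℕₚ.≤-trans s≤S S≤k
        δ≤ : δ₁ * ¼ ≤ evalAt (ρ k s) f
        δ≤ = ≤-trans (*-cancelˡ-≤ (#-pos 3) (≤-trans (≤-reflexive (trans
            ((solve 2 (λ d q → :# 4 :* (d :* q) := d :* (:# 4 :* q)) refl δ₁ ¼)) (trans (*-congˡ 4¼≈1)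
                (*-identityʳ δ₁))))
            (low-R (ρ k s) (ρ-nonNeg k s) (ρ-upper k s t₁ s≤k t₁-nonNeg (below-t₁ k s S s≤S le)))))
          (≤-reflexive (sym (eval-f (ρ k s))))

      high : ∀ {K} n nη → Approximates K → K ≤ # n * δ₃ → 1# ≤ # nη * η → ∀ k → n ℕ.≤ k → nη ℕ.≤ k → 50 ℕ.≤ k →
        ∀ s → k ℕ.≤ s ℕ.+ 9 → s ℕ.≤ suc k → 0# < coeff (Fun.numerator ω S.* denominators (suc k)) (s ℕ.* 2)
      high {K} n nη approx large largeη k n≤k nη≤k 50≤k s k≤s+9 s≤k = 0<-resp (A≈ k s)
        (positive-coefficient {δ₃} {K} k s f (approx k s s≤k) δ≤ (exceeds n k δ₃-pos large n≤k))
        where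
        δ≤ : δ₃ ≤ evalAt (ρ k s) f
        δ≤ = ≤-trans (high-R (ρ k s) (ρ-lower k s k≤s+9 s≤k 50≤k)
            (ρ-upper k s t₃ s≤k t₃-nonNeg (below-t₃ nη k largeη nη≤k s s≤k)))
          (≤-reflexive (sym (eval-f (ρ k s))))

    record Positive (k : ℕ) : Set where
      field
        low-positive : ∀ S → S ℕ.≤ suc k → # suc S ≤ t₁ * (b k + (N k + # S) * t₁) →
          ∀ s → s ℕ.≤ S → 0# ≤ coeff (Fun.numerator ω S.* denominators (suc k)) (s ℕ.* 2)
        high-positive : ∀ s → k ℕ.≤ s ℕ.+ 9 → s ℕ.≤ suc k →
          0# < coeff (Fun.numerator ω S.* denominators (suc k)) (s ℕ.* 2)

    kernel-positivity : ∃[ k₀ ] (∀ k → k₀ ℕ.≤ k → Positive k)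
    kernel-positivity = conclude (approximation f) (pos-inverse (#-pos 3))
      where
      conclude : ∃[ K ] (0# ≤ K) × Approximates K → ∃[ ¼ ] (# 4 * ¼ ≈ 1#) × (0# < ¼) → ∃[ k₀ ] (∀ k → k₀ ℕ.≤ k
          → Positive k)
      conclude (K , _ , approx) (¼ , 4¼≈1 , ¼>0) =
        choose (multiple K (*-pos δ₁-pos ¼>0)) (multiple K δ₃-pos) (multiple 1# (<⇒0< t₃-large))
        where
        choose : ∃[ n ] K ≤ # n * (δ₁ * ¼) → ∃[ n ] K ≤ # n * δ₃ → ∃[ n ] 1# ≤ # n * η → ∃[ k₀ ] (∀ k → k₀ ℕ.≤ k
            → Positive k)
        -- The three numbers beat the approximation error near 0, the same error near T₀, and the
        -- rounding in `below-t₃`; 50 is what `ρ-lower` requires.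
        choose (i , large₁) (j , large₃) (l , largeη) = i ℕ.+ j ℕ.+ l ℕ.+ 50 , λ k k₀≤k → record
          { low-positive  = low i approx 4¼≈1 ¼>0 large₁ k (ℕₚ.≤-trans i≤ k₀≤k)
          ; high-positive = high j l approx large₃ largeη k (ℕₚ.≤-trans j≤ k₀≤k) (ℕₚ.≤-trans l≤ k₀≤k)
              (ℕₚ.≤-trans (ℕₚ.m≤n+m 50 (i ℕ.+ j ℕ.+ l)) k₀≤k) }
          where
          i≤ : i ℕ.≤ i ℕ.+ j ℕ.+ l ℕ.+ 50
          i≤ = ℕₚ.≤-trans (ℕₚ.m≤m+n i j) (ℕₚ.≤-trans (ℕₚ.m≤m+n (i ℕ.+ j) l) (ℕₚ.m≤m+n _ 50))
          j≤ : j ℕ.≤ i ℕ.+ j ℕ.+ l ℕ.+ 50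
          j≤ = ℕₚ.≤-trans (ℕₚ.m≤n+m j i) (ℕₚ.≤-trans (ℕₚ.m≤m+n (i ℕ.+ j) l) (ℕₚ.m≤m+n _ 50))
          l≤ : l ℕ.≤ i ℕ.+ j ℕ.+ l ℕ.+ 50
          l≤ = ℕₚ.≤-trans (ℕₚ.m≤n+m l (i ℕ.+ j)) (ℕₚ.m≤m+n _ 50)

-- Choice of the parameters and the polynomial of the statement

-- A discrete intermediate value theorem: a grid step across a saddle point stands in for the saddle
-- point itself.
crossing : ∀ {A : ℕ → Set} → (∀ i → Dec (A i)) → ¬ A 0 → ∀ M → A M → ∃[ i ] (i ℕ.< M) × (¬ A i) × A (suc i)
crossing dec ¬A0 zero AM = ⊥-elim (¬A0 AM)
crossing dec ¬A0 (suc M) AM with dec M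
... | no ¬AM = M , ℕₚ.≤-refl , ¬AM , AM
... | yes A′ with crossing dec ¬A0 M A′
...   | i , i<M , ¬Ai , Ai = i , ℕₚ.≤-trans i<M (ℕₚ.n≤1+n M) , ¬Ai , Ai

module ParameterChoice (F : OrderedField) where

  open OrderedField F
  open OrderedFieldProperties F
  open KernelPositivity F using (P; Q; 𝐕; Parameters)
  open PolynomialBounds F using (evalAt; lipschitz; Lipschitz)
  open import Algebra.Properties.Semiring.Exp (CommutativeRing.semiring commutativeRing) using (_^_; ^-congˡ)

  -- The polynomial of the statement is even; this is its Horner form in the square of the variable.
  π : Carrier → Carrier
  π X = ((((((((# 11 * X + # 2112) * X - # 8525) * X + # 15048) * X - # 15218) * X + # 9552) * X - # 3718) * X +
      # 828) * X - # 81)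

  private
    ^-nonNeg : ∀ {x} n → 0# ≤ x → 0# ≤ x ^ n
    ^-nonNeg zero x≥0 = <⇒≤ 0<1
    ^-nonNeg (suc n) x≥0 = *-nonNeg x≥0 (^-nonNeg n x≥0)

    ^-pos : ∀ {x} n → 0# < x → 0# < x ^ n
    ^-pos zero x>0 = 0<1
    ^-pos (suc n) x>0 = *-pos x>0 (^-pos n x>0)

    infixr 6 _⊕≥_
    _⊕≥_ : ∀ {x y} → 0# ≤ x → 0# ≤ y → 0# ≤ x + y
    _⊕≥_ = +-nonNeg

    c≥ : ∀ c {x} → 0# ≤ x → 0# ≤ # c * x
    c≥ c = *-nonNeg (#-nonNeg c)

  -- The Taylor coefficients of π at 9/10 are positive.
  π<0⇒ : ∀ X → π X < 0# → # 10 * X < # 9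
  π<0⇒ X πX<0 9≤10X = πX<0 (*-cancelˡ-≤ (#-pos 99999999) (≤-by
    (# 155538711 * z ^ 0 + (# 315863712 * z ^ 1 + (# 267148808 * z ^ 2 + (# 122415384 * z ^ 3 +
        (# 33121270 * z ^ 4 + (# 5387184 * z ^ 5 + (# 503008 * z ^ 6 + (# 21912 * z ^ 7 + (# 11 * z ^ 8))))))))) D≥0
        ((solve 1 (λ X → :# 155538711 :* (:# 10 :* X :- :# 9) :^ 0 :+ (:# 315863712 :* (:# 10 :* X :- :# 9) :^ 1 :+
        (:# 267148808 :* (:# 10 :* X :- :# 9) :^ 2 :+ (:# 122415384 :* (:# 10 :* X :- :# 9) :^ 3 :+ (:# 33121270 :*
        (:# 10 :* X :- :# 9) :^ 4 :+ (:# 5387184 :* (:# 10 :* X :- :# 9) :^ 5 :+ (:# 503008 :* (:# 10 :* X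
        :- :# 9) :^ 6 :+ (:# 21912 :* (:# 10 :* X :- :# 9) :^ 7 :+ (:# 11 :* (:# 10 :* X :- :# 9) :^ 8))))))))
        := :# 100000000 :* ((((((((:# 11 :* X :+ :# 2112) :* X :- :# 8525) :* X :+ :# 15048) :* X :- :# 15218) :* X
        :+ :# 9552) :* X :- :# 3718) :* X :+ :# 828) :* X :- :# 81) :- :# 100000000 :* :# 0) refl X))))
    where
    z : Carrier
    z = # 10 * X - # 9
    z≥0 : 0# ≤ z
    z≥0 = ≤⇒0≤ 9≤10X
    D≥0 : 0# ≤ # 155538711 * z ^ 0 + (# 315863712 * z ^ 1 + (# 267148808 * z ^ 2 + (# 122415384 * z ^ 3 +
        (# 33121270 * z ^ 4 + (# 5387184 * z ^ 5 + (# 503008 * z ^ 6 + (# 21912 * z ^ 7 + (# 11 * z ^ 8))))))))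
    D≥0 = c≥ 155538711 (^-nonNeg 0 z≥0) ⊕≥ c≥ 315863712 (^-nonNeg 1 z≥0) ⊕≥ c≥ 267148808
        (^-nonNeg 2 z≥0) ⊕≥ c≥ 122415384 (^-nonNeg 3 z≥0) ⊕≥ c≥ 33121270 (^-nonNeg 4 z≥0) ⊕≥ c≥ 5387184
        (^-nonNeg 5 z≥0) ⊕≥ c≥ 503008 (^-nonNeg 6 z≥0) ⊕≥ c≥ 21912 (^-nonNeg 7 z≥0) ⊕≥ c≥ 11 (^-nonNeg 8 z≥0)

  private
    -- The homogeneous form p⁴ν(q/p) of `ν`.
    N : Carrier → Carrier → Carrier
    N q p = p ^ 4 - # 440 * (p ^ 3 * q) - # 624 * (p ^ 2 * q ^ 2) - # 275 * (p * q ^ 3) - # 11 * q ^ 4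

    H : Carrier → Carrier → Carrier
    H S G = # 11 * (S ^ 8 * G ^ 0) + # 2112 * (S ^ 7 * G ^ 1) - # 8525 * (S ^ 6 * G ^ 2) + # 15048 *
        (S ^ 5 * G ^ 3) - # 15218 * (S ^ 4 * G ^ 4) + # 9552 * (S ^ 3 * G ^ 5) - # 3718 * (S ^ 2 * G ^ 6) + # 828 *
        (S ^ 1 * G ^ 7) - # 81 * (S ^ 0 * G ^ 8)

    H-π : ∀ X G → H (X * G) G ≈ G ^ 8 * π X
    H-π X G = (solve 2 (λ X G → :# 11 :* ((X :* G) :^ 8 :* G :^ 0) :+ :# 2112 :* ((X :* G) :^ 7 :* G :^ 1)
        :- :# 8525 :* ((X :* G) :^ 6 :* G :^ 2) :+ :# 15048 :* ((X :* G) :^ 5 :* G :^ 3) :- :# 15218 :*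
        ((X :* G) :^ 4 :* G :^ 4) :+ :# 9552 :* ((X :* G) :^ 3 :* G :^ 5) :- :# 3718 :* ((X :* G) :^ 2 :* G :^ 6)
        :+ :# 828 :* ((X :* G) :^ 1 :* G :^ 7) :- :# 81 :* ((X :* G) :^ 0 :* G :^ 8) := G :^ 8 :*
        ((((((((:# 11 :* X :+ :# 2112) :* X :- :# 8525) :* X :+ :# 15048) :* X :- :# 15218) :* X :+ :# 9552) :* X
        :- :# 3718) :* X :+ :# 828) :* X :- :# 81)) refl X G)

    -- Here A = (1 - t)² and A + e = (1 + t)² with e = 4t. In these variables all coefficients are
    -- positive, so the cofactor of `N` in the factorisation stays positive and the sign of `π` is
    -- decided by `N` alone.
    N̂-expansion : ∀ A e → N (A * (A - # 16 * (A + e))) (# 16 * ((A + e) * (A + e))) ≈ # 5449861 * (A ^ 8 * e ^ 0) +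
        (# 45959008 * (A ^ 7 * e ^ 1) + (# 173873104 * (A ^ 6 * e ^ 2) + (# 373684480 * (A ^ 5 * e ^ 3) +
        (# 484802560 * (A ^ 4 * e ^ 4) + (# 376176640 * (A ^ 3 * e ^ 5) + (# 160989184 * (A ^ 2 * e ^ 6) +
        (# 29360128 * (A ^ 1 * e ^ 7) + (# 65536 * (A ^ 0 * e ^ 8)))))))))
    N̂-expansion A e = (solve 2 (λ A e → ((:# 16 :* ((A :+ e) :* (A :+ e))) :^ 4 :- :# 440 :* ((:# 16 :* ((A
        :+ e) :* (A :+ e))) :^ 3 :* (A :* (A :- :# 16 :* (A :+ e)))) :- :# 624 :* ((:# 16 :* ((A :+ e) :* (A
        :+ e))) :^ 2 :* (A :* (A :- :# 16 :* (A :+ e))) :^ 2) :- :# 275 :* ((:# 16 :* ((A :+ e) :* (A :+ e))) :*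
        (A :* (A :- :# 16 :* (A :+ e))) :^ 3) :- :# 11 :* (A :* (A :- :# 16 :* (A :+ e))) :^ 4) := :# 5449861 :*
        (A :^ 8 :* e :^ 0) :+ (:# 45959008 :* (A :^ 7 :* e :^ 1) :+ (:# 173873104 :* (A :^ 6 :* e :^ 2) :+
        (:# 373684480 :* (A :^ 5 :* e :^ 3) :+ (:# 484802560 :* (A :^ 4 :* e :^ 4) :+ (:# 376176640 :*
        (A :^ 3 :* e :^ 5) :+ (:# 160989184 :* (A :^ 2 :* e :^ 6) :+ (:# 29360128 :* (A :^ 1 :* e :^ 7) :+
        (:# 65536 :* (A :^ 0 :* e :^ 8)))))))))) refl A e)

    N̂-pos : ∀ A e → 0# < A → 0# ≤ e → 0# < N (A * (A - # 16 * (A + e))) (# 16 * ((A + e) * (A + e)))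
    N̂-pos A e A>0 e≥0 = 0<-resp (sym (N̂-expansion A e))
      (+-pos-nonNeg (*-pos (#-pos 5449860) (*-pos (^-pos 8 A>0) (^-pos 0 0<1))) (c≥ 45959008 (*-nonNeg
          (^-nonNeg 7 A≥0) (^-nonNeg 1 e≥0)) ⊕≥ c≥ 173873104 (*-nonNeg (^-nonNeg 6 A≥0)
          (^-nonNeg 2 e≥0)) ⊕≥ c≥ 373684480 (*-nonNeg (^-nonNeg 5 A≥0) (^-nonNeg 3 e≥0)) ⊕≥ c≥ 484802560 (*-nonNeg
          (^-nonNeg 4 A≥0) (^-nonNeg 4 e≥0)) ⊕≥ c≥ 376176640 (*-nonNeg (^-nonNeg 3 A≥0)
          (^-nonNeg 5 e≥0)) ⊕≥ c≥ 160989184 (*-nonNeg (^-nonNeg 2 A≥0) (^-nonNeg 6 e≥0)) ⊕≥ c≥ 29360128 (*-nonNeg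
          (^-nonNeg 1 A≥0) (^-nonNeg 7 e≥0)) ⊕≥ c≥ 65536 (*-nonNeg (^-nonNeg 0 A≥0) (^-nonNeg 8 e≥0))))
      where
      A≥0 : 0# ≤ A
      A≥0 = <⇒≤ A>0

    -- At the point r with 36 r² AB = (4B + A)² the polynomial of the statement is, up to a positive factor,
    -- −N·N̂. Here N is the norm from ℚ(√5) of the condition w(T₀) < w′, where T₀ = (2√5 − 3)/11 is the saddle
    -- point of the zero codeword and w′ the other point at which the kernel changes sign.
    factorisation : ∀ A B → H ((# 4 * B + A) * (# 4 * B + A)) (# 36 * (A * B)) ≈
      - (N (# 16 * (B * (B - A))) (A * A) * N (A * (A - # 16 * B)) (# 16 * (B * B)))
    factorisation A B = (solve 2 (λ A B → :# 11 :* (((:# 4 :* B :+ A) :* (:# 4 :* B :+ A)) :^ 8 :* (:# 36 :*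
        (A :* B)) :^ 0) :+ :# 2112 :* (((:# 4 :* B :+ A) :* (:# 4 :* B :+ A)) :^ 7 :* (:# 36 :* (A :* B)) :^ 1)
        :- :# 8525 :* (((:# 4 :* B :+ A) :* (:# 4 :* B :+ A)) :^ 6 :* (:# 36 :* (A :* B)) :^ 2) :+ :# 15048 :*
        (((:# 4 :* B :+ A) :* (:# 4 :* B :+ A)) :^ 5 :* (:# 36 :* (A :* B)) :^ 3) :- :# 15218 :* (((:# 4 :* B
        :+ A) :* (:# 4 :* B :+ A)) :^ 4 :* (:# 36 :* (A :* B)) :^ 4) :+ :# 9552 :* (((:# 4 :* B :+ A) :* (:# 4 :* B
        :+ A)) :^ 3 :* (:# 36 :* (A :* B)) :^ 5) :- :# 3718 :* (((:# 4 :* B :+ A) :* (:# 4 :* B :+ A)) :^ 2 :*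
        (:# 36 :* (A :* B)) :^ 6) :+ :# 828 :* (((:# 4 :* B :+ A) :* (:# 4 :* B :+ A)) :^ 1 :* (:# 36 :*
        (A :* B)) :^ 7) :- :# 81 :* (((:# 4 :* B :+ A) :* (:# 4 :* B :+ A)) :^ 0 :* (:# 36 :* (A :* B)) :^ 8) := :-
        (((A :* A) :^ 4 :- :# 440 :* ((A :* A) :^ 3 :* (:# 16 :* (B :* (B :- A)))) :- :# 624 :* ((A :* A) :^ 2 :*
        (:# 16 :* (B :* (B :- A))) :^ 2) :- :# 275 :* ((A :* A) :* (:# 16 :* (B :* (B :- A))) :^ 3) :- :# 11 :*
        (:# 16 :* (B :* (B :- A))) :^ 4) :* ((:# 16 :* (B :* B)) :^ 4 :- :# 440 :* ((:# 16 :* (B :* B)) :^ 3 :*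
        (A :* (A :- :# 16 :* B))) :- :# 624 :* ((:# 16 :* (B :* B)) :^ 2 :* (A :* (A :- :# 16 :* B)) :^ 2)
        :- :# 275 :* ((:# 16 :* (B :* B)) :* (A :* (A :- :# 16 :* B)) :^ 3) :- :# 11 :* (A :* (A
        :- :# 16 :* B)) :^ 4))) refl A B)

    H-cong : ∀ {S S′} G → S ≈ S′ → H S G ≈ H S′ G
    H-cong G eq = (+-cong (+-cong (+-cong (+-cong (+-cong (+-cong (+-cong (+-cong (*-congˡ (*-congʳ (^-congˡ 8 eq)))
        (*-congˡ (*-congʳ (^-congˡ 7 eq)))) (-‿cong (*-congˡ (*-congʳ (^-congˡ 6 eq))))) (*-congˡ (*-congʳ
        (^-congˡ 5 eq)))) (-‿cong (*-congˡ (*-congʳ (^-congˡ 4 eq))))) (*-congˡ (*-congʳ (^-congˡ 3 eq)))) (-‿cong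
        (*-congˡ (*-congʳ (^-congˡ 2 eq))))) (*-congˡ (*-congʳ (^-congˡ 1 eq)))) (-‿cong (*-congˡ (*-congʳ
        (^-congˡ 0 eq)))))

    H-congʳ : ∀ {S G G′} → G ≈ G′ → H S G ≈ H S G′
    H-congʳ eq = (+-cong (+-cong (+-cong (+-cong (+-cong (+-cong (+-cong (+-cong (*-congˡ (*-congˡ (^-congˡ 0 eq)))
        (*-congˡ (*-congˡ (^-congˡ 1 eq)))) (-‿cong (*-congˡ (*-congˡ (^-congˡ 2 eq))))) (*-congˡ (*-congˡ
        (^-congˡ 3 eq)))) (-‿cong (*-congˡ (*-congˡ (^-congˡ 4 eq))))) (*-congˡ (*-congˡ (^-congˡ 5 eq)))) (-‿cong
        (*-congˡ (*-congˡ (^-congˡ 6 eq))))) (*-congˡ (*-congˡ (^-congˡ 7 eq)))) (-‿cong (*-congˡ (*-congˡ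
        (^-congˡ 8 eq)))))

    N-congˡ : ∀ {q q′} p → q ≈ q′ → N q p ≈ N q′ p
    N-congˡ p eq = +-cong (+-cong (+-cong (+-congˡ (-‿cong (*-congˡ (*-congˡ eq))))
      (-‿cong (*-congˡ (*-congˡ (^-congˡ 2 eq))))) (-‿cong (*-congˡ (*-congˡ (^-congˡ 3 eq))))) (-‿cong (*-congˡ
          (^-congˡ 4 eq)))

    coefficients : List Carrier
    coefficients = (- # 81) ∷ # 828 ∷ (- # 3718) ∷ # 9552 ∷ (- # 15218) ∷ # 15048 ∷ (- # 8525) ∷ # 2112 ∷ # 11 ∷ []

    π≈ : ∀ X → evalAt X coefficients ≈ π X
    π≈ X = (solve 1 (λ X → (:- :# 81) :+ X :* (:# 828 :+ X :* ((:- :# 3718) :+ X :* (:# 9552 :+ X :* ((:- :# 15218)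
        :+ X :* (:# 15048 :+ X :* ((:- :# 8525) :+ X :* (:# 2112 :+ X :* (:# 11 :+ X :* (:# 0))))))))) :=
        ((((((((:# 11 :* X :+ :# 2112) :* X :- :# 8525) :* X :+ :# 15048) :* X :- :# 15218) :* X :+ :# 9552) :* X
        :- :# 3718) :* X :+ :# 828) :* X :- :# 81)) refl X)

  -- This is the factorisation at t = 0, where A = B = 1: `N` is 1 and its cofactor is 5449861, the
  -- first coefficient in `N̂-expansion`.
  π-5/6 : ∀ s → # 6 * s ≈ # 5 → π (s * s) < 0#
  π-5/6 s 6s≈5 0≤π = #-pos 5449860 (0≤⇒≤ (0≤-resp
    (trans (sym (H-π (s * s) (# 36))) (trans (H-cong (# 36) 36s²≈25) ((solve 0 (:# 11 :* (:# 25 :^ 8 :* :# 36 :^ 0)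
        :+ :# 2112 :* (:# 25 :^ 7 :* :# 36 :^ 1) :- :# 8525 :* (:# 25 :^ 6 :* :# 36 :^ 2) :+ :# 15048 :*
        (:# 25 :^ 5 :* :# 36 :^ 3) :- :# 15218 :* (:# 25 :^ 4 :* :# 36 :^ 4) :+ :# 9552 :*
        (:# 25 :^ 3 :* :# 36 :^ 5) :- :# 3718 :* (:# 25 :^ 2 :* :# 36 :^ 6) :+ :# 828 :* (:# 25 :^ 1 :* :# 36 :^ 7)
        :- :# 81 :* (:# 25 :^ 0 :* :# 36 :^ 8) := :# 0 :- :# 5449861) refl))))
    (*-nonNeg (^-nonNeg 8 (#-nonNeg 36)) 0≤π)))
    where
    36s²≈25 : s * s * # 36 ≈ # 25
    36s²≈25 = trans ((solve 1 (λ s → s :* s :* :# 36 := :# 6 :* s :* (:# 6 :* s)) refl s)) (trans (*-cong 6s≈5 6s≈5)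
        ((solve 0 (:# 5 :* :# 5 := :# 25) refl)))

  -- The value w₀ of w at T₀ satisfies w₀² = 19w₀ + 11, so 1 - (ω² + 3ω)w₀ - ωw₀² equals (1 - 11ω) -
  -- (ω² + 22ω)w₀. Multiplying this by its conjugate over ℚ gives `ν` at ω.
  ν : Carrier → Carrier
  ν w = 1# - # 440 * w - # 624 * (w * w) - # 275 * (w * (w * w)) - # 11 * (w * w * (w * w))

  -- t is beyond the saddle point of a weight (2 − 2r)n.
  Criterion : Carrier → Carrier → Set
  Criterion r t = # 6 * r * (1# - t * t) < # 5 + # 6 * t + # 5 * (t * t)

  private
    square-nonNeg : ∀ {x} → 0# ≤ x → 0# ≤ x * x
    square-nonNeg x≥0 = *-nonNeg x≥0 x≥0

    scaled : ∀ c {x} → 0# ≤ # suc c * x → 0# ≤ x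
    scaled c h = *-cancelˡ-≤ (#-pos c) (≤-trans (≤-reflexive (*-zeroʳ _)) h)

    decide : ∀ x y → Dec (x < y)
    decide x y with y ≤? x
    ... | yes y≤x = no (λ x<y → x<y y≤x)
    ... | no y≰x = yes y≰x

    not-less : ∀ x y → ¬ x < y → y ≤ x
    not-less x y ¬x<y with y ≤? x
    ... | yes y≤x = y≤x
    ... | no y≰x = ⊥-elim (¬x<y y≰x)

    grid-suc : ∀ i h → # suc i * h ≈ # i * h + h
    grid-suc i h = trans (*-congʳ (#-suc i)) ((solve 2 (λ i h → (:# 1 :+ i) :* h := i :* h :+ h) refl (# i) h))

    grid-≤ : ∀ {i M h} → 0# ≤ h → # 10 * # M * h ≈ 1# → i ℕ.≤ M → # 10 * (# i * h) ≤ 1#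
    grid-≤ {i} {M} {h} h≥0 eq i≤M = ≤-trans (≤-by (# 10 * ((# M - # i) * h)) (c≥ 10 (*-nonNeg (≤⇒0≤
        (#-mono-≤ i≤M)) h≥0))
      ((solve 3 (λ i M h → :# 10 :* ((M :- i) :* h) := :# 10 :* M :* h :- :# 10 :* (i :* h)) refl (# i) (# M) h)))
          (≤-reflexive eq)

    ν-small : ∀ w → 0# ≤ w → 0# < ν w → # 400 * w ≤ 1#
    ν-small w w≥0 ν>0 = ≤-by (ν w + (# 40 * w + # 624 * (w * w) + # 275 * (w * (w * w)) + # 11 * (w * w * (w * w))))
      (+-nonNeg (<⇒≤ ν>0) (+-nonNeg (+-nonNeg (+-nonNeg (c≥ 40 w≥0) (c≥ 624 w²)) (c≥ 275 (*-nonNeg w≥0 w²))) (c≥ 11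
          (*-nonNeg w² w²))))
      ((solve 1 (λ w → :# 1 :- :# 440 :* w :- :# 624 :* (w :* w) :- :# 275 :* (w :* (w :* w)) :- :# 11 :* (w :* w :*
          (w :* w)) :+ (:# 40 :* w :+ :# 624 :* (w :* w) :+ :# 275 :* (w :* (w :* w)) :+ :# 11 :* (w :* w :*
          (w :* w))) := :# 1 :- :# 400 :* w) refl w))
      where
      w² : 0# ≤ w * w
      w² = *-nonNeg w≥0 w≥0

  module Lower (r : Carrier) (5≤6r : # 5 ≤ # 6 * r) (π<0 : π (r * r) < 0#) where

    private
      X : Carrier
      X = r * r

      r≥0 : 0# ≤ r
      r≥0 = scaled 5 (≤-trans (#-nonNeg 5) 5≤6r)

      20r<19 : # 20 * r < # 19
      20r<19 19≤20r = π<0⇒ X π<0 (*-cancelˡ-≤ (#-pos 39) (≤-by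
        (((# 20 * r - # 19) * (# 20 * r + # 19)) + 1#)
        (+-nonNeg (*-nonNeg (≤⇒0≤ 19≤20r) (+-nonNeg (c≥ 20 r≥0) (#-nonNeg 19))) (<⇒≤ 0<1))
        ((solve 1 (λ r → ((:# 20 :* r :- :# 19) :* (:# 20 :* r :+ :# 19)) :+ :# 1 := :# 40 :* (:# 10 :* (r :* r))
            :- :# 40 :* :# 9) refl r))))

      19-20r≥0 : 0# ≤ # 19 - # 20 * r
      19-20r≥0 = ≤⇒0≤ (<⇒≤ 20r<19)

      1-r≥0 : 0# ≤ 1# - r
      1-r≥0 = scaled 19 (0≤-resp ((solve 1 (λ r → (:# 19 :- :# 20 :* r) :+ :# 1 := :# 20 :* (:# 1 :- r)) refl r))
          (+-nonNeg 19-20r≥0 (<⇒≤ 0<1)))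

      -π>0 : 0# < - π X
      -π>0 = 0<-resp (+-identityˡ _) (<⇒0< π<0)

    record Choice : Set where
      field
        ω t₁ : Carrier
        ω-pos : 0# < ω
        ν-pos : 0# < ν ω
        t₁-nonNeg : 0# ≤ t₁
        t₁-small : # 1000 * t₁ ≤ 1#
        below-ω : Q t₁ < ω * P t₁
        criterion : Criterion r t₁

    private
      -- `t₁` is a grid point just past the saddle point of weight (2 - 2r)n, and `t` is one step
      -- further, with ω = w(t), so that w(t₁) < ω. The number `r′` is the one whose saddle point is
      -- `t`. On a fine grid its square is so close to that of `r` that `π` is still negative there,
      -- and the factorisation turns this into positivity of `ν` at ω.
      module Grid (n i : ℕ) (h L : Carrier)
        (h>0 : 0# < h) (10Mh≈1 : # 10 * # (suc n ℕ.+ 10) * h ≈ 1#) (i<M : i ℕ.< suc n ℕ.+ 10)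
        (lip : Lipschitz coefficients L) (large : L ≤ # n * (- π X))
        (fails : # 5 + # 6 * (# i * h) + # 5 * (# i * h * (# i * h)) ≤ # 6 * r * (1# - # i * h * (# i * h)))
        (holds : Criterion r (# suc i * h)) where

        n′ : ℕ
        n′ = suc n
        h≥0 : 0# ≤ h
        h≥0 = <⇒≤ h>0
        t₀ t₁ t : Carrier
        t₀ = # i * h
        t₁ = # suc i * h
        t = t₁ + h
        t₁≈ : t₁ ≈ t₀ + h
        t₁≈ = grid-suc i h
        t₀≥0 : 0# ≤ t₀
        t₀≥0 = *-nonNeg (#-nonNeg i) h≥0
        t₁≥0 : 0# ≤ t₁
        t₁≥0 = *-nonNeg (#-nonNeg (suc i)) h≥0
        t>0 : 0# < t
        t>0 = 0<-resp (+-comm h t₁) (+-pos-nonNeg h>0 t₁≥0)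
        t≥0 : 0# ≤ t
        t≥0 = <⇒≤ t>0
        1-100h : 0# ≤ 1# - # 100 * h
        1-100h = ≤⇒0≤ (≤-trans (≤-reflexive ((solve 1 (λ h → :# 100 :* h := :# 10 :* (:# 10 :* h)) refl h)))
            (grid-≤ h≥0 10Mh≈1 (ℕₚ.m≤n+m 10 n′)))
        1-10t₁ : 0# ≤ 1# - # 10 * t₁
        1-10t₁ = ≤⇒0≤ (grid-≤ h≥0 10Mh≈1 i<M)
        11-100t : 0# ≤ # 11 - # 100 * t
        11-100t = 0≤-resp ((solve 2 (λ t h → :# 10 :* (:# 1 :- :# 10 :* t) :+ (:# 1 :- :# 100 :* h) := :# 11
            :- :# 100 :* (t :+ h)) refl t₁ h)) (+-nonNeg (c≥ 10 1-10t₁) 1-100h)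
        1-t≥0 : 0# ≤ 1# - t
        1-t≥0 = scaled 99 (0≤-resp ((solve 1 (λ t → (:# 11 :- :# 100 :* t) :+ :# 89 := :# 100 :* (:# 1
            :- t)) refl t)) (+-nonNeg 11-100t (#-nonNeg 89)))
        g r′ : Carrier
        g = # 6 * (1# - t * t)
        g-5≥0 : 0# ≤ g - # 5
        g-5≥0 = scaled 99 (0≤-resp ((solve 1 (λ t → :# 6 :* (:# 11 :- :# 100 :* t) :* t :+ :# 66 :* (:# 1 :- t)
            :+ :# 34 := :# 100 :* (:# 6 :* (:# 1 :- t :* t) :- :# 5)) refl t))
          (+-nonNeg (+-nonNeg (*-nonNeg (c≥ 6 11-100t) t≥0) (c≥ 66 1-t≥0)) (#-nonNeg 34)))
        g>0 : 0# < g
        g>0 = 0<-resp ((solve 1 (λ g → :# 5 :+ (g :- :# 5) := g) refl g)) (+-pos-nonNeg (#-pos 4) g-5≥0)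
        private g-inverse = pos-inverse g>0
        g⁻¹ : Carrier
        g⁻¹ = proj₁ g-inverse
        s : Carrier
        s = # 5 + # 6 * t + # 5 * (t * t)
        r′ = s * g⁻¹
        r′g : r′ * g ≈ s
        r′g = trans ((solve 3 (λ s g k → s :* k :* g := s :* (g :* k)) refl s g g⁻¹)) (trans (*-congˡ (proj₁
            (proj₂ g-inverse))) (*-identityʳ s))
        5+6r≥0 : 0# ≤ # 5 + # 6 * r
        5+6r≥0 = +-nonNeg (#-nonNeg 5) (c≥ 6 r≥0)
        r≤r′ : r ≤ r′
        r≤r′ = *-cancelˡ-≤ g>0 (≤-by (((# 5 + # 6 * t₁ + # 5 * (t₁ * t₁)) - # 6 * r * (1# - t₁ * t₁)) + h * (# 6 +
            (# 5 + # 6 * r) * (t + t₁)))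
          (+-nonNeg (<⇒≤ (<⇒0< holds)) (*-nonNeg h≥0 (+-nonNeg (#-nonNeg 6) (*-nonNeg 5+6r≥0 (+-nonNeg t≥0 t₁≥0)))))
          (trans ((solve 3 (λ r t h → ((:# 5 :+ :# 6 :* t :+ :# 5 :* (t :* t)) :- :# 6 :* r :* (:# 1 :- t :* t))
              :+ h :* (:# 6 :+ (:# 5 :+ :# 6 :* r) :* (t :+ h :+ t)) := (:# 5 :+ :# 6 :* (t :+ h) :+ :# 5 :* ((t
              :+ h) :* (t :+ h))) :- :# 6 :* (:# 1 :- (t :+ h) :* (t :+ h)) :* r) refl r t₁ h))
            (+-congʳ (trans (sym r′g) (*-comm r′ g)))))
        -- The left side of g(r′ - r) = s - rg is bounded below by 5(r′ - r). The right side, as a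
        -- function of the grid point, is at most 0 at `t₀` and rises over the two steps to `t` with
        -- slope at most 9.
        5r′-5r≤18h : # 5 * (r′ - r) ≤ # 18 * h
        5r′-5r≤18h = ≤-trans (≤-by ((g - # 5) * (r′ - r)) (*-nonNeg g-5≥0 (≤⇒0≤ r≤r′)) ((solve 2 (λ g x → (g
            :- :# 5) :* x := g :* x :- :# 5 :* x) refl g (r′ - r))))
          (≤-trans (≤-reflexive (trans ((solve 3 (λ g x r → g :* (x :- r) := x :* g :- r :* g) refl g r′ r))
              (+-congʳ r′g)))
          (≤-by ((# 6 * r * (1# - t₀ * t₀) - (# 5 + # 6 * t₀ + # 5 * (t₀ * t₀))) + # 2 * (h * (# 3 -
              (# 5 + # 6 * r) * (t + t₀))))
            (+-nonNeg (≤⇒0≤ fails) (c≥ 2 (*-nonNeg h≥0 slope)))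
            (trans ((solve 4 (λ r u h t → (:# 6 :* r :* (:# 1 :- u :* u) :- (:# 5 :+ :# 6 :* u :+ :# 5 :*
                (u :* u))) :+ :# 2 :* (h :* (:# 3 :- (:# 5 :+ :# 6 :* r) :* (t :+ u))) := :# 18 :* h :- ((:# 5
                :+ :# 6 :* u :+ :# 5 :* (u :* u)) :- :# 6 :* r :* (:# 1 :- u :* u) :+ :# 2 :* h :* (:# 6 :+ (:# 5
                :+ :# 6 :* r) :* (t :+ u)))) refl r t₀ h t))
              (+-congˡ (-‿cong (trans ((solve 4 (λ r u h t → (:# 5 :+ :# 6 :* u :+ :# 5 :* (u :* u)) :- :# 6 :* r :*
                  (:# 1 :- u :* u) :+ :# 2 :* h :* (:# 6 :+ (:# 5 :+ :# 6 :* r) :* (t :+ u)) := (:# 5 :+ :# 6 :* u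
                  :+ :# 5 :* (u :* u)) :- :# 6 :* r :* (:# 1 :- u :* u) :+ ((u :+ h :+ h) :- u) :* (:# 6 :+ (:# 5
                  :+ :# 6 :* r) :* (t :+ u))) refl r t₀ h t))
                (trans (+-congˡ (*-congʳ (+-congʳ (+-congʳ (sym t₁≈)))))
                ((solve 3 (λ r u t → (:# 5 :+ :# 6 :* u :+ :# 5 :* (u :* u)) :- :# 6 :* r :* (:# 1 :- u :* u) :+ (t
                    :- u) :* (:# 6 :+ (:# 5 :+ :# 6 :* r) :* (t :+ u)) := (:# 5 :+ :# 6 :* t :+ :# 5 :* (t :* t))
                    :- r :* (:# 6 :* (:# 1 :- t :* t))) refl r t₀ t)))))))))
          where
          t₀≤t : 0# ≤ t - t₀
          t₀≤t = 0≤-resp (trans ((solve 2 (λ u h → h :+ h := (u :+ h) :+ h :- u) refl t₀ h)) (+-congʳ (+-congʳ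
              (sym t₁≈)))) (+-nonNeg h≥0 h≥0)
          slope : 0# ≤ # 3 - (# 5 + # 6 * r) * (t + t₀)
          slope = scaled 99 (0≤-resp ((solve 3 (λ r t u → (:# 58 :+ :# 22 :* (:# 11 :- :# 100 :* t)) :+ :# 600 :*
              ((:# 1 :- r) :* (t :+ u)) :+ :# 1100 :* (t :- u) := :# 100 :* (:# 3 :- (:# 5 :+ :# 6 :* r) :* (t
              :+ u))) refl r t t₀))
            (+-nonNeg (+-nonNeg (+-nonNeg (#-nonNeg 58) (c≥ 22 11-100t)) (c≥ 600 (*-nonNeg 1-r≥0
                (+-nonNeg t≥0 t₀≥0)))) (c≥ 1100 t₀≤t)))
        4h-d≥0 : 0# ≤ # 4 * h - (r′ - r)
        4h-d≥0 = scaled 4 (0≤-resp ((solve 2 (λ h x → (:# 18 :* h :- :# 5 :* x) :+ :# 2 :* h := :# 5 :* (:# 4 :* h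
            :- x)) refl h (r′ - r))) (+-nonNeg (≤⇒0≤ 5r′-5r≤18h) (c≥ 2 h≥0)))
        1-r′≥0 : 0# ≤ 1# - r′
        1-r′≥0 = scaled 99 (0≤-resp ((solve 3 (λ r s h → :# 100 :* (:# 4 :* h :- (s :- r)) :+ :# 5 :* (:# 19
            :- :# 20 :* r) :+ :# 4 :* (:# 1 :- :# 100 :* h) :+ :# 1 := :# 100 :* (:# 1 :- s)) refl r r′ h))
          (+-nonNeg (+-nonNeg (+-nonNeg (c≥ 100 4h-d≥0) (c≥ 5 19-20r≥0)) (c≥ 4 1-100h)) (<⇒≤ 0<1)))
        X′ : Carrier
        X′ = r′ * r′
        d≥0 : 0# ≤ r′ - r
        d≥0 = ≤⇒0≤ r≤r′
        r′≥0 : 0# ≤ r′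
        r′≥0 = ≤-trans r≥0 r≤r′
        X≤X′ : X ≤ X′
        X≤X′ = ≤-by ((r′ - r) * (r′ + r)) (*-nonNeg d≥0 (+-nonNeg r′≥0 r≥0)) ((solve 2 (λ r s → (s :- r) :* (s
            :+ r) := s :* s :- r :* r) refl r r′))
        X′≤1 : X′ ≤ 1#
        X′≤1 = ≤-by ((1# - r′) * (1# + r′)) (*-nonNeg 1-r′≥0 (+-nonNeg (<⇒≤ 0<1) r′≥0)) ((solve 1 (λ s → (:# 1
            :- s) :* (:# 1 :+ s) := :# 1 :- s :* s) refl r′))
        8n′h≤1 : # 10 * (# n′ * h) ≤ 1#
        8n′h≤1 = grid-≤ h≥0 10Mh≈1 (ℕₚ.m≤m+n n′ 10)
        close : # n′ * (X′ - X) ≤ 1#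
        close = ≤-by ((1# - # 10 * (# n′ * h)) + # n′ * (# 2 * h + # 2 * (# 4 * h - (r′ - r)) + (r′ - r) *
            ((1# - r′) + (1# - r))))
          (+-nonNeg (≤⇒0≤ 8n′h≤1) (*-nonNeg (#-nonNeg n′) (+-nonNeg (+-nonNeg (c≥ 2 h≥0) (c≥ 2 4h-d≥0))
              (*-nonNeg d≥0 (+-nonNeg 1-r′≥0 1-r≥0)))))
          ((solve 4 (λ n h r s → (:# 1 :- :# 10 :* (n :* h)) :+ n :* (:# 2 :* h :+ :# 2 :* (:# 4 :* h :- (s :- r))
              :+ (s :- r) :* ((:# 1 :- s) :+ (:# 1 :- r))) := :# 1 :- n :* (s :* s :- r :* r)) refl (# n′) h r r′))
        -- Scaled by n + 1, the Lipschitz bound loses `L`, which n copies of -π(X) pay for; one copy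
        -- of π(X) is left over and keeps the result negative.
        πX′<0 : π X′ < 0#
        πX′<0 0≤πX′ = π<0 (≤-trans (*-nonNeg (#-nonNeg n′) 0≤πX′)
            (≤-trans (≤-reflexive (*-congˡ (sym (π≈ X′)))) (≤-trans (lip (# n′) X X′ (#-nonNeg n′)
                (square-nonNeg r≥0) X≤X′ X′≤1 close) final)))
          where
          final : # n′ * evalAt X coefficients + L ≤ π X
          final = ≤-trans (≤-reflexive (+-congʳ (*-cong (#-suc n) (π≈ X)))) (≤-by (# n * (- π X) - L) (≤⇒0≤ large)
            ((solve 3 (λ n x L → n :* (:- x) :- L := x :- ((:# 1 :+ n) :* x :+ L)) refl (# n) (π X) L)))
        1-t>0 : 0# < 1# - t
        1-t>0 = pos-cancelˡ (#-nonNeg 100) (0<-resp ((solve 1 (λ t → :# 89 :+ (:# 11 :- :# 100 :* t) := :# 100 :*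
            (:# 1 :- t)) refl t)) (+-pos-nonNeg (#-pos 88) 11-100t))
        A B G p q : Carrier
        A = (1# - t) * (1# - t)
        B = (1# + t) * (1# + t)
        G = # 36 * (A * B)
        p = P t
        q = Q t
        A>0 : 0# < A
        A>0 = *-pos 1-t>0 1-t>0
        1+t>0 : 0# < 1# + t
        1+t>0 = +-pos-nonNeg 0<1 t≥0
        G>0 : 0# < G
        G>0 = *-pos (#-pos 35) (*-pos A>0 (*-pos 1+t>0 1+t>0))
        p>0 : 0# < p
        p>0 = *-pos A>0 A>0
        -- 4B + A = 5 + 6t + 5t² and AB = (1 - t²)², so equality in the criterion for `r′` at `t` is
        -- the relation 36r′²AB = (4B + A)² under which the factorisation applies.
        square≈ : (# 4 * B + A) * (# 4 * B + A) ≈ X′ * G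
        square≈ = trans ((solve 1 (λ t → (:# 4 :* ((:# 1 :+ t) :* (:# 1 :+ t)) :+ (:# 1 :- t) :* (:# 1 :- t)) :*
            (:# 4 :* ((:# 1 :+ t) :* (:# 1 :+ t)) :+ (:# 1 :- t) :* (:# 1 :- t)) := (:# 5 :+ :# 6 :* t :+ :# 5 :*
            (t :* t)) :* (:# 5 :+ :# 6 :* t :+ :# 5 :* (t :* t))) refl t))
          (trans (*-cong (sym r′g) (sym r′g)) ((solve 2 (λ r t → r :* (:# 6 :* (:# 1 :- t :* t)) :* (r :* (:# 6 :*
              (:# 1 :- t :* t))) := r :* r :* (:# 36 :* ((:# 1 :- t) :* (:# 1 :- t) :* ((:# 1 :+ t) :* (:# 1
              :+ t))))) refl r′ t)))
        e : Carrier
        e = # 4 * t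
        N̂ : Carrier
        N̂ = N (A * (A - # 16 * (A + e))) (# 16 * ((A + e) * (A + e)))
        N̂>0 : 0# < N̂
        N̂>0 = N̂-pos A e A>0 (c≥ 4 t≥0)
        B≈ : B ≈ A + e
        B≈ = (solve 1 (λ t → (:# 1 :+ t) :* (:# 1 :+ t) := (:# 1 :- t) :* (:# 1 :- t) :+ :# 4 :* t) refl t)
        N-product : - (N (# 16 * ((A + e) * (A + e - A))) (A * A) * N̂) ≈ G ^ 8 * π X′
        N-product = trans (sym (factorisation A (A + e))) (trans (H-congʳ (*-congˡ (*-congˡ (sym B≈))))
          (trans (H-cong G (trans (*-cong (+-congʳ (*-congˡ (sym B≈))) (+-congʳ (*-congˡ (sym B≈)))) square≈))
              (H-π X′ G)))
        -- The arguments of the first factor are `q` and `p`, since B - A = 4t and A² = P(t).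
        N>0 : 0# < N q p
        N>0 = 0<-resp (N-congˡ p ((solve 1 (λ t → :# 16 :* (((:# 1 :- t) :* (:# 1 :- t) :+ :# 4 :* t) :* ((:# 1
            :- t) :* (:# 1 :- t) :+ :# 4 :* t :- (:# 1 :- t) :* (:# 1 :- t))) := :# 64 :* (t :* ((:# 1 :+ t) :*
            (:# 1 :+ t)))) refl t)))
          (pos-cancelˡ (<⇒≤ N̂>0) (0<-resp (*-comm _ _) (0<-resp ((solve 1 (λ x → :# 0 :- (:- x) := x) refl (N
              (# 16 * ((A + e) * (A + e - A))) (A * A) * N̂)))
            (0<-resp (+-congˡ (-‿cong (sym N-product))) (0<-resp ((solve 2 (λ a x → a :* (:# 0 :- x) := :# 0
                :- a :* x) refl (G ^ 8) (π X′)))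
              (*-pos (^-pos 8 G>0) (<⇒0< πX′<0)))))))
        private p-inverse = pos-inverse p>0
        p⁻¹ ω : Carrier
        p⁻¹ = proj₁ p-inverse
        ω = q * p⁻¹
        ωp≈q : ω * p ≈ q
        ωp≈q = trans ((solve 3 (λ q p k → q :* k :* p := q :* (p :* k)) refl q p p⁻¹)) (trans (*-congˡ (proj₁
            (proj₂ p-inverse))) (*-identityʳ q))
        q>0 : 0# < q
        q>0 = *-pos (#-pos 63) (*-pos t>0 (*-pos 1+t>0 1+t>0))
        ω>0 : 0# < ω
        ω>0 = *-pos q>0 (proj₂ (proj₂ p-inverse))
        ω≥0 : 0# ≤ ω
        ω≥0 = <⇒≤ ω>0
        ν>0 : 0# < ν ω
        ν>0 = pos-cancelˡ (<⇒≤ (^-pos 4 p>0)) (0<-resp (trans (N-congˡ p (sym ωp≈q)) ((solve 2 (λ w p → p :^ 4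
            :- :# 440 :* (p :^ 3 :* (w :* p)) :- :# 624 :* (p :^ 2 :* (w :* p) :^ 2) :- :# 275 :* (p :*
            (w :* p) :^ 3) :- :# 11 :* (w :* p) :^ 4 := p :^ 4 :* (:# 1 :- :# 440 :* w :- :# 624 :* (w :* w)
            :- :# 275 :* (w :* (w :* w)) :- :# 11 :* (w :* w :* (w :* w)))) refl ω p))) N>0)
        p≤1 : 0# ≤ 1# - p
        p≤1 = 0≤-resp ((solve 1 (λ t → t :* (:# 2 :- t) :* (:# 1 :+ (:# 1 :- t) :* (:# 1 :- t)) := :# 1 :- (:# 1
            :- t) :* (:# 1 :- t) :* ((:# 1 :- t) :* (:# 1 :- t))) refl t))
          (*-nonNeg (*-nonNeg t≥0 (0≤-resp ((solve 1 (λ t → :# 1 :+ (:# 1 :- t) := :# 2 :- t) refl t)) (+-nonNeg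
              (<⇒≤ 0<1) 1-t≥0))) (+-nonNeg (<⇒≤ 0<1) (<⇒≤ A>0)))
        -- 64t ≤ q = ωp ≤ 1/400 bounds t even by 1/25600, and 25600 = 400 · 64.
        t₁-small : # 1000 * t₁ ≤ 1#
        t₁-small = ≤-by ((1# - # 400 * ω) + (# 400 * (ω * (1# - p)) + (# 25600 * (t * (t * (# 2 + t))) +
            (# 24600 * t₁ + # 25600 * h))))
          (≤⇒0≤ (ν-small ω ω≥0 ν>0) ⊕≥ c≥ 400 (*-nonNeg ω≥0 p≤1) ⊕≥ c≥ 25600 (*-nonNeg t≥0 (*-nonNeg t≥0 (+-nonNeg
              (#-nonNeg 2) t≥0))) ⊕≥ c≥ 24600 t₁≥0 ⊕≥ c≥ 25600 h≥0)
          (trans ((solve 5 (λ w p t u h → (:# 1 :- :# 400 :* w) :+ (:# 400 :* (w :* (:# 1 :- p)) :+ (:# 25600 :*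
              (t :* (t :* (:# 2 :+ t))) :+ (:# 24600 :* u :+ :# 25600 :* h))) := :# 1 :- :# 400 :* (w :* p) :+
              (:# 25600 :* (t :* (t :* (:# 2 :+ t))) :+ (:# 24600 :* u :+ :# 25600 :* h))) refl ω p t t₁ h))
            (trans (+-congʳ (+-congˡ (-‿cong (*-congˡ ωp≈q)))) ((solve 2 (λ u h → :# 1 :- :# 400 :* (:# 64 :* ((u
                :+ h) :* ((:# 1 :+ (u :+ h)) :* (:# 1 :+ (u :+ h))))) :+ (:# 25600 :* ((u :+ h) :* ((u :+ h) :*
                (:# 2 :+ (u :+ h)))) :+ (:# 24600 :* u :+ :# 25600 :* h)) := :# 1 :- :# 1000 :* u) refl t₁ h))))
        below-ω : Q t₁ < ω * P t₁
        below-ω = 0<⇒< (pos-cancelˡ (<⇒≤ p>0) (0<-resp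
          (trans ((solve 4 (λ a b p q → (q :- b) :* a :+ b :* (a :- p) := q :* a :- p :* b) refl (P t₁) (Q t₁) p q))
            (trans (+-congʳ (*-congʳ (sym ωp≈q))) ((solve 4 (λ w a b p → w :* p :* a :- p :* b := p :* (w :* a
                :- b)) refl ω (P t₁) (Q t₁) p))))
          (+-pos-nonNeg (*-pos q-increases P₁>0) (*-nonNeg Q₁≥0 p-decreases))))
          where
          1-t₁>0 : 0# < 1# - t₁
          1-t₁>0 = 0<-resp ((solve 2 (λ u h → (:# 1 :- (u :+ h)) :+ h := :# 1 :- u) refl t₁ h))
              (+-pos-nonNeg 1-t>0 h≥0)
          P₁>0 : 0# < P t₁
          P₁>0 = *-pos (*-pos 1-t₁>0 1-t₁>0) (*-pos 1-t₁>0 1-t₁>0)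
          Q₁≥0 : 0# ≤ Q t₁
          Q₁≥0 = c≥ 64 (*-nonNeg t₁≥0 (*-nonNeg (+-nonNeg (<⇒≤ 0<1) t₁≥0) (+-nonNeg (<⇒≤ 0<1) t₁≥0)))
          q-increases : 0# < q - Q t₁
          q-increases = 0<-resp ((solve 2 (λ u h → :# 64 :* (h :* ((:# 1 :+ (u :+ h)) :* (:# 1 :+ (u :+ h))))
              :+ :# 64 :* (u :* (h :* (:# 2 :+ (u :+ h) :+ u))) := :# 64 :* ((u :+ h) :* ((:# 1 :+ (u :+ h)) :*
              (:# 1 :+ (u :+ h)))) :- :# 64 :* (u :* ((:# 1 :+ u) :* (:# 1 :+ u)))) refl t₁ h))
            (+-pos-nonNeg (*-pos (#-pos 63) (*-pos h>0 (*-pos 1+t>0 1+t>0)))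
              (c≥ 64 (*-nonNeg t₁≥0 (*-nonNeg h≥0 (+-nonNeg (+-nonNeg (#-nonNeg 2) t≥0) t₁≥0)))))
          p-decreases : 0# ≤ P t₁ - p
          p-decreases = 0≤-resp ((solve 2 (λ u h → h :* (:# 2 :* (:# 1 :- (u :+ h)) :+ h) :* ((:# 1 :- u) :* (:# 1
              :- u) :+ (:# 1 :- (u :+ h)) :* (:# 1 :- (u :+ h))) := (:# 1 :- u) :* (:# 1 :- u) :* ((:# 1 :- u) :*
              (:# 1 :- u)) :- (:# 1 :- (u :+ h)) :* (:# 1 :- (u :+ h)) :* ((:# 1 :- (u :+ h)) :* (:# 1 :- (u
              :+ h)))) refl t₁ h))
            (*-nonNeg (*-nonNeg h≥0 (+-nonNeg (c≥ 2 1-t≥0) h≥0)) (+-nonNeg (square-nonNeg (<⇒≤ 1-t₁>0)) (<⇒≤ A>0)))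

        result : Choice
        result = record
          { ω = ω ; t₁ = t₁ ; ω-pos = ω>0 ; ν-pos = ν>0 ; t₁-nonNeg = t₁≥0 ; t₁-small = t₁-small
          ; below-ω = below-ω ; criterion = holds }

    choice : Choice
    choice = step₁ (lipschitz coefficients)
      where
      step₁ : ∃[ L ] (0# ≤ L) × Lipschitz coefficients L → Choice
      step₁ (L , _ , lip) = step₂ (multiple L -π>0)
        where
        step₂ : ∃[ n ] L ≤ # n * (- π X) → Choice
        step₂ (n , large) = step₃ (pos-inverse (*-pos (#-pos 9) (#-pos (n ℕ.+ 10))))
          where
          M : ℕ
          -- The grid has M steps on [0, 1/10]. The summand 10 makes 100h ≤ 1 for the crude
          -- estimates, `suc n` makes the grid fine enough for the Lipschitz bound.
          M = suc n ℕ.+ 10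
          step₃ : ∃[ h ] (# 10 * # M * h ≈ 1#) × (0# < h) → Choice
          step₃ (h , 10Mh≈1 , h>0) = step₄ (crossing (λ i → decide _ _) fails₀ M holdsₘ)
            where
            fails₀ : ¬ Criterion r (# 0 * h)
            fails₀ holds = holds (≤-by (# 6 * r - # 5) (≤⇒0≤ 5≤6r)
              ((solve 2 (λ r h → :# 6 :* r :- :# 5 := :# 6 :* r :* (:# 1 :- :# 0 :* h :* (:# 0 :* h)) :- (:# 5
                  :+ :# 6 :* (:# 0 :* h) :+ :# 5 :* (:# 0 :* h :* (:# 0 :* h)))) refl r h)))
            y : Carrier
            y = # 10 * (# M * h)
            y≈1 : y ≈ 1#
            y≈1 = trans ((solve 2 (λ M h → :# 10 :* (M :* h) := :# 10 :* M :* h) refl (# M) h)) 10Mh≈1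
            -- At t = 1/10 the right side is 5.65, and the left side is at most 5.643 because 20r <
            -- 19.
            holdsₘ : Criterion r (# M * h)
            holdsₘ = 0<⇒< (pos-cancelˡ (#-nonNeg 2000) (0<-resp
              (trans ((solve 1 (λ r → :# 14 :+ (:# 6 :* (:# 19 :- :# 20 :* r) :* (:# 100 :- :# 1 :* :# 1)) :=
                  (:# 214 :* (:# 1 :* :# 1) :+ :# 1200 :* :# 1 :- :# 1400) :+ (:# 6 :* (:# 19 :- :# 20 :* r) :*
                  (:# 100 :- :# 1 :* :# 1))) refl r))
                (trans (+-cong (+-congʳ (+-cong (*-congˡ (*-cong (sym y≈1) (sym y≈1))) (*-congˡ (sym y≈1))))
                    (*-congˡ (+-congˡ (-‿cong (*-cong (sym y≈1) (sym y≈1))))))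
                  ((solve 2 (λ r t → (:# 214 :* (:# 10 :* t :* (:# 10 :* t)) :+ :# 1200 :* (:# 10 :* t) :- :# 1400)
                      :+ (:# 6 :* (:# 19 :- :# 20 :* r) :* (:# 100 :- :# 10 :* t :* (:# 10 :* t))) := :# 2000 :*
                      ((:# 5 :+ :# 6 :* t :+ :# 5 :* (t :* t)) :- :# 6 :* r :* (:# 1 :- t :* t))) refl r (# M * h)))))
              (+-pos-nonNeg (#-pos 13) (*-nonNeg (c≥ 6 19-20r≥0) (0≤-resp ((solve 0 (:# 99 := :# 100
                  :- :# 1 :* :# 1) refl)) (#-nonNeg 99))))))
            step₄ : ∃[ i ] (i ℕ.< M) × (¬ Criterion r (# i * h)) × Criterion r (# suc i * h) → Choice
            step₄ (i , i<M , fails , holds) = Grid.result n i h L h>0 10Mh≈1 i<M lip large (not-less _ _ fails) holds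

  module Upper (ω : Carrier) (ω>0 : 0# < ω) (ν>0 : 0# < ν ω) where

    private
      ω≥0 : 0# ≤ ω
      ω≥0 = <⇒≤ ω>0

      400ω≤1 : 0# ≤ 1# - # 400 * ω
      400ω≤1 = ≤⇒0≤ (ν-small ω ω≥0 ν>0)

      -- In the notation of `ν`, the condition at T₀ is (1 - 11ω) - αw₀ > 0, and γ + αw₀ is its
      -- conjugate, obtained by replacing w₀ with 19 - w₀.
      α γ : Carrier
      α = ω * ω + # 22 * ω
      γ = 1# - # 429 * ω - # 19 * (ω * ω)

      α≥0 : 0# ≤ α
      α≥0 = +-nonNeg (square-nonNeg ω≥0) (c≥ 22 ω≥0)

      1-ω≥0 : 0# ≤ 1# - ω
      1-ω≥0 = 0≤-resp ((solve 1 (λ w → (:# 1 :- :# 400 :* w) :+ :# 399 :* w := :# 1 :- w) refl ω)) (+-nonNeg 400ω≤1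
          (c≥ 399 ω≥0))

      1-α≥0 : 0# ≤ 1# - α
      1-α≥0 = 0≤-resp ((solve 1 (λ w → (:# 1 :- :# 400 :* w) :+ w :* (:# 1 :- w) :+ :# 377 :* w := :# 1 :- (w :* w
          :+ :# 22 :* w)) refl ω))
        (+-nonNeg (+-nonNeg 400ω≤1 (*-nonNeg ω≥0 1-ω≥0)) (c≥ 377 ω≥0))

      γ>0 : 0# < γ
      γ>0 = 0<-resp ((solve 1 (λ w → :# 1 :- :# 440 :* w :- :# 624 :* (w :* w) :- :# 275 :* (w :* (w :* w))
          :- :# 11 :* (w :* w :* (w :* w)) :+ (:# 11 :* w :+ :# 605 :* (w :* w) :+ :# 275 :* (w :* (w :* w))
          :+ :# 11 :* (w :* w :* (w :* w))) := :# 1 :- :# 429 :* w :- :# 19 :* (w :* w)) refl ω))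
        (+-pos-nonNeg ν>0 (+-nonNeg (+-nonNeg (+-nonNeg (c≥ 11 ω≥0) (c≥ 605 (square-nonNeg ω≥0)))
          (c≥ 275 (*-nonNeg ω≥0 (square-nonNeg ω≥0)))) (c≥ 11 (square-nonNeg (square-nonNeg ω≥0)))))

    Large : Carrier → Set
    Large t = 1# < # 6 * t + # 11 * (t * t)

    record Choice : Set where
      field
        t₃ : Carrier
        t₃-nonNeg : 0# ≤ t₃
        t₃-small  : # 5 * t₃ ≤ 1#
        t₃-large  : Large t₃
        𝐕-pos : 0# < 𝐕 ω (P t₃) (Q t₃)

    private
      -- Here `t` is the right end of a grid step across T₀. The quantity `k` measures how far w(t)
      -- is from satisfying w² = 19w + 11; it is of order h, and the grid is fine enough for `ν` to
      -- outweigh the resulting error in the last factor.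
      module Grid (M i : ℕ) (h : Carrier) (h>0 : 0# < h) (10Mh≈1 : # 10 * # M * h ≈ 1#) (i<2M : i ℕ.< 2 ℕ.* M)
        (fine : # 1000000 ≤ # M * ν ω)
        (fails : # 6 * (# i * h) + # 11 * (# i * h * (# i * h)) ≤ 1#) (holds : Large (# suc i * h)) where

        h≥0 : 0# ≤ h
        h≥0 = <⇒≤ h>0
        t₀ t : Carrier
        t₀ = # i * h
        t = # suc i * h
        t₀≥0 : 0# ≤ t₀
        t₀≥0 = *-nonNeg (#-nonNeg i) h≥0
        t≥0 : 0# ≤ t
        t≥0 = *-nonNeg (#-nonNeg (suc i)) h≥0
        1-5t≥0 : 0# ≤ 1# - # 5 * t
        1-5t≥0 = 0≤-resp (trans (+-congʳ (*-congˡ (*-congʳ (#-* 2 M))))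
            (trans ((solve 3 (λ M h t → :# 5 :* (:# 2 :* M :* h) :- :# 5 :* t := :# 10 :* M :* h :- :# 5 :* t) refl
                (# M) h t)) (+-congʳ 10Mh≈1)))
          (0≤-resp ((solve 3 (λ a n h → :# 5 :* ((a :- n) :* h) := :# 5 :* (a :* h) :- :# 5 :* (n :* h)) refl
              (# (2 ℕ.* M)) (# suc i) h))
            (c≥ 5 (*-nonNeg (≤⇒0≤ (#-mono-≤ i<2M)) h≥0)))
        g : Carrier
        g = (# 6 * t + # 11 * (t * t)) - 1#
        g>0 : 0# < g
        g>0 = <⇒0< holds
        t₀≤t : 0# ≤ t - t₀
        t₀≤t = 0≤-resp (trans ((solve 2 (λ u h → h := u :+ h :- u) refl t₀ h)) (+-congʳ (sym (grid-suc i h)))) h≥0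
        g≤11h : 0# ≤ # 11 * h - g
        g≤11h = 0≤-resp (trans
            ((solve 3 (λ u t h → (:# 1 :- (:# 6 :* u :+ :# 11 :* (u :* u))) :+ h :* (:# 11 :* (t :- u) :+ :# 4 :*
                (:# 1 :- :# 5 :* t) :+ (:# 1 :- :# 2 :* t)) := :# 11 :* h :+ (:# 1 :- (:# 6 :* u :+ :# 11 :*
                (u :* u))) :- ((u :+ h) :- u) :* (:# 6 :+ :# 11 :* (t :+ u))) refl t₀ t h))
            (trans (+-congˡ (-‿cong (*-congʳ (+-congʳ (sym (grid-suc i h))))))
            ((solve 3 (λ u t h → :# 11 :* h :+ (:# 1 :- (:# 6 :* u :+ :# 11 :* (u :* u))) :- (t :- u) :* (:# 6
                :+ :# 11 :* (t :+ u)) := :# 11 :* h :- ((:# 6 :* t :+ :# 11 :* (t :* t)) :- :# 1)) refl t₀ t h))))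
          (+-nonNeg (≤⇒0≤ fails) (*-nonNeg h≥0 (+-nonNeg (+-nonNeg (c≥ 11 t₀≤t) (c≥ 4 1-5t≥0))
            (0≤-resp ((solve 1 (λ t → (:# 1 :- :# 5 :* t) :+ :# 3 :* t := :# 1 :- :# 2 :* t) refl t))
                (+-nonNeg 1-5t≥0 (c≥ 3 t≥0))))))
        1-t≥0 : 0# ≤ 1# - t
        1-t≥0 = 0≤-resp ((solve 1 (λ t → (:# 1 :- :# 5 :* t) :+ :# 4 :* t := :# 1 :- t) refl t)) (+-nonNeg 1-5t≥0
            (c≥ 4 t≥0))
        A B p q k w₁ w₂ f : Carrier
        A = (1# - t) * (1# - t)
        B = (1# + t) * (1# + t)
        p = P t
        q = Q t
        k = q * q - # 19 * (q * p) - # 11 * (p * p)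
        w₁ = # 11 + # 6 * t - t * t
        w₂ = # 16 * (B * B) - # 4 * (A * B) - # 11 * (A * A)
        f = γ * p + α * q
        A≥0 : 0# ≤ A
        A≥0 = square-nonNeg 1-t≥0
        B≥0 : 0# ≤ B
        B≥0 = square-nonNeg (+-nonNeg (<⇒≤ 0<1) t≥0)
        -- The equation of T₀ divides the homogenised minimal polynomial of w(T₀), so `k` inherits
        -- the smallness of `g`.
        k≈ : k ≈ g * (w₁ * w₂)
        k≈ = (solve 1 (λ t → :# 64 :* (t :* ((:# 1 :+ t) :* (:# 1 :+ t))) :* (:# 64 :* (t :* ((:# 1 :+ t) :* (:# 1
            :+ t)))) :- :# 19 :* (:# 64 :* (t :* ((:# 1 :+ t) :* (:# 1 :+ t))) :* ((:# 1 :- t) :* (:# 1 :- t) :*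
            ((:# 1 :- t) :* (:# 1 :- t)))) :- :# 11 :* ((:# 1 :- t) :* (:# 1 :- t) :* ((:# 1 :- t) :* (:# 1
            :- t)) :* ((:# 1 :- t) :* (:# 1 :- t) :* ((:# 1 :- t) :* (:# 1 :- t)))) := ((:# 6 :* t :+ :# 11 :*
            (t :* t)) :- :# 1) :* ((:# 11 :+ :# 6 :* t :- t :* t) :* (:# 16 :* ((:# 1 :+ t) :* (:# 1 :+ t) :*
            ((:# 1 :+ t) :* (:# 1 :+ t))) :- :# 4 :* ((:# 1 :- t) :* (:# 1 :- t) :* ((:# 1 :+ t) :* (:# 1 :+ t)))
            :- :# 11 :* ((:# 1 :- t) :* (:# 1 :- t) :* ((:# 1 :- t) :* (:# 1 :- t)))))) refl t)
        w₁≥0 : 0# ≤ w₁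
        w₁≥0 = 0≤-resp ((solve 1 (λ t → :# 11 :+ :# 5 :* t :+ t :* (:# 1 :- t) := :# 11 :+ :# 6 :* t
            :- t :* t) refl t)) (+-nonNeg (+-nonNeg (#-nonNeg 11) (c≥ 5 t≥0)) (*-nonNeg t≥0 1-t≥0))
        w₁≤13 : 0# ≤ # 13 - w₁
        w₁≤13 = 0≤-resp ((solve 1 (λ t → :# 2 :* (:# 1 :- :# 5 :* t) :+ :# 4 :* t :+ t :* t := :# 13 :- (:# 11
            :+ :# 6 :* t :- t :* t)) refl t)) (+-nonNeg (+-nonNeg (c≥ 2 1-5t≥0) (c≥ 4 t≥0)) (square-nonNeg t≥0))
        w₂≥0 : 0# ≤ w₂
        w₂≥0 = 0≤-resp ((solve 1 (λ t → (:# 1 :- t) :* (:# 1 :- t) :* ((:# 1 :- t) :* (:# 1 :- t)) :+ :# 112 :*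
            ((:# 1 :- t) :* (:# 1 :- t) :* t) :+ :# 256 :* (t :* t) := :# 16 :* ((:# 1 :+ t) :* (:# 1 :+ t) :*
            ((:# 1 :+ t) :* (:# 1 :+ t))) :- :# 4 :* ((:# 1 :- t) :* (:# 1 :- t) :* ((:# 1 :+ t) :* (:# 1 :+ t)))
            :- :# 11 :* ((:# 1 :- t) :* (:# 1 :- t) :* ((:# 1 :- t) :* (:# 1 :- t)))) refl t))
          (+-nonNeg (+-nonNeg (square-nonNeg A≥0) (c≥ 112 (*-nonNeg A≥0 t≥0))) (c≥ 256 (square-nonNeg t≥0)))
        3-2B≥0 : 0# ≤ # 3 - # 2 * B
        3-2B≥0 = 0≤-resp ((solve 1 (λ t → (:# 1 :- :# 5 :* t) :+ t :* (:# 1 :- :# 5 :* t) :+ :# 3 :* (t :* t)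
            := :# 3 :- :# 2 :* ((:# 1 :+ t) :* (:# 1 :+ t))) refl t)) (+-nonNeg (+-nonNeg 1-5t≥0
            (*-nonNeg t≥0 1-5t≥0)) (c≥ 3 (square-nonNeg t≥0)))
        w₂≤36 : 0# ≤ # 36 - w₂
        w₂≤36 = 0≤-resp ((solve 2 (λ A B → :# 4 :* ((:# 3 :- :# 2 :* B) :* (:# 3 :+ :# 2 :* B)) :+ :# 4 :* (A :* B)
            :+ :# 11 :* (A :* A) := :# 36 :- (:# 16 :* (B :* B) :- :# 4 :* (A :* B) :- :# 11 :* (A :* A))) refl A B))
          (+-nonNeg (+-nonNeg (c≥ 4 (*-nonNeg 3-2B≥0 (+-nonNeg (#-nonNeg 3) (c≥ 2 B≥0)))) (c≥ 4 (*-nonNeg A≥0 B≥0)))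
              (c≥ 11 (square-nonNeg A≥0)))
        k≥0 : 0# ≤ k
        k≥0 = 0≤-resp (sym k≈) (*-nonNeg (<⇒≤ g>0) (*-nonNeg w₁≥0 w₂≥0))
        -- The constant is 11 · 13 · 36, from the bounds on `g`/h, `w₁` and `w₂`.
        k≤5148h : 0# ≤ # 5148 * h - k
        k≤5148h = 0≤-resp (trans ((solve 4 (λ g h a b → :# 468 :* (:# 11 :* h :- g) :+ g :* (:# 13 :* (:# 36 :- b)
            :+ (:# 13 :- a) :* b) := :# 5148 :* h :- g :* (a :* b)) refl g h w₁ w₂)) (+-congˡ (-‿cong (sym k≈))))
          (+-nonNeg (c≥ 468 g≤11h) (*-nonNeg (<⇒≤ g>0) (+-nonNeg (c≥ 13 w₂≤36) (*-nonNeg w₁≤13 w₂≥0))))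
        ν-10⁷h≥0 : 0# ≤ ν ω - # 10000000 * h
        ν-10⁷h≥0 = 0≤-resp (trans ((solve 3 (λ M n h → :# 10 :* (h :* (M :* n :- :# 1000000))
            := :# 10 :* M :* h :* n :- :# 10000000 :* h) refl (# M) (ν ω) h))
            (+-congʳ (trans (*-congʳ 10Mh≈1) (*-identityˡ _))))
          (c≥ 10 (*-nonNeg h≥0 (≤⇒0≤ fine)))
        5p-2≥0 : 0# ≤ # 5 * p - # 2
        5p-2≥0 = scaled 624 (0≤-resp ((solve 1 (λ t → (:# 1 :- :# 5 :* t) :* ((:# 5 :* (:# 1 :- t) :+ :# 4) :*
            (:# 25 :* ((:# 1 :- t) :* (:# 1 :- t)) :+ :# 16) :* :# 5) :+ :# 30 := :# 625 :* (:# 5 :* ((:# 1 :- t) :*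
            (:# 1 :- t) :* ((:# 1 :- t) :* (:# 1 :- t))) :- :# 2)) refl t))
          (+-nonNeg (*-nonNeg 1-5t≥0 (*-nonNeg (*-nonNeg (+-nonNeg (c≥ 5 1-t≥0) (#-nonNeg 4)) (+-nonNeg (c≥ 25 A≥0)
              (#-nonNeg 16))) (#-nonNeg 5))) (#-nonNeg 30)))
        p≥0 : 0# ≤ p
        p≥0 = square-nonNeg A≥0
        q≥0 : 0# ≤ q
        q≥0 = c≥ 64 (*-nonNeg t≥0 B≥0)
        p>0 : 0# < p
        p>0 = pos-cancelˡ (#-nonNeg 5) (0<-resp ((solve 1 (λ p → :# 2 :+ (:# 5 :* p :- :# 2) := :# 5 :* p) refl p))
            (+-pos-nonNeg (#-pos 1) 5p-2≥0))
        1-p≥0 : 0# ≤ 1# - p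
        1-p≥0 = 0≤-resp ((solve 1 (λ t → t :* (:# 1 :+ (:# 1 :- t)) :* (:# 1 :+ (:# 1 :- t) :* (:# 1 :- t)) := :# 1
            :- (:# 1 :- t) :* (:# 1 :- t) :* ((:# 1 :- t) :* (:# 1 :- t))) refl t))
          (*-nonNeg (*-nonNeg t≥0 (+-nonNeg (<⇒≤ 0<1) 1-t≥0)) (+-nonNeg (<⇒≤ 0<1) A≥0))
        20-q≥0 : 0# ≤ # 20 - q
        20-q≥0 = scaled 9 (0≤-resp ((solve 2 (λ t B → :# 64 :* (:# 3 :- :# 2 :* B) :* (:# 5 :* t) :+ :# 192 :*
            (:# 1 :- :# 5 :* t) :+ :# 8 := :# 10 :* (:# 20 :- :# 64 :* (t :* B))) refl t B))
          (+-nonNeg (+-nonNeg (*-nonNeg (c≥ 64 3-2B≥0) (c≥ 5 t≥0)) (c≥ 192 1-5t≥0)) (#-nonNeg 8)))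
        f>0 : 0# < f
        f>0 = +-pos-nonNeg (*-pos γ>0 p>0) (*-nonNeg α≥0 q≥0)
        1-γ≥0 : 0# ≤ 1# - γ
        1-γ≥0 = 0≤-resp ((solve 1 (λ w → :# 429 :* w :+ :# 19 :* (w :* w) := :# 1 :- (:# 1 :- :# 429 :* w
            :- :# 19 :* (w :* w))) refl ω)) (+-nonNeg (c≥ 429 ω≥0) (c≥ 19 (square-nonNeg ω≥0)))
        21-f≥0 : 0# ≤ # 21 - f
        21-f≥0 = 0≤-resp ((solve 4 (λ a c p q → (:# 1 :- p) :* c :+ (:# 1 :- c) :+ (:# 20 :- q) :* a :+ :# 20 :*
            (:# 1 :- a) := :# 21 :- (c :* p :+ a :* q)) refl α γ p q))
          (+-nonNeg (+-nonNeg (+-nonNeg (*-nonNeg 1-p≥0 (<⇒≤ γ>0)) 1-γ≥0) (*-nonNeg 20-q≥0 α≥0)) (c≥ 20 1-α≥0))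
        error≤2 : 0# ≤ # 2 - (p * (α * α) + ω * f)
        error≤2 = 0≤-resp ((solve 4 (λ p a w f → (:# 1 :- p) :* (a :* a) :+ (:# 1 :- a) :* (:# 1 :+ a) :+ w :*
            (:# 21 :- f) :+ (:# 1 :- :# 400 :* w) :+ :# 379 :* w := :# 2 :- (p :* (a :* a) :+ w :* f)) refl p α ω f))
          (+-nonNeg (+-nonNeg (+-nonNeg (+-nonNeg (*-nonNeg 1-p≥0 (square-nonNeg α≥0)) (*-nonNeg 1-α≥0 (+-nonNeg
              (<⇒≤ 0<1) α≥0)))
            (*-nonNeg ω≥0 21-f≥0)) 400ω≤1) (c≥ 379 ω≥0))
        cube≥ : 0# ≤ # 125 * (p * (p * p)) - # 8
        cube≥ = 0≤-resp ((solve 1 (λ p → (:# 5 :* p :- :# 2) :* (:# 25 :* (p :* p) :+ :# 10 :* p :+ :# 4)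
            := :# 125 :* (p :* (p :* p)) :- :# 8) refl p))
          (*-nonNeg 5p-2≥0 (+-nonNeg (+-nonNeg (c≥ 25 (square-nonNeg p≥0)) (c≥ 10 p≥0)) (#-nonNeg 4)))
        -- Since p ≥ 2/5, 125p³ is at least 8. Six copies of `ν` are kept; the other two exceed 2 ·
        -- 10⁷h, which covers 250k ≤ 250 · 5148h, and 18713000 is what remains.
        product>0 : 0# < ν ω * (p * (p * p)) - k * (p * (α * α) + ω * f)
        product>0 = pos-cancelˡ (#-nonNeg 125) (0<-resp
          ((solve 5 (λ n p k h e → :# 6 :* n :+ (n :* (:# 125 :* (p :* (p :* p)) :- :# 8) :+ :# 2 :* (n
              :- :# 10000000 :* h) :+ :# 18713000 :* h :+ :# 250 :* (:# 5148 :* h :- k) :+ :# 125 :* (k :* (:# 2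
              :- e))) := :# 125 :* (n :* (p :* (p :* p)) :- k :* e)) refl (ν ω) p k h (p * (α * α) + ω * f)))
          (+-pos-nonNeg (*-pos (#-pos 5) ν>0) (+-nonNeg (+-nonNeg (+-nonNeg (+-nonNeg
            (*-nonNeg (<⇒≤ ν>0) cube≥) (c≥ 2 ν-10⁷h≥0)) (c≥ 18713000 h≥0)) (c≥ 250 k≤5148h)) (c≥ 125
                (*-nonNeg k≥0 error≤2)))))
        -- Multiplication by the conjugate `f` gives f times the last factor equal to ν p³ - k(pα² +
        -- ωf), which would be exactly the norm times p³ if `t` were T₀.
        𝐕>0 : 0# < 𝐕 ω p q
        𝐕>0 = pos-cancelˡ (<⇒≤ f>0) (0<-resp ((solve 3 (λ w p q → (:# 1 :- :# 440 :* w :- :# 624 :* (w :* w)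
            :- :# 275 :* (w :* (w :* w)) :- :# 11 :* (w :* w :* (w :* w))) :* (p :* (p :* p)) :- (q :* q :- :# 19 :*
            (q :* p) :- :# 11 :* (p :* p)) :* (p :* ((w :* w :+ :# 22 :* w) :* (w :* w :+ :# 22 :* w)) :+ w :*
            ((:# 1 :- :# 429 :* w :- :# 19 :* (w :* w)) :* p :+ (w :* w :+ :# 22 :* w) :* q)) := ((:# 1
            :- :# 429 :* w :- :# 19 :* (w :* w)) :* p :+ (w :* w :+ :# 22 :* w) :* q) :* (p :* p :- (w :* w
            :+ :# 3 :* w) :* (p :* q) :- w :* (q :* q))) refl ω p q))
          product>0)
        result : Choice
        result = record { t₃ = t ; t₃-nonNeg = t≥0 ; t₃-small = 0≤⇒≤ 1-5t≥0 ; t₃-large = holds ; 𝐕-pos = 𝐕>0 }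

    choice : Choice
    choice = step₁ (multiple (# 1000000) ν>0)
      where
      step₁ : ∃[ n ] # 1000000 ≤ # n * ν ω → Choice
      step₁ (n , fine) = step₂ (pos-inverse (*-pos (#-pos 9) (#-pos n)))
        where
        M : ℕ
        M = suc n
        fine′ : # 1000000 ≤ # M * ν ω
        fine′ = ≤-trans fine (≤-by (ν ω) (<⇒≤ ν>0) (trans ((solve 2 (λ n x → x := (:# 1 :+ n) :* x :- n :* x) refl
            (# n) (ν ω))) (+-congʳ (*-congʳ (sym (#-suc n))))))
        step₂ : ∃[ h ] (# 10 * # M * h ≈ 1#) × (0# < h) → Choice
        step₂ (h , 10Mh≈1 , h>0) = step₃ (crossing (λ i → decide _ _) fails₀ (2 ℕ.* M) holds₂ₘ)
          where
          fails₀ : ¬ Large (# 0 * h)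
          fails₀ holds = holds (≤-by 1# (<⇒≤ 0<1) ((solve 1 (λ h → :# 1 := :# 1 :- (:# 6 :* (:# 0 :* h) :+ :# 11 :*
              (:# 0 :* h :* (:# 0 :* h)))) refl h)))
          y : Carrier
          y = # 5 * (# (2 ℕ.* M) * h)
          y≈1 : y ≈ 1#
          y≈1 = trans (*-congˡ (*-congʳ (#-* 2 M))) (trans ((solve 2 (λ M h → :# 5 :* (:# 2 :* M :* h)
              := :# 10 :* M :* h) refl (# M) h)) 10Mh≈1)
          holds₂ₘ : Large (# (2 ℕ.* M) * h)
          holds₂ₘ = 0<⇒< (pos-cancelˡ (#-nonNeg 25) (0<-resp
            (trans ((solve 0 (:# 16 := :# 30 :* :# 1 :+ :# 11 :* (:# 1 :* :# 1) :- :# 25) refl)) (trans (+-congʳ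
                (+-cong (*-congˡ (sym y≈1)) (*-congˡ (*-cong (sym y≈1) (sym y≈1)))))
              ((solve 1 (λ t → :# 30 :* (:# 5 :* t) :+ :# 11 :* (:# 5 :* t :* (:# 5 :* t)) :- :# 25 := :# 25 :*
                  ((:# 6 :* t :+ :# 11 :* (t :* t)) :- :# 1)) refl (# (2 ℕ.* M) * h)))))
            (#-pos 15)))
          step₃ : ∃[ i ] (i ℕ.< 2 ℕ.* M) × (¬ Large (# i * h)) × Large (# suc i * h) → Choice
          step₃ (i , i<2M , fails , holds) = Grid.result M i h h>0 10Mh≈1 i<2M fine′ (not-less _ _ fails) holds

  parameters : ∀ r → # 5 ≤ # 6 * r → π (r * r) < 0# → Σ Parameters (λ params → Criterion r (Parameters.t₁ params))
  parameters r 5≤6r π<0 = record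
      { ω = L.ω ; t₁ = L.t₁ ; t₃ = U′.t₃ ; ω-pos = L.ω-pos ; ω-small = ν-small L.ω (<⇒≤ L.ω-pos) L.ν-pos
      ; t₁-nonNeg = L.t₁-nonNeg ; t₁-small = L.t₁-small ; t₃-nonNeg = U′.t₃-nonNeg ; t₃-small = U′.t₃-small
      ; below-ω = L.below-ω ; t₃-large = U′.t₃-large ; V-pos = U′.𝐕-pos }
    , L.criterion
    where
    module L = Lower.Choice (Lower.choice r 5≤6r π<0)
    module U′ = Upper.Choice (Upper.choice L.ω L.ω-pos L.ν-pos)

-- The bound on the minimum Euclidean weight

private
  AtMost : ℕ → Maybe ℕ → Set
  AtMost w nothing  = ⊥
  AtMost w (just v) = v ℕ.≤ w

  -- The step function of `dE` is local to its definition, so it enters as a parameter with its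
  -- defining equation. The invariant: either the bound has been reached, or a witness is still
  -- ahead in the list.
  foldl-AtMost : ∀ {n} (C : Code n) (step : Maybe ℕ → Vec (Fin 4) n → Maybe ℕ) →
    (∀ m x → step m x ≡ (if C x then (if isZero x then m else minM m (wtE x)) else m)) →
    ∀ w xs m → AtMost w m ⊎ (∃[ c ] (c ∈ xs) × (c ∈C C) × (isZero c ≡ false) × (wtE c ≡ w)) → AtMost w
        (List.foldl step m xs)
  foldl-AtMost C step eq w [] m (inj₁ le) = le
  foldl-AtMost C step eq w (x ∷ xs) m (inj₁ le) = foldl-AtMost C step eq w xs (step m x) (inj₁ (≡.subst (AtMost w)
      (≡.sym (eq m x)) (keep m le)))
    where
    keep : ∀ m → AtMost w m → AtMost w (if C x then (if isZero x then m else minM m (wtE x)) else m)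
    keep (just v) v≤w with C x | isZero x
    ... | false | _     = v≤w
    ... | true  | true  = v≤w
    ... | true  | false = ℕₚ.≤-trans (ℕₚ.m⊓n≤m v (wtE x)) v≤w
  foldl-AtMost C step eq w (x ∷ xs) m (inj₂ (.x , here ≡.refl , c∈C , c≢0 , ≡.refl)) =
    foldl-AtMost C step eq w xs (step m x) (inj₁ (≡.subst (AtMost w) (≡.sym (eq m x)) (reach m)))
    where
    reach : ∀ m → AtMost (wtE x) (if C x then (if isZero x then m else minM m (wtE x)) else m)
    reach m rewrite c∈C | c≢0 with m
    ... | nothing = ℕₚ.≤-refl
    ... | just v  = ℕₚ.m⊓n≤n v (wtE x)
  foldl-AtMost C step eq w (x ∷ xs) m (inj₂ (c , there c∈xs , rest)) = foldl-AtMost C step eq w xs (step m x) (inj₂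
      (c , c∈xs , rest))

  allVecs≡vecs : ∀ n → allVecs n ≡ vecs 4 n
  allVecs≡vecs zero    = ≡.refl
  allVecs≡vecs (suc n) = ≡.cong (λ vs → List.concatMap (λ a → List.map (a ∷_) vs) (List.allFin 4)) (allVecs≡vecs n)

  fromAtMost : ∀ {w} m → AtMost w m → fromMaybe 0 m ℕ.≤ w
  fromAtMost (just v) v≤w = v≤w

dE≤wtE : ∀ {n} (C : Code n) c → c ∈C C → isZero c ≡ false → dE C ℕ.≤ wtE c
dE≤wtE {n} C c c∈C c≢0 = fromAtMost _ (foldl-AtMost C _ (λ _ _ → ≡.refl) (wtE c) (allVecs n) nothing
  (inj₂ (c , ≡.subst (c ∈_) (≡.sym (allVecs≡vecs n)) (∈-vecs c) , c∈C , c≢0 , ≡.refl)))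

module DistanceBound (F : OrderedField) where

  open OrderedField F
  open OrderedFieldProperties F
  open KernelPositivity F
  open ParameterChoice F
  open CoefficientRatios F using (b; N)

  module _ (r : Carrier) (5≤6r : # 5 ≤ # 6 * r) (π<0 : π (r * r) < 0#)
    (params : Parameters) (criterion : Criterion r (Parameters.t₁ params)) where

    private
      open Parameters params
      open WithParameters params

      μ : Carrier
      μ = (# 5 + # 6 * t₁ + # 5 * (t₁ * t₁)) - # 6 * r * (1# - t₁ * t₁)

      μ>0 : 0# < μ
      μ>0 = <⇒0< criterion

      1-t₁²≥0 : 0# ≤ 1# - t₁ * t₁
      1-t₁²≥0 = 0≤-resp ((solve 1 (λ t → ((:# 1 :- :# 1000 :* t) :+ :# 999 :* t) :* (:# 1 :+ t) := :# 1
          :- t :* t) refl t₁))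
        (*-nonNeg (+-nonNeg (≤⇒0≤ t₁-small) (*-nonNeg (#-nonNeg 999) t₁-nonNeg)) (+-nonNeg (<⇒≤ 0<1) t₁-nonNeg))

      -- With κ = k + 1 and the largest admissible S the difference of the sides is κμ - 4 + 4t₁².
      -- The 4 consists of the rounding 3 in the bound on S and the 1 in `suc S`, and μκ ≥ 4 for
      -- large k.
      in-range : ∀ k S l → # 4 ≤ # l * μ → l ℕ.≤ suc k → # S ≤ (# 6 * r - # 5) * # suc k + # 3 →
                 # suc S ≤ t₁ * (b k + (N k + # S) * t₁)
      in-range k S l large l≤k S≤ = ≤-trans (≤-reflexive (#-suc S)) (≤-by
        ((# l * μ - # 4) + (# suc k - # l) * μ + (((# 6 * r - # 5) * # suc k + # 3) - # S) * (1# - t₁ * t₁) + # 4 *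
            (t₁ * t₁))
        (+-nonNeg (+-nonNeg (+-nonNeg (≤⇒0≤ large) (*-nonNeg (≤⇒0≤ (#-mono-≤ l≤k)) (<⇒≤ μ>0)))
          (*-nonNeg (≤⇒0≤ S≤) 1-t₁²≥0)) (*-nonNeg (#-nonNeg 4) (*-nonNeg t₁-nonNeg t₁-nonNeg)))
        ((solve 5 (λ l k S r t → (l :* ((:# 5 :+ :# 6 :* t :+ :# 5 :* (t :* t)) :- :# 6 :* r :* (:# 1 :- t :* t))
            :- :# 4) :+ (k :- l) :* ((:# 5 :+ :# 6 :* t :+ :# 5 :* (t :* t)) :- :# 6 :* r :* (:# 1 :- t :* t)) :+
            (((:# 6 :* r :- :# 5) :* k :+ :# 3) :- S) :* (:# 1 :- t :* t) :+ :# 4 :* (t :* t) := t :* (:# 6 :* k :+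
            (:# 10 :* k :+ :# 1 :+ S) :* t) :- (:# 1 :+ S)) refl (# l) (# suc k) (# S) r t₁)))

      1-r≥0 : 0# ≤ 1# - r
      1-r≥0 = cases (r ≤? 1#)
        where
        cases : Dec (r ≤ 1#) → 0# ≤ 1# - r
        cases (yes r≤1) = ≤⇒0≤ r≤1
        cases (no r≰1) = ⊥-elim (π<0⇒ (r * r) π<0 (≤-by (# 10 * ((r - 1#) * (r - 1#)) + # 20 * (r - 1#) + 1#)
          (+-nonNeg (+-nonNeg (*-nonNeg (#-nonNeg 10) (*-nonNeg r-1≥0 r-1≥0)) (*-nonNeg (#-nonNeg 20) r-1≥0))
              (<⇒≤ 0<1))
          ((solve 1 (λ r → :# 10 :* ((r :- :# 1) :* (r :- :# 1)) :+ :# 20 :* (r :- :# 1) :+ :# 1 := :# 10 :*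
              (r :* r) :- :# 9) refl r))))
          where
          r-1≥0 : 0# ≤ r - 1#
          r-1≥0 = ≤⇒0≤ (<⇒≤ (≰⇒> r≰1))

      ρ₀ : Carrier
      ρ₀ = # 2 - # 2 * r

      module LongCode {n} (C : Code n) (typeII : TypeII C) (a e l k₀ : ℕ)
        (suc-e+m : suc e ℕ.+ Div.quotient (TypeIICode.8∣n C typeII) ≡ 3 ℕ.* suc a) (e≤2 : e ℕ.≤ 2)
        (3a≤m : 3 ℕ.* a ℕ.≤ Div.quotient (TypeIICode.8∣n C typeII))
        (large : # 4 ≤ # l * μ) (positive : ∀ k → k₀ ℕ.≤ k → Positive k)
        (long : k₀ ℕ.+ 9 ℕ.+ l ℕ.≤ a) where

        m k d D S : ℕ
        m = Div.quotient (TypeIICode.8∣n C typeII)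
        k = suc a
        d = dE C
        D = d / 8
        S = suc k ℕ.∸ D

        a≤k : a ℕ.≤ k
        a≤k = ℕₚ.n≤1+n a

        gap : ∀ c → c ∈C C → isZero c ≡ false → suc k ℕ.* 8 ℕ.≤ wtE c ℕ.+ S ℕ.* 8
        gap c c∈C c≢0 = ℕₚ.≤-trans (ℕₚ.*-monoˡ-≤ 8 (ℕₚ.m≤n+m∸n (suc k) D))
          (ℕₚ.≤-trans (ℕₚ.≤-reflexive (ℕₚ.*-distribʳ-+ 8 D S))
            (ℕₚ.+-monoˡ-≤ (S ℕ.* 8) (ℕₚ.≤-trans (m/n*n≤m d 8) (dE≤wtE C c c∈C c≢0))))

        d≤8D+7 : # d ≤ # D * # 8 + # 7
        d≤8D+7 = ≤-trans (#-mono-≤ (ℕₚ.≤-trans (ℕₚ.≤-reflexive (m≡m%n+[m/n]*n d 8))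
            (ℕₚ.≤-trans (ℕₚ.+-monoˡ-≤ (D ℕ.* 8) (ℕₚ.≤-pred (m%n<n d 8))) (ℕₚ.≤-reflexive (ℕₚ.+-comm 7 (D ℕ.* 8))))))
          (≤-reflexive (trans (#-+ (D ℕ.* 8) 7) (+-congʳ (#-* D 8))))

        #n≈8m : # n ≈ # m * # 8
        #n≈8m = trans (reflexive (≡.cong #_ (_∣_.equality (TypeIICode.8∣n C typeII)))) (#-* m 8)

        κ≈ : # suc k ≈ # 2 + # a
        κ≈ = #-+ 2 a

        3a≤#m : # 3 * # a ≤ # m
        3a≤#m = ≤-trans (≤-reflexive (sym (#-* 3 a))) (#-mono-≤ 3a≤m)

        -- With n = 8m, m ≥ 3a and d ≤ 8D + 7, the assumption gives S ≤ a + 2 - 6(1 - r)a + 7/8,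
        -- which is (6r - 5)a + 2 + 7/8. The summand 3 absorbs the rounding.
        S-bound : ρ₀ * # n < # d → # S ≤ (# 6 * r - # 5) * # suc k + # 3
        S-bound exceeds = cases (D ℕ.≤? suc k)
          where
          cases : Dec (D ℕ.≤ suc k) → # S ≤ (# 6 * r - # 5) * # suc k + # 3
          cases (no D≰) = ≤-trans (≤-reflexive (reflexive (≡.cong #_ (ℕₚ.m≤n⇒m∸n≡0 (ℕₚ.<⇒≤ (ℕₚ.≰⇒> D≰))))))
              (+-nonNeg (*-nonNeg (≤⇒0≤ 5≤6r) (#-nonNeg (suc k))) (#-nonNeg 3))
          cases (yes D≤) = *-cancelˡ-≤ (#-pos 7) (≤-by
              ((# D * # 8 + # 7 - # d) + (# d - ρ₀ * # n) + # 16 * ((1# - r) * (# m - # 3 * # a)) + (# 16 *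
                  (# 6 * r - # 5) + # 1))
              (+-nonNeg (+-nonNeg (+-nonNeg (≤⇒0≤ d≤8D+7) (<⇒≤ (<⇒0< exceeds)))
                (*-nonNeg (#-nonNeg 16) (*-nonNeg 1-r≥0 (≤⇒0≤ 3a≤#m)))) (+-nonNeg (*-nonNeg (#-nonNeg 16)
                    (≤⇒0≤ 5≤6r)) (#-nonNeg 1)))
              (trans (+-congʳ (+-congʳ (+-congˡ (+-congˡ (-‿cong (*-congˡ #n≈8m))))))
                (trans ((solve 5 (λ D d r m a → (D :* :# 8 :+ :# 7 :- d) :+ (d :- (:# 2 :- :# 2 :* r) :*
                    (m :* :# 8)) :+ :# 16 :* ((:# 1 :- r) :* (m :- :# 3 :* a)) :+ (:# 16 :* (:# 6 :* r :- :# 5)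
                    :+ :# 1) := :# 8 :* ((:# 6 :* r :- :# 5) :* (:# 2 :+ a) :+ :# 3) :- :# 8 :* (:# 2 :+ a
                    :- D)) refl (# D) (# d) r (# m) (# a)))
                  (+-cong (*-congˡ (+-congʳ (*-congˡ (sym κ≈)))) (-‿cong (*-congˡ (trans (+-congʳ (sym κ≈))
                      (sym S≈))))))))
            where
            S≈ : # S ≈ # suc k - # D
            S≈ = trans ((solve 2 (λ S D → S := S :+ D :- D) refl (# S) (# D))) (+-congʳ (trans (sym (#-+ S D))
              (reflexive (≡.cong #_ (ℕₚ.m∸n+n≡m D≤)))))

        not-exceeds : ¬ ρ₀ * # n < # d
        not-exceeds exceeds = CodeKernel.no-gap F C typeII ω k e S suc-e+m e≤2
          (Positive.low-positive pos S (ℕₚ.m∸n≤m (suc k) D) (in-range k S l large l≤ (S-bound exceeds)))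
          (Positive.high-positive pos) gap (ℕₚ.≤-trans (ℕₚ.≤-trans (ℕₚ.m≤n+m 9 k₀) (ℕₚ.m≤m+n _ l))
              (ℕₚ.≤-trans long a≤k))
          where
          pos : Positive k
          pos = positive k (ℕₚ.≤-trans (ℕₚ.≤-trans (ℕₚ.m≤m+n k₀ 9) (ℕₚ.m≤m+n _ l)) (ℕₚ.≤-trans long a≤k))
          l≤ : l ℕ.≤ suc k
          l≤ = ℕₚ.≤-trans (ℕₚ.m≤n+m l (k₀ ℕ.+ 9)) (ℕₚ.≤-trans long (ℕₚ.≤-trans a≤k (ℕₚ.n≤1+n k)))

        bound : # d ≤ ρ₀ * # n
        bound = cases ((# d) ≤? (ρ₀ * # n))
          where
          cases : Dec (# d ≤ ρ₀ * # n) → # d ≤ ρ₀ * # n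
          cases (yes le) = le
          cases (no nle) = ⊥-elim (not-exceeds nle)

    bound-from-parameters : ∃[ n₀ ] (∀ {n} (C : Code n) → TypeII C → n₀ ℕ.≤ n → # dE C ≤ (# 2 - # 2 * r) * # n)
    bound-from-parameters = conclude kernel-positivity (multiple (# 4) μ>0)
      where
      conclude : ∃[ k₀ ] (∀ k → k₀ ℕ.≤ k → Positive k) → ∃[ l ] # 4 ≤ # l * μ →
        ∃[ n₀ ] (∀ {n} (C : Code n) → TypeII C → n₀ ℕ.≤ n → # dE C ≤ (# 2 - # 2 * r) * # n)
      -- As n = 8m and m = 3a + i with i ≤ 2, a length of at least 24(K + 1) gives a ≥ K.
      conclude (k₀ , positive) (l , large) = suc K ℕ.* 24 , λ C typeII → divide C typeII (Div.quotient
          (TypeIICode.8∣n C typeII) divMod 3)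
        where
        K : ℕ
        K = k₀ ℕ.+ 9 ℕ.+ l
        divide : ∀ {n} (C : Code n) (typeII : TypeII C) → DivMod (Div.quotient (TypeIICode.8∣n C typeII)) 3
            → suc K ℕ.* 24 ℕ.≤ n →
                 # dE C ≤ (# 2 - # 2 * r) * # n
        divide {n} C typeII (ℕDivMod.result a i m≡) n₀≤n = LongCode.bound C typeII a e l k₀ suc-e+m (ℕₚ.m∸n≤m 2
            (toℕ i)) 3a≤m large positive K≤a
          where
          m e : ℕ
          m = Div.quotient (TypeIICode.8∣n C typeII)
          -- With k = a + 1, the least k satisfying 3k > m, this makes e + 1 + m = 3k, as the
          -- residue identity demands, and keeps e ≤ 2.
          e = 2 ℕ.∸ toℕ i
          i≤2 : toℕ i ℕ.≤ 2
          i≤2 = ℕₚ.≤-pred (Finₚ.toℕ<n i)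
          suc-e+m : suc e ℕ.+ m ≡ 3 ℕ.* suc a
          suc-e+m = ≡.trans (≡.cong (suc e ℕ.+_) m≡) (≡.trans (rearrange e (toℕ i) a)
            (≡.trans (≡.cong (λ x → suc x ℕ.+ a ℕ.* 3) (ℕₚ.m∸n+n≡m i≤2))
              (≡.trans (≡.cong (3 ℕ.+_) (ℕₚ.*-comm a 3)) (≡.sym (ℕₚ.*-suc 3 a)))))
            where
            rearrange : ∀ e i a → suc e ℕ.+ (i ℕ.+ a ℕ.* 3) ≡ suc (e ℕ.+ i) ℕ.+ a ℕ.* 3
            rearrange = ℕsolve-∀
          3a≤m : 3 ℕ.* a ℕ.≤ m
          3a≤m = ℕₚ.≤-trans (ℕₚ.≤-reflexive (ℕₚ.*-comm 3 a)) (ℕₚ.≤-trans (ℕₚ.m≤n+m (a ℕ.* 3) (toℕ i))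
              (ℕₚ.≤-reflexive (≡.sym m≡)))
          K≤a : K ℕ.≤ a
          K≤a = ℕₚ.≤-pred (ℕₚ.*-cancelʳ-≤ (suc K) (suc a) 24 (ℕₚ.≤-trans n₀≤n (ℕₚ.≤-trans
            (ℕₚ.≤-reflexive (≡.trans (_∣_.equality (TypeIICode.8∣n C typeII)) (≡.cong (ℕ._* 8) m≡)))
            (ℕₚ.≤-trans (ℕₚ.*-monoˡ-≤ 8 (ℕₚ.+-monoˡ-≤ (a ℕ.* 3) (ℕₚ.≤-trans i≤2 (ℕₚ.n≤1+n 2)))) (ℕₚ.≤-reflexive
                (ℕₚ.*-assoc (suc a) 3 8))))))

  distance-bound : ∀ r → # 5 ≤ # 6 * r → π (r * r) < 0# →
    ∃[ n₀ ] (∀ {n} (C : Code n) → TypeII C → n₀ ℕ.≤ n → # dE C ≤ (# 2 - # 2 * r) * # n)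
  distance-bound r 5≤6r π<0 = let (params , criterion) = parameters r 5≤6r π<0 in
    bound-from-parameters r 5≤6r π<0 params criterion

  -- The index (6r - 5)k of weight (2 - 2r)n is nonnegative only for r ≥ 5/6. For smaller r the
  -- bound at 5/6, that is n/3, is the stronger one.
  distance-bound′ : ∀ r → (# 5 ≤ # 6 * r → π (r * r) < 0#) →
    ∃[ n₀ ] (∀ {n} (C : Code n) → TypeII C → n₀ ℕ.≤ n → # dE C ≤ (# 2 - # 2 * r) * # n)
  distance-bound′ r negative = cases ((# 5) ≤? (# 6 * r))
    where
    Bounded : Carrier → Set
    Bounded x = ∃[ n₀ ] (∀ {n} (C : Code n) → TypeII C → n₀ ℕ.≤ n → # dE C ≤ (# 2 - # 2 * x) * # n)
    weaken : ∀ {x} → r ≤ x → Bounded x → Bounded r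
    weaken {x} r≤x (n₀ , bound) = n₀ , λ {n} C typeII n₀≤n → ≤-trans (bound C typeII n₀≤n)
      (≤-by (# 2 * ((x - r) * # n)) (*-nonNeg (#-nonNeg 2) (*-nonNeg (≤⇒0≤ r≤x) (#-nonNeg n)))
        ((solve 3 (λ x r n → :# 2 :* ((x :- r) :* n) := (:# 2 :- :# 2 :* r) :* n :- (:# 2
            :- :# 2 :* x) :* n) refl x r (# n))))
    cases : Dec (# 5 ≤ # 6 * r) → Bounded r
    cases (yes 5≤6r) = distance-bound r 5≤6r (negative 5≤6r)
    cases (no 5≰6r) = let (⅙ , 6⅙≈1 , _) = pos-inverse (#-pos 5)
                          s = # 5 * ⅙
                          6s≈5 = trans ((solve 1 (λ x → :# 6 :* (:# 5 :* x) := :# 5 :* (:# 6 :* x)) refl ⅙)) (trans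
                              (*-congˡ 6⅙≈1) (*-identityʳ (# 5)))
                      in weaken (*-cancelˡ-≤ (#-pos 5) (≤-trans (<⇒≤ (≰⇒> 5≰6r)) (≤-reflexive (sym 6s≈5))))
                           (distance-bound s (≤-reflexive (sym 6s≈5)) (π-5/6 s 6s≈5))

-- The ordered field of rationals and the final translation

private
  ℚring : CommutativeRing 0ℓ 0ℓ
  ℚring = ℚₚ.+-*-commutativeRing

  toℚᵘ-toℚ : ∀ k → ℚ.toℚᵘ (toℚ k) ℚᵘ.≃ ℚᵘ.mkℚᵘ (+ k) 0
  toℚᵘ-toℚ k = ℚₚ.toℚᵘ-fromℚᵘ (ℚᵘ.mkℚᵘ (+ k) 0)

  toℚ-suc : ∀ k → toℚ (suc k) ≡ ℚ.1ℚ ℚ.+ toℚ k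
  toℚ-suc k = ℚₚ.toℚᵘ-injective (ℚᵘₚ.≃-trans (toℚᵘ-toℚ (suc k)) (ℚᵘₚ.≃-sym
    (ℚᵘₚ.≃-trans (ℚₚ.toℚᵘ-homo-+ ℚ.1ℚ (toℚ k)) (ℚᵘₚ.≃-trans (ℚᵘₚ.+-congʳ (ℚ.toℚᵘ ℚ.1ℚ) (toℚᵘ-toℚ k))
      (ℚᵘ.*≡* (lemma (+ k)))))))
    where
    lemma : ∀ i → (+ 1 ℤ.* + 1 ℤ.+ i ℤ.* + 1) ℤ.* + 1 ≡ (+ 1 ℤ.+ i) ℤ.* + 1
    lemma = solve-∀

#≡toℚ : ∀ k → IntegerCoefficients.#_ ℚring k ≡ toℚ k
#≡toℚ zero    = ≡.refl
#≡toℚ (suc k) = ≡.trans (IntegerCoefficients.#-suc ℚring k)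
  (≡.trans (≡.cong (ℚ.1ℚ ℚ.+_) (#≡toℚ k)) (≡.sym (toℚ-suc k)))

private
  ≤toℚ : ∀ x → ∃[ n ] x ℚ.≤ toℚ n
  ≤toℚ x@(ℚ.mkℚ i d-1 _) = ℤ.∣ i ∣ , ℚₚ.toℚᵘ-cancel-≤ (ℚᵘₚ.≤-respʳ-≃ (ℚᵘₚ.≃-sym (toℚᵘ-toℚ ℤ.∣ i ∣)) (ℚᵘ.*≤*
      (bound i)))
    where
    bound : ∀ i → i ℤ.* + 1 ℤ.≤ + ℤ.∣ i ∣ ℤ.* + suc d-1
    bound (+ n) = ≡.subst₂ ℤ._≤_ (≡.sym (ℤₚ.*-identityʳ (+ n))) (ℤₚ.pos-* n (suc d-1)) (ℤ.+≤+ (ℕₚ.m≤m*n n (suc d-1)))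
    bound ℤ.-[1+ n ] = ≡.subst₂ ℤ._≤_ (≡.sym (ℤₚ.*-identityʳ -[1+ n ])) (ℤₚ.pos-* (suc n) (suc d-1)) ℤ.-≤+

ℚ-orderedField : OrderedField
ℚ-orderedField = record
  { commutativeRing = ℚring
  ; _≤_ = ℚ._≤_
  ; ≤-reflexive = ℚₚ.≤-reflexive
  ; ≤-trans = ℚₚ.≤-trans
  ; ≤-antisym = ℚₚ.≤-antisym
  ; _≤?_ = ℚₚ._≤?_
  ; ≤-total = ℚₚ.≤-total
  ; +-monoʳ-≤ = λ z → ℚₚ.+-monoʳ-≤ z
  ; *-nonNeg = λ {x} {y} x≥0 y≥0 → ≡.subst (ℚ._≤ x ℚ.* y) (ℚₚ.*-zeroʳ x)
      (ℚₚ.*-monoˡ-≤-nonNeg x {{ℚ.nonNegative x≥0}} y≥0)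
  ; 1≰0 = λ { (ℚ.*≤* (ℤ.+≤+ ())) }
  ; inverse = λ x x≢0 → (ℚ.1/ x) {{ℚ.≢-nonZero x≢0}} , ℚₚ.*-inverseʳ x {{ℚ.≢-nonZero x≢0}}
  ; archimedean = λ x → proj₁ (≤toℚ x) , ≡.subst (x ℚ.≤_) (≡.sym (#≡toℚ (proj₁ (≤toℚ x)))) (proj₂ (≤toℚ x))
  }

-- Repeats the shape of `poly` over abstract numerals, so that the comparison with `π` is a ring
-- identity; at the rationals with `toℚ` it unfolds to `poly`.
module PolyBridge (F : OrderedField) (numeral : ℕ → OrderedField.Carrier F)
  (numeral≈ : ∀ k → OrderedField._≈_ F (OrderedField.#_ F k) (numeral k)) where

  open OrderedField F
  open ParameterChoice F using (π)

  power : Carrier → ℕ → Carrier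
  power x zero    = 1#
  power x (suc k) = x * power x k

  polynomial : Carrier → Carrier
  polynomial x =
    (((((((numeral 11 * power x 16 + numeral 2112 * power x 14)
      - numeral 8525 * power x 12) + numeral 15048 * power x 10)
      - numeral 15218 * power x 8) + numeral 9552 * power x 6)
      - numeral 3718 * power x 4) + numeral 828 * power x 2)
      - numeral 81

  π≈polynomial : ∀ x → π (x * x) ≈ polynomial x
  π≈polynomial x = trans ((solve 1 (λ x → ((((((((:# 11 :* (x :* x) :+ :# 2112) :* (x :* x) :- :# 8525) :* (x :* x)
      :+ :# 15048) :* (x :* x) :- :# 15218) :* (x :* x) :+ :# 9552) :* (x :* x) :- :# 3718) :* (x :* x)
      :+ :# 828) :* (x :* x) :- :# 81) := (((((((:# 11 :* (x :* (x :* (x :* (x :* (x :* (x :* (x :* (x :* (x :*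
      (x :* (x :* (x :* (x :* (x :* (x :* (x :* :# 1)))))))))))))))) :+ :# 2112 :* (x :* (x :* (x :* (x :* (x :*
      (x :* (x :* (x :* (x :* (x :* (x :* (x :* (x :* (x :* :# 1))))))))))))))) :- :# 8525 :* (x :* (x :* (x :*
      (x :* (x :* (x :* (x :* (x :* (x :* (x :* (x :* (x :* :# 1))))))))))))) :+ :# 15048 :* (x :* (x :* (x :* (x :*
      (x :* (x :* (x :* (x :* (x :* (x :* :# 1))))))))))) :- :# 15218 :* (x :* (x :* (x :* (x :* (x :* (x :* (x :*
      (x :* :# 1))))))))) :+ :# 9552 :* (x :* (x :* (x :* (x :* (x :* (x :* :# 1))))))) :- :# 3718 :* (x :* (x :*
      (x :* (x :* :# 1))))) :+ :# 828 :* (x :* (x :* :# 1))) :- :# 81) refl x))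
    (+-cong (+-cong (+-cong (+-cong (+-cong (+-cong (+-cong (+-cong
      (*-congʳ (numeral≈ 11)) (*-congʳ (numeral≈ 2112))) (-‿cong (*-congʳ (numeral≈ 8525)))) (*-congʳ
          (numeral≈ 15048)))
      (-‿cong (*-congʳ (numeral≈ 15218)))) (*-congʳ (numeral≈ 9552))) (-‿cong (*-congʳ (numeral≈ 3718))))
      (*-congʳ (numeral≈ 828))) (-‿cong (numeral≈ 81)))

private
  module ℚF = OrderedField ℚ-orderedField
  module ℚFₚ = OrderedFieldProperties ℚ-orderedField
  module Bridge = PolyBridge ℚ-orderedField toℚ #≡toℚ

theorem5 : (n : ℕ → ℕ) (C : (i : ℕ) → Code (n i)) →
    ((i : ℕ) → TypeII (C i)) →
    TendsToInfinity n →
    LimsupRatioBound (λ i → dE (C i)) n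
theorem5 n C typeII tends q below = proj₁ eventually , λ i N≤i → ≡.subst₂ ℚ._≤_
    (#≡toℚ (dE (C i))) (≡.cong₂ ℚ._*_ 2-2r≡q (#≡toℚ (n i)))
    (proj₂ bound (C i) (typeII i) (proj₂ eventually i N≤i))
  where
  r : ℚ.ℚ
  r = (toℚ 2 ℚ.- q) ℚ.* ℚ.½

  negative : ℚF.# 5 ℚF.≤ ℚF.# 6 ℚF.* r → ParameterChoice.π ℚ-orderedField (r ℚ.* r) ℚF.< ℚF.0#
  negative 5≤6r 0≤π = contradict below
    where
    contradict : ¬ BelowRoot r
    contradict (inj₁ r≤0) = ℚFₚ.#-pos 4 (ℚₚ.≤-trans 5≤6r (ℚₚ.≤-trans (ℚFₚ.*-monoˡ-≤ (ℚFₚ.#-nonNeg 6) r≤0)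
        (ℚₚ.≤-reflexive (ℚₚ.*-zeroʳ (ℚF.# 6)))))
    contradict (inj₂ poly<0) = ℚₚ.<-irrefl ≡.refl (ℚₚ.<-≤-trans poly<0 (≡.subst (ℚ.0ℚ ℚ.≤_)
        (Bridge.π≈polynomial r) 0≤π))

  bound : ∃[ n₀ ] (∀ {n} (C : Code n) → TypeII C → n₀ ℕ.≤ n → ℚF.# dE C ℚF.≤ (ℚF.# 2 ℚF.- ℚF.# 2 ℚF.* r) ℚF.* ℚF.# n)
  bound = DistanceBound.distance-bound′ ℚ-orderedField r negative

  eventually : ∃[ N ] ((i : ℕ) → N ℕ.≤ i → proj₁ bound ℕ.≤ n i)
  eventually = tends (proj₁ bound)

  2-2r≡q : ℚF.# 2 ℚF.- ℚF.# 2 ℚF.* r ≡ q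
  2-2r≡q = halves ℚ.½ (≡.cong (ℚ._* ℚ.½) (#≡toℚ 2)) (toℚ 2) (#≡toℚ 2) q
    where
    open ℚF
    -- One half and the numeral 2 are generalised to variables, so that the identity is proved by
    -- ring algebra and not by evaluating fractions.
    halves : ∀ h → # 2 * h ≡ 1# → ∀ two → # 2 ≡ two → ∀ q → # 2 - # 2 * ((two - q) * h) ≡ q
    halves h 2h≡1 two ≡.refl q = ≡.trans ((solve 2 (λ h q → :# 2 :- :# 2 :* ((:# 2 :- q) :* h) := :# 2 :-
        (:# 2 :* h) :* (:# 2 :- q)) ≡.refl h q))
      (≡.trans (≡.cong (λ x → # 2 - x * (# 2 - q)) 2h≡1) ((solve 1 (λ q → :# 2 :- :# 1 :* (:# 2 :- q)
          := q) ≡.refl q)))
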